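{- Let $0\le k\le n$ be integers and let $\Gamma$ be a proper circular arc graph on $n$ vertices that is obtained from a natural unit interval graph $G$ on $[n+k]=\{1,\dots,n+k\}$, whose first $k$ vertices $1,\dots,k$ form a clique and whose last $k$ vertices $n+1,\dots,n+k$ form a clique, by identifying the vertex $n+r$ with the vertex $r$ for each $1\le r\le k$. Let $N\ge n$ be an integer. Then \[ X_\Gamma(\bm x)=\sum_{j}\ \sum_{\substack{T\supseteq T_j\\ T\setminus T_j=\{k+1,\dots,n+k\}\\ (c_T(n+1),\dots,c_T(n+k))=j}}\ \prod_{v=k+1}^{n+k} A\bigl(c_T(v)\mid c_T(N(v))\bigr)\,\frac{e_{c_T(v)}}{e_{c_T(v)-1}}, \] where $j=(j_1,\dots,j_k)$ ranges over $k$-tuples of distinct elements of $[N]=\{1,\dots,N\}$ and $T$ ranges over tableaux with at most $N$ columns.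
   Context: Graphs are finite; when vertices are identified, parallel edges are suppressed, and $\Gamma$ has no loops. $X_\Gamma(\bm x)=\sum_\kappa\prod_{v\in V(\Gamma)}x_{\kappa(v)}$ is the chromatic symmetric function in commuting variables $\bm x=(x_1,x_2,\dots)$, the sum being over proper colorings $\kappa:V(\Gamma)\to\{1,2,\dots\}$ (adjacent vertices receive different colors). $e_i$ is the $i$-th elementary symmetric function in $\bm x$, with $e_0=1$; the right-hand side is computed in the field $\mathbb{Q}(e_1,e_2,\dots)$. A graph on $[m]$ is a natural unit interval graph if whenever $\{p,q\}$ is an edge with $p<q$, then $\{p,r\}$ and $\{r,q\}$ are edges for all $p<r<q$. A proper circular arc graph is the intersection graph of finitely many arcs of a circle, none of which contains another. For a sequence $\sigma=(\sigma_1,\dots,\sigma_\ell)$ of distinct positive integers and a positive integer $y$, set \[ A(1\mid\sigma)=\prod_r\frac{\sigma_r-1}{\sigma_r},\qquad A(\sigma_r+1\mid\sigma)=\frac{\sigma_r+1}{\sigma_r}\prod_{r'\ne r}\frac{\sigma_r-\sigma_{r'}+1}{\sigma_r-\sigma_{r'}}, \] and $A(y\mid\sigma)=0$ if $y\ne1$ and $y-1\notin\{\sigma_1,\dots,\sigma_\ell\}$. (Empty products are $1$.) Tableaux are fillings of Young diagrams by distinct integers, drawn with rows increasing to the right and columns increasing upward (French convention: row lengths weakly decrease going upward, columns are numbered $1,2,\dots$ from the left). $c_T(v)$ is the column of the entry $v$ in $T$. $N(v)$ is the sequence, in increasing order, of the neighbors of $v$ in $G$ that are smaller than $v$, and $c_T(N(v))$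 is the sequence of their columns. For $j=(j_1,\dots,j_k)$, $T_j$ is a fixed tableau with rows of lengths $j_1,\dots,j_k$ (arranged in decreasing order of length from the bottom), in which $r$ is the last entry of the row of length $j_r$ for $1\le r\le k$, and all other entries are distinct nonpositive integers (the choice does not matter). For $k=0$ there is a single empty tuple $j$ and $T_j$ is empty. $T\supseteq T_j$ means that $T$ contains $T_j$ as a subtableau, and $T\setminus T_j$ is the set of the remaining entries of $T$. Convention: if the entries of $c_T(N(v))$ are not distinct for some $v$, the smallest such $v$ is preceded by a smaller vertex whose factor $A$ is $0$, and the summand is taken to be $0$. -}

module Defs where

open import Data.Bool.Base using (true; false; if_then_else_)
import Data.Nat.Properties as ℕ
open import Data.Empty using (⊥)
open import Data.Fin.Base using (Fin; toℕ; splitAt; inject≤; _↑ʳ_)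
import Data.Fin.Base as Fin
import Data.Fin.Properties as Fin
open import Data.Integer.Base using (ℤ; +_; -[1+_]; 0ℤ; 1ℤ)
import Data.Integer.Base as ℤ
import Data.Integer.Properties as ℤ
open import Data.List.Base as List
  using (List; []; _∷_; [_]; _++_; map; filter; foldr; length; concat; concatMap;
         mapMaybe; upTo; allFin; cartesianProductWith; findIndex; head; last)
open import Data.List.Membership.DecPropositional ℕ._≟_
  using () renaming (_∈?_ to _∈ℕ?_)
open import Data.List.Membership.DecPropositional ℤ._≟_
  using () renaming (_∉?_ to _∉ℤ?_)
import Data.List.Properties as List
open import Data.List.Relation.Binary.Permutation.Propositional using (_↭_)
open import Data.List.Relation.Binary.Prefix.Heterogeneous using (Prefix)
open import Data.List.Relation.Binary.Prefix.Heterogeneous.Properties using (prefix?)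
open import Data.List.Relation.Binary.Subset.DecPropositional ℤ._≟_ using (_⊆?_)
open import Data.List.Relation.Binary.Subset.Propositional using (_⊆_)
open import Data.List.Relation.Unary.All as All using (All; []; _∷_; all?)
import Data.List.Relation.Unary.All.Properties as All
open import Data.List.Relation.Unary.Any using (Any)
open import Data.List.Relation.Unary.Linked using (Linked; linked?)
open import Data.List.Relation.Unary.Unique.DecPropositional ℤ._≟_
  using () renaming (unique? to uniqueℤ?)
open import Data.List.Relation.Unary.Unique.DecPropositional ℕ._≟_
  using () renaming (unique? to uniqueℕ?)
open import Data.List.Relation.Unary.Unique.Propositional using (Unique)
open import Data.Maybe.Base as Maybe using (just; fromMaybe)
open import Data.Nat.Base using (ℕ; zero; suc; _+_; _∸_; _≤_; _<_; z≤n; s≤s)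
open import Data.Product.Base using (Σ; ∃-syntax; _×_; _,_)
open import Data.Rational.Base as ℚ using (ℚ; 0ℚ; 1ℚ)
import Data.Rational.Properties as ℚ
open import Data.Sum.Base as Sum using (_⊎_; inj₁; inj₂)
open import Data.Vec.Base as Vec using (Vec; []; _∷_; _∷ʳ_; lookup; tabulate; toList)
import Data.Vec.Properties as Vec
open import Data.Vec.Relation.Unary.All as VecAll using ([]; _∷_) renaming (All to VecAll)
open import Function.Base using (id; _∘_)
open import Function.Bundles using (_⇔_; mk⇔; Equivalence)
open import Level using (0ℓ)
open import Relation.Binary.Core using (Rel)
open import Relation.Binary.Definitions using (Decidable)
open import Relation.Binary.PropositionalEquality
  using (_≡_; _≢_; refl; sym; trans; cong; cong₂; subst; module ≡-Reasoning)
open import Relation.Nullary.Decidable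
  using (Dec; yes; no; does; ¬?; _×-dec_; _→-dec_; does-⇔; dec-true; decidable-stable)
open import Relation.Nullary.Negation using (¬_; contradiction)
import Relation.Unary as Unary

∏ℚ : {X : Set} → List X → (X → ℚ) → ℚ
∏ℚ xs f = foldr (λ x p → f x ℚ.* p) 1ℚ xs

-- ∑₊ a h is the sum of h i j over all i + j ≡ a.
∑₊ : ℕ → (ℕ → ℕ → ℚ) → ℚ
∑₊ zero    h = h 0 0
∑₊ (suc a) h = h 0 (suc a) ℚ.+ ∑₊ a (h ∘ suc)

words : {X : Set} → List X → ∀ n → List (Vec X n)
words xs zero    = [ [] ]
words xs (suc n) = cartesianProductWith _∷_ xs (words xs n)

listsUpTo : {X : Set} → ℕ → List X → List (List X)
listsUpTo m xs = concatMap (λ l → map toList (words xs l)) (upTo (suc m))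

-- Formal power series over ℚ in the commuting variables x₁, x₂, …
--
-- A vector (α₁ , … , αₘ) of exponents stands for the monomial
-- x₁^α₁ ⋯ xₘ^αₘ, so appending a zero exponent does not change the monomial.

record Series : Set where
  field
    coeff  : ∀ {m} → Vec ℕ m → ℚ
    stable : ∀ {m} (α : Vec ℕ m) → coeff (α ∷ʳ 0) ≡ coeff α

open Series public

infix 4 _≈_ _≉_

_≈_ : Series → Series → Set
f ≈ g = ∀ {m} (α : Vec ℕ m) → coeff f α ≡ coeff g α

sum-∷ʳ0 : ∀ {m} (α : Vec ℕ m) → Vec.sum (α ∷ʳ 0) ≡ Vec.sum α
sum-∷ʳ0 []      = refl
sum-∷ʳ0 (a ∷ α) = cong (λ s → a + s) (sum-∷ʳ0 α)

all-∷ʳ0 : ∀ {m} (α : Vec ℕ m) → VecAll (_≤ 1) (α ∷ʳ 0) ⇔ VecAll (_≤ 1) α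
all-∷ʳ0 α = mk⇔ (to α) (from α)
  where
  to : ∀ {m} (α : Vec ℕ m) → VecAll (_≤ 1) (α ∷ʳ 0) → VecAll (_≤ 1) α
  to []      _        = []
  to (a ∷ α) (p ∷ ps) = p ∷ to α ps
  from : ∀ {m} (α : Vec ℕ m) → VecAll (_≤ 1) α → VecAll (_≤ 1) (α ∷ʳ 0)
  from []      []       = z≤n ∷ []
  from (a ∷ α) (p ∷ ps) = p ∷ from α ps

const : ℚ → Series
const q .coeff  α = if does (Vec.sum α ℕ.≟ 0) then q else 0ℚ
const q .stable α = cong (λ s → if does (s ℕ.≟ 0) then q else 0ℚ) (sum-∷ʳ0 α)

0ₛ 1ₛ : Series
0ₛ = const 0ℚ
1ₛ = const 1ℚ

_≉_ : Series → Series → Set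
f ≉ g = ¬ (f ≈ g)

infixl 6 _+ₛ_
infixl 7 _*ₛ_

_+ₛ_ : Series → Series → Series
(f +ₛ g) .coeff  α = coeff f α ℚ.+ coeff g α
(f +ₛ g) .stable α = cong₂ ℚ._+_ (stable f α) (stable g α)

-- convolve f g α is the sum of f β * g γ over all β + γ ≡ α.
convolve : ∀ {m} → (f g : Vec ℕ m → ℚ) → Vec ℕ m → ℚ
convolve f g []      = f [] ℚ.* g []
convolve f g (a ∷ α) = ∑₊ a (λ i j → convolve (f ∘ (i ∷_)) (g ∘ (j ∷_)) α)

∑₊-cong : ∀ a {h h′ : ℕ → ℕ → ℚ} → (∀ i j → h i j ≡ h′ i j) → ∑₊ a h ≡ ∑₊ a h′
∑₊-cong zero    eq = eq 0 0
∑₊-cong (suc a) eq = cong₂ ℚ._+_ (eq 0 (suc a)) (∑₊-cong a (eq ∘ suc))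

convolve-cong : ∀ {m} {f f′ g g′ : Vec ℕ m → ℚ} →
                (∀ β → f β ≡ f′ β) → (∀ β → g β ≡ g′ β) →
                ∀ α → convolve f g α ≡ convolve f′ g′ α
convolve-cong p q []      = cong₂ ℚ._*_ (p []) (q [])
convolve-cong p q (a ∷ α) =
  ∑₊-cong a (λ i j → convolve-cong (p ∘ (i ∷_)) (q ∘ (j ∷_)) α)

convolve-∷ʳ0 : ∀ {m} (f g : Vec ℕ (suc m) → ℚ) (α : Vec ℕ m) →
               convolve f g (α ∷ʳ 0) ≡ convolve (f ∘ (_∷ʳ 0)) (g ∘ (_∷ʳ 0)) α
convolve-∷ʳ0 f g []      = refl
convolve-∷ʳ0 f g (a ∷ α) =
  ∑₊-cong a (λ i j → convolve-∷ʳ0 (f ∘ (i ∷_)) (g ∘ (j ∷_)) α)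

_*ₛ_ : Series → Series → Series
(f *ₛ g) .coeff  α = convolve (coeff f) (coeff g) α
(f *ₛ g) .stable α =
  trans (convolve-∷ʳ0 (coeff f) (coeff g) α) (convolve-cong (stable f) (stable g) α)

IsElementary : ∀ {m} → ℕ → Vec ℕ m → Set
IsElementary i α = VecAll (_≤ 1) α × Vec.sum α ≡ i

isElementary? : ∀ {m} i (α : Vec ℕ m) → Dec (IsElementary i α)
isElementary? i α = VecAll.all? (ℕ._≤? 1) α ×-dec (Vec.sum α ℕ.≟ i)

-- The i-th elementary symmetric function: the sum of all squarefree
-- monomials of degree i.
e : ℕ → Series
e i .coeff  α = if does (isElementary? i α) then 1ℚ else 0ℚ
e i .stable α = cong (if_then 1ℚ else 0ℚ) (does-⇔ eqv (isElementary? i (α ∷ʳ 0)) (isElementary? i α))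
  where
  open Equivalence (all-∷ʳ0 α)
  eqv : IsElementary i (α ∷ʳ 0) ⇔ IsElementary i α
  eqv = mk⇔ (λ (p , s) → to p , trans (sym (sum-∷ʳ0 α)) s)
            (λ (p , s) → from p , trans (sum-∷ʳ0 α) s)

∑₊-single : ∀ a b (h : ℕ → ℕ → ℚ) →
            (∀ i j → i + j ≡ a + b → i < a ⊎ j < b → h i j ≡ 0ℚ) →
            ∑₊ (a + b) h ≡ h a b
∑₊-single zero zero    h z = refl
∑₊-single zero (suc b) h z = trans (cong (h 0 (suc b) ℚ.+_) (vanish b (h ∘ suc) tail))
                                   (ℚ.+-identityʳ (h 0 (suc b)))
  where
  vanish : ∀ b (h : ℕ → ℕ → ℚ) → (∀ i j → i + j ≡ b → h i j ≡ 0ℚ) → ∑₊ b h ≡ 0ℚ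
  vanish zero    h z = z 0 0 refl
  vanish (suc b) h z = cong₂ ℚ._+_ (z 0 (suc b) refl)
                                   (vanish b (h ∘ suc) (λ i j p → z (suc i) j (cong suc p)))
  tail : ∀ i j → i + j ≡ b → h (suc i) j ≡ 0ℚ
  tail i j p = z (suc i) j (cong suc p)
    (inj₂ (s≤s (subst (j ≤_) p (ℕ.m≤n+m j i))))
∑₊-single (suc a) b    h z =
  trans (cong₂ ℚ._+_ (z 0 (suc (a + b)) refl (inj₁ (s≤s z≤n)))
                     (∑₊-single a b (h ∘ suc) tail))
        (ℚ.+-identityˡ (h (suc a) b))
  where
  tail : ∀ i j → i + j ≡ a + b → i < a ⊎ j < b → h (suc i) j ≡ 0ℚ
  tail i j p (inj₁ i<a) = z (suc i) j (cong suc p) (inj₁ (s≤s i<a))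
  tail i j p (inj₂ j<b) = z (suc i) j (cong suc p) (inj₂ j<b)

Zero : ∀ {m} → (Vec ℕ m → ℚ) → Set
Zero f = ∀ α → f α ≡ 0ℚ

zero-stable : ∀ {m} {f : Vec ℕ m → ℚ} → ¬ ¬ Zero f → Zero f
zero-stable ¬¬z α = decidable-stable (_ ℚ.≟ _) (λ ≢0 → ¬¬z (λ z → ≢0 (z α)))

convolve-zeroˡ : ∀ {m} {f : Vec ℕ m → ℚ} (g : Vec ℕ m → ℚ) → Zero f → Zero (convolve f g)
convolve-zeroˡ g z []      = trans (cong (ℚ._* g []) (z [])) (ℚ.*-zeroˡ (g []))
convolve-zeroˡ {f = f} g z (a ∷ α) = go a (λ i j → convolve-zeroˡ (g ∘ (j ∷_)) (z ∘ (i ∷_)) α)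
  where
  go : ∀ a {h : ℕ → ℕ → ℚ} → (∀ i j → h i j ≡ 0ℚ) → ∑₊ a h ≡ 0ℚ
  go zero    p = p 0 0
  go (suc a) p = cong₂ ℚ._+_ (p 0 (suc a)) (go a (p ∘ suc))

convolve-zeroʳ : ∀ {m} (f : Vec ℕ m → ℚ) {g : Vec ℕ m → ℚ} → Zero g → Zero (convolve f g)
convolve-zeroʳ f z []      = trans (cong (f [] ℚ.*_) (z [])) (ℚ.*-zeroʳ (f []))
convolve-zeroʳ f {g} z (a ∷ α) = go a (λ i j → convolve-zeroʳ (f ∘ (i ∷_)) (z ∘ (j ∷_)) α)
  where
  go : ∀ a {h : ℕ → ℕ → ℚ} → (∀ i j → h i j ≡ 0ℚ) → ∑₊ a h ≡ 0ℚ
  go zero    p = p 0 0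
  go (suc a) p = cong₂ ℚ._+_ (p 0 (suc a)) (go a (p ∘ suc))

ℚ-domain : ∀ p q → p ≢ 0ℚ → p ℚ.* q ≡ 0ℚ → q ≡ 0ℚ
ℚ-domain p q p≢0 pq≡0 = begin
  q                     ≡⟨ ℚ.*-identityˡ q ⟨
  1ℚ ℚ.* q              ≡⟨ cong (ℚ._* q) (ℚ.*-inverseˡ p) ⟨
  (ℚ.1/ p ℚ.* p) ℚ.* q  ≡⟨ ℚ.*-assoc (ℚ.1/ p) p q ⟩
  ℚ.1/ p ℚ.* (p ℚ.* q)  ≡⟨ cong (ℚ.1/ p ℚ.*_) pq≡0 ⟩
  ℚ.1/ p ℚ.* 0ℚ         ≡⟨ ℚ.*-zeroʳ (ℚ.1/ p) ⟩
  0ℚ                    ∎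
  where
  open ≡-Reasoning
  instance _ = ℚ.≢-nonZero p≢0

convolve-nonzero : ∀ {m} (f g : Vec ℕ m → ℚ) →
                   ¬ Zero f → ¬ Zero g → ¬ Zero (convolve f g)
convolve-nonzero {zero} f g f≉0 g≉0 z =
  g≉0 λ { [] → ℚ-domain (f []) (g []) (λ f≡0 → f≉0 λ { [] → f≡0 }) (z []) }
convolve-nonzero {suc m} f g f≉0 g≉0 z =
  f≉0 λ { (a ∷ α) → zero-stable (λ fₐ≉0 →
  g≉0 λ { (b ∷ β) → zero-stable (λ gᵦ≉0 →
    leading (suc (a + b)) a b (ℕ.n<1+n (a + b)) fₐ≉0 gᵦ≉0) β }) α }
  where
  leading : ∀ n a b → a + b < n → ¬ Zero (f ∘ (a ∷_)) → ¬ Zero (g ∘ (b ∷_)) → ⊥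
  leading (suc n) a b (s≤s a+b≤n) fₐ≉0 gᵦ≉0 =
    convolve-nonzero (f ∘ (a ∷_)) (g ∘ (b ∷_)) fₐ≉0 gᵦ≉0 λ α →
      trans (sym (∑₊-single a b
                   (λ i j → convolve (f ∘ (i ∷_)) (g ∘ (j ∷_)) α) (vanish α)))
            (z (a + b ∷ α))
    where
    vanish : ∀ α i j → i + j ≡ a + b → i < a ⊎ j < b →
             convolve (f ∘ (i ∷_)) (g ∘ (j ∷_)) α ≡ 0ℚ
    vanish α i j _ (inj₁ i<a) = convolve-zeroˡ (g ∘ (j ∷_))
      (zero-stable (λ fᵢ≉0 → leading n i b
        (ℕ.<-≤-trans (ℕ.+-monoˡ-< b i<a) a+b≤n) fᵢ≉0 gᵦ≉0)) α
    vanish α i j _ (inj₂ j<b) = convolve-zeroʳ (f ∘ (i ∷_))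
      (zero-stable (λ gⱼ≉0 → leading n a j
        (ℕ.<-≤-trans (ℕ.+-monoʳ-< a j<b) a+b≤n) fₐ≉0 gⱼ≉0)) α

pad : ∀ {m} d → Vec ℕ m → Vec ℕ (d + m)
pad zero    α = α
pad (suc d) α = pad d α ∷ʳ 0

coeff-pad : ∀ f {m} d (α : Vec ℕ m) → coeff f (pad d α) ≡ coeff f α
coeff-pad f zero    α = refl
coeff-pad f (suc d) α = trans (stable f (pad d α)) (coeff-pad f d α)

coeff-0ₛ : ∀ {m} (α : Vec ℕ m) → coeff 0ₛ α ≡ 0ℚ
coeff-0ₛ α with does (Vec.sum α ℕ.≟ 0)
... | true  = refl
... | false = refl

-- Series form an integral domain.
*ₛ-nonzero : ∀ f g → f ≉ 0ₛ → g ≉ 0ₛ → f *ₛ g ≉ 0ₛ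
*ₛ-nonzero f g f≉0 g≉0 fg≈0 =
  f≉0 λ {m} α → trans (decidable-stable (_ ℚ.≟ _) (λ fα≢0 →
  g≉0 λ {n} β → trans (decidable-stable (_ ℚ.≟ _) (λ gβ≢0 →
    convolve-nonzero {n + m} (coeff f) (coeff g)
      (λ z → fα≢0 (trans (sym (coeff-pad f n α)) (z (pad n α))))
      (λ z → gβ≢0 (trans (sym (coeff-pad g m β))
               (subst (λ l → ∀ (γ : Vec ℕ l) → coeff g γ ≡ 0ℚ) (ℕ.+-comm n m) z (pad m β))))
      (λ γ → trans (fg≈0 γ) (coeff-0ₛ γ)))) (sym (coeff-0ₛ β)))) (sym (coeff-0ₛ α))

1ₛ-nonzero : 1ₛ ≉ 0ₛ
1ₛ-nonzero 1≈0 = contradiction (1≈0 []) λ ()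

e-nonzero : ∀ i → e i ≉ 0ₛ
e-nonzero i eᵢ≈0 = contradiction (trans (sym coeff≡1) (trans (eᵢ≈0 ones) (coeff-0ₛ ones))) λ ()
  where
  ones : Vec ℕ i
  ones = Vec.replicate i 1
  squarefree : ∀ i → VecAll (_≤ 1) (Vec.replicate i 1)
  squarefree zero    = []
  squarefree (suc i) = ℕ.≤-refl ∷ squarefree i
  degree : ∀ i → Vec.sum (Vec.replicate i 1) ≡ i
  degree zero    = refl
  degree (suc i) = cong suc (degree i)
  coeff≡1 : coeff (e i) ones ≡ 1ℚ
  coeff≡1 = cong (if_then 1ℚ else 0ℚ)
                 (dec-true (isElementary? i ones) (squarefree i , degree i))

-- The field of fractions of Series. It contains ℚ(e₁, e₂, …) as a subfield,
-- so equality of elements of ℚ(e₁, e₂, …) is equality here.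
record Fraction : Set where
  constructor _/_[_]
  field
    num   : Series
    den   : Series
    den≉0 : den ≉ 0ₛ

open Fraction public

infix 4 _≃_

_≃_ : Fraction → Fraction → Set
p ≃ q = num p *ₛ den q ≈ num q *ₛ den p

ι : Series → Fraction
ι f = f / 1ₛ [ 1ₛ-nonzero ]

infixl 6 _+ᶠ_
infixl 7 _*ᶠ_

_+ᶠ_ : Fraction → Fraction → Fraction
p +ᶠ q = (num p *ₛ den q +ₛ num q *ₛ den p) / den p *ₛ den q
         [ *ₛ-nonzero (den p) (den q) (den≉0 p) (den≉0 q) ]

_*ᶠ_ : Fraction → Fraction → Fraction
p *ᶠ q = (num p *ₛ num q) / den p *ₛ den q
         [ *ₛ-nonzero (den p) (den q) (den≉0 p) (den≉0 q) ]

∑ ∏ : {X : Set} → List X → (X → Fraction) → Fraction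
∑ xs f = foldr (λ x s → f x +ᶠ s) (ι 0ₛ) xs
∏ xs f = foldr (λ x p → f x *ᶠ p) (ι 1ₛ) xs

-- The vertex i : Fin m is the element suc (toℕ i) of [m].
record Graph (m : ℕ) : Set₁ where
  field
    Adj         : Rel (Fin m) 0ℓ
    adj?        : Decidable Adj
    symmetric   : ∀ {u v} → Adj u v → Adj v u
    irreflexive : ∀ {v} → ¬ Adj v v

open Graph public

IsNaturalUnitInterval : ∀ {m} → Graph m → Set
IsNaturalUnitInterval G = ∀ {p r q} → p Fin.< r → r Fin.< q →
                          Adj G p q → Adj G p r × Adj G r q

IsClique : ∀ {m} → Graph m → (Fin m → Set) → Set
IsClique G S = ∀ {u v} → S u → S v → u ≢ v → Adj G u v

-- Closed arcs of the circle ℚ/ℤ, whose points are represented by rationals.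
-- Finitely many arcs can be moved to rational endpoints without changing
-- which of them meet or contain each other.
record Arc : Set where
  field
    start extent : ℚ
    0≤extent     : 0ℚ ℚ.≤ extent
    extent<1     : extent ℚ.< 1ℚ

infix 4 _liesOn_

_liesOn_ : ℚ → Arc → Set
p liesOn a = ∃[ z ] (start ℚ.≤ p ℚ.+ z ℚ./ 1) × (p ℚ.+ z ℚ./ 1 ℚ.≤ start ℚ.+ extent)
  where open Arc a

IsProperCircularArc : ∀ {n} → Graph n → Set
IsProperCircularArc {n} Γ = Σ (Fin n → Arc) λ arc →
  (∀ (u v : Fin n) → u ≢ v → ¬ (∀ p → p liesOn arc u → p liesOn arc v)) ×
  (∀ (u v : Fin n) → Adj Γ u v ⇔ (u ≢ v × ∃[ p ] (p liesOn arc u) × (p liesOn arc v)))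

-- Identifies the vertex n + r with r for 1 ≤ r ≤ k.
identify : ∀ {n k} → k ≤ n → Fin (n + k) → Fin n
identify {n} k≤n v = Sum.[ id , (λ r → inject≤ r k≤n) ] (splitAt n v)

-- As Γ is irreflexive, no edge of G may join identified vertices.
IsIdentification : ∀ {n k} → k ≤ n → Graph (n + k) → Graph n → Set
IsIdentification k≤n G Γ = ∀ a b →
  Adj Γ a b ⇔ (∃[ u ] ∃[ v ] identify k≤n u ≡ a × identify k≤n v ≡ b × Adj G u v)

-- A coloring κ is the vector of the colors of the vertices, where the
-- color c : ℕ goes with the variable x_{c+1}.
Proper : ∀ {n} → Graph n → Vec ℕ n → Set
Proper Γ κ = ∀ u v → Adj Γ u v → lookup κ u ≢ lookup κ v

proper? : ∀ {n} (Γ : Graph n) → Unary.Decidable (Proper Γ)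
proper? Γ κ = Fin.all? λ u → Fin.all? λ v →
  adj? Γ u v →-dec ¬? (lookup κ u ℕ.≟ lookup κ v)

-- The exponents of x₁, …, xₘ in ∏ᵥ x_{κ(v)}.
exponents : ∀ m {n} → Vec ℕ n → Vec ℕ m
exponents m κ = tabulate (λ (i : Fin m) → Vec.count (toℕ i ℕ.≟_) κ)

HasMonomial : ∀ {n m} → Graph n → Vec ℕ m → Vec ℕ n → Set
HasMonomial {m = m} Γ α κ = exponents m κ ≡ α × Proper Γ κ

hasMonomial? : ∀ {n m} (Γ : Graph n) (α : Vec ℕ m) → Unary.Decidable (HasMonomial Γ α)
hasMonomial? {m = m} Γ α κ = Vec.≡-dec ℕ._≟_ (exponents m κ) α ×-dec proper? Γ κ

tabulate-∷ʳ : ∀ m (h : ℕ → ℕ) →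
              tabulate {n = suc m} (h ∘ toℕ) ≡ tabulate {n = m} (h ∘ toℕ) ∷ʳ h m
tabulate-∷ʳ zero    h = refl
tabulate-∷ʳ (suc m) h = cong (h 0 ∷_) (tabulate-∷ʳ m (h ∘ suc))

filter-map : ∀ {X Y : Set} {P : Y → Set} (P? : Unary.Decidable P) (f : X → Y) xs →
             filter P? (map f xs) ≡ map f (filter (P? ∘ f) xs)
filter-map P? f []       = refl
filter-map P? f (x ∷ xs) with does (P? (f x))
... | true  = cong (f x ∷_) (filter-map P? f xs)
... | false = filter-map P? f xs

filter-words : ∀ {X : Set} (xs : List X) y n {P : Vec X n → Set} (P? : Unary.Decidable P) →
               (∀ κ → P κ → ∀ i → lookup κ i ≢ y) →
               filter P? (words (xs ++ [ y ]) n) ≡ filter P? (words xs n)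
filter-words xs y zero    P? avoid = refl
filter-words xs y (suc n) P? avoid = begin
  filter P? (cartesianProductWith _∷_ (xs ++ [ y ]) W′)
    ≡⟨ cong (filter P?) (List.cartesianProductWith-distribʳ-++ _∷_ xs [ y ] W′) ⟩
  filter P? (cartesianProductWith _∷_ xs W′ ++ (map (y ∷_) W′ ++ []))
    ≡⟨ List.filter-++ P? (cartesianProductWith _∷_ xs W′) _ ⟩
  filter P? (cartesianProductWith _∷_ xs W′) ++ filter P? (map (y ∷_) W′ ++ [])
    ≡⟨ cong₂ _++_ (go xs) none ⟩
  filter P? (cartesianProductWith _∷_ xs W) ++ []
    ≡⟨ List.++-identityʳ _ ⟩
  filter P? (cartesianProductWith _∷_ xs W) ∎
  where
  open ≡-Reasoning
  W′ = words (xs ++ [ y ]) n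
  W  = words xs n
  none : filter P? (map (y ∷_) W′ ++ []) ≡ []
  none = List.filter-none P?
    (All.++⁺ (All.map⁺ (All.universal (λ κ p → avoid (y ∷ κ) p Fin.zero refl) W′)) [])
  go : ∀ zs → filter P? (cartesianProductWith _∷_ zs W′) ≡ filter P? (cartesianProductWith _∷_ zs W)
  go []       = refl
  go (z ∷ zs) = begin
    filter P? (map (z ∷_) W′ ++ cartesianProductWith _∷_ zs W′)
      ≡⟨ List.filter-++ P? (map (z ∷_) W′) _ ⟩
    filter P? (map (z ∷_) W′) ++ filter P? (cartesianProductWith _∷_ zs W′)
      ≡⟨ cong₂ _++_ (trans (filter-map P? (z ∷_) W′)
                    (trans (cong (map (z ∷_)) (filter-words xs y n (P? ∘ (z ∷_))
                              (λ κ p i → avoid (z ∷ κ) p (Fin.suc i))))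
                           (sym (filter-map P? (z ∷_) W))))
                    (go zs) ⟩
    filter P? (map (z ∷_) W) ++ filter P? (cartesianProductWith _∷_ zs W)
      ≡⟨ List.filter-++ P? (map (z ∷_) W) _ ⟨
    filter P? (map (z ∷_) W ++ cartesianProductWith _∷_ zs W) ∎

count-none : ∀ {X : Set} {P : X → Set} (P? : Unary.Decidable P) {n} (κ : Vec X n) →
             Vec.count P? κ ≡ 0 → ∀ i → ¬ P (lookup κ i)
count-none P? (x ∷ κ) p i q with P? x
count-none P? (x ∷ κ) p Fin.zero    q | no ¬px = ¬px q
count-none P? (x ∷ κ) p (Fin.suc i) q | no ¬px = count-none P? κ p i q

none-count : ∀ {X : Set} {P : X → Set} (P? : Unary.Decidable P) {n} (κ : Vec X n) →
             (∀ i → ¬ P (lookup κ i)) → Vec.count P? κ ≡ 0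
none-count P? []      p = refl
none-count P? (x ∷ κ) p with P? x
... | yes px = contradiction px (p Fin.zero)
... | no  _  = none-count P? κ (p ∘ Fin.suc)

words-∈ : ∀ {X : Set} {P : X → Set} (xs : List X) n → All P xs →
          All (λ κ → ∀ i → P (lookup κ i)) (words xs n)
words-∈ xs zero    ps = (λ ()) ∷ []
words-∈ xs (suc n) ps = go xs ps
  where
  go : ∀ zs → All _ zs → All _ (cartesianProductWith _∷_ zs (words xs n))
  go []       []       = []
  go (z ∷ zs) (q ∷ qs) = All.++⁺
    (All.map⁺ (All.map (λ r → λ { Fin.zero → q ; (Fin.suc i) → r i }) (words-∈ xs n ps)))
    (go zs qs)

-- The coefficient of x^α counts the proper colorings κ with ∏ᵥ x_{κ(v)} = x^α;
-- these use only the first m colors.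
chromatic : ∀ {n} → Graph n → Series
chromatic {n} Γ .coeff  {m} α = (+ length (filter (hasMonomial? Γ α) (words (upTo m) n))) ℚ./ 1
chromatic {n} Γ .stable {m} α = cong (λ κs → (+ length κs) ℚ./ 1) (begin
  filter (hasMonomial? Γ (α ∷ʳ 0)) (words (upTo (suc m)) n)
    ≡⟨ cong (λ cs → filter (hasMonomial? Γ (α ∷ʳ 0)) (words cs n)) (List.upTo-∷ʳ m) ⟨
  filter (hasMonomial? Γ (α ∷ʳ 0)) (words (upTo m ++ [ m ]) n)
    ≡⟨ filter-words (upTo m) m n (hasMonomial? Γ (α ∷ʳ 0)) (λ κ p i → count-none (m ℕ.≟_) κ (unused κ p) i ∘ sym) ⟩
  filter (hasMonomial? Γ (α ∷ʳ 0)) (words (upTo m) n)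
    ≡⟨ filter-cong (words-∈ (upTo m) n (All.applyUpTo⁺₁ id m id)) ⟩
  filter (hasMonomial? Γ α) (words (upTo m) n) ∎)
  where
  open ≡-Reasoning
  split : ∀ κ → exponents (suc m) κ ≡ exponents m κ ∷ʳ Vec.count (m ℕ.≟_) κ
  split κ = tabulate-∷ʳ m (λ c → Vec.count (c ℕ.≟_) κ)
  unused : ∀ κ → HasMonomial Γ (α ∷ʳ 0) κ → Vec.count (m ℕ.≟_) κ ≡ 0
  unused κ (p , _) = Vec.∷ʳ-injectiveʳ (exponents m κ) α (trans (sym (split κ)) p)
  same : ∀ κ → (∀ i → lookup κ i < m) → HasMonomial Γ (α ∷ʳ 0) κ ⇔ HasMonomial Γ α κ
  same κ κ<m = mk⇔
    (λ (p , q) → Vec.∷ʳ-injectiveˡ (exponents m κ) α (trans (sym (split κ)) p) , q)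
    (λ (p , q) → trans (split κ)
      (cong₂ _∷ʳ_ p (none-count (m ℕ.≟_) κ (λ i → ℕ.<⇒≢ (κ<m i) ∘ sym))) , q)
  filter-cong : ∀ {κs} → All (λ κ → ∀ i → lookup κ i < m) κs →
                filter (hasMonomial? Γ (α ∷ʳ 0)) κs ≡ filter (hasMonomial? Γ α) κs
  filter-cong []                  = refl
  filter-cong {κ ∷ κs} (κ<m ∷ ps)
    with does (hasMonomial? Γ (α ∷ʳ 0) κ) | does (hasMonomial? Γ α κ)
       | does-⇔ (same κ κ<m) (hasMonomial? Γ (α ∷ʳ 0) κ) (hasMonomial? Γ α κ)
  ... | true  | _ | refl = cong (κ ∷_) (filter-cong ps)
  ... | false | _ | refl = filter-cong ps

-- Division with p / 0 = 0. For distinct positive σ, no zero denominator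
-- occurs in A y σ.
ratio : ℤ → ℤ → ℚ
ratio p (+ zero)  = 0ℚ
ratio p (+ suc d) = p ℚ./ suc d
ratio p -[1+ d ]  = (ℤ.- p) ℚ./ suc d

-- A y σ is A(y ∣ σ). As the entries of σ are distinct, the indices r′ ≠ r are those with
-- σ_{r′} ≠ σ_r.
A : ℕ → List ℕ → ℚ
A zero            σ = 0ℚ
A (suc zero)      σ = ∏ℚ σ (λ s → ratio (+ s ℤ.- 1ℤ) (+ s))
A (suc s@(suc _)) σ =
  if does (s ∈ℕ? σ)
  then ratio (+ s ℤ.+ 1ℤ) (+ s) ℚ.*
       ∏ℚ (filter (λ s′ → ¬? (s′ ℕ.≟ s)) σ)
          (λ s′ → ratio (+ s ℤ.- + s′ ℤ.+ 1ℤ) (+ s ℤ.- + s′))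
  else 0ℚ

-- The list of the rows, from the bottom row upward, each read from left
-- to right.
Tableau : Set
Tableau = List (List ℤ)

entries : Tableau → List ℤ
entries = concat

-- Prefix ℤ._>_ also makes the upper row at most as long as the lower one.
_below_ : Rel (List ℤ) 0ℓ
lower below upper = Prefix ℤ._>_ upper lower

IsTableau : Tableau → Set
IsTableau T =
  All (λ row → 1 ≤ length row) T × All (Linked ℤ._<_) T × Linked _below_ T × Unique (entries T)

isTableau? : Unary.Decidable IsTableau
isTableau? T =
  all? (λ row → 1 ℕ.≤? length row) T ×-dec all? (linked? ℤ._<?_) T ×-dec
  linked? (λ lower upper → prefix? (λ x y → y ℤ.<? x) upper lower) T ×-dec uniqueℤ? (entries T)

_⊑_ : Tableau → Tableau → Set
_⊑_ = Prefix (Prefix _≡_)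

_∖_ : Tableau → Tableau → List ℤ
T ∖ T₀ = filter (_∉ℤ? entries T₀) (entries T)

-- The column, counted from 1, of an entry; 0 for a non-entry.
column : Tableau → ℤ → ℕ
column T x =
  fromMaybe 0 (head (mapMaybe (λ row → Maybe.map (suc ∘ toℕ) (findIndex (x ℤ.≟_) row)) T))

label : ∀ {m} → Fin m → ℤ
label v = + suc (toℕ v)

-- T has rows of lengths j₁, …, jₖ, the row of length jᵣ ends in r, and all
-- other entries are nonpositive. For distinct positive jᵣ such a T exists:
-- for instance, put c - l² into column c of the row of length l when c < l.
IsInitial : ∀ {k} → Vec ℕ k → Tableau → Set
IsInitial {k} j T =
  IsTableau T ×
  map length T ↭ toList j ×
  (∀ (r : Fin k) → Any (λ row → length row ≡ lookup j r × last row ≡ just (label r)) T) ×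
  All (λ x → x ℤ.≤ 0ℤ ⊎ ∃[ r ] x ≡ label {k} r) (entries T)

tuples : ∀ k → ℕ → List (Vec ℕ k)
tuples k N = filter (uniqueℕ? ∘ toList) (words (map suc (upTo N)) k)

Extends : ℕ → Tableau → List ℤ → Tableau → Set
Extends N T₀ new T =
  IsTableau T × T₀ ⊑ T × (T ∖ T₀ ⊆ new × new ⊆ T ∖ T₀) × All (λ row → length row ≤ N) T

extends? : ∀ N T₀ new → Unary.Decidable (Extends N T₀ new)
extends? N T₀ new T =
  isTableau? T ×-dec prefix? (prefix? ℤ._≟_) T₀ T ×-dec
  ((T ∖ T₀ ⊆? new) ×-dec (new ⊆? T ∖ T₀)) ×-dec all? (λ row → length row ℕ.≤? N) T

-- Every T with Extends N T₀ new T occurs among the candidates: its entries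
-- are distinct and lie in support, so it has at most length support rows.
extensions : ℕ → Tableau → List ℤ → List Tableau
extensions N T₀ new = filter (extends? N T₀ new) (listsUpTo (length support) (listsUpTo N support))
  where support = entries T₀ ++ new

module _ (n k : ℕ) (G : Graph (n + k)) where

  newVertices : List (Fin (n + k))
  newVertices = filter (λ v → k ℕ.≤? toℕ v) (allFin (n + k))

  smallerNeighbors : Fin (n + k) → List (Fin (n + k))
  smallerNeighbors v = filter (λ u → (u Fin.<? v) ×-dec adj? G u v) (allFin (n + k))

  neighborColumns : Tableau → Fin (n + k) → List ℕ
  neighborColumns T v = map (column T ∘ label) (smallerNeighbors v)

  lastColumns : Tableau → Vec ℕ k
  lastColumns T = tabulate (λ r → column T (label (n ↑ʳ r)))

  factor : Tableau → Fin (n + k) → Fraction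
  factor T v = ι (const (A c (neighborColumns T v))) *ᶠ (e c / e (c ∸ 1) [ e-nonzero (c ∸ 1) ])
    where c = column T (label v)

  -- The summand is 0 when some neighborColumns T v has a repeated entry, a
  -- case in which A is not defined.
  summand : Tableau → Fraction
  summand T =
    if does (all? (uniqueℕ? ∘ neighborColumns T) newVertices)
    then ∏ newVertices (factor T)
    else ι 0ₛ

  tableauxFor : ℕ → (Vec ℕ k → Tableau) → Vec ℕ k → List Tableau
  tableauxFor N T₀ j =
    filter (λ T → Vec.≡-dec ℕ._≟_ (lastColumns T) j)
           (extensions N (T₀ j) (map label newVertices))

{-# OPTIONS --safe #-}
module Submission where

-- Add the vertices k+1, …, n+k one at a time. As G is a natural unit interval graph, the neighbours of the next
-- vertex are the last few vertices added, so only these have to be remembered. At a numerical point x of M distinct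
-- positive rationals, the left side is then the trace of an operator on words of k distinct colours (a factor x b for
-- each new vertex), and the right side the trace of an operator on words of k distinct columns (a factor
-- A(y ∣ c) e_y / e_{y−1} for each new vertex): a tableau is determined by the columns of its new entries, and A
-- vanishes when no box can be added in column y. Columns beyond n do not contribute, so the bound N may be replaced by M.
--
-- The two operators are intertwined by an invertible matrix, hence their traces agree. For words of length M this
-- matrix consists of joint eigenfunctions F κ, with eigenvalues x κ₀, x κ₁, …, of commuting elements y 0, y 1, … of an
-- affine symmetric group that acts on functions of the column words: the transpositions act by the seminormal form and
-- the rotation moves the first column to the end with a weight. For shorter words the matrix is obtained by
-- summing over the forgotten letters.
--
-- Finally, power series that are polynomials in each number of variables agree if they agree at all points with
-- positive, strictly decreasing rational coordinates.

open import Data.Bool.Base using (Bool; _∧_; false; if_then_else_; true)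
import Data.Bool.Properties as Bool
open import Data.Empty using (⊥)
open import Data.Fin.Base as Fin using (Fin; _↑ʳ_; _↑ˡ_; inject≤; punchIn; toℕ)
import Data.Fin.Properties as Fin
open import Data.Integer.Base as ℤ using (+_; -[1+_]; 0ℤ; 1ℤ; ℤ)
import Data.Integer.Properties as ℤ
open import Data.List.Base as List using (List; []; _++_; _ʳ++_; _∷_; _∷ʳ_; allFin; cartesianProductWith; concatMap; drop; filter; findIndex; foldr; last; length; map; take; upTo)
open import Data.List.Membership.Propositional using (_∈_; _∉_; find)
import Data.List.Membership.Propositional.Properties as ∈
import Data.List.Properties as List
open import Data.List.Relation.Binary.Permutation.Propositional as ↭ using (_↭_; ↭⇒↭ₛ)
import Data.List.Relation.Binary.Permutation.Propositional.Properties as ↭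
import Data.List.Relation.Binary.Permutation.Setoid.Properties as ↭ₛ
open import Data.List.Relation.Binary.Prefix.Heterogeneous using (Prefix)
open import Data.List.Relation.Binary.Subset.Propositional using (_⊆_)
open import Data.List.Relation.Unary.All as All using (All; []; _∷_; all?)
import Data.List.Relation.Unary.All.Properties as All
open import Data.List.Relation.Unary.AllPairs as AllPairs using (AllPairs; []; _∷_)
import Data.List.Relation.Unary.AllPairs.Properties as AllPairs
open import Data.List.Relation.Unary.Any as Any using (Any; here; there)
import Data.List.Relation.Unary.Any.Properties as Any
open import Data.List.Relation.Unary.Linked using (Linked; [-])
open import Data.List.Relation.Unary.Unique.Propositional using (Unique)
import Data.List.Relation.Unary.Unique.Propositional.Properties as Unique
open import Data.Maybe.Base as Maybe using (Maybe; just; nothing)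
open import Data.Nat.Base as ℕ using (_<_; _≤_; suc; s≤s; zero; z≤n; ℕ)
import Data.Nat.Properties as ℕ
open import Data.Product.Base using (_,_; _×_; proj₁; proj₂; Σ; ∃-syntax)
open import Data.Rational.Base as ℚ using (0ℚ; 1ℚ; ℚ)
import Data.Rational.Properties as ℚ
open import Data.Rational.Solver using (module +-*-Solver)
import Data.Rational.Unnormalised.Base as ℚᵘ
import Data.Rational.Unnormalised.Properties as ℚᵘ
open import Data.Sum.Base as Sum using (_⊎_; inj₁; inj₂)
open import Data.Unit.Base using (tt; ⊤)
open import Data.Vec.Base as Vec using (Vec; toList)
open import Data.Vec.Functional using (insertAt)
import Data.Vec.Functional.Properties as Vector
import Data.Vec.Properties as Vec
import Data.Vec.Relation.Unary.All as VecAll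
open import Defs using (A; IsTableau; Tableau; _below_; _⊑_; column; entries; listsUpTo; ratio; words; ℚ-domain; ∏ℚ)
open import Function.Base using (_∘_; id)
open import Function.Bundles using (Equivalence; mk⇔)
open import Relation.Binary.Bundles using (Setoid)
open import Relation.Binary.Definitions using (tri<; tri>; tri≈)
open import Relation.Binary.PropositionalEquality as ≡ using (_≡_; _≢_; cong; cong₂; module ≡-Reasoning; refl; subst; sym; trans)
import Relation.Binary.Reasoning.Setoid as SetoidReasoning
open import Relation.Binary.Structures using (IsEquivalence)
open import Relation.Nullary.Decidable using (Dec; _×-dec_; dec-false; dec-true; decidable-stable; does; does-⇔; no; yes; ¬?)
open import Relation.Nullary.Negation using (contradiction; ¬_)
import Relation.Unary as Unary
open import Data.List.Relation.Unary.Unique.DecPropositional ℕ._≟_ using (unique?)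

-- Everything starts from the constant function `one`. For each number t the product of all y i - t
-- is symmetric in the y, so it maps `one` to a function fixed by every transposition, hence to a
-- constant. Evaluated at the word 1, 2, ..., M this constant is the product of all x b - t; the
-- rotation weight `ρ` is made for that. Thus for t = x b the product kills `one`, and Lagrange
-- interpolation in y 0, y 1, ... turns `one` into the eigenfunctions `F κ`. They vanish when κ
-- misses a colour. If one belonging to a permutation vanished, all would, and `one` with them. The
-- obstacle is that the eigenvalue equation involves all M positions while only a window of entries
-- is remembered. Summing over forgotten letters makes the functions symmetric in the forgotten
-- columns, so they descend to short column words. The descent can start because `ρ z` is precisely
-- the weight of column z when all other columns are present.

-- Lists without repetition, and words as index sets.

module Lists where

  open import Relation.Binary.PropositionalEquality using (setoid)

  private variable
    B C : Set

  length-∷ʳ : ∀ (xs : List B) x → length (xs ∷ʳ x) ≡ suc (length xs)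
  length-∷ʳ xs x = trans (List.length-++ xs) (ℕ.+-comm (length xs) 1)

  unique-resp : ∀ {xs ys : List B} → xs ↭ ys → Unique xs → Unique ys
  unique-resp p = ↭ₛ.Unique-resp-↭ (setoid _) (↭⇒↭ₛ p)

  unique-tail : ∀ {x : B} {xs} → Unique (x ∷ xs) → Unique xs
  unique-tail (_ ∷ u) = u

  unique-++⁻ : ∀ (p : List B) {c} → Unique (p ++ c) → Unique p × Unique c × (∀ {a} → a ∈ p → a ∉ c)
  unique-++⁻ []      u = [] , u , λ ()
  unique-++⁻ (a ∷ p) {c} (a∉ ∷ u) with unique-++⁻ p u
  ... | up , uc , disj = (All.++⁻ˡ p a∉ ∷ up) , uc ,
    λ { (here refl) a∈c → All.lookup (All.++⁻ʳ p a∉) a∈c refl ; (there q) → disj q }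

  unique-map : ∀ (h : B → ℕ) {L a b} → Unique (map h L) → a ∈ L → b ∈ L → a ≢ b → h a ≢ h b
  unique-map h (p ∷ u) (here refl) (here refl) ne = contradiction refl ne
  unique-map h (p ∷ u) (here refl) (there q)   ne = All.lookup p (∈.∈-map⁺ h q)
  unique-map h (p ∷ u) (there q)   (here refl) ne e = All.lookup p (∈.∈-map⁺ h q) (sym e)
  unique-map h (p ∷ u) (there q)   (there r)   ne = unique-map h u q r ne

  map-unique : ∀ (h : B → ℕ) {L} → Unique L → (∀ {a b} → a ∈ L → b ∈ L → a ≢ b → h a ≢ h b) → Unique (map h L)
  map-unique h {[]}    _       inj = []
  map-unique h {a ∷ L} (p ∷ u) inj = All.tabulate (λ {c} c∈ e → separate c∈ e) ∷ map-unique h u (λ q r → inj (there q) (there r))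
    where
    separate : ∀ {c} → c ∈ map h L → h a ≢ c
    separate c∈ e with ∈.∈-map⁻ h c∈
    ... | b , b∈ , refl = inj (here refl) (there b∈) (All.lookup p b∈) e

  remove : ∀ {b : B} {ys} → b ∈ ys → List B
  remove {ys = _ ∷ ys} (here _)  = ys
  remove {ys = y ∷ ys} (there p) = y ∷ remove p

  remove-↭ : ∀ {b : B} {ys} (p : b ∈ ys) → ys ↭ b ∷ remove p
  remove-↭ {ys = _ ∷ ys} (here refl) = ↭.refl
  remove-↭ {b = b} {y ∷ ys} (there p) = ↭.trans (↭.prep y (remove-↭ p)) (↭.swap y b ↭.refl)

  ∈-remove : ∀ {a b : B} {ys} (p : b ∈ ys) → a ∈ ys → a ≢ b → a ∈ remove p
  ∈-remove p a∈ a≢b with ↭.∈-resp-↭ (remove-↭ p) a∈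
  ... | here a≡b = contradiction a≡b a≢b
  ... | there q  = q

  unique-⊆-length : ∀ {xs ys : List B} → Unique xs → xs ⊆ ys → length xs ≤ length ys
  unique-⊆-length {xs = []} _ _ = z≤n
  unique-⊆-length {xs = x ∷ xs} {ys} (x∉ ∷ u) sub = subst (suc (length xs) ≤_) (sym (↭.↭-length (remove-↭ x∈)))
    (s≤s (unique-⊆-length u (λ a∈ → ∈-remove x∈ (sub (there a∈)) λ a≡x → All.lookup x∉ a∈ (sym a≡x))))
    where x∈ = sub (here refl)

  unique-set⇒↭ : ∀ {xs ys : List B} → Unique xs → Unique ys → xs ⊆ ys → ys ⊆ xs → xs ↭ ys
  unique-set⇒↭ {xs = []} {[]} _ _ _ _ = ↭.refl
  unique-set⇒↭ {xs = []} {y ∷ ys} _ _ _ sub = contradiction (sub (here refl)) λ ()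
  unique-set⇒↭ {xs = x ∷ xs} {ys} (x∉ ∷ u) v sub sub′ = ↭.trans (↭.prep x (unique-set⇒↭ u v′
      (λ a∈ → ∈-remove x∈ (sub (there a∈)) λ a≡x → All.lookup x∉ a∈ (sym a≡x))
      (λ {a} a∈ → back a∈ (sub′ (↭.∈-resp-↭ (↭.↭-sym (remove-↭ x∈)) (there a∈))))))
    (↭.↭-sym (remove-↭ x∈))
    where
    x∈ = sub (here refl)
    w : Unique (x ∷ remove x∈)
    w = unique-resp (remove-↭ x∈) v
    v′ : Unique (remove x∈)
    v′ with w
    ... | _ ∷ v′ = v′
    back : ∀ {a} → a ∈ remove x∈ → a ∈ x ∷ xs → a ∈ xs
    back a∈ (there p)   = p
    back a∈ (here refl) with w
    ... | x∉′ ∷ _ = contradiction refl (All.lookup x∉′ a∈)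

  unique-⊆⇒↭ : ∀ {xs ys : List B} → Unique xs → xs ⊆ ys → length ys ≤ length xs → xs ↭ ys
  unique-⊆⇒↭ {xs = []} {[]} _ _ _ = ↭.refl
  unique-⊆⇒↭ {xs = x ∷ xs} {ys} (x∉ ∷ u) sub len = ↭.trans (↭.prep x (unique-⊆⇒↭ u
      (λ a∈ → ∈-remove x∈ (sub (there a∈)) λ a≡x → All.lookup x∉ a∈ (sym a≡x))
      (ℕ.s≤s⁻¹ (subst (_≤ suc (length xs)) (↭.↭-length (remove-↭ x∈)) len))))
    (↭.↭-sym (remove-↭ x∈))
    where x∈ = sub (here refl)

  -- Serves two kinds of products: the factors r′ ≠ r of `A` and the Lagrange factors b′ ≠ b.
  _without_ : List ℕ → ℕ → List ℕ
  L without b = filter (λ b′ → ¬? (b′ ℕ.≟ b)) L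

  without-here : ∀ a L → (a ∷ L) without a ≡ L without a
  without-here a L = List.filter-reject (λ b → ¬? (b ℕ.≟ a)) (λ ne → ne refl)

  without-there : ∀ {a b} L → a ≢ b → (a ∷ L) without b ≡ a ∷ (L without b)
  without-there {b = b} L a≢b = List.filter-accept (λ b′ → ¬? (b′ ℕ.≟ b)) a≢b

  without-∉ : ∀ {a} L → a ∉ L → L without a ≡ L
  without-∉ {a} L a∉ = List.filter-all (λ b → ¬? (b ℕ.≟ a)) (All.tabulate λ b∈ b≡a → a∉ (subst (_∈ L) b≡a b∈))

  without-↭ : ∀ {L L′} a → L ↭ L′ → L without a ↭ L′ without a
  without-↭ a p = ↭.filter-↭ (λ b → ¬? (b ℕ.≟ a)) p

  -- Columns are numbered from 1, so `ids 1 M` lists them; it is also the word at which functions of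
  -- column words are evaluated. The recursion exhibits the neighbours k, k + 1, for which `φ`
  -- vanishes.
  ids : ℕ → ℕ → List ℕ
  ids k zero    = []
  ids k (suc n) = k ∷ ids (suc k) n

  length-ids : ∀ k n → length (ids k n) ≡ n
  length-ids k zero    = refl
  length-ids k (suc n) = cong suc (length-ids (suc k) n)

  ids-≥ : ∀ k n → All (k ≤_) (ids k n)
  ids-≥ k zero    = []
  ids-≥ k (suc n) = ℕ.≤-refl ∷ All.map ℕ.<⇒≤ (ids-≥ (suc k) n)

  ids-unique : ∀ k n → Unique (ids k n)
  ids-unique k zero    = []
  ids-unique k (suc n) = All.map ℕ.<⇒≢ (ids-≥ (suc k) n) ∷ ids-unique (suc k) n

  ids-++ : ∀ k a b → ids k (a ℕ.+ b) ≡ ids k a ++ ids (a ℕ.+ k) b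
  ids-++ k zero    b = refl
  ids-++ k (suc a) b = cong (k ∷_) (trans (ids-++ (suc k) a b) (cong (λ j → ids (suc k) a ++ ids j b) (ℕ.+-suc a k)))

  ids-∈ : ∀ k n {y} → k ≤ y → y < n ℕ.+ k → y ∈ ids k n
  ids-∈ k zero    k≤y y<k = contradiction k≤y (ℕ.<⇒≱ y<k)
  ids-∈ k (suc n) {y} k≤y y< with ℕ.m≤n⇒m<n∨m≡n k≤y
  ... | inj₂ refl = here refl
  ... | inj₁ k<y  = there (ids-∈ (suc k) n k<y (ℕ.≤-trans y< (ℕ.≤-reflexive (sym (ℕ.+-suc n k)))))

  ∈-ids : ∀ k n {y} → y ∈ ids k n → k ≤ y × y < n ℕ.+ k
  ∈-ids k (suc n) (here refl) = ℕ.≤-refl , s≤s (ℕ.m≤n+m k n)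
  ∈-ids k (suc n) (there p) with ∈-ids (suc k) n p
  ... | k<y , y< = ℕ.<⇒≤ k<y , ℕ.≤-trans y< (ℕ.≤-reflexive (ℕ.+-suc n k))

  -- Words as plain lists: cutting them into windows and joining them then takes no arithmetic on
  -- lengths in types.
  seqs : List B → ℕ → List (List B)
  seqs L zero    = [] ∷ []
  seqs L (suc l) = concatMap (λ b → map (b ∷_) (seqs L l)) L

  ∈-seqs⁺ : ∀ {L : List B} ys → All (_∈ L) ys → ys ∈ seqs L (length ys)
  ∈-seqs⁺     []       []       = here refl
  ∈-seqs⁺ {L = L} (b ∷ ys) (b∈ ∷ p) = ∈.∈-concatMap⁺ (λ b → map (b ∷_) (seqs L (length ys)))
    (Any.map (λ { refl → ∈.∈-map⁺ (b ∷_) (∈-seqs⁺ ys p) }) b∈)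

  ∈-seqs⁻ : ∀ {L : List B} l {ys} → ys ∈ seqs L l → length ys ≡ l × All (_∈ L) ys
  ∈-seqs⁻ zero    (here refl) = refl , []
  ∈-seqs⁻ {L = L} (suc l) ys∈ with find (∈.∈-concatMap⁻ (λ b → map (b ∷_) (seqs L l)) {xs = L} ys∈)
  ... | b , b∈ , q with ∈.∈-map⁻ (b ∷_) q
  ...   | v , v∈ , refl with ∈-seqs⁻ l v∈
  ...     | refl , p = refl , b∈ ∷ p

  seqs-unique : ∀ {L : List B} l → Unique L → Unique (seqs L l)
  seqs-unique         zero    _ = [] ∷ []
  seqs-unique {L = L} (suc l) uL = go L uL
    where
    go : ∀ bs → Unique bs → Unique (concatMap (λ b → map (b ∷_) (seqs L l)) bs)
    go []       _        = []
    go (b ∷ bs) (b∉ ∷ u) = Unique.++⁺ (Unique.map⁺ (proj₂ ∘ List.∷-injective) (seqs-unique l uL)) (go bs u) disjoint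
      where
      disjoint : ∀ {v} → v ∈ map (b ∷_) (seqs L l) × v ∈ concatMap (λ b → map (b ∷_) (seqs L l)) bs → ⊥
      disjoint (p , q) with ∈.∈-map⁻ (b ∷_) p | find (∈.∈-concatMap⁻ (λ b → map (b ∷_) (seqs L l)) {xs = bs} q)
      ... | _ , _ , refl | b′ , b′∈ , r with ∈.∈-map⁻ (b′ ∷_) r
      ...   | _ , _ , refl = All.lookup b∉ b′∈ refl

-- Finite sums and products of rationals.

module Sums where

  open Lists
  open import Data.Rational.Base using (_+_; _*_)

  open +-*-Solver using (solve; _:+_; _:*_; _:-_; :-_; _:=_; con)

  private variable
    B C : Set

  ∑ℚ : List B → (B → ℚ) → ℚ
  ∑ℚ L f = foldr (λ b r → f b + r) 0ℚ L

  ∑-cong : ∀ (L : List B) {f g} → (∀ {b} → b ∈ L → f b ≡ g b) → ∑ℚ L f ≡ ∑ℚ L g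
  ∑-cong []      e = refl
  ∑-cong (b ∷ L) e = cong₂ _+_ (e (here refl)) (∑-cong L (e ∘ there))

  ∑-+ : ∀ (L : List B) f g → ∑ℚ L (λ b → f b + g b) ≡ ∑ℚ L f + ∑ℚ L g
  ∑-+ []      f g = sym (ℚ.+-identityˡ 0ℚ)
  ∑-+ (b ∷ L) f g = trans (cong (λ z → (f b + g b) + z) (∑-+ L f g))
    (solve 4 (λ a b c d → (a :+ b) :+ (c :+ d) := (a :+ c) :+ (b :+ d)) refl (f b) (g b) (∑ℚ L f) (∑ℚ L g))

  ∑-* : ∀ (L : List B) t f → ∑ℚ L (λ b → t * f b) ≡ t * ∑ℚ L f
  ∑-* []      t f = sym (ℚ.*-zeroʳ t)
  ∑-* (b ∷ L) t f = trans (cong (λ z → t * f b + z) (∑-* L t f)) (sym (ℚ.*-distribˡ-+ t (f b) (∑ℚ L f)))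

  ∑-zero : ∀ (L : List B) {f} → (∀ {b} → b ∈ L → f b ≡ 0ℚ) → ∑ℚ L f ≡ 0ℚ
  ∑-zero []      e = refl
  ∑-zero (b ∷ L) e = trans (cong₂ _+_ (e (here refl)) (∑-zero L (e ∘ there))) (ℚ.+-identityˡ 0ℚ)

  ∑-comm : ∀ (L : List B) (K : List C) (f : B → C → ℚ) →
           ∑ℚ L (λ b → ∑ℚ K (f b)) ≡ ∑ℚ K (λ c → ∑ℚ L (λ b → f b c))
  ∑-comm []      K f = sym (∑-zero K (λ _ → refl))
  ∑-comm (b ∷ L) K f = trans (cong (λ z → ∑ℚ K (f b) + z) (∑-comm L K f))
    (sym (∑-+ K (f b) (λ c → ∑ℚ L (λ b → f b c))))

  -- For a recursion that is valid for every letter but one: the exceptional letter contributes the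
  -- correction `d`.
  ∑-differ : ∀ (L : List B) {b f g} d → b ∈ L → Unique L → (∀ {a} → a ∈ L → a ≢ b → f a ≡ g a) →
             f b ≡ g b + d → ∑ℚ L f ≡ ∑ℚ L g + d
  ∑-differ (b ∷ L) {f = f} {g} d (here refl) (b∉ ∷ u) e e′ = trans
    (cong₂ _+_ e′ (∑-cong L λ {a} a∈ → e (there a∈) (λ a≡b → All.lookup b∉ a∈ (sym a≡b))))
    (solve 3 (λ a d c → (a :+ d) :+ c := (a :+ c) :+ d) refl (g b) d (∑ℚ L g))
  ∑-differ (a ∷ L) {b} {f} {g} d (there b∈) (a∉ ∷ u) e e′ = trans
    (cong₂ _+_ (e (here refl) (All.lookup a∉ b∈)) (∑-differ L d b∈ u (e ∘ there) e′))
    (sym (ℚ.+-assoc (g a) (∑ℚ L g) d))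

  ∑-single : ∀ (L : List B) {b f} → b ∈ L → Unique L → (∀ {a} → a ∈ L → a ≢ b → f a ≡ 0ℚ) → ∑ℚ L f ≡ f b
  ∑-single L {b} {f} b∈ u e = trans (∑-differ L {g = λ _ → 0ℚ} (f b) b∈ u e (sym (ℚ.+-identityˡ (f b))))
    (trans (cong (_+ f b) (∑-zero L (λ _ → refl))) (ℚ.+-identityˡ (f b)))

  ∑-++ : ∀ (L K : List B) f → ∑ℚ (L ++ K) f ≡ ∑ℚ L f + ∑ℚ K f
  ∑-++ []      K f = sym (ℚ.+-identityˡ (∑ℚ K f))
  ∑-++ (b ∷ L) K f = trans (cong (λ z → f b + z) (∑-++ L K f)) (sym (ℚ.+-assoc (f b) (∑ℚ L f) (∑ℚ K f)))

  ∑-map : ∀ (g : C → B) (L : List C) f → ∑ℚ (map g L) f ≡ ∑ℚ L (f ∘ g)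
  ∑-map g []      f = refl
  ∑-map g (c ∷ L) f = cong (λ z → f (g c) + z) (∑-map g L f)

  ∑-filter : ∀ {P : B → Set} (P? : Unary.Decidable P) L {f : B → ℚ} →
             (∀ {b} → b ∈ L → ¬ P b → f b ≡ 0ℚ) → ∑ℚ (filter P? L) f ≡ ∑ℚ L f
  ∑-filter P? []      z = refl
  ∑-filter P? (b ∷ L) {f} z with P? b
  ... | yes _ = cong (λ r → f b + r) (∑-filter P? L (z ∘ there))
  ... | no ¬p = trans (∑-filter P? L (z ∘ there)) (sym (trans (cong (_+ ∑ℚ L f) (z (here refl) ¬p)) (ℚ.+-identityˡ (∑ℚ L f))))

  ∑-seqs-suc : ∀ (L : List B) l f → ∑ℚ (seqs L (suc l)) f ≡ ∑ℚ L (λ b → ∑ℚ (seqs L l) (f ∘ (b ∷_)))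
  ∑-seqs-suc L l f = go L
    where
    go : ∀ bs → ∑ℚ (concatMap (λ b → map (b ∷_) (seqs L l)) bs) f ≡ ∑ℚ bs (λ b → ∑ℚ (seqs L l) (f ∘ (b ∷_)))
    go []       = refl
    go (b ∷ bs) = trans (∑-++ (map (b ∷_) (seqs L l)) _ f) (cong₂ _+_ (∑-map (b ∷_) (seqs L l) f) (go bs))

  ∏-zero : ∀ {b} (L : List B) f → b ∈ L → f b ≡ 0ℚ → ∏ℚ L f ≡ 0ℚ
  ∏-zero (b ∷ L) f (here refl) e = trans (cong (_* ∏ℚ L f) e) (ℚ.*-zeroˡ (∏ℚ L f))
  ∏-zero (a ∷ L) f (there p)   e = trans (cong (f a *_) (∏-zero L f p e)) (ℚ.*-zeroʳ (f a))

  ∏-cong : ∀ (L : List B) {f g} → (∀ {b} → b ∈ L → f b ≡ g b) → ∏ℚ L f ≡ ∏ℚ L g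
  ∏-cong []      e = refl
  ∏-cong (b ∷ L) e = cong₂ _*_ (e (here refl)) (∏-cong L (e ∘ there))

  ∏-map : ∀ (g : C → B) L f → ∏ℚ (map g L) f ≡ ∏ℚ L (f ∘ g)
  ∏-map g []      f = refl
  ∏-map g (c ∷ L) f = cong (f (g c) *_) (∏-map g L f)

  ∏-++ : ∀ (L L′ : List B) f → ∏ℚ (L ++ L′) f ≡ ∏ℚ L f * ∏ℚ L′ f
  ∏-++ []      L′ f = sym (ℚ.*-identityˡ (∏ℚ L′ f))
  ∏-++ (a ∷ L) L′ f = trans (cong (f a *_) (∏-++ L L′ f)) (sym (ℚ.*-assoc (f a) (∏ℚ L f) (∏ℚ L′ f)))

  ∏-↭ : ∀ {L L′ : List B} f → L ↭ L′ → ∏ℚ L f ≡ ∏ℚ L′ f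
  ∏-↭ f ↭.refl = refl
  ∏-↭ f (↭.prep a p) = cong (f a *_) (∏-↭ f p)
  ∏-↭ f (↭.swap {xs} {ys} a b p) = trans (cong (λ z → f a * (f b * z)) (∏-↭ f p))
    (solve 3 (λ a b c → a :* (b :* c) := b :* (a :* c)) refl (f a) (f b) (∏ℚ ys f))
  ∏-↭ f (↭.trans p q) = trans (∏-↭ f p) (∏-↭ f q)

  *-nonzero : ∀ {a b} → a ≢ 0ℚ → b ≢ 0ℚ → a * b ≢ 0ℚ
  *-nonzero {a} {b} a≢0 b≢0 ab≡0 = b≢0 (ℚ-domain a b a≢0 ab≡0)

  ∏-nonzero : ∀ (L : List B) f → All (λ b → f b ≢ 0ℚ) L → ∏ℚ L f ≢ 0ℚ
  ∏-nonzero []      f []       ()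
  ∏-nonzero (b ∷ L) f (p ∷ ps) = *-nonzero p (∏-nonzero L f ps)

-- Integers inside the rationals, and reciprocals of differences.

module Rat where

  open import Data.Rational.Base using (_+_; _*_; _-_; -_)
  open import Data.Integer.Solver using () renaming (module +-*-Solver to ℤ-Solver)

  opaque
    ⟦_⟧ : ℤ → ℚ
    ⟦ z ⟧ = z ℚ./ 1

    ⟦⟧-def : ∀ z → ⟦ z ⟧ ≡ z ℚ./ 1
    ⟦⟧-def z = refl

    ⟦⟧ᵘ : ∀ z → ℚ.toℚᵘ ⟦ z ⟧ ℚᵘ.≃ ℚᵘ.mkℚᵘ z 0
    ⟦⟧ᵘ z = ℚ.toℚᵘ-fromℚᵘ (ℚᵘ.mkℚᵘ z 0)

    ⟦⟧-0 : ⟦ 0ℤ ⟧ ≡ 0ℚ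
    ⟦⟧-0 = refl

    ⟦⟧-1 : ⟦ 1ℤ ⟧ ≡ 1ℚ
    ⟦⟧-1 = refl

  ⟦⟧-+ : ∀ a b → ⟦ a ℤ.+ b ⟧ ≡ ⟦ a ⟧ + ⟦ b ⟧
  ⟦⟧-+ a b = ℚ.toℚᵘ-injective (begin
    ℚ.toℚᵘ ⟦ a ℤ.+ b ⟧                    ≈⟨ ⟦⟧ᵘ (a ℤ.+ b) ⟩
    ℚᵘ.mkℚᵘ (a ℤ.+ b) 0                   ≈⟨ ℚᵘ.*≡* (solve 2 (λ a b → (a :+ b) :* con 1ℤ := (a :* con 1ℤ :+ b :* con 1ℤ) :* con 1ℤ) refl a b) ⟩
    ℚᵘ.mkℚᵘ a 0 ℚᵘ.+ ℚᵘ.mkℚᵘ b 0          ≈⟨ ℚᵘ.+-cong (⟦⟧ᵘ a) (⟦⟧ᵘ b) ⟨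
    ℚ.toℚᵘ ⟦ a ⟧ ℚᵘ.+ ℚ.toℚᵘ ⟦ b ⟧        ≈⟨ ℚ.toℚᵘ-homo-+ ⟦ a ⟧ ⟦ b ⟧ ⟨
    ℚ.toℚᵘ (⟦ a ⟧ + ⟦ b ⟧) ∎)
    where
    open ℚᵘ.≃-Reasoning
    open ℤ-Solver using (solve; _:+_; _:*_; _:-_; :-_; _:=_; con)

  ⟦⟧-neg : ∀ a → ⟦ ℤ.- a ⟧ ≡ - ⟦ a ⟧
  ⟦⟧-neg a = begin
    ⟦ ℤ.- a ⟧                          ≡⟨ solve 2 (λ a b → b := (a :+ b) :- a) refl ⟦ a ⟧ ⟦ ℤ.- a ⟧ ⟩
    (⟦ a ⟧ + ⟦ ℤ.- a ⟧) - ⟦ a ⟧        ≡⟨ cong (_- ⟦ a ⟧) (⟦⟧-+ a (ℤ.- a)) ⟨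
    ⟦ a ℤ.- a ⟧ - ⟦ a ⟧                ≡⟨ cong (_- ⟦ a ⟧) (trans (cong ⟦_⟧ (ℤ.+-inverseʳ a)) ⟦⟧-0) ⟩
    0ℚ - ⟦ a ⟧                         ≡⟨ ℚ.+-identityˡ (- ⟦ a ⟧) ⟩
    - ⟦ a ⟧ ∎
    where
    open ≡-Reasoning
    open +-*-Solver using (solve; _:+_; _:*_; _:-_; :-_; _:=_; con)

  ⟦⟧-injective : ∀ {a b} → ⟦ a ⟧ ≡ ⟦ b ⟧ → a ≡ b
  ⟦⟧-injective {a} {b} e with ℚᵘ.≃-trans (ℚᵘ.≃-sym (⟦⟧ᵘ a)) (ℚᵘ.≃-trans (ℚᵘ.≃-reflexive (cong ℚ.toℚᵘ e)) (⟦⟧ᵘ b))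
  ... | ℚᵘ.*≡* p = trans (sym (ℤ.*-identityʳ a)) (trans p (ℤ.*-identityʳ b))

  opaque
    -- Inversion with inv 0 = 0.
    inv : ℚ → ℚ
    inv p with p ℚ.≟ 0ℚ
    ... | yes _   = 0ℚ
    ... | no  p≢0 = ℚ.1/_ p {{ℚ.≢-nonZero p≢0}}

    *-inv : ∀ {p} → p ≢ 0ℚ → p * inv p ≡ 1ℚ
    *-inv {p} p≢0 with p ℚ.≟ 0ℚ
    ... | yes p≡0 = contradiction p≡0 p≢0
    ... | no  ¬p  = ℚ.*-inverseʳ p {{ℚ.≢-nonZero ¬p}}

    inv-0 : inv 0ℚ ≡ 0ℚ
    inv-0 = refl

    inv-‿1 : inv (- 1ℚ) ≡ - 1ℚ
    inv-‿1 = refl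

  -‿cancel : ∀ {p q} → p - q ≡ 0ℚ → p ≡ q
  -‿cancel {p} {q} e = trans (solve 2 (λ p q → p := (p :- q) :+ q) refl p q) (trans (cong (_+ q) e) (ℚ.+-identityˡ q))
    where open +-*-Solver

  *-cancelˡ : ∀ {r p q} → r ≢ 0ℚ → r * p ≡ r * q → p ≡ q
  *-cancelˡ {r} {p} {q} r≢0 e = -‿cancel (ℚ-domain r (p - q) r≢0
    (trans (solve 3 (λ r p q → r :* (p :- q) := r :* p :- r :* q) refl r p q)
           (trans (cong (_- r * q) e) (ℚ.+-inverseʳ (r * q)))))
    where open +-*-Solver

  private
    scaled : ∀ z d → ⟦ + suc d ⟧ * (z ℚ./ suc d) ≡ ⟦ z ⟧
    scaled z d = ℚ.toℚᵘ-injective (begin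
      ℚ.toℚᵘ (⟦ + suc d ⟧ * (z ℚ./ suc d))            ≈⟨ ℚ.toℚᵘ-homo-* ⟦ + suc d ⟧ (z ℚ./ suc d) ⟩
      ℚ.toℚᵘ ⟦ + suc d ⟧ ℚᵘ.* ℚ.toℚᵘ (z ℚ./ suc d)
        ≈⟨ ℚᵘ.*-cong (⟦⟧ᵘ (+ suc d)) (ℚ.toℚᵘ-fromℚᵘ (ℚᵘ.mkℚᵘ z d)) ⟩
      ℚᵘ.mkℚᵘ (+ suc d) 0 ℚᵘ.* ℚᵘ.mkℚᵘ z d            ≈⟨ ℚᵘ.*≡* (lem (+ suc d) z) ⟩
      ℚᵘ.mkℚᵘ z 0                                      ≈⟨ ⟦⟧ᵘ z ⟨
      ℚ.toℚᵘ ⟦ z ⟧ ∎)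
      where
      open ℚᵘ.≃-Reasoning
      lem : ∀ n z → (+ suc d ℤ.* z) ℤ.* + 1 ≡ z ℤ.* + suc (d ℕ.+ 0)
      lem n z rewrite ℕ.+-identityʳ d = trans (ℤ.*-identityʳ _) (ℤ.*-comm (+ suc d) z)

    quotient-inv : ∀ {r p q} → r ≢ 0ℚ → r * p ≡ q → p ≡ q * inv r
    quotient-inv {r} {p} {q} r≢0 e = *-cancelˡ r≢0 (trans e (begin
      q               ≡⟨ ℚ.*-identityʳ q ⟨
      q * 1ℚ          ≡⟨ cong (q *_) (*-inv r≢0) ⟨
      q * (r * inv r) ≡⟨ solve 3 (λ q r i → q :* (r :* i) := r :* (q :* i)) refl q r (inv r) ⟩
      r * (q * inv r) ∎))
      where
      open ≡-Reasoning
      open +-*-Solver using (solve; _:+_; _:*_; _:-_; :-_; _:=_; con)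

  ⟦⟧≢0 : ∀ {z} → z ≢ 0ℤ → ⟦ z ⟧ ≢ 0ℚ
  ⟦⟧≢0 z≢0 e = z≢0 (⟦⟧-injective (trans e (sym ⟦⟧-0)))

  ratio-inv : ∀ p q → ratio p q ≡ ⟦ p ⟧ * inv ⟦ q ⟧
  ratio-inv p (+ zero)  = sym (trans (cong (λ z → ⟦ p ⟧ * inv z) ⟦⟧-0) (trans (cong (⟦ p ⟧ *_) inv-0) (ℚ.*-zeroʳ ⟦ p ⟧)))
  ratio-inv p (+ suc d) = quotient-inv (⟦⟧≢0 λ ()) (scaled p d)
  ratio-inv p -[1+ d ]  = quotient-inv (⟦⟧≢0 λ ()) (begin
    ⟦ -[1+ d ] ⟧ * ((ℤ.- p) ℚ./ suc d)     ≡⟨ cong (_* ((ℤ.- p) ℚ./ suc d)) (⟦⟧-neg (+ suc d)) ⟩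
    - ⟦ + suc d ⟧ * ((ℤ.- p) ℚ./ suc d)    ≡⟨ ℚ.neg-distribˡ-* ⟦ + suc d ⟧ _ ⟨
    - (⟦ + suc d ⟧ * ((ℤ.- p) ℚ./ suc d))  ≡⟨ cong -_ (scaled (ℤ.- p) d) ⟩
    - ⟦ ℤ.- p ⟧                            ≡⟨ ⟦⟧-neg (ℤ.- p) ⟨
    ⟦ ℤ.- ℤ.- p ⟧                          ≡⟨ cong ⟦_⟧ (ℤ.neg-involutive p) ⟩
    ⟦ p ⟧ ∎)
    where open ≡-Reasoning

  nat : ℕ → ℚ
  nat n = ⟦ + n ⟧

  nat-injective : ∀ {a b} → nat a ≡ nat b → a ≡ b
  nat-injective e = ℤ.+-injective (⟦⟧-injective e)

  nat-suc : ∀ a → nat (suc a) ≡ 1ℚ + nat a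
  nat-suc a = trans (⟦⟧-+ 1ℤ (+ a)) (cong (_+ nat a) ⟦⟧-1)

  nat-+ : ∀ a b → nat (a ℕ.+ b) ≡ nat a + nat b
  nat-+ a b = ⟦⟧-+ (+ a) (+ b)

  nat-diff≢0 : ∀ {a b} → a ≢ b → nat a - nat b ≢ 0ℚ
  nat-diff≢0 a≢b e = a≢b (nat-injective (-‿cancel e))

  opaque
    -- The reciprocal axial distance of the seminormal form, columns serving as contents. On the
    -- diagonal it is 0 by the convention for `inv`.
    ψ : ℕ → ℕ → ℚ
    ψ a b = inv (nat a - nat b)

    ψ-def : ∀ a b → ψ a b ≡ inv (nat a - nat b)
    ψ-def a b = refl

  -- For a ≠ b this is (a - b + 1)/(a - b), at once the factor of `A` and the off-diagonal
  -- coefficient of a seminormal transposition. This coincidence links the tableau weights with the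
  -- group action.
  φ : ℕ → ℕ → ℚ
  φ a b = 1ℚ + ψ a b

  ψ-inverse : ∀ {a b} → a ≢ b → (nat a - nat b) * ψ a b ≡ 1ℚ
  ψ-inverse {a} {b} a≢b = trans (cong ((nat a - nat b) *_) (ψ-def a b)) (*-inv (nat-diff≢0 a≢b))

  ψ-anti : ∀ {a b} → a ≢ b → ψ b a ≡ - ψ a b
  ψ-anti {a} {b} a≢b = *-cancelˡ (nat-diff≢0 (λ e → a≢b (sym e))) (begin
    (nat b - nat a) * ψ b a       ≡⟨ ψ-inverse (λ e → a≢b (sym e)) ⟩
    1ℚ                            ≡⟨ ψ-inverse a≢b ⟨
    (nat a - nat b) * ψ a b       ≡⟨ solve 3 (λ a b p → (a :- b) :* p := (b :- a) :* (:- p)) refl (nat a) (nat b) (ψ a b) ⟩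
    (nat b - nat a) * (- ψ a b) ∎)
    where
    open ≡-Reasoning
    open +-*-Solver using (solve; _:+_; _:*_; _:-_; :-_; _:=_; con)

  -- 1/(a−b) · 1/(b−c) = 1/(a−c) · (1/(a−b) + 1/(b−c))
  ψ-fractions : ∀ {a b c} → a ≢ b → b ≢ c → a ≢ c → ψ a b * ψ b c ≡ ψ a c * (ψ a b + ψ b c)
  ψ-fractions {a} {b} {c} a≢b b≢c a≢c = begin
    p * q                                ≡⟨ ℚ.*-identityˡ _ ⟨
    1ℚ * (p * q)                         ≡⟨ cong (_* (p * q)) (ψ-inverse a≢c) ⟨
    ((a′ - c′) * r) * (p * q)            ≡⟨ solve 6 (λ a b c p q r → ((a :- c) :* r) :* (p :* q)
                                              := r :* (((a :- b) :* p) :* q :+ p :* ((b :- c) :* q))) refl a′ b′ c′ p q r ⟩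
    r * (((a′ - b′) * p) * q + p * ((b′ - c′) * q))
      ≡⟨ cong₂ (λ u v → r * (u * q + p * v)) (ψ-inverse a≢b) (ψ-inverse b≢c) ⟩
    r * (1ℚ * q + p * 1ℚ)                ≡⟨ solve 3 (λ p q r → r :* (con 1ℚ :* q :+ p :* con 1ℚ) := r :* (p :+ q)) refl p q r ⟩
    r * (p + q) ∎
    where
    open ≡-Reasoning
    open +-*-Solver using (solve; _:+_; _:*_; _:-_; :-_; _:=_; con)
    p = ψ a b
    q = ψ b c
    r = ψ a c
    a′ = nat a
    b′ = nat b
    c′ = nat c

  -- Used twice with different effect: it makes evaluation at the increasing word invariant under
  -- transpositions, and it gives weight 0 to a column that is already occupied.
  φ≡0 : ∀ a → φ a (suc a) ≡ 0ℚ
  φ≡0 a = cong (λ z → 1ℚ + z) (trans (ψ-def a (suc a)) (trans (cong (λ z → inv (nat a - z)) (nat-suc a))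
    (trans (cong inv (solve 1 (λ a → a :- (con 1ℚ :+ a) := con (- 1ℚ)) refl (nat a))) inv-‿1)))
    where open +-*-Solver

  φ≢0 : ∀ {a b} → a ≢ b → suc a ≢ b → φ a b ≢ 0ℚ
  φ≢0 {a} {b} a≢b a+1≢b e = a+1≢b (nat-injective (-‿cancel (begin
    nat (suc a) - nat b              ≡⟨ cong (_- nat b) (nat-suc a) ⟩
    (1ℚ + nat a) - nat b           ≡⟨ solve 2 (λ a b → (con 1ℚ :+ a) :- b := con 1ℚ :+ (a :- b)) refl (nat a) (nat b) ⟩
    1ℚ + (nat a - nat b)           ≡⟨ cong (_+ (nat a - nat b)) (ψ-inverse a≢b) ⟨
    (nat a - nat b) * ψ a b + (nat a - nat b)
      ≡⟨ solve 2 (λ d p → d :* p :+ d := d :* (con 1ℚ :+ p)) refl (nat a - nat b) (ψ a b) ⟩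
    (nat a - nat b) * φ a b        ≡⟨ cong ((nat a - nat b) *_) e ⟩
    (nat a - nat b) * 0ℚ           ≡⟨ ℚ.*-zeroʳ (nat a - nat b) ⟩
    0ℚ ∎)))
    where
    open ≡-Reasoning
    open +-*-Solver using (solve; _:+_; _:*_; _:-_; :-_; _:=_; con)

-- The extended affine symmetric group and its commuting elements.

module Affine where

  open import Data.Nat.Base using (_+_)

  -- An action of the extended affine symmetric group on suc (suc m) letters:
  -- s 0, …, s m are the simple transpositions and q is the affine rotation.
  module AffineAction
    {X : Set} (_≈_ : X → X → Set) (isEquivalence : IsEquivalence _≈_)
    (m : ℕ) (s : ℕ → X → X) (q : X → X)
    (s-cong : ∀ i {u v} → u ≈ v → s i u ≈ s i v)
    (q-cong : ∀ {u v} → u ≈ v → q u ≈ q v)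
    (s-inv : ∀ i v → i ≤ m → s i (s i v) ≈ v)
    (s-far : ∀ i j v → suc i < j → s i (s j v) ≈ s j (s i v))
    (s-braid : ∀ i v → suc i ≤ m → s i (s (suc i) (s i v)) ≈ s (suc i) (s i (s (suc i) v)))
    (q-s : ∀ i v → suc i ≤ m → q (s i v) ≈ s (suc i) (q v))
    (q-s-last : ∀ v → q (q (s m v)) ≈ s 0 (q (q v)))
    where

    setoid : Setoid _ _
    setoid = record { isEquivalence = isEquivalence }

    open IsEquivalence isEquivalence public
      renaming (refl to ≈-refl; sym to ≈-sym; trans to ≈-trans; reflexive to ≈-reflexive)
    open SetoidReasoning setoid

    -- In product notation `cycle p` is s_{p-1} ⋯ s_0, `cycle⁺ p` is its shift s_p ⋯ s_1, and
    -- `uncycle p` is the inverse s_0 ⋯ s_{p-1}.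
    cycle : ℕ → X → X
    cycle zero    v = v
    cycle (suc p) v = s p (cycle p v)

    cycle⁺ : ℕ → X → X
    cycle⁺ zero    v = v
    cycle⁺ (suc p) v = s (suc p) (cycle⁺ p v)

    uncycle : ℕ → X → X
    uncycle zero    v = v
    uncycle (suc p) v = uncycle p (s p v)

    cycle-cong : ∀ p {u v} → u ≈ v → cycle p u ≈ cycle p v
    cycle-cong zero    e = e
    cycle-cong (suc p) e = s-cong p (cycle-cong p e)

    cycle-uncycle : ∀ p v → p ≤ suc m → cycle p (uncycle p v) ≈ v
    cycle-uncycle zero    v _        = ≈-refl
    cycle-uncycle (suc p) v (s≤s p≤) = begin
      s p (cycle p (uncycle p (s p v))) ≈⟨ s-cong p (cycle-uncycle p (s p v) (ℕ.m≤n⇒m≤1+n p≤)) ⟩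
      s p (s p v)                       ≈⟨ s-inv p v p≤ ⟩
      v ∎

    cycle-far : ∀ p j v → p < j → s j (cycle p v) ≈ cycle p (s j v)
    cycle-far zero    j v _   = ≈-refl
    cycle-far (suc p) j v p<j = begin
      s j (s p (cycle p v)) ≈⟨ s-far p j (cycle p v) p<j ⟨
      s p (s j (cycle p v)) ≈⟨ s-cong p (cycle-far p j v (ℕ.<-trans (ℕ.n<1+n p) p<j)) ⟩
      s p (cycle p (s j v)) ∎

    -- All factors of the cycle but two commute past the transposition; at those two a single braid
    -- relation lowers its index.
    cycle-shift : ∀ p j v → suc j < p → p ≤ suc m → cycle p (s (suc j) v) ≈ s j (cycle p v)
    cycle-shift (suc p) j v (s≤s j<p) (s≤s p≤m) with ℕ.m≤n⇒m<n∨m≡n j<p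
    ... | inj₁ j+1<p = begin
      s p (cycle p (s (suc j) v)) ≈⟨ s-cong p (cycle-shift p j v j+1<p (ℕ.m≤n⇒m≤1+n p≤m)) ⟩
      s p (s j (cycle p v))       ≈⟨ s-far j p (cycle p v) j+1<p ⟨
      s j (s p (cycle p v)) ∎
    ... | inj₂ refl = begin
      s (suc j) (s j (cycle j (s (suc j) v)))
        ≈⟨ s-cong (suc j) (s-cong j (cycle-far j (suc j) v (ℕ.n<1+n j))) ⟨
      s (suc j) (s j (s (suc j) (cycle j v))) ≈⟨ s-braid j (cycle j v) p≤m ⟨
      s j (s (suc j) (s j (cycle j v))) ∎

    cycle-cycle⁺ : ∀ p v → cycle (suc p) v ≈ cycle⁺ p (s 0 v)
    cycle-cycle⁺ zero    v = ≈-refl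
    cycle-cycle⁺ (suc p) v = s-cong (suc p) (cycle-cycle⁺ p v)

    shift-cycle⁺ : ∀ P p v → p < P → P ≤ suc m → cycle P (cycle⁺ p v) ≈ cycle p (cycle P v)
    shift-cycle⁺ P zero    v _   _  = ≈-refl
    shift-cycle⁺ P (suc p) v p<P P≤ = begin
      cycle P (s (suc p) (cycle⁺ p v)) ≈⟨ cycle-shift P p (cycle⁺ p v) p<P P≤ ⟩
      s p (cycle P (cycle⁺ p v))       ≈⟨ s-cong p (shift-cycle⁺ P p v (ℕ.<-trans (ℕ.n<1+n p) p<P) P≤) ⟩
      s p (cycle p (cycle P v)) ∎

    q-cycle : ∀ p v → p ≤ m → q (cycle p v) ≈ cycle⁺ p (q v)
    q-cycle zero    v _   = ≈-refl
    q-cycle (suc p) v p<m = begin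
      q (s p (cycle p v))       ≈⟨ q-s p (cycle p v) p<m ⟩
      s (suc p) (q (cycle p v)) ≈⟨ s-cong (suc p) (q-cycle p v (ℕ.<⇒≤ p<m)) ⟩
      s (suc p) (cycle⁺ p (q v)) ∎

    C : X → X
    C = cycle (suc m)

    -- The Jucys–Murphy type generators of the translation lattice.
    y : ℕ → X → X
    y zero    v = q (C v)
    y (suc i) v = s i (y i (s i v))

    y-cong : ∀ i {u v} → u ≈ v → y i u ≈ y i v
    y-cong zero    e = q-cong (cycle-cong (suc m) e)
    y-cong (suc i) e = s-cong i (y-cong i (s-cong i e))

    s-y₀ : ∀ j v → suc j ≤ m → s (suc j) (y 0 v) ≈ y 0 (s (suc j) v)
    s-y₀ j v j<m = begin
      s (suc j) (q (C v)) ≈⟨ q-s j (C v) j<m ⟨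
      q (s j (C v))       ≈⟨ q-cong (cycle-shift (suc m) j v (s≤s j<m) ℕ.≤-refl) ⟨
      q (C (s (suc j) v)) ∎

    cycle⁺-cong : ∀ p {u v} → u ≈ v → cycle⁺ p u ≈ cycle⁺ p v
    cycle⁺-cong zero    e = e
    cycle⁺-cong (suc p) e = s-cong (suc p) (cycle⁺-cong p e)

    q²cycles : X → X
    q²cycles v = q (q (cycle m (C v)))

    -- Both rotations are brought to the left, so that y 0 s_0 y 0 becomes q² times a permutation.
    -- In this form `q-s-last` applies.
    y₀-as : ∀ v → q (C (s 0 (q (C v)))) ≈ q²cycles v
    y₀-as v = q-cong (begin
      C (s 0 (q (C v)))            ≈⟨ cycle-cycle⁺ m (s 0 (q (C v))) ⟩
      cycle⁺ m (s 0 (s 0 (q (C v)))) ≈⟨ cycle⁺-cong m (s-inv 0 (q (C v)) z≤n) ⟩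
      cycle⁺ m (q (C v))           ≈⟨ q-cycle m (C v) ℕ.≤-refl ⟨
      q (cycle m (C v)) ∎)

    CC : ∀ v → C (C v) ≈ cycle m (C (s 0 v))
    CC v = begin
      C (C v)                 ≈⟨ cycle-cong (suc m) (cycle-cycle⁺ m v) ⟩
      C (cycle⁺ m (s 0 v))    ≈⟨ shift-cycle⁺ (suc m) m (s 0 v) ℕ.≤-refl ℕ.≤-refl ⟩
      cycle m (C (s 0 v)) ∎

    s₀-q²cycles : ∀ v → s 0 (q²cycles v) ≈ q²cycles (s 0 v)
    s₀-q²cycles v = begin
      s 0 (q (q (cycle m (C v))))   ≈⟨ q-s-last (cycle m (C v)) ⟨
      q (q (C (C v)))               ≈⟨ q-cong (q-cong (CC v)) ⟩
      q (q (cycle m (C (s 0 v)))) ∎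

    -- As y 1 = s_0 (y 0) s_0, this amounts to s_0 commuting with y 0 s_0 y 0, which is
    -- `s₀-q²cycles`.
    y₀y₁ : ∀ v → y 0 (y 1 v) ≈ y 1 (y 0 v)
    y₀y₁ v = begin
      q (C (s 0 (q (C (s 0 v))))) ≈⟨ y₀-as (s 0 v) ⟩
      q²cycles (s 0 v)            ≈⟨ s₀-q²cycles v ⟨
      s 0 (q²cycles v)            ≈⟨ s-cong 0 (y₀-as v) ⟨
      s 0 (q (C (s 0 (q (C v))))) ∎

    s-y< : ∀ i j v → j < i → i ≤ m → s i (y j v) ≈ y j (s i v)
    s-y< (suc i) zero    v _         i≤ = s-y₀ i v i≤
    s-y< i       (suc j) v j<i i≤ = begin
      s i (s j (y j (s j v))) ≈⟨ s-far j i _ j<i ⟨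
      s j (s i (y j (s j v))) ≈⟨ s-cong j (s-y< i j (s j v) (ℕ.<-trans (ℕ.n<1+n j) j<i) i≤) ⟩
      s j (y j (s i (s j v))) ≈⟨ s-cong j (y-cong j (s-far j i v j<i)) ⟨
      s j (y j (s j (s i v))) ∎

    -- Induction on the distance d of the indices. At distance 2 the braid relation is used once on
    -- each side of y i, and in between s_{i+1} passes y i.
    s-y> : ∀ i d v → suc (d + i) ≤ m → s i (y (suc (suc (d + i))) v) ≈ y (suc (suc (d + i))) (s i v)
    s-y> i zero v i<m = begin
      s i (s (suc i) (s i (y i (s i (s (suc i) v)))))
        ≈⟨ s-braid i _ i<m ⟩
      s (suc i) (s i (s (suc i) (y i (s i (s (suc i) v)))))
        ≈⟨ s-cong (suc i) (s-cong i (s-y< (suc i) i _ ℕ.≤-refl i<m)) ⟩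
      s (suc i) (s i (y i (s (suc i) (s i (s (suc i) v)))))
        ≈⟨ s-cong (suc i) (s-cong i (y-cong i (s-braid i v i<m))) ⟨
      s (suc i) (s i (y i (s i (s (suc i) (s i v))))) ∎
    s-y> i (suc d) v d<m = begin
      s i (s k (y k (s k v))) ≈⟨ s-far i k _ i<k ⟩
      s k (s i (y k (s k v))) ≈⟨ s-cong k (s-y> i d (s k v) (ℕ.<⇒≤ d<m)) ⟩
      s k (y k (s i (s k v))) ≈⟨ s-cong k (y-cong k (s-far i k v i<k)) ⟩
      s k (y k (s k (s i v))) ∎
      where
      k = suc (suc (d + i))
      i<k : suc i < k
      i<k = s≤s (s≤s (ℕ.m≤n+m i d))

    s-y-far : ∀ i j v → suc i < j → j ≤ suc m → s i (y j v) ≈ y j (s i v)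
    s-y-far i (suc (suc j)) v (s≤s (s≤s i≤j)) (s≤s j<m) =
      ≡.subst (λ k → suc k ≤ m → s i (y (suc (suc k)) v) ≈ y (suc (suc k)) (s i v))
              (ℕ.m∸n+n≡m i≤j) (s-y> i _ v) j<m

    s-y : ∀ i v → i ≤ m → s i (y i v) ≈ y (suc i) (s i v)
    s-y i v i≤ = s-cong i (y-cong i (≈-sym (s-inv i v i≤)))

    s-y⁺ : ∀ i v → i ≤ m → s i (y (suc i) v) ≈ y i (s i v)
    s-y⁺ i v i≤ = s-inv i _ i≤

    y₀-comm : ∀ j v → j ≤ suc m → y 0 (y j v) ≈ y j (y 0 v)
    y₀-comm zero          v _  = ≈-refl
    y₀-comm (suc zero)    v _  = y₀y₁ v
    y₀-comm (suc (suc j)) v (s≤s j<m) = begin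
      y 0 (s (suc j) (y (suc j) (s (suc j) v))) ≈⟨ s-y₀ j _ j<m ⟨
      s (suc j) (y 0 (y (suc j) (s (suc j) v))) ≈⟨ s-cong (suc j) (y₀-comm (suc j) _ (ℕ.m≤n⇒m≤1+n j<m)) ⟩
      s (suc j) (y (suc j) (y 0 (s (suc j) v))) ≈⟨ s-cong (suc j) (y-cong (suc j) (s-y₀ j v j<m)) ⟨
      s (suc j) (y (suc j) (s (suc j) (y 0 v))) ∎

    y-comm< : ∀ i j v → i < j → j ≤ suc m → y i (y j v) ≈ y j (y i v)
    y-comm< zero    j v _   j≤ = y₀-comm j v j≤
    y-comm< (suc i) j v i<j j≤ = begin
      s i (y i (s i (y j v))) ≈⟨ s-cong i (y-cong i (s-y-far i j v i<j j≤)) ⟩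
      s i (y i (y j (s i v))) ≈⟨ s-cong i (y-comm< i j _ (ℕ.<-trans (ℕ.n<1+n i) i<j) j≤) ⟩
      s i (y j (y i (s i v))) ≈⟨ s-y-far i j _ i<j j≤ ⟩
      y j (s i (y i (s i v))) ∎

    y-comm : ∀ i j v → i ≤ suc m → j ≤ suc m → y i (y j v) ≈ y j (y i v)
    y-comm i j v i≤ j≤ with ℕ.<-cmp i j
    ... | tri< i<j _ _ = y-comm< i j v i<j j≤
    ... | tri≈ _ refl _ = ≈-refl
    ... | tri> _ _ j<i = ≈-sym (y-comm< j i v j<i i≤)

    q-y : ∀ i v → i ≤ m → q (y i v) ≈ y (suc i) (q v)
    q-y zero v _ = begin
      q (q (s m (cycle m v)))       ≈⟨ q-s-last (cycle m v) ⟩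
      s 0 (q (q (cycle m v)))       ≈⟨ s-cong 0 (q-cong (q-cycle m v ℕ.≤-refl)) ⟩
      s 0 (q (cycle⁺ m (q v)))
        ≈⟨ s-cong 0 (q-cong (≈-trans (cycle-cycle⁺ m _) (cycle⁺-cong m (s-inv 0 (q v) z≤n)))) ⟨
      s 0 (q (C (s 0 (q v)))) ∎
    q-y (suc i) v i<m = begin
      q (s i (y i (s i v)))             ≈⟨ q-s i _ i<m ⟩
      s (suc i) (q (y i (s i v)))       ≈⟨ s-cong (suc i) (q-y i _ (ℕ.<⇒≤ i<m)) ⟩
      s (suc i) (y (suc i) (q (s i v))) ≈⟨ s-cong (suc i) (y-cong (suc i) (q-s i v i<m)) ⟩
      s (suc i) (y (suc i) (s (suc i) (q v))) ∎

    y-conj : ∀ p v → y p v ≈ cycle p (y 0 (uncycle p v))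
    y-conj zero    v = ≈-refl
    y-conj (suc p) v = s-cong p (y-conj p (s p v))

    -- Together with `q-y` it shows that the rotation permutes the y cyclically and without a twist,
    -- so that rotating a word of eigenvalues keeps the eigenvalues.
    q-y-last : ∀ v → q (y (suc m) v) ≈ y 0 (q v)
    q-y-last v = q-cong (≈-trans (y-conj (suc m) v)
      (cycle-cong (suc m) (q-cong (cycle-uncycle (suc m) v ℕ.≤-refl))))

-- Joint eigenfunctions of the commuting elements by Lagrange interpolation.

module Eigen where

  open Affine
  open Lists
  open Sums using (*-nonzero)
  open import Data.Rational.Base using (_+_; _*_; _-_; -_)

  swapAt : {B : Set} → ℕ → List B → List B
  swapAt zero    (a ∷ b ∷ l) = b ∷ a ∷ l
  swapAt zero    l           = l
  swapAt (suc i) []          = []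
  swapAt (suc i) (a ∷ l)     = a ∷ swapAt i l

  at : List ℕ → ℕ → ℕ
  at []      _       = 0
  at (a ∷ l) zero    = a
  at (a ∷ l) (suc i) = at l i

  at-swapAt : ∀ i κ → suc i < length κ → at (swapAt i κ) i ≡ at κ (suc i)
  at-swapAt zero    (a ∷ b ∷ κ) _ = refl
  at-swapAt zero    (a ∷ [])    (s≤s ())
  at-swapAt (suc i) (a ∷ κ)     (s≤s p) = at-swapAt i κ p

  length-swapAt : ∀ {B : Set} i (κ : List B) → length (swapAt i κ) ≡ length κ
  length-swapAt zero    []          = refl
  length-swapAt zero    (_ ∷ [])    = refl
  length-swapAt zero    (_ ∷ _ ∷ _) = refl
  length-swapAt (suc i) []          = refl
  length-swapAt (suc i) (_ ∷ κ)     = cong suc (length-swapAt i κ)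

  swapAt-involutive : ∀ {B : Set} i (κ : List B) → swapAt i (swapAt i κ) ≡ κ
  swapAt-involutive zero    []          = refl
  swapAt-involutive zero    (_ ∷ [])    = refl
  swapAt-involutive zero    (_ ∷ _ ∷ _) = refl
  swapAt-involutive (suc i) []          = refl
  swapAt-involutive (suc i) (_ ∷ κ)     = cong (_ ∷_) (swapAt-involutive i κ)

  All-swapAt : ∀ {B : Set} {P : B → Set} i {κ : List B} → All P κ → All P (swapAt i κ)
  All-swapAt zero    []           = []
  All-swapAt zero    (p ∷ [])     = p ∷ []
  All-swapAt zero    (p ∷ p′ ∷ q) = p′ ∷ p ∷ q
  All-swapAt (suc i) []           = []
  All-swapAt (suc i) (p ∷ q)      = p ∷ All-swapAt i q

  module YPolynomials
    {I : Set} (Valid : I → Set) (m : ℕ)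
    (s : ℕ → (I → ℚ) → (I → ℚ)) (q : (I → ℚ) → (I → ℚ))
    where

    X : Set
    X = I → ℚ

    infix 4 _≈_
    -- Compared at valid words only: the involution and braid relations of the seminormal form need
    -- distinct letters.
    _≈_ : X → X → Set
    u ≈ v = ∀ c → Valid c → u c ≡ v c

    ≈-isEquivalence : IsEquivalence _≈_
    ≈-isEquivalence = record
      { refl  = λ c _ → refl
      ; sym   = λ e c p → ≡.sym (e c p)
      ; trans = λ e f c p → ≡.trans (e c p) (f c p)
      }

    -- The single operation u + t v lets one equation express both additivity and homogeneity.
    lin : ℚ → X → X → X
    lin t u v c = u c + t * v c

    O : X
    O _ = 0ℚ

    scale : ℚ → X → X
    scale t v c = t * v c

    record IsAction : Set where
      field
        s-cong   : ∀ i {u v} → u ≈ v → s i u ≈ s i v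
        q-cong   : ∀ {u v} → u ≈ v → q u ≈ q v
        s-inv    : ∀ i v → i ≤ m → s i (s i v) ≈ v
        s-far    : ∀ i j v → suc i < j → s i (s j v) ≈ s j (s i v)
        s-braid  : ∀ i v → suc i ≤ m → s i (s (suc i) (s i v)) ≈ s (suc i) (s i (s (suc i) v))
        q-s      : ∀ i v → suc i ≤ m → q (s i v) ≈ s (suc i) (q v)
        q-s-last : ∀ v → q (q (s m v)) ≈ s 0 (q (q v))
        s-lin    : ∀ i t u v → s i (lin t u v) ≈ lin t (s i u) (s i v)
        q-lin    : ∀ t u v → q (lin t u v) ≈ lin t (q u) (q v)

    module Acting (act : IsAction) where
      open IsAction act
      open AffineAction _≈_ ≈-isEquivalence m s q s-cong q-cong s-inv s-far s-braid q-s q-s-last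
        public
      open SetoidReasoning setoid

      M : ℕ
      M = suc (suc m)

      lin-cong : ∀ t {u u′ v v′} → u ≈ u′ → v ≈ v′ → lin t u v ≈ lin t u′ v′
      lin-cong t e f c p = cong₂ (λ a b → a + t * b) (e c p) (f c p)

      scale-cong : ∀ t {u v} → u ≈ v → scale t u ≈ scale t v
      scale-cong t e c p = cong (t *_) (e c p)

      record IsLinear (f : X → X) : Set where
        field
          cong-≈ : ∀ {u v} → u ≈ v → f u ≈ f v
          lin-≈  : ∀ t u v → f (lin t u v) ≈ lin t (f u) (f v)

        O-≈ : f O ≈ O
        O-≈ c p = ≡.trans
          (cong-≈ (λ _ _ → refl) c p)
          (a≡0 (f O c) (≡.trans (cong-≈ {O} {lin 1ℚ O O} (λ _ _ → refl) c p) (lin-≈ 1ℚ O O c p)))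
          where
          a≡0 : ∀ a → a ≡ a + 1ℚ * a → a ≡ 0ℚ
          a≡0 a e = ≡.trans (solve 1 (λ a → a := (a :+ con 1ℚ :* a) :- a) refl a)
            (≡.trans (cong (_- a) (≡.sym e)) (solve 1 (λ a → a :- a := con 0ℚ) refl a))
            where open +-*-Solver

        scale-≈ : ∀ t v → f (scale t v) ≈ scale t (f v)
        scale-≈ t v = begin
          f (scale t v)     ≈⟨ cong-≈ (λ c _ → ≡.sym (ℚ.+-identityˡ _)) ⟩
          f (lin t O v)     ≈⟨ lin-≈ t O v ⟩
          lin t (f O) (f v) ≈⟨ lin-cong t O-≈ ≈-refl ⟩
          lin t O (f v)     ≈⟨ (λ c _ → ℚ.+-identityˡ _) ⟩
          scale t (f v) ∎

      open IsLinear

      s-linear : ∀ i → IsLinear (s i)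
      s-linear i = record { cong-≈ = s-cong i ; lin-≈ = s-lin i }

      q-linear : IsLinear q
      q-linear = record { cong-≈ = q-cong ; lin-≈ = q-lin }

      id-linear : IsLinear (λ v → v)
      id-linear = record { cong-≈ = λ e → e ; lin-≈ = λ _ _ _ → ≈-refl }

      ∘-linear : ∀ {f g} → IsLinear f → IsLinear g → IsLinear (λ v → f (g v))
      ∘-linear {f} {g} F G = record
        { cong-≈ = λ e → cong-≈ F (cong-≈ G e)
        ; lin-≈  = λ t u v → ≈-trans (cong-≈ F (lin-≈ G t u v)) (lin-≈ F t (g u) (g v))
        }

      cycle-linear : ∀ p → IsLinear (cycle p)
      cycle-linear zero    = id-linear
      cycle-linear (suc p) = ∘-linear (s-linear p) (cycle-linear p)

      y-linear : ∀ i → IsLinear (y i)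
      y-linear zero    = ∘-linear q-linear (cycle-linear (suc m))
      y-linear (suc i) = ∘-linear (s-linear i) (∘-linear (y-linear i) (s-linear i))

      L : ℕ → ℚ → X → X
      L i t v = lin (- t) (y i v) v

      L-linear : ∀ i t → IsLinear (L i t)
      L-linear i t = record
        { cong-≈ = λ e → lin-cong (- t) (y-cong i e) e
        ; lin-≈  = λ t′ u v c p → ≡.trans (cong (_+ - t * (u c + t′ * v c)) (lin-≈ (y-linear i) t′ u v c p))
            (solve 6 (λ t t′ a b c d → (a :+ t′ :* b) :+ (:- t) :* (c :+ t′ :* d)
               := (a :+ (:- t) :* c) :+ t′ :* (b :+ (:- t) :* d)) refl t t′ (y i u c) (y i v c) (u c) (v c))
        }
        where open +-*-Solver

      L-comm : ∀ i j t t′ v → i < M → j < M → L i t (L j t′ v) ≈ L j t′ (L i t v)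
      L-comm i j t t′ v (s≤s i<) (s≤s j<) c p = ≡.trans
        (cong (_+ - t * (y j v c + - t′ * v c)) (lin-≈ (y-linear i) (- t′) (y j v) v c p))
        (≡.trans (≡.trans (cong (λ z → (z + - t′ * y i v c) + - t * (y j v c + - t′ * v c)) (y-comm i j v i< j< c p))
          (solve 6 (λ t t′ a b c d → (a :+ (:- t′) :* b) :+ (:- t) :* (c :+ (:- t′) :* d)
                    := (a :+ (:- t) :* c) :+ (:- t′) :* (b :+ (:- t) :* d)) refl
                  t t′ (y j (y i v) c) (y i v c) (y j v c) (v c)))
          (≡.sym (cong (_+ - t′ * (y i v c + - t * v c)) (lin-≈ (y-linear j) (- t) (y i v) v c p))))
        where open +-*-Solver

      s-L-far : ∀ j i t v → suc j < i → i < M → s j (L i t v) ≈ L i t (s j v)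
      s-L-far j i t v j<i (s≤s i<) = ≈-trans (s-lin j (- t) (y i v) v)
        (lin-cong (- t) (s-y-far j i v j<i i<) ≈-refl)

      s-L-near : ∀ j i t v → i < j → j ≤ m → s j (L i t v) ≈ L i t (s j v)
      s-L-near j i t v i<j j≤ = ≈-trans (s-lin j (- t) (y i v) v)
        (lin-cong (- t) (s-y< j i v i<j j≤) ≈-refl)

      s-L : ∀ i t v → i ≤ m → s i (L i t v) ≈ L (suc i) t (s i v)
      s-L i t v i≤ = ≈-trans (s-lin i (- t) (y i v) v) (lin-cong (- t) (s-y i v i≤) ≈-refl)

      s-L⁺ : ∀ i t v → i ≤ m → s i (L (suc i) t v) ≈ L i t (s i v)
      s-L⁺ i t v i≤ = ≈-trans (s-lin i (- t) (y (suc i) v) v) (lin-cong (- t) (s-y⁺ i v i≤) ≈-refl)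

      q-L : ∀ i t v → i ≤ m → q (L i t v) ≈ L (suc i) t (q v)
      q-L i t v i≤ = ≈-trans (q-lin (- t) (y i v) v) (lin-cong (- t) (q-y i v i≤) ≈-refl)

      q-L-last : ∀ t v → q (L (suc m) t v) ≈ L 0 t (q v)
      q-L-last t v = ≈-trans (q-lin (- t) (y (suc m) v) v) (lin-cong (- t) (q-y-last v) ≈-refl)

      module Interpolation (x : ℕ → ℚ) (x-distinct : ∀ {a b} → a < M → b < M → a ≢ b → x a ≢ x b)
               (one : X) (s-one : ∀ i → i ≤ m → s i one ≈ one) where

        Rl : ℕ → List ℕ → X → X
        Rl i Ls v = foldr (λ b u → L i (x b) u) v Ls

        Rl-linear : ∀ i Ls → IsLinear (Rl i Ls)
        Rl-linear i []       = id-linear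
        Rl-linear i (b ∷ Ls) = ∘-linear (L-linear i (x b)) (Rl-linear i Ls)

        Rl-move : ∀ (g : X → X) i j → IsLinear g → (∀ t v → g (L i t v) ≈ L j t (g v)) →
                  ∀ Ls v → g (Rl i Ls v) ≈ Rl j Ls (g v)
        Rl-move g i j G e []       v = ≈-refl
        Rl-move g i j G e (b ∷ Ls) v =
          ≈-trans (e (x b) _) (cong-≈ (L-linear j (x b)) (Rl-move g i j G e Ls v))

        L-Rl : ∀ i j t Ls v → i < M → j < M → L j t (Rl i Ls v) ≈ Rl i Ls (L j t v)
        L-Rl i j t Ls v i< j< = Rl-move (L j t) i i (L-linear j t) (λ t′ v → L-comm j i t t′ v j< i<) Ls v

        others : ℕ → List ℕ
        others b = upTo M without b

        -- The Lagrange numerator in y i: it annihilates the eigenvalues x b′ with b′ ≠ b.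
        R : ℕ → ℕ → X → X
        R i b = Rl i (others b)

        R-linear : ∀ i b → IsLinear (R i b)
        R-linear i b = Rl-linear i (others b)

        R-comm : ∀ i j a b v → i < M → j < M → R i a (R j b v) ≈ R j b (R i a v)
        R-comm i j a b v i< j< =
          Rl-move (R i a) j j (R-linear i a) (λ t v → ≈-sym (L-Rl i j t (others a) v i< j<)) (others b) v

        Pk : ℕ → List ℕ → X → X
        Pk i []      v = v
        Pk i (b ∷ κ) v = R i b (Pk (suc i) κ v)

        Pk-linear : ∀ i κ → IsLinear (Pk i κ)
        Pk-linear i []      = id-linear
        Pk-linear i (b ∷ κ) = ∘-linear (R-linear i b) (Pk-linear (suc i) κ)

        private
          step : ∀ i l → i ℕ.+ suc l ≤ M → suc i ℕ.+ l ≤ M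
          step i l = ≡.subst (_≤ M) (ℕ.+-suc i l)

          first : ∀ i l → i ℕ.+ suc l ≤ M → i < M
          first i l le = ℕ.≤-trans (s≤s (ℕ.m≤m+n i l)) (step i l le)

        Pk-move : ∀ (g : X → X) i κ → IsLinear g → i ℕ.+ length κ ≤ M →
                  (∀ j t v → i ≤ j → j < M → g (L j t v) ≈ L j t (g v)) →
                  ∀ v → g (Pk i κ v) ≈ Pk i κ (g v)
        Pk-move g i []      G le e v = ≈-refl
        Pk-move g i (b ∷ κ) G le e v = ≈-trans
          (Rl-move g i i G (λ t v → e i t v ℕ.≤-refl (first i (length κ) le)) (others b) _)
          (cong-≈ (R-linear i b) (Pk-move g (suc i) κ G (step i (length κ) le)
            (λ j t v i<j → e j t v (ℕ.<⇒≤ i<j)) v))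

        L-Pk : ∀ j t i κ v → j < M → i ℕ.+ length κ ≤ M → L j t (Pk i κ v) ≈ Pk i κ (L j t v)
        L-Pk j t i κ v j< le = Pk-move (L j t) i κ (L-linear j t) le (λ j′ t′ v _ j′< → L-comm j j′ t t′ v j< j′<) v

        R-Pk : ∀ j b i κ v → j < M → i ℕ.+ length κ ≤ M → R j b (Pk i κ v) ≈ Pk i κ (R j b v)
        R-Pk j b i κ v j< le = Pk-move (R j b) i κ (R-linear j b) le
          (λ j′ t′ v _ j′< → ≈-sym (L-Rl j j′ t′ (others b) v j< j′<)) v

        -- Conjugation by a transposition exchanges two neighbouring y. It therefore exchanges two
        -- neighbouring interpolation factors, whose order is immaterial because all of them
        -- commute.
        s-Pk : ∀ j i κ v → suc j < length κ → i ℕ.+ length κ ≤ M →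
               s (j ℕ.+ i) (Pk i κ v) ≈ Pk i (swapAt j κ) (s (j ℕ.+ i) v)
        s-Pk zero i (a ∷ []) v (s≤s ()) le
        s-Pk zero i (a ∷ b ∷ κ) v _ le = begin
          s i (R i a (R (suc i) b P))
            ≈⟨ Rl-move (s i) i (suc i) (s-linear i) (λ t v → s-L i t v i≤m) (others a) _ ⟩
          R (suc i) a (s i (R (suc i) b P))
            ≈⟨ cong-≈ (R-linear (suc i) a) (Rl-move (s i) (suc i) i (s-linear i) (λ t v → s-L⁺ i t v i≤m) (others b) _) ⟩
          R (suc i) a (R i b (s i P))
            ≈⟨ R-comm (suc i) i a b _ i+1<M (ℕ.<⇒≤ i+1<M) ⟩
          R i b (R (suc i) a (s i P))
            ≈⟨ cong-≈ (∘-linear (R-linear i b) (R-linear (suc i) a))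
                 (Pk-move (s i) (suc (suc i)) κ (s-linear i) (step (suc i) (length κ) (step i _ le))
                   (λ j t v i<j j< → s-L-far i j t v i<j j<) v) ⟩
          R i b (R (suc i) a (Pk (suc (suc i)) κ (s i v))) ∎
          where
          P = Pk (suc (suc i)) κ v
          i+1<M : suc i < M
          i+1<M = first (suc i) (length κ) (step i _ le)
          i≤m : i ≤ m
          i≤m = ℕ.s≤s⁻¹ (ℕ.s≤s⁻¹ i+1<M)
        s-Pk (suc j) i (a ∷ κ) v (s≤s j<) le = begin
          s (suc j ℕ.+ i) (R i a P)
            ≈⟨ Rl-move (s (suc j ℕ.+ i)) i i (s-linear _) (λ t v → s-L-near (suc j ℕ.+ i) i t v (s≤s (ℕ.m≤n+m i j)) j+i<m) (others a) _ ⟩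
          R i a (s (suc j ℕ.+ i) P)
            ≈⟨ cong-≈ (R-linear i a) (≡.subst (λ k → s k P ≈ Pk (suc i) (swapAt j κ) (s k v)) (ℕ.+-suc j i)
                 (s-Pk j (suc i) κ v j< (step i (length κ) le))) ⟩
          R i a (Pk (suc i) (swapAt j κ) (s (suc j ℕ.+ i) v)) ∎
          where
          P = Pk (suc i) κ v
          j+i<m : suc j ℕ.+ i ≤ m
          j+i<m = ℕ.s≤s⁻¹ (ℕ.s≤s⁻¹ (ℕ.≤-trans
            (≡.subst (_≤ suc i ℕ.+ length κ) (≡.trans (ℕ.+-comm (suc i) (suc (suc j))) (cong (λ k → suc (suc k)) (ℕ.+-suc j i))) (ℕ.+-monoʳ-≤ (suc i) j<))
            (step i (length κ) le)))

        -- The unnormalised projection of `one` to the joint eigenspace in which y i has the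
        -- eigenvalue x of the i-th letter of κ.
        F : List ℕ → X
        F κ = Pk 0 κ one

        s-F : ∀ j κ → length κ ≡ M → j ≤ m → s j (F κ) ≈ F (swapAt j κ)
        s-F j κ len j≤ = ≡.subst (λ k → s k (F κ) ≈ F (swapAt j κ)) (ℕ.+-identityʳ j)
          (≈-trans (s-Pk j 0 κ one (≡.subst (suc j <_) (≡.sym len) (s≤s (s≤s j≤))) (ℕ.≤-reflexive len))
                   (cong-≈ (Pk-linear 0 (swapAt j κ))
                     (≡.subst (λ k → s k one ≈ one) (≡.sym (ℕ.+-identityʳ j)) (s-one j j≤))))

        Pk-∷ʳ : ∀ i κ b v → Pk i (κ ∷ʳ b) v ≡ Pk i κ (R (length κ ℕ.+ i) b v)
        Pk-∷ʳ i []      b v = refl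
        Pk-∷ʳ i (a ∷ κ) b v = cong (R i a) (≡.trans (Pk-∷ʳ (suc i) κ b v)
          (cong (λ k → Pk (suc i) κ (R k b v)) (ℕ.+-suc (length κ) i)))

        q-Pk : ∀ i κ v → i ℕ.+ length κ ≤ suc m → q (Pk i κ v) ≈ Pk (suc i) κ (q v)
        q-Pk i []      v _  = ≈-refl
        q-Pk i (b ∷ κ) v le = ≈-trans
          (Rl-move q i (suc i) q-linear (λ t v → q-L i t v i≤m) (others b) _)
          (cong-≈ (R-linear (suc i) b) (q-Pk (suc i) κ v (≡.subst (_≤ suc m) (ℕ.+-suc i (length κ)) le)))
          where
          i≤m : i ≤ m
          i≤m = ℕ.s≤s⁻¹ (ℕ.≤-trans (s≤s (ℕ.m≤m+n i (length κ))) (≡.subst (_≤ suc m) (ℕ.+-suc i (length κ)) le))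

        cycle-one : ∀ p → p ≤ suc m → cycle p one ≈ one
        cycle-one zero    _       = ≈-refl
        cycle-one (suc p) (s≤s p≤) = ≈-trans (s-cong p (cycle-one p (ℕ.m≤n⇒m≤1+n p≤))) (s-one p p≤)

        q-one : q one ≈ y 0 one
        q-one = q-cong (≈-sym (cycle-one (suc m) ℕ.≤-refl))

        -- The rotation raises every position by one and sends the last one to 0. What is left of it
        -- acts on `one`, where it agrees with y 0.
        q-F : ∀ κ b → length κ ≡ suc m → q (F (κ ∷ʳ b)) ≈ y 0 (F (b ∷ κ))
        q-F κ b len = begin
          q (F (κ ∷ʳ b))
            ≈⟨ q-cong (≈-reflexive (≡.trans (Pk-∷ʳ 0 κ b one)
                 (cong (λ k → Pk 0 κ (R k b one)) (≡.trans (ℕ.+-identityʳ _) len)))) ⟩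
          q (Pk 0 κ (R (suc m) b one)) ≈⟨ q-Pk 0 κ _ (ℕ.≤-reflexive len) ⟩
          Pk 1 κ (q (R (suc m) b one))
            ≈⟨ cong-≈ (Pk-linear 1 κ) (Rl-move q (suc m) 0 q-linear q-L-last (others b) one) ⟩
          Pk 1 κ (R 0 b (q one))       ≈⟨ cong-≈ (∘-linear (Pk-linear 1 κ) (R-linear 0 b)) q-one ⟩
          Pk 1 κ (R 0 b (y 0 one))     ≈⟨ y₀-past ⟨
          y 0 (Pk 1 κ (R 0 b one))
            ≈⟨ y-cong 0 (R-Pk 0 b 1 κ one (s≤s z≤n) le) ⟨
          y 0 (R 0 b (Pk 1 κ one)) ∎
          where
          le : 1 ℕ.+ length κ ≤ M
          le = s≤s (ℕ.≤-reflexive len)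
          -- Writing y 0 as y 0 - 0 makes the commutation lemmas for `L` available.
          L0 : ∀ v → L 0 0ℚ v ≈ y 0 v
          L0 v c p = solve 2 (λ a b → a :+ (:- con 0ℚ) :* b := a) refl (y 0 v c) (v c)
            where open +-*-Solver
          y₀-past : y 0 (Pk 1 κ (R 0 b one)) ≈ Pk 1 κ (R 0 b (y 0 one))
          y₀-past = begin
            y 0 (Pk 1 κ (R 0 b one))      ≈⟨ L0 _ ⟨
            L 0 0ℚ (Pk 1 κ (R 0 b one))   ≈⟨ L-Pk 0 0ℚ 1 κ _ (s≤s z≤n) le ⟩
            Pk 1 κ (L 0 0ℚ (R 0 b one))
              ≈⟨ cong-≈ (Pk-linear 1 κ) (L-Rl 0 0 0ℚ (others b) one (s≤s z≤n) (s≤s z≤n)) ⟩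
            Pk 1 κ (R 0 b (L 0 0ℚ one))   ≈⟨ cong-≈ (∘-linear (Pk-linear 1 κ) (R-linear 0 b)) (L0 one) ⟩
            Pk 1 κ (R 0 b (y 0 one)) ∎

        -- The product of y p - t over the d positions from i on. With all M positions it is
        -- symmetric in the y.
        Nr : ℕ → ℕ → ℚ → X → X
        Nr i zero    t v = v
        Nr i (suc d) t v = L i t (Nr (suc i) d t v)

        Nr-linear : ∀ i d t → IsLinear (Nr i d t)
        Nr-linear i zero    t = id-linear
        Nr-linear i (suc d) t = ∘-linear (L-linear i t) (Nr-linear (suc i) d t)

        L-Nr : ∀ j t′ i d t v → j < M → i ℕ.+ d ≤ M → L j t′ (Nr i d t v) ≈ Nr i d t (L j t′ v)
        L-Nr j t′ i zero    t v j< le = ≈-refl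
        L-Nr j t′ i (suc d) t v j< le = ≈-trans (L-comm j i t′ t _ j< (first i d le))
          (cong-≈ (L-linear i t) (L-Nr j t′ (suc i) d t v j< (step i d le)))

        Rl-kill : ∀ {b} i Ls v → i < M → b ∈ Ls → L i (x b) v ≈ O → Rl i Ls v ≈ O
        Rl-kill i (b ∷ Ls) v i< (here refl) e = ≈-trans (L-Rl i i (x b) Ls v i< i<)
          (≈-trans (cong-≈ (Rl-linear i Ls) e) (O-≈ (Rl-linear i Ls)))
        Rl-kill i (a ∷ Ls) v i< (there b∈) e = ≈-trans (cong-≈ (L-linear i (x a)) (Rl-kill i Ls v i< b∈ e))
          (O-≈ (L-linear i (x a)))

        ∈-others : ∀ {a b} → b < M → b ≢ a → b ∈ others a
        ∈-others {a} b< b≢a = ∈.∈-filter⁺ (λ b′ → ¬? (b′ ℕ.≟ a)) (∈.∈-upTo⁺ b<) b≢a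

        -- A letter b that does not occur in κ leaves the factor y j - x b in the interpolation
        -- polynomial of every position j; these factors together form `Nr`.
        Pk-kill : ∀ {b} i κ v → b < M → b ∉ κ → i ℕ.+ length κ ≤ M →
                  Nr i (length κ) (x b) v ≈ O → Pk i κ v ≈ O
        Pk-kill i []      v b< b∉ le e = e
        Pk-kill {b} i (a ∷ κ) v b< b∉ le e =
          Rl-kill i (others a) _ i< (∈-others {a} b< (λ { refl → b∉ (here refl) }))
            (≈-trans (L-Pk i (x b) (suc i) κ v i< (step i _ le))
              (Pk-kill (suc i) κ (L i (x b) v) b< (b∉ ∘ there) (step i _ le)
                (≈-trans (≈-sym (L-Nr i (x b) (suc i) (length κ) (x b) v i< (step i _ le))) e)))
          where i< = first i (length κ) le

        -- Subtracting the two equations eliminates y i and leaves (x b - x a) v = 0.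
        separate : ∀ i a b v → x a ≢ x b → L i (x a) v ≈ O → L i (x b) v ≈ O → v ≈ O
        separate i a b v a≢b ea eb c p with v c ℚ.≟ 0ℚ
        ... | yes z = z
        ... | no ¬z = contradiction prod (*-nonzero (λ d → a≢b (diff (x a) (x b) d)) ¬z)
          where
          open +-*-Solver
          diff : ∀ u w → w - u ≡ 0ℚ → u ≡ w
          diff u w e = ≡.trans (solve 2 (λ u w → u := w :- (w :- u)) refl u w)
            (≡.trans (cong (λ z → w - z) e) (solve 1 (λ w → w :- con 0ℚ := w) refl w))
          prod : (x b - x a) * v c ≡ 0ℚ
          prod = ≡.trans (solve 4 (λ a b w v → (b :- a) :* v := (w :+ (:- a) :* v) :- (w :+ (:- b) :* v)) refl
                           (x a) (x b) (y i v c) (v c))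
                   (≡.trans (cong₂ _-_ (ea c p) (eb c p)) refl)

        Rl-restore : ∀ {b} i Ls v → i < M → Unique Ls → b ∈ Ls → L i (x b) (Rl i (Ls without b) v) ≈ Rl i Ls v
        Rl-restore {b} i (b ∷ Ls) v i< (b∉ ∷ u) (here refl) =
          cong-≈ (L-linear i (x b)) (≈-reflexive (cong (λ l → Rl i l v) (≡.trans (without-here b Ls) (without-∉ Ls λ p → All.lookup b∉ p refl))))
        Rl-restore {b} i (a ∷ Ls) v i< (a∉ ∷ u) (there b∈) = begin
          L i (x b) (Rl i ((a ∷ Ls) without b) v)
            ≈⟨ cong-≈ (L-linear i (x b)) (≈-reflexive (cong (λ l → Rl i l v) (without-there Ls (All.lookup a∉ b∈)))) ⟩
          L i (x b) (L i (x a) (Rl i (Ls without b) v)) ≈⟨ L-comm i i (x b) (x a) _ i< i< ⟩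
          L i (x a) (L i (x b) (Rl i (Ls without b) v)) ≈⟨ cong-≈ (L-linear i (x a)) (Rl-restore i Ls v i< u b∈) ⟩
          L i (x a) (Rl i Ls v) ∎

        -- Lagrange interpolation: the polynomials ∏_{b′ ≠ b} (y − x_{b′}) span the constants.
        peel : ∀ i l Ls v → i < M → Unique (l ∷ Ls) → All (_< M) (l ∷ Ls) →
               (∀ {b} → b ∈ l ∷ Ls → Rl i ((l ∷ Ls) without b) v ≈ O) → v ≈ O
        peel i l [] v i< _ _ h =
          ≈-trans (≈-reflexive (≡.sym (cong (λ L → Rl i L v) (without-here l [])))) (h (here refl))
        peel i l (k ∷ Ls) v i< (l∉ ∷ u) (l< ∷ k<) h = peel i k Ls v i< u k< λ {b} b∈ →
          separate i l b _ (x-distinct l< (All.lookup k< b∈) (All.lookup l∉ b∈))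
            (≈-trans (≈-reflexive (≡.sym (cong (λ L → Rl i L v) (without-there (k ∷ Ls) (All.lookup l∉ b∈)))))
                     (h (there b∈)))
            (≈-trans (Rl-restore i (k ∷ Ls) v i< u b∈)
              (≈-trans (≈-reflexive (≡.sym (cong (λ L → Rl i L v) (≡.trans (without-here l (k ∷ Ls)) (without-∉ (k ∷ Ls) λ p → All.lookup l∉ p refl))))) (h (here refl))))

        -- Interpolation one position after another: no nonzero function is killed by all products
        -- of Lagrange numerators.
        peel-all : ∀ l i v → i ℕ.+ l ≤ M →
                   (∀ κ → length κ ≡ l → All (_< M) κ → Pk i κ v ≈ O) → v ≈ O
        peel-all zero    i v le h = h [] refl []
        peel-all (suc l) i v le h = peel-all l (suc i) v (step i l le) λ κ len κ< →
          peel i 0 _ _ (first i l le) (Unique.upTo⁺ M) (All.tabulate ∈.∈-upTo⁻) λ {b} b∈ →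
            h (b ∷ κ) (cong suc len) (∈.∈-upTo⁻ b∈ ∷ κ<)

        module Killed (kill : ∀ {b} → b < M → Nr 0 M (x b) one ≈ O) where

          F-missing : ∀ {b} κ → length κ ≡ M → b < M → b ∉ κ → F κ ≈ O
          F-missing {b} κ len b< b∉ = Pk-kill 0 κ one b< b∉ (ℕ.≤-reflexive len)
            (≡.subst (λ l → Nr 0 l (x b) one ≈ O) (≡.sym len) (kill b<))

          -- The factor y 0 - x b accounts for position 0, and since b is absent from κ every later
          -- position supplies its own factor y i - x b. Together they kill `one`.
          eigen₀ : ∀ b κ → length κ ≡ suc m → b < M → b ∉ κ → L 0 (x b) (F (b ∷ κ)) ≈ O
          eigen₀ b κ len b< b∉ = begin
            L 0 (x b) (R 0 b (Pk 1 κ one)) ≈⟨ L-Rl 0 0 (x b) (others b) _ (s≤s z≤n) (s≤s z≤n) ⟩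
            R 0 b (L 0 (x b) (Pk 1 κ one)) ≈⟨ cong-≈ (R-linear 0 b) (L-Pk 0 (x b) 1 κ one (s≤s z≤n) le) ⟩
            R 0 b (Pk 1 κ (L 0 (x b) one)) ≈⟨ cong-≈ (R-linear 0 b) (Pk-kill 1 κ _ b< b∉ le (≈-trans
                (≈-sym (L-Nr 0 (x b) 1 (length κ) (x b) one (s≤s z≤n) le))
                (≡.subst (λ l → Nr 0 (suc l) (x b) one ≈ O) (≡.sym len) (kill b<)))) ⟩
            R 0 b O ≈⟨ O-≈ (R-linear 0 b) ⟩
            O ∎
            where
            le : 1 ℕ.+ length κ ≤ M
            le = s≤s (ℕ.≤-reflexive len)

          module Pigeon (pigeon : ∀ b κ → length κ ≡ suc m → b ∈ κ → ∃[ a ] a < M × a ∉ b ∷ κ) where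

            eigen₀′ : ∀ κ → length κ ≡ M → All (_< M) κ → y 0 (F κ) ≈ scale (x (at κ 0)) (F κ)
            eigen₀′ (b ∷ κ) len (b< ∷ _) = λ c p →
              ≡.trans (solve 3 (λ w t v → w := (w :+ (:- t) :* v) :+ t :* v) refl (y 0 (F (b ∷ κ)) c) (x b) (F (b ∷ κ) c))
                (≡.trans (cong (_+ x b * F (b ∷ κ) c) (e c p)) (ℚ.+-identityˡ _))
              where
              open +-*-Solver
              e : L 0 (x b) (F (b ∷ κ)) ≈ O
              e with b ∈? κ
                where open import Data.List.Membership.DecPropositional ℕ._≟_ using (_∈?_)
              ... | no b∉ = eigen₀ b κ (ℕ.suc-injective len) b< b∉
              ... | yes b∈ with pigeon b κ (ℕ.suc-injective len) b∈
              ...   | a , a< , a∉ = ≈-trans (cong-≈ (L-linear 0 (x b)) (F-missing (b ∷ κ) len a< a∉))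
                                            (O-≈ (L-linear 0 (x b)))

            eigen : ∀ i κ → length κ ≡ M → All (_< M) κ → i < M → y i (F κ) ≈ scale (x (at κ i)) (F κ)
            eigen zero    κ len κ< i< = eigen₀′ κ len κ<
            eigen (suc i) κ len κ< (s≤s (s≤s i≤)) = begin
              s i (y i (s i (F κ)))       ≈⟨ s-cong i (y-cong i (s-F i κ len i≤)) ⟩
              s i (y i (F κ′))
                ≈⟨ s-cong i (eigen i κ′ (≡.trans (length-swapAt i κ) len) (All-swapAt i κ<) (s≤s (ℕ.m≤n⇒m≤1+n i≤))) ⟩
              s i (scale (x (at κ′ i)) (F κ′))
                ≈⟨ scale-≈ (s-linear i) (x (at κ′ i)) (F κ′) ⟩
              scale (x (at κ′ i)) (s i (F κ′))
                ≈⟨ scale-cong (x (at κ′ i)) (≈-trans (s-F i κ′ (≡.trans (length-swapAt i κ) len) i≤)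
                     (≈-reflexive (cong F (swapAt-involutive i κ)))) ⟩
              scale (x (at κ′ i)) (F κ)
                ≈⟨ ≈-reflexive (cong (λ b → scale (x b) (F κ))
                     (at-swapAt i κ (≡.subst (suc i <_) (≡.sym len) (s≤s (s≤s i≤))))) ⟩
              scale (x (at κ (suc i))) (F κ) ∎
              where κ′ = swapAt i κ

            -- The eigenvalue on `F κ` of the interpolation operator for κ₀ placed at position i. It
            -- separates words: it is 0 when κ₀ differs from the corresponding part of κ, and
            -- nonzero when they agree.
            coef : ℕ → List ℕ → List ℕ → ℚ
            coef i []       κ = 1ℚ
            coef i (b ∷ κ₀) κ = ∏ℚ (others b) (λ b′ → x (at κ i) - x b′) * coef (suc i) κ₀ κ

            Rl-eigen : ∀ i Ls t v → y i v ≈ scale t v → Rl i Ls v ≈ scale (∏ℚ Ls (λ b → t - x b)) v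
            Rl-eigen i []       t v e c p = ≡.sym (ℚ.*-identityˡ (v c))
            Rl-eigen i (b ∷ Ls) t v e = begin
              L i (x b) (Rl i Ls v)       ≈⟨ cong-≈ (L-linear i (x b)) (Rl-eigen i Ls t v e) ⟩
              L i (x b) (scale π v)       ≈⟨ scale-≈ (L-linear i (x b)) π v ⟩
              scale π (L i (x b) v)       ≈⟨ (λ c p → ≡.trans (cong (λ w → π * (w + - x b * v c)) (e c p))
                   (solve 4 (λ p t b v → p :* (t :* v :+ (:- b) :* v) := (t :- b) :* p :* v) refl π t (x b) (v c))) ⟩
              scale ((t - x b) * π) v ∎
              where
              open +-*-Solver
              π = ∏ℚ Ls (λ b → t - x b)

            Pk-F : ∀ i κ₀ κ → length κ ≡ M → All (_< M) κ → i ℕ.+ length κ₀ ≤ M →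
                   Pk i κ₀ (F κ) ≈ scale (coef i κ₀ κ) (F κ)
            Pk-F i []       κ len κ< le c p = ≡.sym (ℚ.*-identityˡ _)
            Pk-F i (b ∷ κ₀) κ len κ< le = begin
              R i b (Pk (suc i) κ₀ (F κ)) ≈⟨ cong-≈ (R-linear i b) (Pk-F (suc i) κ₀ κ len κ< (step i _ le)) ⟩
              R i b (scale k (F κ))       ≈⟨ scale-≈ (R-linear i b) k (F κ) ⟩
              scale k (R i b (F κ))
                ≈⟨ scale-cong k (Rl-eigen i (others b) (x (at κ i)) (F κ) (eigen i κ len κ< (first i _ le))) ⟩
              scale k (scale π (F κ))     ≈⟨ (λ c p → solve 3 (λ k p v → k :* (p :* v) := p :* k :* v) refl k π (F κ c)) ⟩
              scale (π * k) (F κ) ∎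
              where
              open +-*-Solver
              k = coef (suc i) κ₀ κ
              π = ∏ℚ (others b) (λ b′ → x (at κ i) - x b′)

-- The tableau weights A and their partial fraction identity.

module Coeff where

  open Rat
  open Lists
  open Sums using (∏-zero; ∏-cong; ∏-↭)
  open import Data.Rational.Base using (_+_; _*_; _-_; -_)
  open import Data.List.Membership.DecPropositional ℕ._≟_ using (_∈?_)

  open +-*-Solver using (solve; _:+_; _:*_; _:-_; :-_; _:=_; con)

  opaque
    -- The weight A (suc s) σ, with 0 treated as one more entry of σ.
    Ā : ℕ → List ℕ → ℚ
    Ā s σ = if does (s ∈? 0 ∷ σ) then ∏ℚ ((0 ∷ σ) without s) (φ s) else 0ℚ

    Ā-def : ∀ s σ → Ā s σ ≡ (if does (s ∈? 0 ∷ σ) then ∏ℚ ((0 ∷ σ) without s) (φ s) else 0ℚ)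
    Ā-def s σ = refl

  Ā-∉ : ∀ {s σ} → s ∉ 0 ∷ σ → Ā s σ ≡ 0ℚ
  Ā-∉ {s} {σ} s∉ = trans (Ā-def s σ)
    (cong (if_then ∏ℚ ((0 ∷ σ) without s) (φ s) else 0ℚ) (dec-false (s ∈? 0 ∷ σ) s∉))

  Ā-∈ : ∀ {s σ} → s ∈ 0 ∷ σ → Ā s σ ≡ ∏ℚ ((0 ∷ σ) without s) (φ s)
  Ā-∈ {s} {σ} s∈ = trans (Ā-def s σ)
    (cong (if_then ∏ℚ ((0 ∷ σ) without s) (φ s) else 0ℚ) (dec-true (s ∈? 0 ∷ σ) s∈))

  if-cong : ∀ {b b′ : Bool} {x x′ : ℚ} → b ≡ b′ → (b ≡ true → x ≡ x′) →
            (if b then x else 0ℚ) ≡ (if b′ then x′ else 0ℚ)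
  if-cong {true}  refl e = e refl
  if-cong {false} refl e = refl

  Ā-↭ : ∀ {σ σ′} s → σ ↭ σ′ → Ā s σ ≡ Ā s σ′
  Ā-↭ {σ} {σ′} s p = trans (Ā-def s σ) (trans (if-cong
    (does-⇔ (mk⇔ (↭.∈-resp-↭ (↭.prep 0 p)) (↭.∈-resp-↭ (↭.↭-sym (↭.prep 0 p)))) (s ∈? 0 ∷ σ) (s ∈? 0 ∷ σ′))
    (λ _ → ∏-↭ (φ s) (without-↭ s (↭.prep 0 p)))) (sym (Ā-def s σ′)))

  Ā-∷ : ∀ {s z} σ → s ≢ z → Ā s (z ∷ σ) ≡ φ s z * Ā s σ
  Ā-∷ {s} {z} σ s≢z = go (s ∈? 0 ∷ σ)
    where
    s∈′ : s ∈ 0 ∷ σ → s ∈ 0 ∷ z ∷ σ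
    s∈′ (here e)  = here e
    s∈′ (there e) = there (there e)
    go : Dec (s ∈ 0 ∷ σ) → Ā s (z ∷ σ) ≡ φ s z * Ā s σ
    go (no s∉) = trans
      (Ā-∉ {s} {z ∷ σ} λ { (here e) → s∉ (here e) ; (there (here e)) → s≢z e ; (there (there e)) → s∉ (there e) })
      (sym (trans (cong (φ s z *_) (Ā-∉ s∉)) (ℚ.*-zeroʳ (φ s z))))
    go (yes s∈) = trans (Ā-∈ {s} {z ∷ σ} (s∈′ s∈)) (trans
      (trans (∏-↭ (φ s) (without-↭ s (↭.swap 0 z ↭.refl)))
             (cong (λ l → ∏ℚ l (φ s)) (without-there (0 ∷ σ) (s≢z ∘ sym))))
      (cong (φ s z *_) (sym (Ā-∈ s∈))))

  Ā-self : ∀ {z₁ z₂} σ → z₁ ≢ z₂ → Ā z₁ (z₁ ∷ z₂ ∷ σ) ≡ φ z₁ z₂ * Ā z₁ (z₁ ∷ σ)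
  Ā-self {z₁} {z₂} σ z₁≢z₂ = trans (Ā-↭ z₁ (↭.swap z₁ z₂ ↭.refl)) (Ā-∷ (z₁ ∷ σ) z₁≢z₂)

  -- An occupied column s + 1 brings in the factor `φ s (suc s)`, which is 0. The weight itself thus
  -- keeps the columns of adjacent vertices distinct.
  Ā-suc-∈ : ∀ {s σ} → suc s ∈ σ → Ā s σ ≡ 0ℚ
  Ā-suc-∈ {s} {σ} s+1∈ = go (s ∈? 0 ∷ σ)
    where
    go : Dec (s ∈ 0 ∷ σ) → Ā s σ ≡ 0ℚ
    go (no s∉)  = Ā-∉ s∉
    go (yes s∈) = trans (Ā-∈ s∈) (∏-zero ((0 ∷ σ) without s) (φ s)
      (∈.∈-filter⁺ (λ b → ¬? (b ℕ.≟ s)) {xs = 0 ∷ σ} (there s+1∈) (λ e → ℕ.1+n≢n e)) (φ≡0 s))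

  -- The relation between appending before and after forgetting two entries.
  Ā-modular : ∀ s {z₁ z₂} σ → z₁ ≢ z₂ → z₁ ∉ 0 ∷ σ → z₂ ∉ 0 ∷ σ →
              φ z₁ z₂ * (Ā s (z₁ ∷ σ) - Ā s (z₂ ∷ z₁ ∷ σ)) - ψ z₁ z₂ * (Ā s (z₂ ∷ σ) - Ā s (z₁ ∷ z₂ ∷ σ))
              ≡ Ā s σ - Ā s (z₂ ∷ σ)
  Ā-modular s {z₁} {z₂} σ z₁≢z₂ z₁∉ z₂∉ = go (s ℕ.≟ z₁) (s ℕ.≟ z₂)
    where
    alg₁ : ∀ p a {a₁ a₂₁ a₂ a₁₂ a₀} → a₁ ≡ a → a₂₁ ≡ (1ℚ + p) * a → a₂ ≡ (1ℚ + p) * a₀ → a₁₂ ≡ (1ℚ + p) * a → a₀ ≡ 0ℚ →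
           (1ℚ + p) * (a₁ - a₂₁) - p * (a₂ - a₁₂) ≡ a₀ - a₂
    alg₁ p a refl refl refl refl refl =
      solve 2 (λ p a → (con 1ℚ :+ p) :* (a :- (con 1ℚ :+ p) :* a) :- p :* ((con 1ℚ :+ p) :* con 0ℚ :- (con 1ℚ :+ p) :* a)
               := con 0ℚ :- (con 1ℚ :+ p) :* con 0ℚ) refl p a
    alg₂ : ∀ p a {p′ a₁ a₂₁ a₂ a₁₂ a₀} → p′ ≡ - p → a₁ ≡ (1ℚ + p′) * a₀ → a₂₁ ≡ (1ℚ + p′) * a → a₂ ≡ a → a₁₂ ≡ (1ℚ + p′) * a → a₀ ≡ 0ℚ →
           (1ℚ + p) * (a₁ - a₂₁) - p * (a₂ - a₁₂) ≡ a₀ - a₂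
    alg₂ p a refl refl refl refl refl refl =
      solve 2 (λ p a → (con 1ℚ :+ p) :* ((con 1ℚ :+ :- p) :* con 0ℚ :- (con 1ℚ :+ :- p) :* a) :- p :* (a :- (con 1ℚ :+ :- p) :* a)
               := con 0ℚ :- a) refl p a
    alg₃ : ∀ p q r a {a₁ a₂₁ a₂ a₁₂} → p * q ≡ r * (p - q) → a₁ ≡ (1ℚ + p) * a → a₂₁ ≡ (1ℚ + q) * ((1ℚ + p) * a) →
           a₂ ≡ (1ℚ + q) * a → a₁₂ ≡ (1ℚ + p) * ((1ℚ + q) * a) →
           (1ℚ + r) * (a₁ - a₂₁) - r * (a₂ - a₁₂) ≡ a - a₂
    alg₃ p q r a e refl refl refl refl = -‿cancel (trans
      (solve 4 (λ p q r a →
          ((con 1ℚ :+ r) :* ((con 1ℚ :+ p) :* a :- (con 1ℚ :+ q) :* ((con 1ℚ :+ p) :* a))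
           :- r :* ((con 1ℚ :+ q) :* a :- (con 1ℚ :+ p) :* ((con 1ℚ :+ q) :* a)))
          :- (a :- (con 1ℚ :+ q) :* a)
          := :- a :* (p :* q :- r :* (p :- q))) refl p q r a)
      (trans (cong (- a *_) (trans (cong (_- r * (p - q)) e) (ℚ.+-inverseʳ (r * (p - q)))))
             (ℚ.*-zeroʳ (- a))))
    frac : s ≢ z₁ → s ≢ z₂ → ψ s z₁ * ψ s z₂ ≡ ψ z₁ z₂ * (ψ s z₁ - ψ s z₂)
    frac s≢z₁ s≢z₂ = begin
      ψ s z₁ * ψ s z₂                      ≡⟨ cong (_* ψ s z₂) (ψ-anti (s≢z₁ ∘ sym)) ⟩
      - ψ z₁ s * ψ s z₂                    ≡⟨ ℚ.neg-distribˡ-* (ψ z₁ s) (ψ s z₂) ⟨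
      - (ψ z₁ s * ψ s z₂)                  ≡⟨ cong -_ (ψ-fractions (s≢z₁ ∘ sym) s≢z₂ z₁≢z₂) ⟩
      - (ψ z₁ z₂ * (ψ z₁ s + ψ s z₂))      ≡⟨ solve 3 (λ r p q → :- (r :* (p :+ q)) := r :* (:- p :- q)) refl (ψ z₁ z₂) (ψ z₁ s) (ψ s z₂) ⟩
      ψ z₁ z₂ * (- ψ z₁ s - ψ s z₂)        ≡⟨ cong (λ w → ψ z₁ z₂ * (w - ψ s z₂)) (ψ-anti (s≢z₁ ∘ sym)) ⟨
      ψ z₁ z₂ * (ψ s z₁ - ψ s z₂) ∎
      where open ≡-Reasoning
    go : Dec (s ≡ z₁) → Dec (s ≡ z₂) →
         φ z₁ z₂ * (Ā s (z₁ ∷ σ) - Ā s (z₂ ∷ z₁ ∷ σ)) - ψ z₁ z₂ * (Ā s (z₂ ∷ σ) - Ā s (z₁ ∷ z₂ ∷ σ)) ≡ Ā s σ - Ā s (z₂ ∷ σ)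
    go (yes refl) (yes refl) = contradiction refl z₁≢z₂
    -- If s is z₁ or z₂, it lies outside 0 ∷ σ, and only weights of lists that contain s survive.
    -- Otherwise all five weights are multiples of `Ā s σ` and the claim reduces to `frac`.
    go (yes refl) (no s≢z₂)  = alg₁ (ψ z₁ z₂) (Ā z₁ (z₁ ∷ σ)) refl (Ā-∷ (z₁ ∷ σ) s≢z₂) (Ā-∷ σ s≢z₂) (Ā-self σ z₁≢z₂) (Ā-∉ z₁∉)
    go (no s≢z₁) (yes refl)  = alg₂ (ψ z₁ z₂) (Ā z₂ (z₂ ∷ σ)) (ψ-anti z₁≢z₂) (Ā-∷ σ s≢z₁) (Ā-self σ s≢z₁) refl (Ā-∷ (z₂ ∷ σ) s≢z₁) (Ā-∉ z₂∉)
    go (no s≢z₁) (no s≢z₂)   = alg₃ (ψ s z₁) (ψ s z₂) (ψ z₁ z₂) (Ā s σ) (frac s≢z₁ s≢z₂)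
      (Ā-∷ σ s≢z₁) (trans (Ā-∷ (z₁ ∷ σ) s≢z₂) (cong (φ s z₂ *_) (Ā-∷ σ s≢z₁)))
      (Ā-∷ σ s≢z₂) (trans (Ā-∷ (z₂ ∷ σ) s≢z₁) (cong (φ s z₁ *_) (Ā-∷ σ s≢z₂)))

  nat-0 : nat 0 ≡ 0ℚ
  nat-0 = ⟦⟧-0

  inv-nat : ∀ a b → ψ a b ≡ inv ⟦ + a ℤ.- + b ⟧
  inv-nat a b = trans (ψ-def a b) (cong inv (trans (cong (λ z → nat a + z) (sym (⟦⟧-neg (+ b)))) (sym (⟦⟧-+ (+ a) (ℤ.- + b)))))

  ratio-φ : ∀ {a b} → a ≢ b → ratio (+ a ℤ.- + b ℤ.+ 1ℤ) (+ a ℤ.- + b) ≡ φ a b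
  ratio-φ {a} {b} a≢b = begin
    ratio (d ℤ.+ 1ℤ) d                ≡⟨ ratio-inv (d ℤ.+ 1ℤ) d ⟩
    ⟦ d ℤ.+ 1ℤ ⟧ * inv ⟦ d ⟧          ≡⟨ cong (_* inv ⟦ d ⟧) (trans (⟦⟧-+ d 1ℤ) (cong (λ z → ⟦ d ⟧ + z) ⟦⟧-1)) ⟩
    (⟦ d ⟧ + 1ℚ) * inv ⟦ d ⟧
      ≡⟨ solve 2 (λ d i → (d :+ con 1ℚ) :* i := d :* i :+ i) refl ⟦ d ⟧ (inv ⟦ d ⟧) ⟩
    ⟦ d ⟧ * inv ⟦ d ⟧ + inv ⟦ d ⟧
      ≡⟨ cong₂ _+_ (*-inv (⟦⟧≢0 (λ e → a≢b (ℤ.+-injective (ℤ.i-j≡0⇒i≡j (+ a) (+ b) e))))) (sym (inv-nat a b)) ⟩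
    φ a b ∎
    where
    open ≡-Reasoning
    d = + a ℤ.- + b

  ratio-φ₀ : ∀ {b} → b ≢ 0 → ratio (+ b ℤ.- 1ℤ) (+ b) ≡ φ 0 b
  ratio-φ₀ {b} b≢0 = begin
    ratio (+ b ℤ.- 1ℤ) (+ b)        ≡⟨ ratio-inv (+ b ℤ.- 1ℤ) (+ b) ⟩
    ⟦ + b ℤ.- 1ℤ ⟧ * inv (nat b)
      ≡⟨ cong (_* inv (nat b)) (trans (⟦⟧-+ (+ b) (ℤ.- 1ℤ)) (cong (λ z → nat b + z) (trans (⟦⟧-neg 1ℤ) (cong -_ ⟦⟧-1)))) ⟩
    (nat b + - 1ℚ) * inv (nat b)    ≡⟨ solve 2 (λ b i → (b :+ :- con 1ℚ) :* i := b :* i :+ :- i) refl (nat b) (inv (nat b)) ⟩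
    nat b * inv (nat b) + - inv (nat b)
      ≡⟨ cong₂ (λ u v → u + - inv v) (*-inv (⟦⟧≢0 (b≢0 ∘ ℤ.+-injective))) (solve 1 (λ b → b := b :- con 0ℚ) refl (nat b)) ⟩
    1ℚ + - inv (nat b - 0ℚ)         ≡⟨ cong (λ z → 1ℚ + - z) (trans (ψ-def b 0) (cong (λ z → inv (nat b - z)) nat-0)) ⟨
    1ℚ + - ψ b 0                    ≡⟨ cong (λ z → 1ℚ + z) (ψ-anti b≢0) ⟨
    φ 0 b ∎
    where open ≡-Reasoning

  ratio-φ⁰ : ∀ {a} → a ≢ 0 → ratio (+ a ℤ.+ 1ℤ) (+ a) ≡ φ a 0
  ratio-φ⁰ {a} a≢0 = trans (cong (λ z → ratio (z ℤ.+ 1ℤ) z) (sym (ℤ.+-identityʳ (+ a)))) (ratio-φ a≢0)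

  -- The extra entry 0 merges the two formulas for A: `φ 0 b` is (b - 1)/b and `φ a 0` is (a + 1)/a.
  -- It must not already be in σ, which holds since columns are positive.
  A-Ā : ∀ s {σ} → 0 ∉ σ → A (suc s) σ ≡ Ā s σ
  A-Ā zero {σ} 0∉ = begin
    ∏ℚ σ (λ s → ratio (+ s ℤ.- 1ℤ) (+ s))
      ≡⟨ ∏-cong σ (λ {b} b∈ → ratio-φ₀ {b} λ { refl → 0∉ b∈ }) ⟩
    ∏ℚ σ (φ 0)                 ≡⟨ cong (λ l → ∏ℚ l (φ 0)) (trans (without-here 0 σ) (without-∉ σ 0∉)) ⟨
    ∏ℚ ((0 ∷ σ) without 0) (φ 0) ≡⟨ Ā-∈ {0} {σ} (here refl) ⟨
    Ā 0 σ ∎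
    where open ≡-Reasoning
  A-Ā (suc s) {σ} 0∉ = trans (if-cong
    (does-⇔ (mk⇔ there (λ { (here ()) ; (there p) → p })) (suc s ∈? σ) (suc s ∈? 0 ∷ σ))
    (λ _ → sym (begin
      ∏ℚ ((0 ∷ σ) without suc s) (φ (suc s)) ≡⟨ cong (λ l → ∏ℚ l (φ (suc s))) (without-there {0} {suc s} σ λ ()) ⟩
      φ (suc s) 0 * ∏ℚ (σ without suc s) (φ (suc s))
        ≡⟨ cong₂ _*_ (ratio-φ⁰ λ ()) (∏-cong (σ without suc s) λ b∈ → ratio-φ (proj₂ (∈.∈-filter⁻ (λ b → ¬? (b ℕ.≟ suc s)) {xs = σ} b∈) ∘ sym)) ⟨
      _ ∎))) (sym (Ā-def (suc s) σ))
    where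
    open ≡-Reasoning

-- The seminormal representation on full column words, and the spectrum on `one`.

module Seminormal where

  open Rat
  open Eigen
  open Lists
  open import Data.Rational.Base using (_+_; _*_; _-_; -_)

  open +-*-Solver using (solve; _:+_; _:*_; _:-_; :-_; _:=_; con)

  swapAt-↭ : ∀ i (c : List ℕ) → swapAt i c ↭ c
  swapAt-↭ zero    []          = ↭.refl
  swapAt-↭ zero    (_ ∷ [])    = ↭.refl
  swapAt-↭ zero    (a ∷ b ∷ c) = ↭.swap b a ↭.refl
  swapAt-↭ (suc i) []          = ↭.refl
  swapAt-↭ (suc i) (a ∷ c)     = ↭.prep a (swapAt-↭ i c)

  swapAt-++ : ∀ (p : List ℕ) a b c → swapAt (length p) (p ++ a ∷ b ∷ c) ≡ p ++ b ∷ a ∷ c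
  swapAt-++ []      a b c = refl
  swapAt-++ (d ∷ p) a b c = cong (d ∷_) (swapAt-++ p a b c)

  Fn : Set
  Fn = List ℕ → ℚ

  -- The dual of Young's seminormal form, with the entries of c as contents.
  s : ℕ → Fn → Fn
  s zero    u (a ∷ b ∷ c) = φ a b * u (b ∷ a ∷ c) + (- ψ a b) * u (a ∷ b ∷ c)
  s zero    u c           = u c
  s (suc i) u []          = u []
  s (suc i) u (a ∷ c)     = s i (u ∘ (a ∷_)) c

  s-ext : ∀ i c {u v : Fn} → u c ≡ v c → u (swapAt i c) ≡ v (swapAt i c) → s i u c ≡ s i v c
  s-ext zero    []          e e′ = e
  s-ext zero    (_ ∷ [])    e e′ = e
  s-ext zero    (a ∷ b ∷ c) e e′ = cong₂ (λ z w → φ a b * w + (- ψ a b) * z) e e′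
  s-ext (suc i) []          e e′ = e
  s-ext (suc i) (a ∷ c)     e e′ = s-ext i c e e′

  s-lin : ∀ i t (u v : Fn) c → s i (λ c → u c + t * v c) c ≡ s i u c + t * s i v c
  s-lin zero    t u v []          = refl
  s-lin zero    t u v (_ ∷ [])    = refl
  s-lin zero    t u v (a ∷ b ∷ c) =
    solve 7 (λ f p t u u′ v v′ → f :* (u :+ t :* v) :+ p :* (u′ :+ t :* v′) := (f :* u :+ p :* u′) :+ t :* (f :* v :+ p :* v′)) refl
      (φ a b) (- ψ a b) t (u (b ∷ a ∷ c)) (u (a ∷ b ∷ c)) (v (b ∷ a ∷ c)) (v (a ∷ b ∷ c))
  s-lin (suc i) t u v []          = refl
  s-lin (suc i) t u v (a ∷ c)     = s-lin i t (u ∘ (a ∷_)) (v ∘ (a ∷_)) c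

  s-comb : ∀ i α β (u v : Fn) c → s i (λ c → α * u c + β * v c) c ≡ α * s i u c + β * s i v c
  s-comb zero    α β u v []          = refl
  s-comb zero    α β u v (_ ∷ [])    = refl
  s-comb zero    α β u v (a ∷ b ∷ c) =
    solve 8 (λ f p α β u u′ v v′ → f :* (α :* u :+ β :* v) :+ p :* (α :* u′ :+ β :* v′)
               := α :* (f :* u :+ p :* u′) :+ β :* (f :* v :+ p :* v′)) refl
      (φ a b) (- ψ a b) α β (u (b ∷ a ∷ c)) (u (a ∷ b ∷ c)) (v (b ∷ a ∷ c)) (v (a ∷ b ∷ c))
  s-comb (suc i) α β u v []          = refl
  s-comb (suc i) α β u v (a ∷ c)     = s-comb i α β (u ∘ (a ∷_)) (v ∘ (a ∷_)) c

  s-scale : ∀ i α (u : Fn) c → s i (λ c → α * u c) c ≡ α * s i u c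
  s-scale zero    α u []          = refl
  s-scale zero    α u (_ ∷ [])    = refl
  s-scale zero    α u (a ∷ b ∷ c) =
    solve 5 (λ f p α u u′ → f :* (α :* u) :+ p :* (α :* u′) := α :* (f :* u :+ p :* u′)) refl
      (φ a b) (- ψ a b) α (u (b ∷ a ∷ c)) (u (a ∷ b ∷ c))
  s-scale (suc i) α u []          = refl
  s-scale (suc i) α u (a ∷ c)     = s-scale i α (u ∘ (a ∷_)) c

  s-inverse : ∀ i u c → Unique c → s i (s i u) c ≡ u c
  s-inverse zero    u []          _ = refl
  s-inverse zero    u (_ ∷ [])    _ = refl
  s-inverse zero    u (a ∷ b ∷ c) ((a≢b ∷ _) ∷ _) = alg (ψ a b) (u (a ∷ b ∷ c)) (u (b ∷ a ∷ c)) (ψ-anti a≢b)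
    where
    alg : ∀ p u u′ {p′} → p′ ≡ - p → (1ℚ + p) * ((1ℚ + p′) * u + - p′ * u′) + - p * ((1ℚ + p) * u′ + - p * u) ≡ u
    alg p u u′ refl = solve 3 (λ p u u′ → (con 1ℚ :+ p) :* ((con 1ℚ :+ :- p) :* u :+ :- (:- p) :* u′)
      :+ :- p :* ((con 1ℚ :+ p) :* u′ :+ :- p :* u) := u) refl p u u′
  s-inverse (suc i) u []          _       = refl
  s-inverse (suc i) u (a ∷ c)     (_ ∷ d) = s-inverse i (u ∘ (a ∷_)) c d

  s-commute : ∀ i j u c → suc i ℕ.< j → s i (s j u) c ≡ s j (s i u) c
  s-commute zero    (suc zero)    u c           (s≤s ())
  s-commute zero    (suc (suc j)) u []          _ = refl
  s-commute zero    (suc (suc j)) u (_ ∷ [])    _ = refl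
  s-commute zero    (suc (suc j)) u (a ∷ b ∷ c) _ =
    sym (s-comb j (φ a b) (- ψ a b) (λ c → u (b ∷ a ∷ c)) (λ c → u (a ∷ b ∷ c)) c)
  s-commute (suc i) (suc j) u []      _       = refl
  s-commute (suc i) (suc j) u (a ∷ c) (s≤s p) = s-commute i j (u ∘ (a ∷_)) c p

  s-braid-at : ∀ i u c → Unique c → suc (suc i) < length c →
               s i (s (suc i) (s i u)) c ≡ s (suc i) (s i (s (suc i) u)) c
  s-braid-at zero u (a ∷ [])     _ (s≤s ())
  s-braid-at zero u (a ∷ b ∷ []) _ (s≤s (s≤s ()))
  s-braid-at zero u (a ∷ b ∷ c ∷ l) ((a≢b ∷ a≢c ∷ _) ∷ (b≢c ∷ _) ∷ _) _ =
    alg (ψ a b) (ψ b c) (ψ a c) (u (a ∷ b ∷ c ∷ l)) (u (b ∷ a ∷ c ∷ l)) (u (a ∷ c ∷ b ∷ l))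
        (u (b ∷ c ∷ a ∷ l)) (u (c ∷ a ∷ b ∷ l)) (u (c ∷ b ∷ a ∷ l))
        (ψ-anti a≢b) (ψ-anti b≢c) (ψ-fractions a≢b b≢c a≢c)
    where
    alg : ∀ p q r x y z v w t {p′ q′} → p′ ≡ - p → q′ ≡ - q → p * q ≡ r * (p + q) →
          (1ℚ + p) * ((1ℚ + r) * ((1ℚ + q) * t + - q * v) + - r * ((1ℚ + p′) * x + - p′ * y))
            + - p * ((1ℚ + q) * ((1ℚ + r) * w + - r * z) + - q * ((1ℚ + p) * y + - p * x))
          ≡ (1ℚ + q) * ((1ℚ + r) * ((1ℚ + p) * t + - p * w) + - r * ((1ℚ + q′) * x + - q′ * z))
            + - q * ((1ℚ + p) * ((1ℚ + r) * v + - r * y) + - p * ((1ℚ + q) * z + - q * x))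
    alg p q r x y z v w t refl refl e = -‿cancel (trans
      (solve 9 (λ p q r x y z v w t →
         ((con 1ℚ :+ p) :* ((con 1ℚ :+ r) :* ((con 1ℚ :+ q) :* t :+ :- q :* v) :+ :- r :* ((con 1ℚ :+ :- p) :* x :+ :- (:- p) :* y))
            :+ :- p :* ((con 1ℚ :+ q) :* ((con 1ℚ :+ r) :* w :+ :- r :* z) :+ :- q :* ((con 1ℚ :+ p) :* y :+ :- p :* x)))
         :- ((con 1ℚ :+ q) :* ((con 1ℚ :+ r) :* ((con 1ℚ :+ p) :* t :+ :- p :* w) :+ :- r :* ((con 1ℚ :+ :- q) :* x :+ :- (:- q) :* z))
            :+ :- q :* ((con 1ℚ :+ p) :* ((con 1ℚ :+ r) :* v :+ :- r :* y) :+ :- p :* ((con 1ℚ :+ q) :* z :+ :- q :* x)))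
         := (:- (p :- q) :* x :+ (con 1ℚ :+ p) :* y :- (con 1ℚ :+ q) :* z) :* (p :* q :- r :* (p :+ q))) refl p q r x y z v w t)
      (trans (cong ((- (p - q) * x + (1ℚ + p) * y - (1ℚ + q) * z) *_)
                   (trans (cong (_- r * (p + q)) e) (ℚ.+-inverseʳ (r * (p + q)))))
             (ℚ.*-zeroʳ (- (p - q) * x + (1ℚ + p) * y - (1ℚ + q) * z))))
  s-braid-at (suc i) u (a ∷ c) (_ ∷ d) (s≤s p) = s-braid-at i (u ∘ (a ∷_)) c d p

  s-∷ʳ : ∀ i u c a → suc i < length c → s i u (c ∷ʳ a) ≡ s i (u ∘ (_∷ʳ a)) c
  s-∷ʳ zero    u (_ ∷ [])    a (s≤s ())
  s-∷ʳ zero    u (d ∷ b ∷ c) a _       = refl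
  s-∷ʳ (suc i) u (d ∷ c)     a (s≤s p) = s-∷ʳ i (u ∘ (d ∷_)) c a p

  s-last : ∀ u c a b → s (length c) u ((c ∷ʳ a) ∷ʳ b) ≡ φ a b * u ((c ∷ʳ b) ∷ʳ a) + (- ψ a b) * u ((c ∷ʳ a) ∷ʳ b)
  s-last u []      a b = refl
  s-last u (d ∷ c) a b = s-last (u ∘ (d ∷_)) c a b

  s-const : ∀ i k c → s i (λ _ → k) c ≡ k
  s-const zero    k []          = refl
  s-const zero    k (_ ∷ [])    = refl
  s-const zero    k (a ∷ b ∷ c) = solve 2 (λ p k → (con 1ℚ :+ p) :* k :+ :- p :* k := k) refl (ψ a b) k
  s-const (suc i) k []          = refl
  s-const (suc i) k (a ∷ c)     = s-const i k c

  -- At consecutive letters k, k + 1 the off-diagonal coefficient is 0 and the diagonal one is 1.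
  s-ids : ∀ i u k n → s i u (ids k n) ≡ u (ids k n)
  s-ids zero    u k zero          = refl
  s-ids zero    u k (suc zero)    = refl
  s-ids zero    u k (suc (suc n)) = alg (ψ k (suc k)) _ _ (φ≡0 k)
    where
    alg : ∀ p w w′ → 1ℚ + p ≡ 0ℚ → (1ℚ + p) * w + - p * w′ ≡ w′
    alg p w w′ e = trans (solve 3 (λ p w w′ → (con 1ℚ :+ p) :* w :+ :- p :* w′ := (con 1ℚ :+ p) :* (w :- w′) :+ w′) refl p w w′)
      (trans (cong (λ z → z * (w - w′) + w′) e) (solve 2 (λ d w → con 0ℚ :* d :+ w := w) refl (w - w′) w′))
  s-ids (suc i) u k zero    = refl
  s-ids (suc i) u k (suc n) = s-ids i (u ∘ (k ∷_)) (suc k) n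

  -- Since the two coefficients of `s i` add up to 1, being fixed at c says that `φ` times the
  -- difference of the two values is 0.
  s-fixed-swap : ∀ i u c → Unique c → suc i < length c → s i u c ≡ u c → s i u (swapAt i c) ≡ u (swapAt i c) →
                 u (swapAt i c) ≡ u c
  s-fixed-swap zero u (_ ∷ []) _ (s≤s ())
  s-fixed-swap zero u (a ∷ b ∷ c) ((a≢b ∷ _) ∷ _) _ e e′ = go (suc a ℕ.≟ b)
    where
    alg : ∀ {p w w′} → 1ℚ + p ≢ 0ℚ → (1ℚ + p) * w + - p * w′ ≡ w′ → w ≡ w′
    alg {p} {w} {w′} ne e = *-cancelˡ ne (trans
      (solve 3 (λ p w w′ → (con 1ℚ :+ p) :* w := ((con 1ℚ :+ p) :* w :+ :- p :* w′) :+ p :* w′) refl p w w′)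
      (trans (cong (_+ p * w′) e) (solve 2 (λ p w′ → w′ :+ p :* w′ := (con 1ℚ :+ p) :* w′) refl p w′)))
    go : Dec (suc a ≡ b) → u (b ∷ a ∷ c) ≡ u (a ∷ b ∷ c)
    go (no a+1≢b)  = alg {ψ a b} (φ≢0 a≢b a+1≢b) e
    -- For b = a + 1 the equation at c is void because `φ a b` is 0; at the swapped word the
    -- coefficient is 2.
    go (yes refl) = sym (alg {ψ b a} (φ≢0 (a≢b ∘ sym) (ℕ.<⇒≢ (ℕ.m<n⇒m<1+n ℕ.≤-refl) ∘ sym)) e′)
  s-fixed-swap (suc i) u (a ∷ c) (_ ∷ d) (s≤s p) e e′ = s-fixed-swap i (u ∘ (a ∷_)) c d p e e′

  -- Models the value at the identity word of y_0 ⋯ y_{j-1} times d further factors y_p - t, applied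
  -- to `one`. The recursion expands one factor, whose y_p counts as y_j.
  psi : ℚ → (ℕ → ℚ) → ℕ → ℕ → ℚ
  psi t a j zero    = a j
  psi t a j (suc d) = psi t a (suc j) d + - t * psi t a j d

  module Representation (m : ℕ) (ρ : ℕ → ℚ) where

    Valid : List ℕ → Set
    Valid c = c ↭ ids 1 (suc (suc m))

    q : Fn → Fn
    q u []      = u []
    q u (a ∷ c) = ρ a * u (c ∷ʳ a)

    open YPolynomials Valid m s q public

    valid-unique : ∀ {c} → Valid c → Unique c
    valid-unique v = unique-resp (↭.↭-sym v) (ids-unique 1 (suc (suc m)))

    valid-length : ∀ {c} → Valid c → length c ≡ suc (suc m)
    valid-length v = trans (↭.↭-length v) (length-ids 1 (suc (suc m)))

    valid-swap : ∀ i {c} → Valid c → Valid (swapAt i c)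
    valid-swap i {c} v = ↭.trans (swapAt-↭ i c) v

    valid-rotate : ∀ {a c} → Valid (a ∷ c) → Valid (c ∷ʳ a)
    valid-rotate {a} {c} v = ↭.trans (↭.↭-sym (↭.∷↭∷ʳ a c)) v

    isAction : IsAction
    isAction = record
      { s-cong   = λ i e c v → s-ext i c (e c v) (e (swapAt i c) (valid-swap i v))
      ; q-cong   = λ { e [] v → e [] v ; e (a ∷ c) v → cong (ρ a *_) (e (c ∷ʳ a) (valid-rotate v)) }
      ; s-inv    = λ i u _ c v → s-inverse i u c (valid-unique v)
      ; s-far    = λ i j u p c v → s-commute i j u c p
      ; s-braid  = λ i u p c v → s-braid-at i u c (valid-unique v)
                     (subst (suc (suc i) <_) (sym (valid-length v)) (s≤s (s≤s p)))
      ; q-s      = q-s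
      ; q-s-last = q-s-last
      ; s-lin    = λ i t u v c _ → s-lin i t u v c
      ; q-lin    = λ { t u v [] _ → refl
                     ; t u v (a ∷ c) _ → solve 4 (λ r u t v → r :* (u :+ t :* v) := r :* u :+ t :* (r :* v)) refl
                         (ρ a) (u (c ∷ʳ a)) t (v (c ∷ʳ a)) }
      }
      where
      q-s : ∀ i u → suc i ≤ m → q (s i u) ≈ s (suc i) (q u)
      q-s i u p []      v = contradiction (valid-length v) λ ()
      q-s i u p (a ∷ c) v = trans
        (cong (ρ a *_) (s-∷ʳ i u c a (subst (suc i <_) (sym (ℕ.suc-injective (valid-length v))) (s≤s p))))
        (sym (s-scale i (ρ a) (u ∘ (_∷ʳ a)) c))
      q-s-last : ∀ u → q (q (s m u)) ≈ s 0 (q (q u))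
      q-s-last u []          v = contradiction (valid-length v) λ ()
      q-s-last u (a ∷ [])    v = contradiction (valid-length v) λ ()
      q-s-last u (a ∷ b ∷ c) v = trans
        (cong (λ z → ρ a * (ρ b * z)) (subst (λ l → s l u ((c ∷ʳ a) ∷ʳ b) ≡ φ a b * u ((c ∷ʳ b) ∷ʳ a) + (- ψ a b) * u ((c ∷ʳ a) ∷ʳ b))
          (ℕ.suc-injective (ℕ.suc-injective (valid-length v))) (s-last u c a b)))
        (solve 6 (λ ra rb f p u u′ → ra :* (rb :* (f :* u :+ p :* u′)) := f :* (rb :* (ra :* u)) :+ p :* (ra :* (rb :* u′))) refl
          (ρ a) (ρ b) (φ a b) (- ψ a b) (u ((c ∷ʳ b) ∷ʳ a)) (u ((c ∷ʳ a) ∷ʳ b)))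

    open Acting isAction public
    open SetoidReasoning setoid

    one : X
    one _ = 1ℚ

    s-one : ∀ i → i ≤ m → s i one ≈ one
    s-one i _ c _ = s-const i 1ℚ c

    identity : List ℕ
    identity = ids 1 M

    -- A function fixed by the transpositions of the first l positions is symmetric in them. The
    -- derivation of the permutation is followed: p holds the letters already passed, r those beyond
    -- reach, and each swap is an instance of `s-fixed-swap`.
    fixed⇒prefix : ∀ {h} l → l ≤ M → (∀ i → suc i < l → s i h ≈ h) →
                   ∀ p {xs ys} r → xs ↭ ys → length p ℕ.+ length xs ≤ l → Valid (p ++ xs ++ r) →
                   h (p ++ xs ++ r) ≡ h (p ++ ys ++ r)
    fixed⇒prefix {h} l l≤ fix p r ↭.refl le v = refl
    fixed⇒prefix {h} l l≤ fix p r (↭.prep {xs} {ys} a e) le v =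
      trans (cong h (sym (List.++-assoc p _ (xs ++ r))))
        (trans (fixed⇒prefix l l≤ fix (p ∷ʳ a) r e
                 (ℕ.≤-trans (ℕ.≤-reflexive (trans (cong (ℕ._+ length xs) (List.length-++ p))
                    (trans (ℕ.+-assoc (length p) 1 (length xs)) refl))) le)
                 (subst Valid (sym (List.++-assoc p _ (xs ++ r))) v))
               (cong h (List.++-assoc p _ (ys ++ r))))
    fixed⇒prefix {h} l l≤ fix p r (↭.swap {xs} {ys} a b e) le v = trans
      (trans (cong h (sym (List.++-assoc p _ (xs ++ r))))
        (trans (fixed⇒prefix l l≤ fix (p ++ a ∷ b ∷ []) r e
                 (ℕ.≤-trans (ℕ.≤-reflexive (trans (cong (ℕ._+ length xs) (List.length-++ p))
                    (ℕ.+-assoc (length p) 2 (length xs)))) le)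
                 (subst Valid (sym (List.++-assoc p _ (xs ++ r))) v))
               (cong h (List.++-assoc p _ (ys ++ r)))))
      (trans (sym (s-fixed-swap (length p) h (p ++ a ∷ b ∷ ys ++ r) (valid-unique v′) l<
                    (fix (length p) l≤′ _ v′) (fix (length p) l≤′ _ (valid-swap (length p) v′))))
             (cong h (swapAt-++ p a b (ys ++ r))))
      where
      v′ : Valid (p ++ a ∷ b ∷ ys ++ r)
      v′ = ↭.trans (↭.++⁺ˡ p (↭.↭-sym (↭.prep a (↭.prep b (↭.++⁺ʳ r e))))) v
      l≤′ : suc (length p) < l
      l≤′ = ℕ.≤-trans (ℕ.≤-reflexive (ℕ.+-comm 2 (length p)))
        (ℕ.≤-trans (ℕ.+-monoʳ-≤ (length p) (s≤s (s≤s (z≤n {length xs})))) le)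
      l< : suc (length p) < length (p ++ a ∷ b ∷ ys ++ r)
      l< = subst (suc (length p) <_) (sym (valid-length v′)) (ℕ.≤-trans l≤′ l≤)
    fixed⇒prefix {h} l l≤ fix p r (↭.trans e e′) le v = trans (fixed⇒prefix l l≤ fix p r e le v)
      (fixed⇒prefix l l≤ fix p r e′ (subst (λ k → length p ℕ.+ k ≤ l) (↭.↭-length e) le)
        (↭.trans (↭.++⁺ˡ p (↭.↭-sym (↭.++⁺ʳ r e))) v))

    fixed⇒constant : ∀ {h} → (∀ i → i ≤ m → s i h ≈ h) → ∀ {c} → Valid c → h c ≡ h identity
    fixed⇒constant {h} fix {c} v = trans (cong h (sym (List.++-identityʳ c)))
      (trans (fixed⇒prefix M ℕ.≤-refl (λ i i< → fix i (ℕ.s≤s⁻¹ (ℕ.s≤s⁻¹ i<))) [] [] v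
               (ℕ.≤-reflexive (valid-length v)) (subst Valid (sym (List.++-identityʳ c)) v))
             (cong h (List.++-identityʳ identity)))

    module Spectrum (x : ℕ → ℚ) (x-distinct : ∀ {a b} → a < M → b < M → a ≢ b → x a ≢ x b)
      where

      open Interpolation x x-distinct one s-one public
      open IsLinear

      Yl Yl⁺ : ℕ → X → X
      Yl zero    v = v
      Yl (suc j) v = Yl j (y j v)
      Yl⁺ zero    v = v
      Yl⁺ (suc j) v = Yl⁺ j (y (suc j) v)

      Yl-linear : ∀ j → IsLinear (Yl j)
      Yl-linear zero    = id-linear
      Yl-linear (suc j) = ∘-linear (Yl-linear j) (y-linear j)

      Yl⁺-linear : ∀ j → IsLinear (Yl⁺ j)
      Yl⁺-linear zero    = id-linear
      Yl⁺-linear (suc j) = ∘-linear (Yl⁺-linear j) (y-linear (suc j))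

      qp : ℕ → X
      qp zero    = one
      qp (suc j) = q (qp j)

      q-Yl : ∀ j v → j ≤ suc m → q (Yl j v) ≈ Yl⁺ j (q v)
      q-Yl zero    v _        = ≈-refl
      q-Yl (suc j) v (s≤s j≤) = ≈-trans (q-Yl j (y j v) (ℕ.m≤n⇒m≤1+n j≤)) (cong-≈ (Yl⁺-linear j) (q-y j v j≤))

      y₀-Yl⁺ : ∀ j v → j ≤ suc m → Yl⁺ j (y 0 v) ≈ y 0 (Yl⁺ j v)
      y₀-Yl⁺ zero    v _  = ≈-refl
      y₀-Yl⁺ (suc j) v j≤ = ≈-trans (cong-≈ (Yl⁺-linear j) (≈-sym (y₀-comm (suc j) v j≤)))
        (y₀-Yl⁺ j (y (suc j) v) (ℕ.<⇒≤ j≤))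

      y₀-Yl⁺≡ : ∀ j v → y 0 (Yl⁺ j v) ≡ Yl (suc j) v
      y₀-Yl⁺≡ zero    v = refl
      y₀-Yl⁺≡ (suc j) v = y₀-Yl⁺≡ j (y (suc j) v)

      -- On `one` the rotation agrees with y 0. Pulling it through y_0 ⋯ y_{j-1} raises all indices
      -- and makes room for one more y 0, so the product of the first j of the y acts on `one` as
      -- the j-th power of the rotation.
      Yl-qp : ∀ j → j ≤ M → Yl j one ≈ qp j
      Yl-qp zero    _        = ≈-refl
      Yl-qp (suc j) (s≤s j≤) = begin
        Yl (suc j) one     ≈⟨ ≈-reflexive (y₀-Yl⁺≡ j one) ⟨
        y 0 (Yl⁺ j one)    ≈⟨ y₀-Yl⁺ j one j≤ ⟨
        Yl⁺ j (y 0 one)    ≈⟨ cong-≈ (Yl⁺-linear j) q-one ⟨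
        Yl⁺ j (q one)      ≈⟨ q-Yl j one j≤ ⟨
        q (Yl j one)       ≈⟨ q-cong′ (Yl-qp j (ℕ.m≤n⇒m≤1+n j≤)) ⟩
        q (qp j) ∎
        where q-cong′ = IsAction.q-cong isAction

      -- Each rotation reads off the first letter with its weight and sends it behind r.
      qp-++ : ∀ p r → qp (length p) (p ++ r) ≡ ∏ℚ p ρ
      qp-++ []      r = refl
      qp-++ (a ∷ p) r = cong (ρ a *_) (trans (cong (qp (length p)) (List.++-assoc p r _)) (qp-++ p (r ∷ʳ a)))

      -- A functional invariant under every `s i`, by `s-ids`; a constant function is determined by
      -- it.
      ε : X → ℚ
      ε v = v identity

      ε-cong : ∀ {u v} → u ≈ v → ε u ≡ ε v
      ε-cong e = e identity ↭.refl

      ε-Yl : ∀ j → j ≤ M → ε (Yl j one) ≡ ∏ℚ (ids 1 j) ρ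
      ε-Yl j j≤ = trans (ε-cong (Yl-qp j j≤)) (trans
        (cong (qp j) (trans (cong (ids 1) (sym (ℕ.m+[n∸m]≡n j≤))) (ids-++ 1 j (M ℕ.∸ j))))
        (trans (cong (λ l → qp l (ids 1 j ++ ids (j ℕ.+ 1) (M ℕ.∸ j))) (sym (length-ids 1 j))) (qp-++ (ids 1 j) _)))

      s-Nr : ∀ i p d t v → suc i < p → p ℕ.+ d ≤ M → s i (Nr p d t v) ≈ Nr p d t (s i v)
      s-Nr i p zero    t v i<p le = ≈-refl
      s-Nr i p (suc d) t v i<p le = ≈-trans
        (s-L-far i p t _ i<p (ℕ.≤-trans (s≤s (ℕ.m≤m+n p d)) le′))
        (cong-≈ (L-linear p t) (s-Nr i (suc p) d t v (ℕ.m<n⇒m<1+n i<p) le′))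
        where
        le′ : suc p ℕ.+ d ≤ M
        le′ = subst (_≤ M) (ℕ.+-suc p d) le

      s-Yl : ∀ k j v → j ≤ k → k ≤ m → Yl j (s k v) ≈ s k (Yl j v)
      s-Yl k zero    v _   _  = ≈-refl
      s-Yl k (suc j) v j<k k≤ = ≈-trans (cong-≈ (Yl-linear j) (≈-sym (s-y< k j v j<k k≤)))
        (s-Yl k j (y j v) (ℕ.<⇒≤ j<k) k≤)

      -- In y (k + 1) = s_k (y k) s_k the right s_k fixes B, while the left one commutes with `Yl j`
      -- and disappears under `ε`. Hence any later y may be replaced by y j.
      ε-move : ∀ d j B → d ℕ.+ j ≤ suc m → (∀ i → i < d ℕ.+ j → s i B ≈ B) →
               ε (Yl j (y (d ℕ.+ j) B)) ≡ ε (Yl (suc j) B)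
      ε-move zero    j B _        _   = refl
      ε-move (suc d) j B (s≤s le) fix = trans
        (ε-cong (≈-trans (s-Yl k j _ (ℕ.m≤n+m j d) le)
                         (s-cong′ k (cong-≈ (Yl-linear j) (y-cong k (fix k ℕ.≤-refl))))))
        (trans (s-ids k (Yl j (y k B)) 1 M)
               (ε-move d j B (ℕ.m≤n⇒m≤1+n le) (λ i i< → fix i (ℕ.m<n⇒m<1+n i<))))
        where
        k = d ℕ.+ j
        s-cong′ = IsAction.s-cong isAction

      ε-Nr : ∀ t d j p → j ≤ p → p ℕ.+ d ≡ M →
             ε (Yl j (Nr p d t one)) ≡ psi t (λ j → ∏ℚ (ids 1 j) ρ) j d
      ε-Nr t zero    j p j≤p e = ε-Yl j (ℕ.≤-trans j≤p (ℕ.≤-reflexive (trans (sym (ℕ.+-identityʳ p)) e)))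
      ε-Nr t (suc d) j p j≤p e = trans
        (ε-cong (lin-≈ (Yl-linear j) (- t) (y p B) B))
        (cong₂ (λ u v → u + - t * v)
          (trans (subst (λ k → ε (Yl j (y k B)) ≡ ε (Yl (suc j) B)) (ℕ.m∸n+n≡m j≤p)
                   (ε-move (p ℕ.∸ j) j B
                     (subst (_≤ suc m) (sym (ℕ.m∸n+n≡m j≤p)) (ℕ.s≤s⁻¹ (ℕ.≤-trans (ℕ.m≤m+n (suc p) d) (ℕ.≤-reflexive e′))))
                     (λ i i< → ≈-trans (s-Nr i (suc p) d t one (s≤s (subst (i <_) (ℕ.m∸n+n≡m j≤p) i<)) (ℕ.≤-reflexive e′))
                       (cong-≈ (Nr-linear (suc p) d t) (λ c _ → s-const i 1ℚ c)))))
                 (ε-Nr t d (suc j) (suc p) (s≤s j≤p) e′))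
          (ε-Nr t d j (suc p) (ℕ.m≤n⇒m≤1+n j≤p) e′))
        where
        B = Nr (suc p) d t one
        e′ : suc p ℕ.+ d ≡ M
        e′ = trans (sym (ℕ.+-suc p d)) e

      s-Nr-in : ∀ j p d t v → suc j < d → p ℕ.+ d ≤ M → s (j ℕ.+ p) (Nr p d t v) ≈ Nr p d t (s (j ℕ.+ p) v)
      s-Nr-in zero    p (suc zero)    t v (s≤s ()) le
      s-Nr-in zero    p (suc (suc d)) t v _ le = begin
        s p (L p t (L (suc p) t B))   ≈⟨ s-L p t _ p≤m ⟩
        L (suc p) t (s p (L (suc p) t B)) ≈⟨ cong-≈ (L-linear (suc p) t) (s-L⁺ p t B p≤m) ⟩
        L (suc p) t (L p t (s p B))   ≈⟨ L-comm (suc p) p t t _ p+1< (ℕ.<⇒≤ p+1<) ⟩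
        L p t (L (suc p) t (s p B))
          ≈⟨ cong-≈ (∘-linear (L-linear p t) (L-linear (suc p) t)) (s-Nr p (suc (suc p)) d t v ℕ.≤-refl le′) ⟩
        L p t (L (suc p) t (Nr (suc (suc p)) d t (s p v))) ∎
        where
        B = Nr (suc (suc p)) d t v
        le′ : suc (suc p) ℕ.+ d ≤ M
        le′ = subst (_≤ M) (trans (ℕ.+-suc p _) (cong suc (ℕ.+-suc p d))) le
        p+1< : suc p < M
        p+1< = ℕ.≤-trans (s≤s (s≤s (ℕ.m≤m+n p d))) le′
        p≤m : p ≤ m
        p≤m = ℕ.s≤s⁻¹ (ℕ.s≤s⁻¹ p+1<)
      s-Nr-in (suc j) p (suc d) t v (s≤s j<) le = begin
        s (suc j ℕ.+ p) (L p t B) ≈⟨ s-L-near _ p t B (s≤s (ℕ.m≤n+m p j)) j≤ ⟩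
        L p t (s (suc j ℕ.+ p) B)
          ≈⟨ cong-≈ (L-linear p t) (subst (λ k → s k B ≈ Nr (suc p) d t (s k v)) (ℕ.+-suc j p) (s-Nr-in j (suc p) d t v j< le′)) ⟩
        L p t (Nr (suc p) d t (s (suc j ℕ.+ p) v)) ∎
        where
        B = Nr (suc p) d t v
        le′ : suc p ℕ.+ d ≤ M
        le′ = subst (_≤ M) (ℕ.+-suc p d) le
        j≤ : suc j ℕ.+ p ≤ m
        j≤ = ℕ.s≤s⁻¹ (ℕ.s≤s⁻¹ (ℕ.≤-trans
          (ℕ.≤-reflexive (cong suc (trans (cong suc (cong suc (ℕ.+-comm j p))) (sym (trans (ℕ.+-suc p (suc j)) (cong suc (ℕ.+-suc p j)))))))
          (ℕ.≤-trans (s≤s (ℕ.+-monoʳ-≤ p j<)) le′)))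

      -- `Nr 0 M t` is symmetric in the y and commutes with the transpositions, so its value on
      -- `one` is a constant function, and one evaluation decides.
      killed : ∀ t → psi t (λ j → ∏ℚ (ids 1 j) ρ) 0 M ≡ 0ℚ → Nr 0 M t one ≈ O
      killed t e c v = trans
        (fixed⇒constant (λ i i≤ → ≈-trans
          (subst (λ k → s k (Nr 0 M t one) ≈ Nr 0 M t (s k one)) (ℕ.+-identityʳ i) (s-Nr-in i 0 M t one (s≤s (s≤s i≤)) ℕ.≤-refl))
          (cong-≈ (Nr-linear 0 M t) (s-one i i≤))) v)
        (trans (ε-Nr t M 0 0 z≤n refl) e)

-- Elementary symmetric polynomials at a point, and the rotation weight.

module Elementary where

  open Rat
  open Lists
  open Sums using (∏-++; ∏-↭)
  open Coeff
  open Seminormal using (psi)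
  open import Data.Rational.Base using (_+_; _*_; _-_; -_)

  open +-*-Solver using (solve; _:+_; _:*_; _:-_; :-_; _:=_; con)

  E : List ℚ → ℕ → ℚ
  E L       zero    = 1ℚ
  E []      (suc l) = 0ℚ
  E (x ∷ L) (suc l) = E L (suc l) + x * E L l

  E-large : ∀ L l → length L < l → E L l ≡ 0ℚ
  E-large []      (suc l) _       = refl
  E-large (x ∷ L) (suc l) (s≤s p) = trans
    (cong₂ (λ a b → a + x * b) (E-large L (suc l) (ℕ.m<n⇒m<1+n p)) (E-large L l p))
    (solve 1 (λ x → con 0ℚ :+ x :* con 0ℚ := con 0ℚ) refl x)

  E-nonneg : ∀ L l → All (0ℚ ℚ.<_) L → 0ℚ ℚ.≤ E L l
  E-nonneg L       zero    _        = ℚ.nonNegative⁻¹ 1ℚ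
  E-nonneg []      (suc l) _        = ℚ.≤-refl
  E-nonneg (x ∷ L) (suc l) (p ∷ ps) = subst (ℚ._≤ E (x ∷ L) (suc l)) (ℚ.+-identityˡ 0ℚ)
    (ℚ.+-mono-≤ (E-nonneg L (suc l) ps)
      (ℚ.nonNegative⁻¹ (x * E L l) {{ℚ.nonNeg*nonNeg⇒nonNeg x {{ℚ.nonNegative (ℚ.<⇒≤ p)}} (E L l) {{ℚ.nonNegative (E-nonneg L l ps)}}}}))

  E-positive : ∀ L l → All (0ℚ ℚ.<_) L → l ≤ length L → 0ℚ ℚ.< E L l
  E-positive L       zero    _        _       = ℚ.positive⁻¹ 1ℚ
  E-positive (x ∷ L) (suc l) (p ∷ ps) (s≤s q) = subst (ℚ._< E (x ∷ L) (suc l)) (ℚ.+-identityˡ 0ℚ)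
    (ℚ.+-mono-≤-< (E-nonneg L (suc l) ps)
      (ℚ.positive⁻¹ (x * E L l) {{ℚ.pos*pos⇒pos x {{ℚ.positive p}} (E L l) {{ℚ.positive (E-positive L l ps q)}}}}))

  E≢0 : ∀ L l → All (0ℚ ℚ.<_) L → l ≤ length L → E L l ≢ 0ℚ
  E≢0 L l p q e = ℚ.<-irrefl (sym e) (E-positive L l p q)

  -- horner p n f is the sum of p ^ (n ∸ l) * f l over l ≤ n.
  horner : ℚ → ℕ → (ℕ → ℚ) → ℚ
  horner p zero    f = f 0
  horner p (suc n) f = p * horner p n f + f (suc n)

  power : ℚ → ℕ → ℚ
  power p zero    = 1ℚ
  power p (suc n) = p * power p n

  horner-shift : ∀ p n f → horner p (suc n) f ≡ power p (suc n) * f 0 + horner p n (f ∘ suc)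
  horner-shift p zero    f = solve 3 (λ p a b → p :* a :+ b := p :* con 1ℚ :* a :+ b) refl p (f 0) (f 1)
  horner-shift p (suc n) f = trans (cong (λ z → p * z + f (suc (suc n))) (horner-shift p n f))
    (solve 5 (λ p w a h b → p :* (w :* a :+ h) :+ b := p :* w :* a :+ (p :* h :+ b)) refl
      p (power p (suc n)) (f 0) (horner p n (f ∘ suc)) (f (suc (suc n))))

  horner-cong : ∀ p n {f g} → (∀ l → l ≤ n → f l ≡ g l) → horner p n f ≡ horner p n g
  horner-cong p zero    e = e 0 z≤n
  horner-cong p (suc n) e = cong₂ (λ a b → p * a + b) (horner-cong p n λ l l≤ → e l (ℕ.m≤n⇒m≤1+n l≤)) (e (suc n) ℕ.≤-refl)

  horner-lin : ∀ p n x f g → horner p n (λ l → f l + x * g l) ≡ horner p n f + x * horner p n g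
  horner-lin p zero    x f g = refl
  horner-lin p (suc n) x f g = trans (cong (λ z → p * z + (f (suc n) + x * g (suc n))) (horner-lin p n x f g))
    (solve 6 (λ p x a b c d → p :* (a :+ x :* b) :+ (c :+ x :* d) := (p :* a :+ c) :+ x :* (p :* b :+ d)) refl
      p x (horner p n f) (horner p n g) (f (suc n)) (g (suc n)))

  ∏-shifted : ℚ → List ℚ → ℚ
  ∏-shifted t = foldr (λ x p → (x - t) * p) 1ℚ

  ∏-shifted-zero : ∀ {t L} → t ∈ L → ∏-shifted t L ≡ 0ℚ
  ∏-shifted-zero {t} {x ∷ L} (here refl) = trans (cong (_* ∏-shifted t L) (ℚ.+-inverseʳ t)) (ℚ.*-zeroˡ (∏-shifted t L))
  ∏-shifted-zero {t} {x ∷ L} (there t∈)  = trans (cong ((x - t) *_) (∏-shifted-zero t∈)) (ℚ.*-zeroʳ (x - t))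

  E-generating : ∀ t L → horner (- t) (length L) (E L) ≡ ∏-shifted t L
  E-generating t []      = refl
  E-generating t (x ∷ L) = begin
    horner p (suc n) (E (x ∷ L))
      ≡⟨ horner-shift p n (E (x ∷ L)) ⟩
    power p (suc n) * 1ℚ + horner p n (λ l → E L (suc l) + x * E L l)
      ≡⟨ cong (λ z → power p (suc n) * 1ℚ + z) (horner-lin p n x (E L ∘ suc) (E L)) ⟩
    power p (suc n) * 1ℚ + (horner p n (E L ∘ suc) + x * horner p n (E L))
      ≡⟨ solve 3 (λ a b c → a :+ (b :+ c) := (a :+ b) :+ c) refl (power p (suc n) * 1ℚ) (horner p n (E L ∘ suc)) (x * horner p n (E L)) ⟩
    (power p (suc n) * 1ℚ + horner p n (E L ∘ suc)) + x * horner p n (E L)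
      ≡⟨ cong (_+ x * horner p n (E L)) (horner-shift p n (E L)) ⟨
    (p * horner p n (E L) + E L (suc n)) + x * horner p n (E L)
      ≡⟨ cong (λ z → (p * horner p n (E L) + z) + x * horner p n (E L)) (E-large L (suc n) ℕ.≤-refl) ⟩
    (p * horner p n (E L) + 0ℚ) + x * horner p n (E L)
      ≡⟨ solve 3 (λ t h x → (:- t :* h :+ con 0ℚ) :+ x :* h := (x :- t) :* h) refl t (horner p n (E L)) x ⟩
    (x - t) * horner p n (E L)
      ≡⟨ cong ((x - t) *_) (E-generating t L) ⟩
    (x - t) * ∏-shifted t L ∎
    where
    open ≡-Reasoning
    p = - t
    n = length L

  binomial : ℕ → ℕ → ℚ
  binomial n       zero    = 1ℚ
  binomial zero    (suc l) = 0ℚ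
  binomial (suc n) (suc l) = binomial n l + binomial n (suc l)

  binomial-large : ∀ n l → n < l → binomial n l ≡ 0ℚ
  binomial-large zero    (suc l) _       = refl
  binomial-large (suc n) (suc l) (s≤s p) = trans
    (cong₂ _+_ (binomial-large n l p) (binomial-large n (suc l) (ℕ.m<n⇒m<1+n p))) (ℚ.+-identityˡ 0ℚ)

  -- Proved jointly with `binomial-top`, each one step of Pascal's rule away from the other. With
  -- rational differences it also holds for l > n.
  binomial-absorb : ∀ n l → nat (suc l) * binomial n (suc l) ≡ (nat n - nat l) * binomial n l
  binomial-top : ∀ n l → (nat (suc n) - nat l) * binomial (suc n) l ≡ nat (suc n) * binomial n l

  binomial-absorb zero zero = trans (ℚ.*-zeroʳ (nat 1)) (sym (trans (cong (_* 1ℚ) (ℚ.+-inverseʳ (nat 0))) (ℚ.*-zeroˡ 1ℚ)))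
  binomial-absorb zero (suc l) = trans (ℚ.*-zeroʳ (nat (suc (suc l)))) (sym (ℚ.*-zeroʳ (nat 0 - nat (suc l))))
  binomial-absorb (suc n) l = begin
    nat (suc l) * (a + b)
      ≡⟨ solve 3 (λ m a b → m :* (a :+ b) := m :* a :+ m :* b) refl (nat (suc l)) a b ⟩
    nat (suc l) * a + nat (suc l) * b
      ≡⟨ cong₂ (λ u v → u * a + v) (nat-suc l) (binomial-absorb n l) ⟩
    (1ℚ + nat l) * a + (nat n - nat l) * a
      ≡⟨ solve 3 (λ n l a → (con 1ℚ :+ l) :* a :+ (n :- l) :* a := (con 1ℚ :+ n) :* a) refl (nat n) (nat l) a ⟩
    (1ℚ + nat n) * a       ≡⟨ cong (_* a) (nat-suc n) ⟨
    nat (suc n) * a        ≡⟨ binomial-top n l ⟨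
    (nat (suc n) - nat l) * binomial (suc n) l ∎
    where
    open ≡-Reasoning
    a = binomial n l
    b = binomial n (suc l)

  binomial-top n zero = cong (_* 1ℚ) (trans (cong (λ z → nat (suc n) - z) nat-0) (solve 1 (λ a → a :- con 0ℚ := a) refl (nat (suc n))))
  binomial-top n (suc l) = alg (nat n) (nat l) (binomial n l) (binomial n (suc l)) (nat-suc n) (nat-suc l) (binomial-absorb n l)
    where
    alg : ∀ n l a b {n′ l′} → n′ ≡ 1ℚ + n → l′ ≡ 1ℚ + l → l′ * b ≡ (n - l) * a → (n′ - l′) * (a + b) ≡ n′ * b
    alg n l a b refl refl e = trans
      (solve 4 (λ n l a b → ((con 1ℚ :+ n) :- (con 1ℚ :+ l)) :* (a :+ b)
          := (n :- l) :* a :+ (n :- l) :* b) refl n l a b)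
      (trans (cong (_+ (n - l) * b) (sym e))
             (solve 3 (λ n l b → (con 1ℚ :+ l) :* b :+ (n :- l) :* b := (con 1ℚ :+ n) :* b) refl n l b))

  -- The recursion of `psi` is that of (S - t)^d for the shift S of the sequence a; this is the
  -- binomial theorem for it.
  psi-binomial : ∀ t a j d → psi t a j d ≡ horner (- t) d (λ l → binomial d l * a (l ℕ.+ j))
  psi-binomial t a j zero    = sym (ℚ.*-identityˡ (a j))
  psi-binomial t a j (suc d) = begin
    psi t a (suc j) d + p * psi t a j d
      ≡⟨ cong₂ (λ u v → u + p * v) (psi-binomial t a (suc j) d) (psi-binomial t a j d) ⟩
    horner p d (λ l → binomial d l * a (l ℕ.+ suc j)) + p * G
      ≡⟨ cong (_+ p * G) (horner-cong p d λ l _ → cong (λ k → binomial d l * a k) (ℕ.+-suc l j)) ⟩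
    H + p * G
      ≡⟨ solve 2 (λ h g → h :+ g := h :+ con 1ℚ :* (g :+ con 0ℚ)) refl H (p * G) ⟩
    H + 1ℚ * (p * G + 0ℚ)
      ≡⟨ cong (λ z → H + 1ℚ * (p * G + z)) (trans (cong (_* a (suc d ℕ.+ j)) (binomial-large d (suc d) ℕ.≤-refl)) (ℚ.*-zeroˡ (a (suc d ℕ.+ j)))) ⟨
    H + 1ℚ * horner p (suc d) (λ l → binomial d l * a (l ℕ.+ j))
      ≡⟨ cong (λ z → H + 1ℚ * z) (horner-shift p d (λ l → binomial d l * a (l ℕ.+ j))) ⟩
    H + 1ℚ * (W + K)
      ≡⟨ solve 3 (λ h w k → h :+ con 1ℚ :* (w :+ k) := w :+ (h :+ con 1ℚ :* k)) refl H W K ⟩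
    W + (H + 1ℚ * K)
      ≡⟨ cong (λ z → W + z) (horner-lin p d 1ℚ (λ l → binomial d l * a (suc l ℕ.+ j)) (λ l → binomial d (suc l) * a (suc l ℕ.+ j))) ⟨
    W + horner p d (λ l → binomial d l * a (suc l ℕ.+ j) + 1ℚ * (binomial d (suc l) * a (suc l ℕ.+ j)))
      ≡⟨ cong (λ z → W + z) (horner-cong p d λ l _ → solve 3 (λ x y a → x :* a :+ con 1ℚ :* (y :* a) := (x :+ y) :* a) refl
           (binomial d l) (binomial d (suc l)) (a (suc l ℕ.+ j))) ⟩
    W + horner p d (λ l → binomial (suc d) (suc l) * a (suc l ℕ.+ j))
      ≡⟨ horner-shift p d (λ l → binomial (suc d) l * a (l ℕ.+ j)) ⟨
    horner p (suc d) (λ l → binomial (suc d) l * a (l ℕ.+ j)) ∎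
    where
    open ≡-Reasoning
    p = - t
    G = horner p d (λ l → binomial d l * a (l ℕ.+ j))
    H = horner p d (λ l → binomial d l * a (suc l ℕ.+ j))
    K = horner p d (λ l → binomial d (suc l) * a (suc l ℕ.+ j))
    W = power p (suc d) * (1ℚ * a j)

  module Weights (Lx : List ℚ) (positive : All (0ℚ ℚ.<_) Lx) where

    M : ℕ
    M = length Lx

    w : ℕ → ℚ
    w y = E Lx y * inv (E Lx (y ℕ.∸ 1))

    -- For 1 ≤ z ≤ M this is z/(M - z + 1) · e_z/e_{z-1}, the ratio of consecutive terms of e_z/C(M,
    -- z). The factor z/(M - z + 1) is A(z ∣ c) for c made of all other columns, as `Ā-complete`
    -- shows. The value at 0 is a default: no column is 0.
    ρ : ℕ → ℚ
    ρ zero    = 0ℚ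
    ρ (suc z) = (nat (suc z) * inv (nat (M ℕ.∸ z))) * w (suc z)

    nat≢0 : ∀ {a} → a ≢ 0 → nat a ≢ 0ℚ
    nat≢0 a≢0 e = a≢0 (nat-injective (trans e (sym nat-0)))

    nat-∸ : ∀ {a b} → b ≤ a → nat (a ℕ.∸ b) ≡ nat a - nat b
    nat-∸ {a} {b} b≤a = trans (solve 2 (λ c b → c := (c :+ b) :- b) refl (nat (a ℕ.∸ b)) (nat b))
      (cong (_- nat b) (trans (sym (nat-+ (a ℕ.∸ b) b)) (cong nat (ℕ.m∸n+n≡m b≤a))))

    ē : ℕ → ℚ
    ē j = ∏ℚ (ids 1 j) ρ

    ∏-snoc : ∀ k j (f : ℕ → ℚ) → ∏ℚ (ids k (suc j)) f ≡ f (j ℕ.+ k) * ∏ℚ (ids k j) f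
    ∏-snoc k zero    f = refl
    ∏-snoc k (suc j) f = trans (cong (f k *_) (trans (∏-snoc (suc k) j f) (cong (λ i → f i * ∏ℚ (ids (suc k) j) f) (ℕ.+-suc j k))))
      (solve 3 (λ a b c → a :* (b :* c) := b :* (a :* c)) refl (f k) (f (suc j ℕ.+ k)) (∏ℚ (ids (suc k) j) f))

    -- The product of the weights telescopes to e_l/C(M, l). Positivity of the variables keeps the
    -- intermediate e_l invertible.
    binomial-ē : ∀ l → l ≤ M → binomial M l * ē l ≡ E Lx l
    binomial-ē zero    _  = refl
    binomial-ē (suc l) l< = begin
      binomial M (suc l) * ē (suc l)
        ≡⟨ cong (binomial M (suc l) *_) (trans (∏-snoc 1 l ρ) (cong (λ i → ρ i * ē l) (ℕ.+-comm l 1))) ⟩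
      binomial M (suc l) * (((nat (suc l) * i) * (E Lx (suc l) * j)) * ē l)
        ≡⟨ solve 6 (λ b n i e j a → b :* (((n :* i) :* (e :* j)) :* a) := (n :* b) :* (i :* (e :* (j :* a)))) refl
             (binomial M (suc l)) (nat (suc l)) i (E Lx (suc l)) j (ē l) ⟩
      (nat (suc l) * binomial M (suc l)) * (i * (E Lx (suc l) * (j * ē l)))
        ≡⟨ cong (_* (i * (E Lx (suc l) * (j * ē l)))) (trans (binomial-absorb M l) (cong (_* binomial M l) (sym (nat-∸ (ℕ.<⇒≤ l<))))) ⟩
      (nat (M ℕ.∸ l) * binomial M l) * (i * (E Lx (suc l) * (j * ē l)))
        ≡⟨ solve 6 (λ n b i e j a → (n :* b) :* (i :* (e :* (j :* a))) := (n :* i) :* (e :* ((b :* a) :* j))) refl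
             (nat (M ℕ.∸ l)) (binomial M l) i (E Lx (suc l)) j (ē l) ⟩
      (nat (M ℕ.∸ l) * i) * (E Lx (suc l) * ((binomial M l * ē l) * j))
        ≡⟨ cong₂ (λ u v → u * (E Lx (suc l) * v)) (*-inv (nat≢0 (ℕ.m>n⇒m∸n≢0 l<)))
             (trans (cong (_* j) (binomial-ē l (ℕ.<⇒≤ l<))) (*-inv (E≢0 Lx l positive (ℕ.<⇒≤ l<)))) ⟩
      1ℚ * (E Lx (suc l) * 1ℚ)
        ≡⟨ solve 1 (λ e → con 1ℚ :* (e :* con 1ℚ) := e) refl (E Lx (suc l)) ⟩
      E Lx (suc l) ∎
      where
      open ≡-Reasoning
      i = inv (nat (M ℕ.∸ l))
      j = inv (E Lx l)

    -- The binomial coefficients of `psi-binomial` cancel those in `ē`. What remains is the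
    -- expansion of the product of all x - t, in which t is a root.
    psi-vanishes : ∀ {t} → t ∈ Lx → psi t ē 0 M ≡ 0ℚ
    psi-vanishes {t} t∈ = trans (psi-binomial t ē 0 M) (trans
      (horner-cong (- t) M λ l l≤ → trans (cong (λ k → binomial M l * ē k) (ℕ.+-identityʳ l)) (binomial-ē l l≤))
      (trans (E-generating t Lx) (∏-shifted-zero t∈)))

    ∏φ-below : ∀ z n k → n ℕ.+ k ≡ z → ∏ℚ (ids k n) (φ z) ≡ nat (suc n)
    ∏φ-below z zero    k e = sym (trans (nat-suc 0) (trans (cong (λ z → 1ℚ + z) nat-0) (ℚ.+-identityʳ 1ℚ)))
    ∏φ-below z (suc n) k e = trans (cong (φ z k *_) (∏φ-below z n (suc k) (trans (ℕ.+-suc n k) e)))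
      (alg (ψ z k) (nat (suc n)) (trans (cong (_* ψ z k) diff) (ψ-inverse z≢k)) (nat-suc (suc n)))
      where
      z≢k : z ≢ k
      z≢k refl = ℕ.1+n≰n (ℕ.≤-trans (ℕ.m≤n+m (suc z) n) (ℕ.≤-reflexive (trans (ℕ.+-suc n z) e)))
      diff : nat (suc n) ≡ nat z - nat k
      diff = trans (solve 2 (λ a b → a := (a :+ b) :- b) refl (nat (suc n)) (nat k))
        (cong (_- nat k) (trans (sym (nat-+ (suc n) k)) (cong nat e)))
      alg : ∀ p N {N′} → N * p ≡ 1ℚ → N′ ≡ 1ℚ + N → (1ℚ + p) * N ≡ N′
      alg p N e e′ = trans (solve 2 (λ p N → (con 1ℚ :+ p) :* N := N :* p :+ N) refl p N) (trans (cong (_+ N) e) (sym e′))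

    -- For k > z the factor is (k - z - 1)/(k - z), so the product telescopes to i/(i + n); in
    -- multiplied form i + n may be 0.
    ∏φ-above : ∀ z n i → nat (i ℕ.+ n) * ∏ℚ (ids (suc (i ℕ.+ z)) n) (φ z) ≡ nat i
    ∏φ-above z zero    i = trans (ℚ.*-identityʳ _) (cong nat (ℕ.+-identityʳ i))
    ∏φ-above z (suc n) i = begin
      nat (i ℕ.+ suc n) * (φ z k * Π)   ≡⟨ cong (λ j → nat j * (φ z k * Π)) (ℕ.+-suc i n) ⟩
      nat (suc i ℕ.+ n) * (φ z k * Π)
        ≡⟨ solve 3 (λ a f p → a :* (f :* p) := f :* (a :* p)) refl (nat (suc i ℕ.+ n)) (φ z k) Π ⟩
      φ z k * (nat (suc i ℕ.+ n) * Π)   ≡⟨ cong (φ z k *_) (∏φ-above z n (suc i)) ⟩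
      φ z k * nat (suc i)               ≡⟨ alg (ψ z k) (nat i) (nat (suc i)) (nat-suc i) (trans (cong (_* ψ z k) diff) (ψ-inverse z≢k)) ⟩
      nat i ∎
      where
      open ≡-Reasoning
      k = suc (i ℕ.+ z)
      Π = ∏ℚ (ids (suc (suc i ℕ.+ z)) n) (φ z)
      z≢k : z ≢ k
      z≢k e = ℕ.1+n≰n (ℕ.≤-trans (s≤s (ℕ.m≤n+m z i)) (ℕ.≤-reflexive (sym e)))
      diff : - nat (suc i) ≡ nat z - nat k
      diff = trans (solve 2 (λ a b → :- a := b :- (a :+ b)) refl (nat (suc i)) (nat z))
        (cong (λ w → nat z - w) (sym (nat-+ (suc i) z)))
      alg : ∀ p i I → I ≡ 1ℚ + i → - I * p ≡ 1ℚ → (1ℚ + p) * I ≡ i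
      alg p i I refl e = trans (solve 2 (λ p i → (con 1ℚ :+ p) :* (con 1ℚ :+ i) := (con 1ℚ :+ i) :- (:- (con 1ℚ :+ i) :* p)) refl p i)
        (trans (cong (λ w → (1ℚ + i) - w) e) (solve 1 (λ i → (con 1ℚ :+ i) :- con 1ℚ := i) refl i))

    -- Appending to all columns but one can only restore the missing one.
    Ā-complete : ∀ z c → (suc z ∷ c) ↭ ids 1 M → Ā z c ≡ nat (suc z) * inv (nat (M ℕ.∸ z))
    Ā-complete z c perm = begin
      Ā z c                                     ≡⟨ Ā-∈ (↭.∈-resp-↭ (↭.↭-sym full) (here refl)) ⟩
      ∏ℚ ((0 ∷ c) without z) (φ z)               ≡⟨ ∏-↭ (φ z) (without-↭ z full) ⟩
      ∏ℚ ((z ∷ (lo ++ hi)) without z) (φ z)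
        ≡⟨ cong (λ l → ∏ℚ l (φ z)) (trans (without-here z (lo ++ hi)) (without-∉ (lo ++ hi) z∉)) ⟩
      ∏ℚ (lo ++ hi) (φ z)                        ≡⟨ ∏-++ lo hi (φ z) ⟩
      ∏ℚ lo (φ z) * ∏ℚ hi (φ z)                   ≡⟨ cong₂ _*_ (∏φ-below z z 0 (ℕ.+-identityʳ z)) hi≡ ⟩
      nat (suc z) * inv (nat (M ℕ.∸ z)) ∎
      where
      open ≡-Reasoning
      z<M : z < M
      z<M = ℕ.s≤s⁻¹ (subst (suc z <_) (ℕ.+-comm M 1) (proj₂ (∈-ids 1 M (↭.∈-resp-↭ perm (here refl)))))
      n = M ℕ.∸ suc z
      M≡ : M ≡ z ℕ.+ suc n
      M≡ = sym (trans (ℕ.+-suc z n) (ℕ.m+[n∸m]≡n z<M))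
      lo = ids 0 z
      hi = ids (suc (suc z)) n
      c↭ : c ↭ ids 1 z ++ hi
      c↭ = ↭.drop-∷ (↭.trans perm (↭.trans (↭.↭-reflexive (trans (cong (ids 1) M≡)
        (trans (ids-++ 1 z (suc n)) (cong (λ k → ids 1 z ++ ids k (suc n)) (ℕ.+-comm z 1))))) (↭.shift (suc z) (ids 1 z) hi)))
      full : 0 ∷ c ↭ z ∷ (lo ++ hi)
      full = ↭.trans (↭.prep 0 c↭) (↭.trans (↭.↭-reflexive (trans (cong (_++ hi) (ids-snoc 0 z)) (trans (List.++-assoc lo _ hi) (cong (λ k → lo ++ k ∷ hi) (ℕ.+-identityʳ z))))) (↭.shift z lo hi))
        where
        ids-snoc : ∀ k n → k ∷ ids (suc k) n ≡ ids k n ++ (n ℕ.+ k) ∷ []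
        ids-snoc k n = trans (cong (ids k) (ℕ.+-comm 1 n)) (ids-++ k n 1)
      z∉ : z ∉ lo ++ hi
      z∉ z∈ with ∈.∈-++⁻ lo z∈
      ... | inj₁ p = ℕ.<-irrefl (sym (ℕ.+-identityʳ z)) (proj₂ (∈-ids 0 z p))
      ... | inj₂ p = ℕ.1+n≰n (ℕ.<⇒≤ (All.lookup (ids-≥ (suc (suc z)) n) p))
      hi≡ : ∏ℚ hi (φ z) ≡ inv (nat (M ℕ.∸ z))
      hi≡ = *-cancelˡ (nat≢0 {suc n} λ ()) (trans (∏φ-above z n 1) (trans (trans (nat-suc 0) (trans (cong (λ z → 1ℚ + z) nat-0) (ℚ.+-identityʳ 1ℚ)))
        (sym (trans (cong (λ k → nat (suc n) * inv (nat k)) (trans (cong (ℕ._∸ z) M≡) (ℕ.m+n∸m≡n z (suc n)))) (*-inv (nat≢0 {suc n} λ ()))))))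

    ρ-complete : ∀ z c → (suc z ∷ c) ↭ ids 1 M → Ā z c * w (suc z) ≡ ρ (suc z)
    ρ-complete z c perm = cong (_* w (suc z)) (Ā-complete z c perm)

-- Forgetting positions: relations between the truncated eigenfunctions.

module Intertwiner where

  open Rat
  open Eigen
  open Coeff
  open Lists
  open Sums
  open Seminormal
  open Elementary using (module Weights)
  open import Data.Rational.Base using (_+_; _*_; _-_; -_)
  open import Data.List.Membership.DecPropositional ℕ._≟_ using (_∈?_)

  open +-*-Solver using (solve; _:+_; _:*_; _:-_; :-_; _:=_; con)

  swapAt-++ˡ : ∀ i (w κ : List ℕ) → suc i < length w → swapAt i (w ++ κ) ≡ swapAt i w ++ κ
  swapAt-++ˡ zero    (a ∷ [])    κ (s≤s ())
  swapAt-++ˡ zero    (a ∷ b ∷ w) κ _       = refl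
  swapAt-++ˡ (suc i) (a ∷ w)     κ (s≤s p) = cong (a ∷_) (swapAt-++ˡ i w κ p)

  s-at : ∀ p u a b c → s (length p) u (p ++ a ∷ b ∷ c) ≡ φ a b * u (p ++ b ∷ a ∷ c) + (- ψ a b) * u (p ++ a ∷ b ∷ c)
  s-at []      u a b c = refl
  s-at (d ∷ p) u a b c = s-at p (u ∘ (d ∷_)) a b c

  module Intertwining (m : ℕ) (x : ℕ → ℚ)
    (x-distinct : ∀ {a b} → a < suc (suc m) → b < suc (suc m) → a ≢ b → x a ≢ x b)
    (x-positive : ∀ {a} → a < suc (suc m) → 0ℚ ℚ.< x a) where

    Lx : List ℚ
    Lx = map x (upTo (suc (suc m)))

    module W = Weights Lx (All.map⁺ (All.tabulate (x-positive ∘ ∈.∈-upTo⁻)))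

    length-Lx : W.M ≡ suc (suc m)
    length-Lx = trans (List.length-map x (upTo (suc (suc m)))) (List.length-upTo (suc (suc m)))

    open Representation m W.ρ
    open Spectrum x x-distinct
    open IsLinear

    w : ℕ → ℚ
    w = W.w

    kill : ∀ {b} → b < M → Nr 0 M (x b) one ≈ O
    kill {b} b< = killed (x b) (subst (λ k → psi (x b) W.ē 0 k ≡ 0ℚ) length-Lx
      (W.psi-vanishes (∈.∈-map⁺ x (∈.∈-upTo⁺ b<))))

    open Killed kill

    -- Pigeonhole. A repetition in κ is recorded by a shorter list `κ⁻` with the same letters, hence
    -- the separate argument.
    missing : ∀ κ κ⁻ → κ ⊆ κ⁻ → length κ⁻ < M → ∃[ a ] a < M × a ∉ κ
    missing κ κ⁻ sub len with All.all? (_∈? κ) (upTo M)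
    ... | yes all = contradiction (ℕ.≤-trans (ℕ.≤-reflexive (sym (List.length-upTo M)))
          (unique-⊆-length (Unique.upTo⁺ M) (λ a∈ → sub (All.lookup all a∈)))) (ℕ.<⇒≱ len)
    ... | no ¬all with find (All.¬All⇒Any¬ (_∈? κ) (upTo M) ¬all)
    ...   | a , a∈ , a∉ = a , ∈.∈-upTo⁻ a∈ , a∉

    pigeon : ∀ b κ → length κ ≡ suc m → b ∈ κ → ∃[ a ] a < M × a ∉ b ∷ κ
    pigeon b κ len b∈ = missing (b ∷ κ) κ (λ { (here refl) → b∈ ; (there p) → p }) (ℕ.≤-reflexive (cong suc len))

    open Pigeon pigeon public using (eigen; eigen₀′; coef; Pk-F)

    Σc : (ℕ → ℚ) → ℚ
    Σc = ∑ℚ (upTo M)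

    -- Repeated letters are allowed: `F` is 0 at words that miss a colour, so the sum over a
    -- forgotten letter needs no side condition.
    Σw : ℕ → (List ℕ → ℚ) → ℚ
    Σw zero    f = f []
    Σw (suc l) f = Σc (λ b → Σw l (f ∘ (b ∷_)))

    Σw-cong : ∀ l {f g} → (∀ v → length v ≡ l → All (_< M) v → f v ≡ g v) → Σw l f ≡ Σw l g
    Σw-cong zero    e = e [] refl []
    Σw-cong (suc l) e = ∑-cong (upTo M) λ {b} b∈ → Σw-cong l λ v len v< → e (b ∷ v) (cong suc len) (∈.∈-upTo⁻ b∈ ∷ v<)

    Σw-zero : ∀ l {f} → (∀ v → length v ≡ l → All (_< M) v → f v ≡ 0ℚ) → Σw l f ≡ 0ℚ
    Σw-zero zero    e = e [] refl []
    Σw-zero (suc l) e = ∑-zero (upTo M) λ {b} b∈ → Σw-zero l λ v len v< → e (b ∷ v) (cong suc len) (∈.∈-upTo⁻ b∈ ∷ v<)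

    Σw-∑ : ∀ {B : Set} l (K : List B) (f : List ℕ → B → ℚ) → Σw l (λ v → ∑ℚ K (f v)) ≡ ∑ℚ K (λ b → Σw l (λ v → f v b))
    Σw-∑ zero    K f = refl
    Σw-∑ (suc l) K f = trans (∑-cong (upTo M) λ {b} _ → Σw-∑ l K (f ∘ (b ∷_)))
      (∑-comm (upTo M) K (λ b c → Σw l (λ v → f (b ∷ v) c)))

    Σw-snoc : ∀ l f → Σw (suc l) f ≡ Σw l (λ v → Σc (λ b → f (v ∷ʳ b)))
    Σw-snoc zero    f = refl
    Σw-snoc (suc l) f = ∑-cong (upTo M) λ {b} _ → Σw-snoc l (f ∘ (b ∷_))

    Σw-swap : ∀ i l f → suc i < l → Σw l (f ∘ swapAt i) ≡ Σw l f
    Σw-swap zero    (suc zero)    f (s≤s ())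
    Σw-swap zero    (suc (suc l)) f _       = ∑-comm (upTo M) (upTo M) (λ a b → Σw l (λ v → f (b ∷ a ∷ v)))
    Σw-swap (suc i) (suc l)       f (s≤s p) = ∑-cong (upTo M) λ {b} _ → Σw-swap i l (f ∘ (b ∷_)) p

    linear-∑ : ∀ {f} → IsLinear f → ∀ {B : Set} (K : List B) (u : B → X) →
               f (λ c → ∑ℚ K (λ b → u b c)) ≈ λ c → ∑ℚ K (λ b → f (u b) c)
    linear-∑ F []      u = O-≈ F
    linear-∑ {f} F (b ∷ K) u c v = trans (cong-≈ F (λ c _ → sum-lin (u b c) _) c v)
      (trans (lin-≈ F 1ℚ (λ c → ∑ℚ K (λ b → u b c)) (u b) c v)
             (trans (sym (sum-lin (f (u b) c) _)) (cong (λ z → f (u b) c + z) (linear-∑ F K u c v))))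
      where
      sum-lin : ∀ a b → a + b ≡ b + 1ℚ * a
      sum-lin = solve 2 (λ a b → a :+ b := b :+ con 1ℚ :* a) refl

    linear-Σw : ∀ {f} → IsLinear f → ∀ l (u : List ℕ → X) →
                f (λ c → Σw l (λ v → u v c)) ≈ λ c → Σw l (λ v → f (u v) c)
    linear-Σw F zero    u = ≈-refl
    linear-Σw F (suc l) u c v = trans (linear-∑ F (upTo M) (λ b c → Σw l (λ v → u (b ∷ v) c)) c v)
      (∑-cong (upTo M) λ {b} _ → linear-Σw F l (u ∘ (b ∷_)) c v)

    -- The colourings of all M positions which end in κ, the first l of them being forgotten.
    Gl : ℕ → List ℕ → X
    Gl l κ c = Σw l (λ v → F (v ++ κ) c)

    private
      len-++ : ∀ {l} (v κ : List ℕ) → length v ≡ l → l ℕ.+ length κ ≡ M → length (v ++ κ) ≡ M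
      len-++ v κ e e′ = trans (List.length-++ v) (trans (cong (ℕ._+ length κ) e) e′)

    -- On the eigenfunctions `s i` swaps two letters of the forgotten part, which only reorders the
    -- sum.
    Gl-fixed : ∀ i l κ → suc i < l → l ℕ.+ length κ ≡ M → s i (Gl l κ) ≈ Gl l κ
    Gl-fixed i l κ i< len c v = trans (linear-Σw (s-linear i) l (λ v → F (v ++ κ)) c v) (trans
      (Σw-cong l λ u lu _ → trans (s-F i (u ++ κ) (len-++ u κ lu len) i≤m c v)
        (cong (λ κ → F κ c) (swapAt-++ˡ i u κ (subst (suc i <_) (sym lu) i<))))
      (Σw-swap i l (λ v → F (v ++ κ) c) i<))
      where
      i≤m : i ≤ m
      i≤m = ℕ.s≤s⁻¹ (ℕ.s≤s⁻¹ (ℕ.≤-trans i< (ℕ.≤-trans (ℕ.m≤m+n l (length κ)) (ℕ.≤-reflexive len))))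

    Gl-forget : ∀ l κ c → Gl (suc l) κ c ≡ Σc (λ b → Gl l (b ∷ κ) c)
    Gl-forget l κ c = trans (Σw-snoc l (λ v → F (v ++ κ) c)) (trans
      (Σw-cong l λ v _ _ → ∑-cong (upTo M) λ {b} _ → cong (λ κ → F κ c) (List.++-assoc v (b ∷ []) κ))
      (Σw-∑ l (upTo M) (λ v b → F (v ++ b ∷ κ) c)))

    Gl-exchange : ∀ l b d κ → l ℕ.+ length (b ∷ d ∷ κ) ≡ M → s l (Gl l (b ∷ d ∷ κ)) ≈ Gl l (d ∷ b ∷ κ)
    Gl-exchange l b d κ len c v = trans (linear-Σw (s-linear l) l (λ v → F (v ++ b ∷ d ∷ κ)) c v)
      (Σw-cong l λ u lu _ → trans (s-F l (u ++ b ∷ d ∷ κ) (len-++ u (b ∷ d ∷ κ) lu len) l≤m c v)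
        (cong (λ κ → F κ c) (trans (cong (λ i → swapAt i (u ++ b ∷ d ∷ κ)) (sym lu)) (swapAt-++ u b d κ))))
      where
      l≤m : l ≤ m
      l≤m = ℕ.s≤s⁻¹ (ℕ.s≤s⁻¹ (ℕ.≤-trans (ℕ.≤-reflexive (ℕ.+-comm 2 l))
        (ℕ.≤-trans (ℕ.+-monoʳ-≤ l (s≤s (s≤s (z≤n {length κ})))) (ℕ.≤-reflexive len))))

    InRange : List ℕ → Set
    InRange c = Unique c × All (_∈ identity) c

    comp : List ℕ → List ℕ
    comp c = filter (λ a → ¬? (a ∈? c)) identity

    identity-unique : Unique identity
    identity-unique = ids-unique 1 M

    valid-comp : ∀ {c} → InRange c → Valid (comp c ++ c)
    valid-comp {c} (u , r) = unique-set⇒↭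
      (Unique.++⁺ (Unique.filter⁺ (λ a → ¬? (a ∈? c)) identity-unique) u
        (λ (p , q) → proj₂ (∈.∈-filter⁻ (λ a → ¬? (a ∈? c)) {xs = identity} p) q))
      identity-unique to from
      where
      to : comp c ++ c ⊆ identity
      to p with ∈.∈-++⁻ (comp c) p
      ... | inj₁ q = proj₁ (∈.∈-filter⁻ (λ a → ¬? (a ∈? c)) {xs = identity} q)
      ... | inj₂ q = All.lookup r q
      from : identity ⊆ comp c ++ c
      from {a} p with a ∈? c
      ... | yes q = ∈.∈-++⁺ʳ (comp c) q
      ... | no ¬q = ∈.∈-++⁺ˡ (∈.∈-filter⁺ (λ a → ¬? (a ∈? c)) p ¬q)

    valid⇒range : ∀ p {c} → Valid (p ++ c) → InRange c
    valid⇒range p v with unique-++⁻ p (valid-unique v)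
    ... | _ , uc , _ = uc , All.tabulate λ a∈ → ↭.∈-resp-↭ v (∈.∈-++⁺ʳ p a∈)

    range-tail : ∀ {z c} → InRange (z ∷ c) → InRange c
    range-tail (_ ∷ u , _ ∷ r) = u , r

    comp-length : ∀ {c} → InRange c → length (comp c) ℕ.+ length c ≡ M
    comp-length {c} r = trans (sym (List.length-++ (comp c))) (valid-length (valid-comp r))

    complement : ∀ p {c} → Valid (p ++ c) → p ↭ comp c
    complement p {c} v with unique-++⁻ p (valid-unique v)
    ... | up , uc , disj = unique-set⇒↭ up (Unique.filter⁺ (λ a → ¬? (a ∈? c)) identity-unique)
      (λ a∈ → ∈.∈-filter⁺ (λ a → ¬? (a ∈? c)) (↭.∈-resp-↭ v (∈.∈-++⁺ˡ a∈)) (disj a∈))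
      back
      where
      back : comp c ⊆ p
      back a∈ with ∈.∈-filter⁻ (λ a → ¬? (a ∈? c)) {xs = identity} a∈
      ... | a∈i , a∉c with ∈.∈-++⁻ p (↭.∈-resp-↭ (↭.↭-sym v) a∈i)
      ...   | inj₁ q = q
      ...   | inj₂ q = contradiction q a∉c

    -- The particular completion of c does not matter: `Gl l κ` is symmetric in the first l columns,
    -- and `g-eq` passes to any other completion.
    g : ℕ → List ℕ → List ℕ → ℚ
    g l κ c = Gl l κ (comp c ++ c)

    g-eq : ∀ p {c} l κ → Valid (p ++ c) → length p ≡ l → l ℕ.+ length κ ≡ M → Gl l κ (p ++ c) ≡ g l κ c
    g-eq p {c} l κ v lp len = fixed⇒prefix l (ℕ.≤-trans (ℕ.m≤m+n l (length κ)) (ℕ.≤-reflexive len))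
      (λ i i< → Gl-fixed i l κ i< len) [] c (complement p v) (ℕ.≤-reflexive lp) v

    private
      comp-len : ∀ {c} {l k} → InRange c → length c ≡ k → l ℕ.+ k ≡ M → length (comp c) ≡ l
      comp-len {c} {l} {k} r e e′ = ℕ.+-cancelʳ-≡ k (length (comp c)) l
        (trans (cong (length (comp c) ℕ.+_) (sym e)) (trans (comp-length r) (sym e′)))

    g-forget : ∀ l κ z c → length c ≡ length κ → suc l ℕ.+ length κ ≡ M → InRange (z ∷ c) →
               g (suc l) κ c ≡ Σc (λ b → g l (b ∷ κ) (z ∷ c))
    g-forget l κ z c lc len r = trans (sym (g-eq (P ∷ʳ z) (suc l) κ v lp len))
      (trans (Gl-forget l κ ((P ∷ʳ z) ++ c)) (∑-cong (upTo M) λ {b} _ → cong (Gl l (b ∷ κ)) assoc))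
      where
      P = comp (z ∷ c)
      assoc : (P ∷ʳ z) ++ c ≡ P ++ z ∷ c
      assoc = List.++-assoc P (z ∷ []) c
      v : Valid ((P ∷ʳ z) ++ c)
      v = subst Valid (sym assoc) (valid-comp r)
      lp : length (P ∷ʳ z) ≡ suc l
      lp = trans (List.length-++ P) (trans (ℕ.+-comm (length P) 1)
        (cong suc (comp-len r (cong suc lc) (trans (ℕ.+-suc l (length κ)) len))))

    g-exchange : ∀ l b d κ z₁ z₂ c → length c ≡ length κ → l ℕ.+ length (b ∷ d ∷ κ) ≡ M → InRange (z₁ ∷ z₂ ∷ c) →
                 g l (d ∷ b ∷ κ) (z₁ ∷ z₂ ∷ c) ≡
                 φ z₁ z₂ * g l (b ∷ d ∷ κ) (z₂ ∷ z₁ ∷ c) + (- ψ z₁ z₂) * g l (b ∷ d ∷ κ) (z₁ ∷ z₂ ∷ c)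
    g-exchange l b d κ z₁ z₂ c lc len r = begin
      Gl l (d ∷ b ∷ κ) (P ++ z₁ ∷ z₂ ∷ c)
        ≡⟨ Gl-exchange l b d κ len _ (valid-comp r) ⟨
      s l u (P ++ z₁ ∷ z₂ ∷ c)
        ≡⟨ cong (λ i → s i u (P ++ z₁ ∷ z₂ ∷ c)) (sym lp) ⟩
      s (length P) u (P ++ z₁ ∷ z₂ ∷ c)
        ≡⟨ s-at P u z₁ z₂ c ⟩
      φ z₁ z₂ * u (P ++ z₂ ∷ z₁ ∷ c) + (- ψ z₁ z₂) * u (P ++ z₁ ∷ z₂ ∷ c)
        ≡⟨ cong (λ e → φ z₁ z₂ * e + (- ψ z₁ z₂) * u (P ++ z₁ ∷ z₂ ∷ c)) (g-eq P l (b ∷ d ∷ κ) v lp len) ⟩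
      φ z₁ z₂ * g l (b ∷ d ∷ κ) (z₂ ∷ z₁ ∷ c) + (- ψ z₁ z₂) * u (P ++ z₁ ∷ z₂ ∷ c) ∎
      where
      open ≡-Reasoning
      P = comp (z₁ ∷ z₂ ∷ c)
      u = Gl l (b ∷ d ∷ κ)
      lp : length P ≡ l
      lp = comp-len r (cong (λ k → suc (suc k)) lc) len
      v : Valid (P ++ z₂ ∷ z₁ ∷ c)
      v = ↭.trans (↭.++⁺ˡ P (↭.swap z₂ z₁ ↭.refl)) (valid-comp r)

    g-missing : ∀ l κ κ⁻ c → l ℕ.+ length κ ≡ M → length κ⁻ < length κ → κ ⊆ κ⁻ → InRange c → g l κ c ≡ 0ℚ
    g-missing l κ κ⁻ c len lt sub r = Σw-zero l λ v lv v< → zero-at v lv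
      where
      zero-at : ∀ v → length v ≡ l → F (v ++ κ) (comp c ++ c) ≡ 0ℚ
      zero-at v lv with missing (v ++ κ) (v ++ κ⁻) sub′ (ℕ.≤-trans (ℕ.≤-reflexive (cong suc (List.length-++ v)))
          (ℕ.≤-trans (ℕ.+-monoʳ-< (length v) lt) (ℕ.≤-reflexive (trans (cong (ℕ._+ length κ) lv) len))))
        where
        sub′ : v ++ κ ⊆ v ++ κ⁻
        sub′ p with ∈.∈-++⁻ v p
        ... | inj₁ q = ∈.∈-++⁺ˡ q
        ... | inj₂ q = ∈.∈-++⁺ʳ v (sub q)
      ... | a , a< , a∉ = F-missing (v ++ κ) (len-++ v κ lv len) a< a∉ _ (valid-comp r)

    identity-≥1 : ∀ {z} → z ∈ identity → suc (z ℕ.∸ 1) ≡ z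
    identity-≥1 {zero}  z∈ = contradiction (All.lookup (ids-≥ 1 M) z∈) λ ()
    identity-≥1 {suc z} _  = refl

    0∉identity : 0 ∉ identity
    0∉identity z∈ = contradiction (All.lookup (ids-≥ 1 M) z∈) λ ()

    Ā⁻ : ℕ → List ℕ → ℚ
    Ā⁻ y c = Ā (y ℕ.∸ 1) c

    Ā⁻-∈ : ∀ {y c} → y ∈ identity → y ∈ c → Ā⁻ y c ≡ 0ℚ
    Ā⁻-∈ {y} {c} y∈ y∈c = Ā-suc-∈ (subst (_∈ c) (sym (identity-≥1 y∈)) y∈c)

    fresh : ∀ {c} → InRange c → length c < M → ∃[ z ] InRange (z ∷ c)
    fresh {c} r lt with comp c in eq
    ... | []    = contradiction (subst (λ l → length l ℕ.+ length c ≡ M) eq (comp-length r)) (ℕ.<⇒≢ lt)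
    ... | z ∷ _ with ∈.∈-filter⁻ (λ a → ¬? (a ∈? c)) {xs = identity} (subst (z ∈_) (sym eq) (here refl))
    ...   | z∈ , z∉ = z , (All.tabulate (λ a∈ z≡a → z∉ (subst (_∈ c) (sym z≡a) a∈)) ∷ proj₁ r) , (z∈ ∷ proj₂ r)

    range-snoc : ∀ {c y} → InRange c → y ∈ identity → y ∉ c → InRange (c ∷ʳ y)
    range-snoc {c} {y} (u , r) y∈ y∉ = unique-resp (↭.∷↭∷ʳ y c) (All.tabulate (λ a∈ y≡a → y∉ (subst (_∈ c) (sym y≡a) a∈)) ∷ u)
      , All.++⁺ r (y∈ ∷ [])

    private
      len-snoc : ∀ {B C : Set} (c : List B) (κ : List C) (a : B) (b : C) → length c ≡ length κ → length (c ∷ʳ a) ≡ length (κ ∷ʳ b)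
      len-snoc c κ a b e = trans (List.length-++ c) (trans (cong (ℕ._+ 1) e) (sym (List.length-++ κ)))

    -- The eigenvalue equation of y 0 with l letters forgotten. Colour b moves from the front to the
    -- end, column z is given up and a column y appended; the coefficient is the weight of y without
    -- z present, minus its weight with z present.
    QRelation : ℕ → Set
    QRelation l = ∀ b κ z c → b < M → All (_< M) κ → length c ≡ length κ → suc l ℕ.+ length κ ≡ M → InRange (z ∷ c) →
      x b * g l (b ∷ κ) (z ∷ c) ≡ ∑ℚ identity (λ y → (Ā⁻ y c - Ā⁻ y (z ∷ c)) * (w y * g l (κ ∷ʳ b) (c ∷ʳ y)))

    q-relation-top : QRelation 0
    q-relation-top b κ z c b< κ< lc len r = begin
      x b * g 0 (b ∷ κ) (z ∷ c)          ≡⟨ cong (x b *_) (g-eq [] 0 (b ∷ κ) v refl len) ⟨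
      x b * F (b ∷ κ) (z ∷ c)            ≡⟨ eigen₀′ (b ∷ κ) len (b< ∷ κ<) (z ∷ c) v ⟨
      y 0 (F (b ∷ κ)) (z ∷ c)            ≡⟨ q-F κ b lκ (z ∷ c) v ⟨
      W.ρ z * F (κ ∷ʳ b) (c ∷ʳ z)
        ≡⟨ cong (W.ρ z *_) (g-eq [] 0 (κ ∷ʳ b) (valid-rotate v) refl (trans (length-∷ʳ κ b) len)) ⟩
      W.ρ z * G z                         ≡⟨ cong (_* G z) (ρ≡ z z∈ v) ⟨
      (Ā⁻ z c * w z) * G z
        ≡⟨ solve 3 (λ a w g → (a :* w) :* g := (a :- con 0ℚ) :* (w :* g)) refl (Ā⁻ z c) (w z) (G z) ⟩
      (Ā⁻ z c - 0ℚ) * (w z * G z)         ≡⟨ cong (λ e → (Ā⁻ z c - e) * (w z * G z)) (Ā⁻-∈ {z} {z ∷ c} z∈ (here refl)) ⟨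
      -- With all columns in z ∷ c, every y ≠ z occurs in c and both of its weights vanish, so only
      -- y = z remains.
      (Ā⁻ z c - Ā⁻ z (z ∷ c)) * (w z * G z) ≡⟨ ∑-single identity {z} z∈ identity-unique others≡0 ⟨
      ∑ℚ identity (λ y → (Ā⁻ y c - Ā⁻ y (z ∷ c)) * (w y * G y)) ∎
      where
      open ≡-Reasoning
      G : ℕ → ℚ
      G y = g 0 (κ ∷ʳ b) (c ∷ʳ y)
      lκ : length κ ≡ suc m
      lκ = ℕ.suc-injective len
      comp≡[] : comp (z ∷ c) ≡ []
      comp≡[] with comp (z ∷ c) | comp-len {z ∷ c} {0} r (cong suc lc) len
      ... | [] | _ = refl
      v : Valid (z ∷ c)
      v = subst (λ p → Valid (p ++ z ∷ c)) comp≡[] (valid-comp r)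
      z∈ : z ∈ identity
      z∈ = All.lookup (proj₂ r) (here refl)
      ρ≡ : ∀ z → z ∈ identity → Valid (z ∷ c) → Ā⁻ z c * w z ≡ W.ρ z
      ρ≡ zero    z∈ v = contradiction z∈ 0∉identity
      ρ≡ (suc z) z∈ v = W.ρ-complete z c (subst (λ k → suc z ∷ c ↭ ids 1 k) (sym length-Lx) v)
      others≡0 : ∀ {y} → y ∈ identity → y ≢ z → (Ā⁻ y c - Ā⁻ y (z ∷ c)) * (w y * G y) ≡ 0ℚ
      others≡0 {y} y∈ y≢z with ↭.∈-resp-↭ (↭.↭-sym v) y∈
      ... | here y≡z  = contradiction y≡z y≢z
      ... | there y∈c = trans (cong₂ (λ a b → (a - b) * (w y * G y)) (Ā⁻-∈ {y} {c} y∈ y∈c) (Ā⁻-∈ {y} {z ∷ c} y∈ (there y∈c)))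
        (solve 1 (λ a → (con 0ℚ :- con 0ℚ) :* a := con 0ℚ) refl (w y * G y))

    q-relation-step : ∀ l → QRelation l → QRelation (suc l)
    q-relation-step l IH b κ z₂ c b< κ< lc len r = step (proj₁ extra) (proj₂ extra)
      where
      extra = fresh r (ℕ.≤-trans (s≤s (s≤s (ℕ.≤-trans (ℕ.≤-reflexive lc) (ℕ.m≤n+m (length κ) l)))) (ℕ.≤-reflexive len))
      step : ∀ z₁ → InRange (z₁ ∷ z₂ ∷ c) → x b * g (suc l) (b ∷ κ) (z₂ ∷ c) ≡
             ∑ℚ identity (λ y → (Ā⁻ y c - Ā⁻ y (z₂ ∷ c)) * (w y * g (suc l) (κ ∷ʳ b) (c ∷ʳ y)))
      step z₁ r₁ =   begin
        x b * g (suc l) (b ∷ κ) (z₂ ∷ c)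
          ≡⟨ cong (x b *_) (g-forget l (b ∷ κ) z₁ (z₂ ∷ c) (cong suc lc) len′ r₁) ⟩
        x b * Σc (λ d → g l (d ∷ b ∷ κ) (z₁ ∷ z₂ ∷ c))
          ≡⟨ ∑-* (upTo M) (x b) (λ d → g l (d ∷ b ∷ κ) (z₁ ∷ z₂ ∷ c)) ⟨
        Σc (λ d → x b * g l (d ∷ b ∷ κ) (z₁ ∷ z₂ ∷ c))
          ≡⟨ ∑-cong (upTo M) (λ {d} d∈ → exchanged d (∈.∈-upTo⁻ d∈)) ⟩
        Σc (λ d → ∑ℚ identity (λ y → T d y))
          ≡⟨ ∑-comm (upTo M) identity T ⟩
        ∑ℚ identity (λ y → Σc (λ d → T d y))
          ≡⟨ ∑-cong identity (λ {y} y∈ → total y y∈) ⟩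
        ∑ℚ identity (λ y → (Ā⁻ y c - Ā⁻ y (z₂ ∷ c)) * (w y * G y)) ∎
        where
        open ≡-Reasoning
        G : ℕ → ℚ
        G y = g (suc l) (κ ∷ʳ b) (c ∷ʳ y)
        g₁ g₂ : ℕ → ℕ → ℚ
        g₁ d y = g l ((d ∷ κ) ∷ʳ b) ((z₁ ∷ c) ∷ʳ y)
        g₂ d y = g l ((d ∷ κ) ∷ʳ b) ((z₂ ∷ c) ∷ʳ y)
        P = φ z₁ z₂
        Q = ψ z₁ z₂
        k₁ k₂ : ℕ → ℚ
        k₁ y = Ā⁻ y (z₁ ∷ c) - Ā⁻ y (z₂ ∷ z₁ ∷ c)
        k₂ y = Ā⁻ y (z₂ ∷ c) - Ā⁻ y (z₁ ∷ z₂ ∷ c)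
        T : ℕ → ℕ → ℚ
        T d y = P * (k₁ y * (w y * g₁ d y)) + (- Q) * (k₂ y * (w y * g₂ d y))
        len′ : suc l ℕ.+ length (b ∷ κ) ≡ M
        len′ = trans (cong suc (ℕ.+-suc l (length κ))) len
        len″ : l ℕ.+ suc (suc (length κ)) ≡ M
        len″ = trans (ℕ.+-suc l (suc (length κ))) len′
        r₂ : InRange (z₂ ∷ z₁ ∷ c)
        r₂ = unique-resp (↭.swap z₁ z₂ ↭.refl) (proj₁ r₁) , swap-All (proj₂ r₁)
          where
          swap-All : All (_∈ identity) (z₁ ∷ z₂ ∷ c) → All (_∈ identity) (z₂ ∷ z₁ ∷ c)
          swap-All (p ∷ q ∷ ps) = q ∷ p ∷ ps
        exchanged : ∀ d → d < M → x b * g l (d ∷ b ∷ κ) (z₁ ∷ z₂ ∷ c) ≡ ∑ℚ identity (λ y → T d y)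
        exchanged d d< = begin
          x b * g l (d ∷ b ∷ κ) (z₁ ∷ z₂ ∷ c)
            ≡⟨ cong (x b *_) (g-exchange l b d κ z₁ z₂ c lc len″ r₁) ⟩
          x b * (P * g l (b ∷ d ∷ κ) (z₂ ∷ z₁ ∷ c) + (- Q) * g l (b ∷ d ∷ κ) (z₁ ∷ z₂ ∷ c))
            ≡⟨ solve 5 (λ x p q u v → x :* (p :* u :+ q :* v) := p :* (x :* u) :+ q :* (x :* v)) refl
                 (x b) P (- Q) (g l (b ∷ d ∷ κ) (z₂ ∷ z₁ ∷ c)) (g l (b ∷ d ∷ κ) (z₁ ∷ z₂ ∷ c)) ⟩
          P * (x b * g l (b ∷ d ∷ κ) (z₂ ∷ z₁ ∷ c)) + (- Q) * (x b * g l (b ∷ d ∷ κ) (z₁ ∷ z₂ ∷ c))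
            ≡⟨ cong₂ (λ u v → P * u + (- Q) * v)
                 (IH b (d ∷ κ) z₂ (z₁ ∷ c) b< (d< ∷ κ<) (cong suc lc) len′ r₂)
                 (IH b (d ∷ κ) z₁ (z₂ ∷ c) b< (d< ∷ κ<) (cong suc lc) len′ r₁) ⟩
          P * ∑ℚ identity (λ y → k₁ y * (w y * g₁ d y)) + (- Q) * ∑ℚ identity (λ y → k₂ y * (w y * g₂ d y))
            ≡⟨ cong₂ _+_ (∑-* identity P (λ y → k₁ y * (w y * g₁ d y))) (∑-* identity (- Q) (λ y → k₂ y * (w y * g₂ d y))) ⟨
          ∑ℚ identity (λ y → P * (k₁ y * (w y * g₁ d y))) + ∑ℚ identity (λ y → (- Q) * (k₂ y * (w y * g₂ d y)))
            ≡⟨ ∑-+ identity (λ y → P * (k₁ y * (w y * g₁ d y))) (λ y → (- Q) * (k₂ y * (w y * g₂ d y))) ⟨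
          ∑ℚ identity (λ y → T d y) ∎
        -- The sum over d contracts by `g-forget` only if z, c and y are distinct columns; in the
        -- other case the coefficient is 0.
        absorb : ∀ z y (k : ℚ) → y ∈ identity → InRange (z ∷ c) → (y ∈ z ∷ c → k ≡ 0ℚ) →
                 k * Σc (λ d → g l ((d ∷ κ) ∷ʳ b) ((z ∷ c) ∷ʳ y)) ≡ k * G y
        absorb z y k y∈ rz k≡0 = by-membership (y ∈? z ∷ c)
          where
          S : ℚ
          S = Σc (λ d → g l ((d ∷ κ) ∷ʳ b) ((z ∷ c) ∷ʳ y))
          by-membership : Dec (y ∈ z ∷ c) → k * S ≡ k * G y
          by-membership (yes p) = trans (cong (_* S) (k≡0 p)) (trans (ℚ.*-zeroˡ S) (sym (trans (cong (_* G y) (k≡0 p)) (ℚ.*-zeroˡ (G y)))))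
          by-membership (no ¬p) = cong (k *_) (sym (g-forget l (κ ∷ʳ b) z (c ∷ʳ y) (len-snoc c κ y b lc)
            (trans (cong (suc l ℕ.+_) (length-∷ʳ κ b)) len′) (range-snoc rz y∈ ¬p)))
        total : ∀ y → y ∈ identity → Σc (λ d → T d y) ≡ (Ā⁻ y c - Ā⁻ y (z₂ ∷ c)) * (w y * G y)
        total y y∈ = begin
          Σc (λ d → T d y)
            ≡⟨ ∑-cong (upTo M) (λ {d} _ → solve 7 (λ p q k k′ w g g′ → p :* (k :* (w :* g)) :+ q :* (k′ :* (w :* g′))
                 := (p :* w :* k) :* g :+ (q :* w :* k′) :* g′) refl P (- Q) (k₁ y) (k₂ y) (w y) (g₁ d y) (g₂ d y)) ⟩
          Σc (λ d → (P * w y * k₁ y) * g₁ d y + ((- Q) * w y * k₂ y) * g₂ d y)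
            ≡⟨ ∑-+ (upTo M) (λ d → (P * w y * k₁ y) * g₁ d y) (λ d → ((- Q) * w y * k₂ y) * g₂ d y) ⟩
          Σc (λ d → (P * w y * k₁ y) * g₁ d y) + Σc (λ d → ((- Q) * w y * k₂ y) * g₂ d y)
            ≡⟨ cong₂ _+_ (∑-* (upTo M) (P * w y * k₁ y) (λ d → g₁ d y)) (∑-* (upTo M) ((- Q) * w y * k₂ y) (λ d → g₂ d y)) ⟩
          (P * w y * k₁ y) * Σc (λ d → g₁ d y) + ((- Q) * w y * k₂ y) * Σc (λ d → g₂ d y)
            ≡⟨ cong₂ _+_ (absorb z₁ y (P * w y * k₁ y) y∈ (range-tail r₂) (λ p → vanish₁ p))
                         (absorb z₂ y ((- Q) * w y * k₂ y) y∈ r (λ p → vanish₂ p)) ⟩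
          (P * w y * k₁ y) * G y + ((- Q) * w y * k₂ y) * G y
            ≡⟨ solve 6 (λ p q k k′ w g → (p :* w :* k) :* g :+ (:- q :* w :* k′) :* g := (p :* k :- q :* k′) :* (w :* g)) refl
                 P Q (k₁ y) (k₂ y) (w y) (G y) ⟩
          (P * k₁ y - Q * k₂ y) * (w y * G y)
            ≡⟨ cong (_* (w y * G y)) (Ā-modular (y ℕ.∸ 1) c z₁≢z₂ z₁∉ z₂∉) ⟩
          (Ā⁻ y c - Ā⁻ y (z₂ ∷ c)) * (w y * G y) ∎
          where
          times0 : ∀ p {k} → k ≡ 0ℚ → p * k ≡ 0ℚ
          times0 p refl = ℚ.*-zeroʳ p
          minus0 : ∀ {a b} → a ≡ 0ℚ → b ≡ 0ℚ → a - b ≡ 0ℚ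
          minus0 refl refl = refl
          vanish₁ : y ∈ z₁ ∷ c → P * w y * k₁ y ≡ 0ℚ
          vanish₁ p = times0 (P * w y) (minus0 (Ā⁻-∈ {y} {z₁ ∷ c} y∈ p) (Ā⁻-∈ {y} {z₂ ∷ z₁ ∷ c} y∈ (there p)))
          vanish₂ : y ∈ z₂ ∷ c → (- Q) * w y * k₂ y ≡ 0ℚ
          vanish₂ p = times0 ((- Q) * w y) (minus0 (Ā⁻-∈ {y} {z₂ ∷ c} y∈ p) (Ā⁻-∈ {y} {z₁ ∷ z₂ ∷ c} y∈ (there p)))
          z₁≢z₂ : z₁ ≢ z₂
          z₁≢z₂ = All.lookup (AllPairs.head (proj₁ r₁)) (here refl)
          z₁∉ : z₁ ∉ 0 ∷ c
          z₁∉ (here refl) = 0∉identity (All.lookup (proj₂ r₁) (here refl))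
          z₁∉ (there p)   = All.lookup (AllPairs.head (proj₁ r₁)) (there p) refl
          z₂∉ : z₂ ∉ 0 ∷ c
          z₂∉ (here refl) = 0∉identity (All.lookup (proj₂ r) (here refl))
          z₂∉ (there p)   = All.lookup (AllPairs.head (proj₁ r)) p refl

    q-relation : ∀ l → QRelation l
    q-relation zero    = q-relation-top
    q-relation (suc l) = q-relation-step l (q-relation l)

    private
      no-room : ∀ {z c k} {y} → InRange (z ∷ c) → y ∈ identity → y ∉ z ∷ c → length c ≡ k → suc k ≢ M
      no-room {z} {c} {k} {y} rz y∈ y∉ lc e = ℕ.1+n≰n (ℕ.≤-trans (ℕ.≤-reflexive (cong suc (trans (sym e) (cong suc (sym lc)))))
        (ℕ.≤-trans (unique-⊆-length {ys = identity}
            (All.tabulate (λ a∈ y≡a → y∉ (subst (_∈ z ∷ c) (sym y≡a) a∈)) ∷ proj₁ rz)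
            (λ { (here refl) → y∈ ; (there q) → All.lookup (proj₂ rz) q }))
          (ℕ.≤-reflexive (length-ids 1 M))))

      g-repeated : ∀ l κ b z c y → length c ≡ length κ → l ℕ.+ suc (length κ) ≡ M → InRange (z ∷ c) → y ∈ identity →
                   y ∉ z ∷ c → g (l ℕ.∸ 1) ((b ∷ κ) ∷ʳ b) ((z ∷ c) ∷ʳ y) ≡ 0ℚ
      g-repeated zero    κ b z c y lc len rz y∈ y∉ = contradiction len (no-room rz y∈ y∉ lc)
      g-repeated (suc l) κ b z c y lc len rz y∈ y∉ = g-missing l ((b ∷ κ) ∷ʳ b) (κ ∷ʳ b) ((z ∷ c) ∷ʳ y)
        (trans (cong (λ k → l ℕ.+ suc k) (length-∷ʳ κ b)) (trans (ℕ.+-suc l _) len)) ℕ.≤-refl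
        (λ { (here refl) → ∈.∈-++⁺ʳ κ (here refl) ; (there q) → q }) (range-snoc rz y∈ y∉)

      g-forget-snoc : ∀ l κ b z c y → length c ≡ length κ → l ℕ.+ suc (length κ) ≡ M → InRange (z ∷ c) → y ∈ identity →
                      y ∉ z ∷ c → Σc (λ d → g (l ℕ.∸ 1) ((d ∷ κ) ∷ʳ b) ((z ∷ c) ∷ʳ y)) ≡ g l (κ ∷ʳ b) (c ∷ʳ y)
      g-forget-snoc zero    κ b z c y lc len rz y∈ y∉ = contradiction len (no-room rz y∈ y∉ lc)
      g-forget-snoc (suc l) κ b z c y lc len rz y∈ y∉ = sym (g-forget l (κ ∷ʳ b) z (c ∷ʳ y) (len-snoc c κ y b lc)
        (trans (cong (suc l ℕ.+_) (length-∷ʳ κ b)) len) (range-snoc rz y∈ y∉))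

    -- Appending a new colour b multiplies by x b. The truncated l ∸ 1 does no harm at l = 0: then c
    -- fills all columns and every weight is 0.
    URelation : ℕ → Set
    URelation l = ∀ b κ c → b < M → b ∉ κ → All (_< M) κ → length c ≡ length κ → l ℕ.+ length κ ≡ M → InRange c →
      x b * g l κ c ≡ ∑ℚ identity (λ y → Ā⁻ y c * (w y * g (l ℕ.∸ 1) (κ ∷ʳ b) (c ∷ʳ y)))

    -- A forgotten letter d is restored with a column z. For d ≠ b induction applies, with weights
    -- relative to z ∷ c. For d = b the inductive formula would give 0, as b would be repeated,
    -- whereas `q-relation` gives `Q`; this correction turns the weights relative to z ∷ c into
    -- those relative to c.
    u-relation : ∀ l → URelation l
    u-relation zero b κ c b< b∉ κ< lc len r = trans
      (trans (cong (x b *_) (F-missing κ len b< b∉ _ (valid-comp r))) (ℚ.*-zeroʳ (x b)))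
      (sym (∑-zero identity λ {y} y∈ → trans
        (cong (_* (w y * g 0 (κ ∷ʳ b) (c ∷ʳ y))) (Ā⁻-∈ {y} {c} y∈ (all∈ y∈)))
        (ℚ.*-zeroˡ (w y * g 0 (κ ∷ʳ b) (c ∷ʳ y)))))
      where
      comp≡[] : comp c ≡ []
      comp≡[] with comp c | comp-len {c} {0} r lc len
      ... | [] | _ = refl
      all∈ : ∀ {y} → y ∈ identity → y ∈ c
      all∈ y∈ = ↭.∈-resp-↭ (↭.↭-sym (subst (λ p → Valid (p ++ c)) comp≡[] (valid-comp r))) y∈
    u-relation (suc l) b κ c b< b∉ κ< lc len r = step (proj₁ extra) (proj₂ extra)
      where
      extra = fresh r (ℕ.≤-trans (s≤s (ℕ.≤-trans (ℕ.≤-reflexive lc) (ℕ.m≤n+m (length κ) l))) (ℕ.≤-reflexive len))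
      step : ∀ z → InRange (z ∷ c) → x b * g (suc l) κ c ≡ ∑ℚ identity (λ y → Ā⁻ y c * (w y * g l (κ ∷ʳ b) (c ∷ʳ y)))
      step z rz =   begin
        x b * g (suc l) κ c
          ≡⟨ cong (x b *_) (g-forget l κ z c lc len rz) ⟩
        x b * Σc (λ d → g l (d ∷ κ) (z ∷ c))
          ≡⟨ ∑-* (upTo M) (x b) (λ d → g l (d ∷ κ) (z ∷ c)) ⟨
        Σc (λ d → x b * g l (d ∷ κ) (z ∷ c))
          ≡⟨ ∑-differ (upTo M) {b} Q (∈.∈-upTo⁺ b<) (Unique.upTo⁺ M) differ here′ ⟩
        Σc T + Q
          ≡⟨ cong (_+ Q) (trans (∑-comm (upTo M) identity (λ d y → Ā⁻ y (z ∷ c) * (w y * gz d y))) (∑-cong identity λ {y} y∈ → absorb y y∈)) ⟩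
        ∑ℚ identity (λ y → Ā⁻ y (z ∷ c) * (w y * G y)) + Q
          ≡⟨ ∑-+ identity (λ y → Ā⁻ y (z ∷ c) * (w y * G y)) (λ y → (Ā⁻ y c - Ā⁻ y (z ∷ c)) * (w y * G y)) ⟨
        ∑ℚ identity (λ y → Ā⁻ y (z ∷ c) * (w y * G y) + (Ā⁻ y c - Ā⁻ y (z ∷ c)) * (w y * G y))
          ≡⟨ ∑-cong identity (λ {y} _ → solve 3 (λ a b g → b :* g :+ (a :- b) :* g := a :* g) refl (Ā⁻ y c) (Ā⁻ y (z ∷ c)) (w y * G y)) ⟩
        ∑ℚ identity (λ y → Ā⁻ y c * (w y * G y)) ∎
        where
        open ≡-Reasoning
        G : ℕ → ℚ
        G y = g l (κ ∷ʳ b) (c ∷ʳ y)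
        gz : ℕ → ℕ → ℚ
        gz d y = g (l ℕ.∸ 1) ((d ∷ κ) ∷ʳ b) ((z ∷ c) ∷ʳ y)
        T : ℕ → ℚ
        T d = ∑ℚ identity (λ y → Ā⁻ y (z ∷ c) * (w y * gz d y))
        Q = ∑ℚ identity (λ y → (Ā⁻ y c - Ā⁻ y (z ∷ c)) * (w y * G y))
        len′ : l ℕ.+ suc (length κ) ≡ M
        len′ = trans (ℕ.+-suc l (length κ)) len
        differ : ∀ {d} → d ∈ upTo M → d ≢ b → x b * g l (d ∷ κ) (z ∷ c) ≡ T d
        differ {d} d∈ d≢b = u-relation l b (d ∷ κ) (z ∷ c) b< (λ { (here e) → d≢b (sym e) ; (there p) → b∉ p })
          (∈.∈-upTo⁻ d∈ ∷ κ<) (cong suc lc) len′ rz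
        zero-term : ∀ {y} → y ∈ identity → Ā⁻ y (z ∷ c) * (w y * gz b y) ≡ 0ℚ
        zero-term {y} y∈ = by-membership (y ∈? z ∷ c)
          where
          by-membership : Dec (y ∈ z ∷ c) → Ā⁻ y (z ∷ c) * (w y * gz b y) ≡ 0ℚ
          by-membership (yes p) = trans (cong (_* (w y * gz b y)) (Ā⁻-∈ {y} {z ∷ c} y∈ p)) (ℚ.*-zeroˡ (w y * gz b y))
          by-membership (no ¬p) = trans (cong (λ e → Ā⁻ y (z ∷ c) * (w y * e)) (g-repeated l κ b z c y lc len′ rz y∈ ¬p))
                        (solve 2 (λ a w → a :* (w :* con 0ℚ) := con 0ℚ) refl (Ā⁻ y (z ∷ c)) (w y))
        here′ : x b * g l (b ∷ κ) (z ∷ c) ≡ T b + Q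
        here′ = trans (q-relation l b κ z c b< κ< lc len rz)
          (sym (trans (cong (_+ Q) (∑-zero identity zero-term)) (ℚ.+-identityˡ Q)))
        absorb : ∀ y → y ∈ identity → Σc (λ d → Ā⁻ y (z ∷ c) * (w y * gz d y)) ≡ Ā⁻ y (z ∷ c) * (w y * G y)
        absorb y y∈ = trans
          (trans (∑-cong (upTo M) λ {d} _ → sym (ℚ.*-assoc a (w y) (gz d y))) (∑-* (upTo M) (a * w y) (λ d → gz d y)))
          (trans sums (ℚ.*-assoc a (w y) (G y)))
          where
          a = Ā⁻ y (z ∷ c)
          vanish : y ∈ z ∷ c → ∀ e → (a * w y) * e ≡ 0ℚ
          vanish p e = trans (cong (λ a → (a * w y) * e) (Ā⁻-∈ {y} {z ∷ c} y∈ p)) (solve 2 (λ w e → (con 0ℚ :* w) :* e := con 0ℚ) refl (w y) e)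
          by-membership : Dec (y ∈ z ∷ c) → (a * w y) * Σc (λ d → gz d y) ≡ (a * w y) * G y
          by-membership (yes p) = trans (vanish p (Σc (λ d → gz d y))) (sym (vanish p (G y)))
          by-membership (no ¬p) = cong ((a * w y) *_) (g-forget-snoc l κ b z c y lc len′ rz y∈ ¬p)
          sums : (a * w y) * Σc (λ d → gz d y) ≡ (a * w y) * G y
          sums = by-membership (y ∈? z ∷ c)

-- Linear algebra: injective square matrices and similar traces.

module LinAlg where

  open Rat using (inv; *-inv; -‿cancel)
  open import Data.Fin.Base using (zero; suc)
  open import Data.Rational.Base using (_+_; _*_; _-_; -_)

  open +-*-Solver using (solve; _:+_; _:*_; _:-_; :-_; _:=_; con)

  sum : ∀ {n} → (Fin n → ℚ) → ℚ
  sum {zero}  f = 0ℚ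
  sum {suc n} f = f zero + sum (λ i → f (suc i))

  sum-cong : ∀ {n} {f g : Fin n → ℚ} → (∀ i → f i ≡ g i) → sum f ≡ sum g
  sum-cong {zero}  e = refl
  sum-cong {suc n} e = cong₂ _+_ (e zero) (sum-cong (λ i → e (suc i)))

  sum-+ : ∀ {n} (f g : Fin n → ℚ) → sum (λ i → f i + g i) ≡ sum f + sum g
  sum-+ {zero}  f g = sym (ℚ.+-identityˡ 0ℚ)
  sum-+ {suc n} f g = trans (cong (λ z → (f zero + g zero) + z) (sum-+ (λ i → f (suc i)) (λ i → g (suc i))))
    (solve 4 (λ a b c d → (a :+ b) :+ (c :+ d) := (a :+ c) :+ (b :+ d)) refl
      (f zero) (g zero) (sum (λ i → f (suc i))) (sum (λ i → g (suc i))))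

  sum-remove : ∀ {n} (p : Fin (suc n)) (f : Fin (suc n) → ℚ) → sum f ≡ f p + sum (λ i → f (punchIn p i))
  sum-remove zero f = refl
  sum-remove {suc n} (suc p) f = trans (cong (λ z → f zero + z) (sum-remove p (λ i → f (suc i))))
    (solve 3 (λ a b c → a :+ (b :+ c) := b :+ (a :+ c)) refl (f zero) (f (suc p)) (sum (λ i → f (suc (punchIn p i)))))

  sum-* : ∀ {n} t (f : Fin n → ℚ) → sum (λ i → t * f i) ≡ t * sum f
  sum-* {zero}  t f = sym (ℚ.*-zeroʳ t)
  sum-* {suc n} t f = trans (cong (λ z → t * f zero + z) (sum-* t (λ i → f (suc i))))
    (sym (ℚ.*-distribˡ-+ t (f zero) (sum (λ i → f (suc i)))))

  sum-zero : ∀ {n} {f : Fin n → ℚ} → (∀ i → f i ≡ 0ℚ) → sum f ≡ 0ℚ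
  sum-zero {zero}  e = refl
  sum-zero {suc n} e = trans (cong₂ _+_ (e zero) (sum-zero (λ i → e (suc i)))) (ℚ.+-identityˡ 0ℚ)

  sum-comm : ∀ {m n} (f : Fin m → Fin n → ℚ) → sum (λ i → sum (f i)) ≡ sum (λ j → sum (λ i → f i j))
  sum-comm {zero} {n} f = sym (sum-zero {n} {λ _ → 0ℚ} (λ _ → refl))
  sum-comm {suc m} f = trans (cong (λ z → sum (f zero) + z) (sum-comm (λ i → f (suc i))))
    (sym (sum-+ (f zero) (λ j → sum (λ i → f (suc i) j))))

  sum-single : ∀ {n} (f : Fin n → ℚ) p → (∀ i → i ≢ p → f i ≡ 0ℚ) → sum f ≡ f p
  sum-single {suc n} f p e = trans (sum-remove p f)
    (trans (cong (λ z → f p + z) (sum-zero {f = λ i → f (punchIn p i)} λ i → e (punchIn p i) (Fin.punchInᵢ≢i p i))) (ℚ.+-identityʳ (f p)))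

  -- Gaussian elimination on the first coordinate: n + 1 vectors in dimension n admit a nontrivial
  -- relation.
  dependent : ∀ n (v : Fin (suc n) → Fin n → ℚ) →
              Σ (Fin (suc n) → ℚ) λ a → (Σ (Fin (suc n)) λ i → a i ≢ 0ℚ) × (∀ c → sum (λ i → a i * v i c) ≡ 0ℚ)
  dependent zero    v = (λ _ → 1ℚ) , (zero , λ ()) , λ ()
  dependent (suc n) v with Fin.any? (λ i → ¬? (v i zero ℚ.≟ 0ℚ))
  ... | no none with dependent n (λ i c → v (suc i) (suc c))
  ...   | a′ , (i , a′i≢0) , rel = a , (suc i , a′i≢0) , relation
    where
    a : Fin (suc (suc n)) → ℚ
    a zero    = 0ℚ
    a (suc i) = a′ i
    v₀ : ∀ i → v i zero ≡ 0ℚ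
    v₀ i = decidable-stable (v i zero ℚ.≟ 0ℚ) (λ ne → none (i , ne))
    relation : ∀ c → sum (λ i → a i * v i c) ≡ 0ℚ
    relation zero    = sum-zero λ i → trans (cong (a i *_) (v₀ i)) (ℚ.*-zeroʳ (a i))
    relation (suc c) = trans (cong₂ _+_ (ℚ.*-zeroˡ (v zero (suc c))) (rel c)) (ℚ.+-identityˡ 0ℚ)
  -- Vector p is the pivot that clears coordinate 0 of the others. Its own coefficient `α` is then
  -- forced by coordinate 0.
  dependent (suc n) v | yes (p , vp≢0) with dependent n (λ i c → v (punchIn p i) (suc c) - (v (punchIn p i) zero * inv (v p zero)) * v p (suc c))
  ... | a′ , (i , a′i≢0) , rel = a , (punchIn p i , λ e → a′i≢0 (trans (sym (Vector.insertAt-punchIn a′ p α i)) e)) , relation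
    where
    k = inv (v p zero)
    S = sum (λ i → a′ i * v (punchIn p i) zero)
    α = - (S * k)
    a : Fin (suc (suc n)) → ℚ
    a = insertAt a′ p α
    split : ∀ c → sum (λ i → a i * v i c) ≡ α * v p c + sum (λ i → a′ i * v (punchIn p i) c)
    split c = trans (sum-remove p (λ i → a i * v i c))
      (cong₂ _+_ (cong (_* v p c) (Vector.insertAt-lookup a′ p α))
                 (sum-cong λ i → cong (_* v (punchIn p i) c) (Vector.insertAt-punchIn a′ p α i)))
    relation : ∀ c → sum (λ i → a i * v i c) ≡ 0ℚ
    relation zero    = trans (split zero) (trans
      (solve 3 (λ s k w → (:- (s :* k)) :* w :+ s := s :- s :* (w :* k)) refl S k (v p zero))
      (trans (cong (λ z → S - S * z) (*-inv vp≢0)) (solve 1 (λ s → s :- s :* con 1ℚ := con 0ℚ) refl S)))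
    relation (suc c) = trans (split (suc c)) (trans (sym expand) (rel c))
      where
      open ≡-Reasoning
      vc = v p (suc c)
      V : Fin (suc n) → ℚ
      V i = v (punchIn p i) (suc c)
      Z : Fin (suc n) → ℚ
      Z i = v (punchIn p i) zero
      expand : sum (λ i → a′ i * (V i - (Z i * k) * vc)) ≡ α * vc + sum (λ i → a′ i * V i)
      expand = begin
        sum (λ i → a′ i * (V i - (Z i * k) * vc))
          ≡⟨ sum-cong (λ i → solve 5 (λ a v z k c → a :* (v :- (z :* k) :* c) := (:- (k :* c)) :* (a :* z) :+ a :* v) refl
               (a′ i) (V i) (Z i) k vc) ⟩
        sum (λ i → (- (k * vc)) * (a′ i * Z i) + a′ i * V i)
          ≡⟨ sum-+ (λ i → (- (k * vc)) * (a′ i * Z i)) (λ i → a′ i * V i) ⟩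
        sum (λ i → (- (k * vc)) * (a′ i * Z i)) + sum (λ i → a′ i * V i)
          ≡⟨ cong (_+ sum (λ i → a′ i * V i)) (trans (sum-* (- (k * vc)) (λ i → a′ i * Z i))
               (solve 3 (λ s k c → (:- (k :* c)) :* s := (:- (s :* k)) :* c) refl S k vc)) ⟩
        α * vc + sum (λ i → a′ i * V i) ∎

  module _ {N : ℕ} where

    Matrix : Set
    Matrix = Fin N → Fin N → ℚ

    Injective : Matrix → Set
    Injective G = ∀ (a : Fin N → ℚ) → (∀ i → sum (λ κ → G i κ * a κ) ≡ 0ℚ) → ∀ κ → a κ ≡ 0ℚ

    opaque
      δ : Matrix
      δ i j = if does (i Fin.≟ j) then 1ℚ else 0ℚ

      δ-diag : ∀ i → δ i i ≡ 1ℚ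
      δ-diag i = cong (if_then 1ℚ else 0ℚ) (dec-true (i Fin.≟ i) refl)

      δ-off : ∀ {i j} → i ≢ j → δ i j ≡ 0ℚ
      δ-off {i} {j} ne = cong (if_then 1ℚ else 0ℚ) (dec-false (i Fin.≟ j) ne)

    sum-δʳ : ∀ (f : Fin N → ℚ) j → sum (λ i → f i * δ i j) ≡ f j
    sum-δʳ f j = trans (sum-single (λ i → f i * δ i j) j λ i ne → trans (cong (f i *_) (δ-off ne)) (ℚ.*-zeroʳ (f i)))
      (trans (cong (f j *_) (δ-diag j)) (ℚ.*-identityʳ (f j)))

    sum-δˡ : ∀ (f : Fin N → ℚ) j → sum (λ i → δ j i * f i) ≡ f j
    sum-δˡ f j = trans (sum-single (λ i → δ j i * f i) j λ i ne → trans (cong (_* f i) (δ-off (λ e → ne (sym e)))) (ℚ.*-zeroˡ (f i)))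
      (trans (cong (_* f j) (δ-diag j)) (ℚ.*-identityˡ (f j)))

    infixl 7 _∙_
    _∙_ : Matrix → Matrix → Matrix
    (P ∙ Q) i j = sum (λ k → P i k * Q k j)

    ∙-assoc : ∀ P Q R i j → ((P ∙ Q) ∙ R) i j ≡ (P ∙ (Q ∙ R)) i j
    ∙-assoc P Q R i j = begin
      sum (λ l → sum (λ k → P i k * Q k l) * R l j)
        ≡⟨ sum-cong (λ l → trans (ℚ.*-comm (sum (λ k → P i k * Q k l)) (R l j)) (sym (sum-* (R l j) (λ k → P i k * Q k l)))) ⟩
      sum (λ l → sum (λ k → R l j * (P i k * Q k l)))
        ≡⟨ sum-comm (λ l k → R l j * (P i k * Q k l)) ⟩
      sum (λ k → sum (λ l → R l j * (P i k * Q k l)))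
        ≡⟨ sum-cong (λ k → trans (sum-cong (λ l → solve 3 (λ r p q → r :* (p :* q) := p :* (q :* r)) refl (R l j) (P i k) (Q k l)))
                                 (sum-* (P i k) (λ l → Q k l * R l j))) ⟩
      sum (λ k → P i k * sum (λ l → Q k l * R l j)) ∎
      where open ≡-Reasoning

    trace : Matrix → ℚ
    trace P = sum (λ i → P i i)

    trace-comm : ∀ P Q → trace (P ∙ Q) ≡ trace (Q ∙ P)
    trace-comm P Q = trans (sum-comm (λ i k → P i k * Q k i))
      (sum-cong λ k → sum-cong λ i → ℚ.*-comm (P i k) (Q k i))

    module _ (G : Matrix) (injective : Injective G) where

      -- The right side b and the N columns of G are dependent. Injectivity forces the coefficient
      -- of b to be nonzero, so b can be solved for.
      solvable : ∀ (b : Fin N → ℚ) → Σ (Fin N → ℚ) λ a → ∀ i → sum (λ κ → G i κ * a κ) ≡ b i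
      solvable b with dependent N (λ { zero i → b i ; (suc κ) i → G i κ })
      ... | a , (p , ap≢0) , rel = (λ κ → - inv (a zero) * a (suc κ)) , λ i → begin
        sum (λ κ → G i κ * (- inv (a zero) * a (suc κ)))
          ≡⟨ sum-cong (λ κ → solve 3 (λ g k a → g :* (:- k :* a) := (:- k) :* (a :* g)) refl (G i κ) (inv (a zero)) (a (suc κ))) ⟩
        sum (λ κ → (- inv (a zero)) * (a (suc κ) * G i κ))
          ≡⟨ sum-* (- inv (a zero)) (λ κ → a (suc κ) * G i κ) ⟩
        (- inv (a zero)) * S i
          ≡⟨ solve 4 (λ k s a b → (:- k) :* s := (a :* k) :* b :- k :* (a :* b :+ s)) refl (inv (a zero)) (S i) (a zero) (b i) ⟩
        (a zero * inv (a zero)) * b i - inv (a zero) * (a zero * b i + S i)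
          ≡⟨ cong₂ (λ u v → u * b i - inv (a zero) * v) (*-inv a₀≢0) (rel i) ⟩
        1ℚ * b i - inv (a zero) * 0ℚ
          ≡⟨ solve 2 (λ b k → con 1ℚ :* b :- k :* con 0ℚ := b) refl (b i) (inv (a zero)) ⟩
        b i ∎
        where
        open ≡-Reasoning
        S : Fin N → ℚ
        S i = sum (λ κ → a (suc κ) * G i κ)
        a₀≢0 : a zero ≢ 0ℚ
        a₀≢0 a₀≡0 = ap≢0 (all-zero p)
          where
          tail-zero : ∀ κ → a (suc κ) ≡ 0ℚ
          tail-zero = injective (λ κ → a (suc κ)) λ i → trans
            (sum-cong λ κ → ℚ.*-comm (G i κ) (a (suc κ)))
            (trans (sym (trans (cong (_+ S i) (trans (cong (_* b i) a₀≡0) (ℚ.*-zeroˡ (b i)))) (ℚ.+-identityˡ (S i)))) (rel i))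
          all-zero : ∀ p → a p ≡ 0ℚ
          all-zero zero    = a₀≡0
          all-zero (suc κ) = tail-zero κ

      inverse : Matrix
      inverse κ j = proj₁ (solvable (λ i → δ i j)) κ

      inverseʳ : ∀ i j → (G ∙ inverse) i j ≡ δ i j
      inverseʳ i j = proj₂ (solvable (λ i → δ i j)) i

      -- G sends the difference of the two sides to 0, by the right inverse, and G is injective.
      inverseˡ : ∀ i j → (inverse ∙ G) i j ≡ δ i j
      inverseˡ i j = -‿cancel (injective (λ κ → (inverse ∙ G) κ j - δ κ j) (λ i → begin
        sum (λ κ → G i κ * ((inverse ∙ G) κ j - δ κ j))
          ≡⟨ sum-cong (λ κ → solve 3 (λ g u d → g :* (u :- d) := g :* u :+ (:- con 1ℚ) :* (g :* d)) refl (G i κ) ((inverse ∙ G) κ j) (δ κ j)) ⟩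
        sum (λ κ → G i κ * (inverse ∙ G) κ j + (- 1ℚ) * (G i κ * δ κ j))
          ≡⟨ sum-+ (λ κ → G i κ * (inverse ∙ G) κ j) (λ κ → (- 1ℚ) * (G i κ * δ κ j)) ⟩
        (G ∙ (inverse ∙ G)) i j + sum (λ κ → (- 1ℚ) * (G i κ * δ κ j))
          ≡⟨ cong₂ _+_ (trans (sym (∙-assoc G inverse G i j)) (trans (sum-cong λ k → cong (_* G k j) (inverseʳ i k)) (sum-δˡ (λ k → G k j) i)))
               (trans (sum-* (- 1ℚ) (λ κ → G i κ * δ κ j)) (cong ((- 1ℚ) *_) (sum-δʳ (G i) j))) ⟩
        G i j + (- 1ℚ) * G i j
          ≡⟨ solve 1 (λ g → g :+ (:- con 1ℚ) :* g := con 0ℚ) refl (G i j) ⟩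
        0ℚ ∎) i)
        where open ≡-Reasoning

      trace-intertwined : ∀ P Q → (∀ i j → (P ∙ G) i j ≡ (G ∙ Q) i j) → trace P ≡ trace Q
      trace-intertwined P Q e = begin
        trace P                           ≡⟨ sum-cong (λ i → sum-δʳ (P i) i) ⟨
        sum (λ i → sum (λ k → P i k * δ k i))
          ≡⟨ sum-cong (λ i → sum-cong λ k → cong (P i k *_) (inverseʳ k i)) ⟨
        trace (P ∙ (G ∙ inverse))         ≡⟨ sum-cong (λ i → ∙-assoc P G inverse i i) ⟨
        trace ((P ∙ G) ∙ inverse)         ≡⟨ sum-cong (λ i → sum-cong λ k → cong (_* inverse k i) (e i k)) ⟩
        trace ((G ∙ Q) ∙ inverse)         ≡⟨ trace-comm (G ∙ Q) inverse ⟩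
        trace (inverse ∙ (G ∙ Q))         ≡⟨ sum-cong (λ i → ∙-assoc inverse G Q i i) ⟨
        trace ((inverse ∙ G) ∙ Q)         ≡⟨ sum-cong (λ i → trans (sum-cong λ k → cong (_* Q k i) (inverseˡ i k)) (sum-δˡ (λ k → Q k i) i)) ⟩
        trace Q ∎
        where open ≡-Reasoning

-- Independence of the truncated eigenfunctions and equality of the two traces.

module Traces where

  open Rat
  open Eigen
  open Coeff
  open Lists
  open Sums
  open Seminormal
  open Intertwiner
  open LinAlg
  open import Data.Fin.Base using (zero; suc)
  open import Data.Rational.Base using (_+_; _*_; _-_; -_)
  open import Data.List.Base using (lookup; tabulate)
  open import Data.List.Membership.DecPropositional ℕ._≟_ using (_∈?_)

  open +-*-Solver using (solve; _:+_; _:*_; _:-_; :-_; _:=_; con)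

  lastn : {B : Set} → ℕ → List B → List B
  lastn d c = drop (length c ℕ.∸ d) c

  lastn-++ : ∀ {B : Set} (p : List B) {c d} → length c ≡ d → lastn d (p ++ c) ≡ c
  lastn-++ {B} p {c} {d} refl = trans (cong (λ k → drop k (p ++ c)) eq) (drop-length-++ p c)
    where
    eq : length (p ++ c) ℕ.∸ length c ≡ length p
    eq = trans (cong (ℕ._∸ length c) (List.length-++ p)) (ℕ.m+n∸n≡m (length p) (length c))
    drop-length-++ : ∀ {B : Set} (p c : List B) → drop (length p) (p ++ c) ≡ c
    drop-length-++ []      c = refl
    drop-length-++ (_ ∷ p) c = drop-length-++ p c

  lastn-split : ∀ {B : Set} d (c : List B) → d ≤ length c → ∃[ p ] c ≡ p ++ lastn d c × length (lastn d c) ≡ d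
  lastn-split d c le = take (length c ℕ.∸ d) c , sym (List.take++drop≡id (length c ℕ.∸ d) c)
    , trans (List.length-drop (length c ℕ.∸ d) c) (ℕ.m∸[m∸n]≡n le)

  δ′ : List ℕ → List ℕ → ℚ
  δ′ a b = if does (List.≡-dec ℕ._≟_ a b) then 1ℚ else 0ℚ

  δ′-same : ∀ a → δ′ a a ≡ 1ℚ
  δ′-same a = cong (if_then 1ℚ else 0ℚ) (dec-true (List.≡-dec ℕ._≟_ a a) refl)

  δ′-diff : ∀ {a b} → a ≢ b → δ′ a b ≡ 0ℚ
  δ′-diff {a} {b} ne = cong (if_then 1ℚ else 0ℚ) (dec-false (List.≡-dec ℕ._≟_ a b) ne)

  -- For each d in ds, the last d entries of the current list, k long at the start, are kept and one entry is appended.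
  Windows : ℕ → ℕ → ℕ → List ℕ → Set
  Windows M k₀ k []       = k₀ ≤ k
  Windows M k₀ k (d ∷ ds) = d ≤ k × d < M × Windows M k₀ (suc d) ds

  -- κ lists the colours of the vertices that are still remembered.
  𝒱 : (ℕ → ℚ) → ℕ → List ℕ → List ℕ → (List ℕ → ℚ) → ℚ
  𝒱 x M []       κ H = H κ
  𝒱 x M (d ∷ ds) κ H = ∑ℚ (upTo M) λ b →
    (if does (b ∈? lastn d κ) then 0ℚ else x b) * 𝒱 x M ds (lastn d κ ∷ʳ b) H

  𝒲 : (ℕ → ℚ) → ℕ → List ℕ → List ℕ → (List ℕ → ℚ) → ℚ
  𝒲 w M []       c H = H c
  𝒲 w M (d ∷ ds) c H = ∑ℚ (ids 1 M) λ y →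
    Ā (y ℕ.∸ 1) (lastn d c) * (w y * 𝒲 w M ds (lastn d c ∷ʳ y) H)

  injWords : ℕ → ℕ → List (List ℕ)
  injWords M k = filter unique? (seqs (upTo M) k)

  private
    ++-injective : ∀ (v v′ : List ℕ) {κ κ′} → length v ≡ length v′ → v ++ κ ≡ v′ ++ κ′ → v ≡ v′ × κ ≡ κ′
    ++-injective []      []        _ e = refl , e
    ++-injective (a ∷ v) (b ∷ v′) l e with List.∷-injective e
    ... | refl , e′ with ++-injective v v′ (ℕ.suc-injective l) e′
    ...   | refl , e″ = refl , e″

    at-++ : ∀ p a κ → at (p ++ a ∷ κ) (length p) ≡ a
    at-++ []      a κ = refl
    at-++ (_ ∷ p) a κ = at-++ p a κ

    ∑-allFin : ∀ {n} (f : Fin n → ℚ) → ∑ℚ (allFin n) f ≡ sum f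
    ∑-allFin {n} f = go n id f
      where
      go : ∀ n {N} (g : Fin n → Fin N) (f : Fin N → ℚ) → ∑ℚ (tabulate g) f ≡ sum (f ∘ g)
      go zero    g f = refl
      go (suc n) g f = cong (λ z → f (g zero) + z) (go n (g ∘ suc) f)

    ∑-lookup : ∀ {B : Set} (K : List B) (f : B → ℚ) → ∑ℚ K f ≡ sum (f ∘ lookup K)
    ∑-lookup []      f = refl
    ∑-lookup (b ∷ K) f = cong (λ z → f b + z) (∑-lookup K f)

  module TraceIdentity (m : ℕ) (x : ℕ → ℚ)
    (x-distinct : ∀ {a b} → a < suc (suc m) → b < suc (suc m) → a ≢ b → x a ≢ x b)
    (x-positive : ∀ {a} → a < suc (suc m) → 0ℚ ℚ.< x a) where

    open Intertwining m x x-distinct x-positive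
    open Representation m W.ρ
    open Spectrum x x-distinct
    open IsLinear
    open Killed kill using (F-missing)

    -- Where the letters differ, the Lagrange product for the letter of κ₀ contains the factor of
    -- the letter of κ′, evaluated at its own root.
    coef-differ : ∀ p κ′ κ₀ → length κ₀ ≡ length κ′ → κ₀ ≢ κ′ → All (_< M) κ′ → coef (length p) κ₀ (p ++ κ′) ≡ 0ℚ
    coef-differ p []       []       len ne κ< = contradiction refl ne
    coef-differ p (a ∷ κ′) (b ∷ κ₀) len ne (a< ∷ κ<) = go (a ℕ.≟ b)
      where
      here-letter : ℕ
      here-letter = at (p ++ a ∷ κ′) (length p)
      f : ℕ → ℚ
      f b′ = x here-letter - x b′
      factor-zero : ∀ b → a ≢ b → ∏ℚ (others b) f ≡ 0ℚ
      factor-zero b a≢b = ∏-zero (others b) f (∈-others a< a≢b)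
        (trans (cong (λ e → x e - x a) (at-++ p a κ′)) (ℚ.+-inverseʳ (x a)))
      later-zero : a ≡ b → coef (suc (length p)) κ₀ (p ++ a ∷ κ′) ≡ 0ℚ
      later-zero refl = trans
        (cong₂ (λ i κ → coef i κ₀ κ) (sym (trans (List.length-++ p) (ℕ.+-comm (length p) 1))) (sym (List.++-assoc p (a ∷ []) κ′)))
        (coef-differ (p ∷ʳ a) κ′ κ₀ (ℕ.suc-injective len) (ne ∘ cong (a ∷_)) κ<)
      go : Dec (a ≡ b) → coef (length p) (b ∷ κ₀) (p ++ a ∷ κ′) ≡ 0ℚ
      go (no a≢b) = trans (cong (_* coef (suc (length p)) κ₀ (p ++ a ∷ κ′)) (factor-zero b a≢b))
        (ℚ.*-zeroˡ (coef (suc (length p)) κ₀ (p ++ a ∷ κ′)))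
      go (yes e)  = trans (cong (∏ℚ (others b) f *_) (later-zero e)) (ℚ.*-zeroʳ (∏ℚ (others b) f))

    coef-same : ∀ p κ → All (_< M) κ → coef (length p) κ (p ++ κ) ≢ 0ℚ
    coef-same p []      _ ()
    coef-same p (a ∷ κ) (a< ∷ κ<) = *-nonzero
      (∏-nonzero (others a) (λ b → x (at (p ++ a ∷ κ) (length p)) - x b) (All.tabulate factor))
      (subst (_≢ 0ℚ) (cong₂ (λ i κ′ → coef i κ κ′) (trans (List.length-++ p) (ℕ.+-comm (length p) 1)) (List.++-assoc p (a ∷ []) κ))
        (coef-same (p ∷ʳ a) κ κ<))
      where
      factor : ∀ {b} → b ∈ others a → x (at (p ++ a ∷ κ) (length p)) - x b ≢ 0ℚ
      factor {b} b∈ e with ∈.∈-filter⁻ (λ b′ → ¬? (b′ ℕ.≟ a)) {xs = upTo M} b∈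
      ... | b∈′ , b≢a = x-distinct a< (∈.∈-upTo⁻ b∈′) (b≢a ∘ sym)
            (trans (cong x (sym (at-++ p a κ))) (-‿cancel e))

    F-transfer : ∀ p {xs ys} → xs ↭ ys → length (p ++ xs) ≡ M → F (p ++ xs) ≈ O → F (p ++ ys) ≈ O
    F-transfer p ↭.refl len e = e
    F-transfer p (↭.prep {xs} {ys} a q) len e = subst (λ κ → F κ ≈ O) (List.++-assoc p (a ∷ []) ys)
      (F-transfer (p ∷ʳ a) q (trans (cong length (List.++-assoc p (a ∷ []) xs)) len)
        (subst (λ κ → F κ ≈ O) (sym (List.++-assoc p (a ∷ []) xs)) e))
    F-transfer p (↭.swap {xs} {ys} a b q) len e = ≈-trans
      (≈-reflexive (cong F (sym (swapAt-++ p a b ys))))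
      (≈-trans (≈-sym (s-F (length p) (p ++ a ∷ b ∷ ys) len′ l≤m))
        (≈-trans (IsAction.s-cong isAction (length p) e′) (O-≈ (s-linear (length p)))))
      where
      len′ : length (p ++ a ∷ b ∷ ys) ≡ M
      len′ = trans (↭.↭-length (↭.++⁺ˡ p (↭.↭-sym (↭.prep a (↭.prep b q))))) len
      e′ : F (p ++ a ∷ b ∷ ys) ≈ O
      e′ = subst (λ κ → F κ ≈ O) (List.++-assoc p (a ∷ b ∷ []) ys)
        (F-transfer (p ++ a ∷ b ∷ []) q (trans (cong length (List.++-assoc p (a ∷ b ∷ []) xs)) len)
          (subst (λ κ → F κ ≈ O) (sym (List.++-assoc p (a ∷ b ∷ []) xs)) e))
      l≤m : length p ≤ m
      l≤m = ℕ.s≤s⁻¹ (ℕ.s≤s⁻¹ (ℕ.≤-trans (ℕ.≤-reflexive (ℕ.+-comm 2 (length p)))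
        (ℕ.≤-trans (ℕ.+-monoʳ-≤ (length p) (s≤s (s≤s (z≤n {length xs}))))
          (ℕ.≤-reflexive (trans (sym (List.length-++ p)) len)))))
    F-transfer p (↭.trans q q′) len e = F-transfer p q′ (trans (sym (↭.↭-length (↭.++⁺ˡ p q))) len) (F-transfer p q len e)

    ↭-upTo : ∀ {κ} → Unique κ → length κ ≡ M → All (_< M) κ → κ ↭ upTo M
    ↭-upTo u len κ< = unique-⊆⇒↭ u (λ a∈ → ∈.∈-upTo⁺ (All.lookup κ< a∈)) (ℕ.≤-reflexive (trans (List.length-upTo M) (sym len)))

    -- The transpositions permute the `F κ`, so one vanishing permutation makes all of them vanish.
    -- Words missing a colour vanish anyway, and `peel-all` would yield 1 = 0 at the identity word.
    F-nonzero : ∀ {κ} → Unique κ → length κ ≡ M → All (_< M) κ → ¬ (F κ ≈ O)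
    F-nonzero {κ₀} u len κ< e = contradiction (one≈O identity ↭.refl) λ ()
      where
      all-zero : ∀ κ → length κ ≡ M → All (_< M) κ → F κ ≈ O
      all-zero κ len′ κ<′ with All.all? (_∈? κ) (upTo M)
      ... | yes all = F-transfer [] (↭.trans (↭-upTo u len κ<)
              (unique-⊆⇒↭ (Unique.upTo⁺ M) (λ a∈ → All.lookup all a∈) (ℕ.≤-reflexive (trans len′ (sym (List.length-upTo M)))))) len e
      ... | no ¬all with find (All.¬All⇒Any¬ (_∈? κ) (upTo M) ¬all)
      ...   | a , a∈ , a∉ = F-missing κ len′ (∈.∈-upTo⁻ a∈) a∉
      one≈O : one ≈ O
      one≈O = peel-all M 0 one ℕ.≤-refl all-zero

    Σw-* : ∀ l t f → Σw l (λ v → t * f v) ≡ t * Σw l f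
    Σw-* zero    t f = refl
    Σw-* (suc l) t f = trans (∑-cong (upTo M) λ {b} _ → Σw-* l t (f ∘ (b ∷_))) (∑-* (upTo M) t (λ b → Σw l (f ∘ (b ∷_))))

    Σw-comm : ∀ l k (f : List ℕ → List ℕ → ℚ) → Σw l (λ v → Σw k (f v)) ≡ Σw k (λ κ → Σw l (λ v → f v κ))
    Σw-comm l zero    f = refl
    Σw-comm l (suc k) f = trans (Σw-∑ l (upTo M) (λ v b → Σw k (f v ∘ (b ∷_))))
      (∑-cong (upTo M) λ {b} _ → Σw-comm l k (λ v → f v ∘ (b ∷_)))

    Σw-split : ∀ l k f → Σw (l ℕ.+ k) f ≡ Σw l (λ v → Σw k (λ κ → f (v ++ κ)))
    Σw-split zero    k f = refl
    Σw-split (suc l) k f = ∑-cong (upTo M) λ {b} _ → Σw-split l k (f ∘ (b ∷_))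

    Σw-single : ∀ κ f → All (_< M) κ → (∀ κ′ → length κ′ ≡ length κ → All (_< M) κ′ → κ′ ≢ κ → f κ′ ≡ 0ℚ) → Σw (length κ) f ≡ f κ
    Σw-single []      f _         z = refl
    Σw-single (b ∷ κ) f (b< ∷ κ<) z = trans
      (∑-single (upTo M) (∈.∈-upTo⁺ b<) (Unique.upTo⁺ M) λ {a} a∈ a≢b →
        Σw-zero (length κ) λ v lv v< → z (a ∷ v) (cong suc lv) (∈.∈-upTo⁻ a∈ ∷ v<) (a≢b ∘ proj₁ ∘ List.∷-injective))
      (Σw-single κ (f ∘ (b ∷_)) κ< λ κ′ lκ κ′< ne → z (b ∷ κ′) (cong suc lκ) (b< ∷ κ′<) (ne ∘ proj₂ ∘ List.∷-injective))

    module _ (l k : ℕ) (len : l ℕ.+ k ≡ M) {B : Set} (K : List B) (κ : B → List ℕ) (a : B → ℚ) (uK : Unique K)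
      (κ-ok : ∀ {b} → b ∈ K → length (κ b) ≡ k × All (_< M) (κ b)) (κ-inj : ∀ {b b′} → κ b ≡ κ b′ → b ≡ b′)
      (rel : ∀ c → InRange c → length c ≡ k → ∑ℚ K (λ b → a b * g l (κ b) c) ≡ 0ℚ) where

      private
        eigenvector-zero : ∀ {b₀} → b₀ ∈ K → a b₀ ≢ 0ℚ → ∀ v₀ → length v₀ ≡ l → All (_< M) v₀ → F (v₀ ++ κ b₀) ≈ O
        eigenvector-zero {b₀} b₀∈ ne v₀ len-v₀ v₀< = vanish
          where
          full = v₀ ++ κ b₀
          full< : All (_< M) full
          full< = All.++⁺ v₀< (proj₂ (κ-ok b₀∈))
          len-full : length full ≡ M
          len-full = trans (List.length-++ v₀) (trans (cong₂ ℕ._+_ len-v₀ (proj₁ (κ-ok b₀∈))) len)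
          len-++ : ∀ {v b} → b ∈ K → length v ≡ l → length (v ++ κ b) ≡ M
          len-++ {v} b∈ lv = trans (List.length-++ v) (trans (cong₂ ℕ._+_ lv (proj₁ (κ-ok b∈))) len)
          -- The given relation lifted to full words: at a valid word, `Gl` is `g` of its last k
          -- columns.
          V : X
          V c = Σw l (λ v → ∑ℚ K (λ b → a b * F (v ++ κ b) c))
          V≈O : V ≈ O
          V≈O c valid = trans (Σw-∑ l K (λ v b → a b * F (v ++ κ b) c)) (trans
            (∑-cong K λ {b} b∈ → trans (Σw-* l (a b) (λ v → F (v ++ κ b) c)) (cong (a b *_)
              (trans (cong (Gl l (κ b)) (sym split)) (g-eq (take l c) l (κ b) valid′ take-len (trans (cong (l ℕ.+_) (proj₁ (κ-ok b∈))) len)))))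
            (rel (drop l c) (valid⇒range (take l c) valid′)
              (trans (List.length-drop l c) (trans (cong (ℕ._∸ l) (trans (valid-length valid) (sym len))) (ℕ.m+n∸m≡n l k)))))
            where
            split : take l c ++ drop l c ≡ c
            split = List.take++drop≡id l c
            valid′ : Valid (take l c ++ drop l c)
            valid′ = subst Valid (sym split) valid
            take-len : length (take l c) ≡ l
            take-len = trans (List.length-take l c) (ℕ.m≤n⇒m⊓n≡m (ℕ.≤-trans (ℕ.m≤m+n l k) (ℕ.≤-reflexive (trans len (sym (valid-length valid))))))
          -- The interpolation operator for `full` scales each eigenfunction by `coef`, and by
          -- `coef-differ` only the term of `v₀` and `b₀` survives.
          project : Pk 0 full V ≈ λ c → Σw l (λ v → ∑ℚ K (λ b → a b * (coef 0 full (v ++ κ b) * F (v ++ κ b) c)))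
          project c valid = trans (linear-Σw P l (λ v c → ∑ℚ K (λ b → a b * F (v ++ κ b) c)) c valid)
            (Σw-cong l λ v lv v< → trans (linear-∑ P K (λ b → scale (a b) (F (v ++ κ b))) c valid)
              (∑-cong K λ {b} b∈ → trans (scale-≈ P (a b) (F (v ++ κ b)) c valid)
                (cong (a b *_) (Pk-F 0 full (v ++ κ b) (len-++ {v} b∈ lv) (All.++⁺ v< (proj₂ (κ-ok b∈))) (ℕ.≤-reflexive len-full) c valid))))
            where P = Pk-linear 0 full
          differ : ∀ {v b} c → b ∈ K → length v ≡ l → All (_< M) v → full ≢ v ++ κ b →
                   a b * (coef 0 full (v ++ κ b) * F (v ++ κ b) c) ≡ 0ℚ
          differ {v} {b} c b∈ lv v< ne = trans (cong (λ e → a b * (e * F (v ++ κ b) c))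
              (coef-differ [] (v ++ κ b) full (trans len-full (sym (len-++ {v} b∈ lv))) ne (All.++⁺ v< (proj₂ (κ-ok b∈)))))
            (solve 2 (λ a f → a :* (con 0ℚ :* f) := con 0ℚ) refl (a b) (F (v ++ κ b) c))
          vanish : F full ≈ O
          vanish c valid = domain (trans (sym single) (trans (sym (project c valid)) (trans (cong-≈ P V≈O c valid) (O-≈ P c valid))))
            where
            open import Defs using (ℚ-domain)
            P = Pk-linear 0 full
            single : Σw l (λ v → ∑ℚ K (λ b → a b * (coef 0 full (v ++ κ b) * F (v ++ κ b) c))) ≡ a b₀ * (coef 0 full full * F full c)
            single = trans (cong (λ l → Σw l (λ v → ∑ℚ K (λ b → a b * (coef 0 full (v ++ κ b) * F (v ++ κ b) c)))) (sym len-v₀)) (trans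
              (Σw-single v₀ (λ v → ∑ℚ K (λ b → a b * (coef 0 full (v ++ κ b) * F (v ++ κ b) c))) v₀< λ v lv v< ne′ → ∑-zero K {λ b → a b * (coef 0 full (v ++ κ b) * F (v ++ κ b) c)} λ {b} b∈ →
                differ {v} c b∈ (trans lv len-v₀) v< λ e → ne′ (sym (proj₁ (++-injective v₀ v (sym lv) e))))
              (∑-single K {f = λ b → a b * (coef 0 full (v₀ ++ κ b) * F (v₀ ++ κ b) c)} b₀∈ uK λ {b} b∈ b≢b₀ → differ {v₀} c b∈ len-v₀ v₀< λ e → b≢b₀ (κ-inj (sym (proj₂ (++-injective v₀ v₀ refl e))))))
            domain : a b₀ * (coef 0 full full * F full c) ≡ 0ℚ → F full c ≡ 0ℚ
            domain e = ℚ-domain (coef 0 full full) (F full c) (coef-same [] full full<) (ℚ-domain (a b₀) (coef 0 full full * F full c) ne e)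

      -- The functions g l κ are joint eigenfunctions with distinct eigenvalues.
      independent : ∀ {b₀} → b₀ ∈ K → Unique (κ b₀) → a b₀ ≡ 0ℚ
      independent {b₀} b₀∈ u₀ = decidable-stable (a b₀ ℚ.≟ 0ℚ) λ ne →
        F-nonzero unique-full len-full (All.++⁺ v₀< κ₀<) (eigenvector-zero b₀∈ ne v₀ len-v₀ v₀<)
        where
        κ₀ v₀ : List ℕ
        κ₀ = κ b₀
        v₀ = filter (λ c → ¬? (c ∈? κ₀)) (upTo M)
        κ₀< : All (_< M) κ₀
        κ₀< = proj₂ (κ-ok b₀∈)
        v₀< : All (_< M) v₀
        v₀< = All.tabulate λ p → ∈.∈-upTo⁻ (proj₁ (∈.∈-filter⁻ (λ c → ¬? (c ∈? κ₀)) {xs = upTo M} p))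
        unique-full : Unique (v₀ ++ κ₀)
        unique-full = Unique.++⁺ (Unique.filter⁺ (λ c → ¬? (c ∈? κ₀)) (Unique.upTo⁺ M)) u₀
          (λ (p , q) → proj₂ (∈.∈-filter⁻ (λ c → ¬? (c ∈? κ₀)) {xs = upTo M} p) q)
        covers : upTo M ⊆ v₀ ++ κ₀
        covers {c} c∈ with c ∈? κ₀
        ... | yes p = ∈.∈-++⁺ʳ v₀ p
        ... | no ¬p = ∈.∈-++⁺ˡ (∈.∈-filter⁺ (λ c → ¬? (c ∈? κ₀)) c∈ ¬p)
        len-full : length (v₀ ++ κ₀) ≡ M
        len-full = trans (↭.↭-length (unique-set⇒↭ unique-full (Unique.upTo⁺ M)
          (λ p → ∈.∈-upTo⁺ (All.lookup (All.++⁺ v₀< κ₀<) p)) covers)) (List.length-upTo M)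
        len-v₀ : length v₀ ≡ l
        len-v₀ = ℕ.+-cancelʳ-≡ k (length v₀) l (trans (trans (cong (length v₀ ℕ.+_) (sym (proj₁ (κ-ok b₀∈)))) (sym (List.length-++ v₀)))
          (trans len-full (sym len)))

    ĝ : List ℕ → List ℕ → ℚ
    ĝ κ c = g (M ℕ.∸ length κ) κ c

    private
      ∸-step : ∀ {k} → k < M → M ℕ.∸ k ≡ suc (M ℕ.∸ suc k)
      ∸-step {k} (s≤s k≤) = ℕ.+-∸-assoc 1 k≤

    ĝ-forget : ∀ κ z c → length c ≡ length κ → length κ < M → InRange (z ∷ c) → ĝ κ c ≡ Σc (λ b → ĝ (b ∷ κ) (z ∷ c))
    ĝ-forget κ z c lc κ< r = trans (cong (λ l → g l κ c) (∸-step κ<))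
      (g-forget (M ℕ.∸ suc (length κ)) κ z c lc (trans (sym (ℕ.+-suc (M ℕ.∸ suc (length κ)) (length κ))) (ℕ.m∸n+n≡m κ<)) r)

    range-drop : ∀ p {c} → InRange (p ++ c) → InRange c
    range-drop []      r = r
    range-drop (_ ∷ p) r = range-drop p (range-tail r)

    range-length : ∀ {c} → InRange c → length c ≤ M
    range-length {c} r = ℕ.≤-trans (ℕ.m≤n+m (length c) (length (comp c))) (ℕ.≤-reflexive (comp-length r))

    ĝ-extend : ∀ p κ c → length c ≡ length κ → InRange (p ++ c) → ĝ κ c ≡ Σw (length p) (λ v → ĝ (v ++ κ) (p ++ c))
    ĝ-extend []      κ c lc r = refl
    ĝ-extend (z ∷ p) κ c lc r = trans (ĝ-extend p κ c lc (range-tail r)) (trans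
      (Σw-cong (length p) λ v lv _ → ĝ-forget (v ++ κ) z (p ++ c)
        (trans (List.length-++ p) (trans (cong₂ ℕ._+_ (sym lv) lc) (sym (List.length-++ v))))
        (subst (_< M) (trans (List.length-++ p) (trans (cong₂ ℕ._+_ (sym lv) lc) (sym (List.length-++ v)))) (range-length r)) r)
      (Σw-∑ (length p) (upTo M) (λ v b → ĝ (b ∷ v ++ κ) (z ∷ p ++ c))))

    -- Shrinking the window on the colour side matches shrinking it on the column side: the surplus
    -- letters of κ are summed out, and by `ĝ-extend` this absorbs the surplus columns of c.
    ĝ-window : ∀ d c (h : List ℕ → ℚ) → d ≤ length c → InRange c →
               Σw (length c) (λ κ → ĝ κ c * h (lastn d κ)) ≡ Σw d (λ κ → ĝ κ (lastn d c) * h κ)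
    ĝ-window d c h d≤ r = begin
      Σw (length c) (λ κ → ĝ κ c * h (lastn d κ))
        ≡⟨ cong (λ c″ → Σw (length c″) (λ κ → ĝ κ c″ * h (lastn d κ))) e ⟩
      Σw (length (p ++ c′)) f
        ≡⟨ cong (λ k → Σw k f) (trans (List.length-++ p) (cong (length p ℕ.+_) l)) ⟩
      Σw (length p ℕ.+ d) f
        ≡⟨ Σw-split (length p) d f ⟩
      Σw (length p) (λ v → Σw d (λ κ → f (v ++ κ)))
        ≡⟨ Σw-comm (length p) d (λ v κ → f (v ++ κ)) ⟩
      Σw d (λ κ → Σw (length p) (λ v → f (v ++ κ)))
        ≡⟨ Σw-cong d (λ κ lκ _ → collapse κ lκ) ⟩
      Σw d (λ κ → ĝ κ c′ * h κ) ∎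
      where
      open ≡-Reasoning
      c′ p : List ℕ
      c′ = lastn d c
      p = proj₁ (lastn-split d c d≤)
      e : c ≡ p ++ c′
      e = proj₁ (proj₂ (lastn-split d c d≤))
      l : length c′ ≡ d
      l = proj₂ (proj₂ (lastn-split d c d≤))
      f : List ℕ → ℚ
      f κ = ĝ κ (p ++ c′) * h (lastn d κ)
      collapse : ∀ κ → length κ ≡ d → Σw (length p) (λ v → f (v ++ κ)) ≡ ĝ κ c′ * h κ
      collapse κ lκ = begin
        Σw (length p) (λ v → f (v ++ κ))
          ≡⟨ Σw-cong (length p) (λ v _ _ → trans (cong (λ κ′ → ĝ (v ++ κ) (p ++ c′) * h κ′) (lastn-++ v {κ} lκ))
               (ℚ.*-comm (ĝ (v ++ κ) (p ++ c′)) (h κ))) ⟩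
        Σw (length p) (λ v → h κ * ĝ (v ++ κ) (p ++ c′))
          ≡⟨ Σw-* (length p) (h κ) (λ v → ĝ (v ++ κ) (p ++ c′)) ⟩
        h κ * Σw (length p) (λ v → ĝ (v ++ κ) (p ++ c′))
          ≡⟨ cong (h κ *_) (ĝ-extend p κ c′ (trans l (sym lκ)) (subst InRange e r)) ⟨
        h κ * ĝ κ c′
          ≡⟨ ℚ.*-comm (h κ) (ĝ κ c′) ⟩
        ĝ κ c′ * h κ ∎

    ĝ-missing : ∀ κ κ⁻ c → length κ ≤ M → length κ⁻ < length κ → κ ⊆ κ⁻ → InRange c → ĝ κ c ≡ 0ℚ
    ĝ-missing κ κ⁻ c le = g-missing (M ℕ.∸ length κ) κ κ⁻ c (ℕ.m∸n+n≡m le)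

    -- The intertwining of a single step. A colour that is already in κ gives 0, because `ĝ`
    -- vanishes at words with a repeated letter: this is how properness of a colouring appears on
    -- the column side.
    ĝ-append : ∀ b κ c → b < M → All (_< M) κ → length c ≡ length κ → length κ < M → InRange c →
      ∑ℚ identity (λ y → Ā⁻ y c * (w y * ĝ (κ ∷ʳ b) (c ∷ʳ y))) ≡ (if does (b ∈? κ) then 0ℚ else x b) * ĝ κ c
    ĝ-append b κ c b< κ< lc lκ r = go (b ∈? κ)
      where
      term : ℕ → ℕ → ℚ
      term l y = Ā⁻ y c * (w y * g l (κ ∷ʳ b) (c ∷ʳ y))
      zero-term : b ∈ κ → ∀ y → y ∈ identity → Ā⁻ y c * (w y * ĝ (κ ∷ʳ b) (c ∷ʳ y)) ≡ 0ℚ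
      zero-term b∈ y y∈ with y ∈? c
      ... | yes y∈c = trans (cong (_* (w y * ĝ (κ ∷ʳ b) (c ∷ʳ y))) (Ā⁻-∈ {y} {c} y∈ y∈c)) (ℚ.*-zeroˡ (w y * ĝ (κ ∷ʳ b) (c ∷ʳ y)))
      ... | no y∉ = trans (cong (λ e → Ā⁻ y c * (w y * e)) (ĝ-missing (κ ∷ʳ b) κ (c ∷ʳ y)
              (ℕ.≤-trans (ℕ.≤-reflexive (length-∷ʳ κ b)) lκ) (ℕ.≤-reflexive (sym (length-∷ʳ κ b))) sub (range-snoc r y∈ y∉)))
            (solve 2 (λ a w → a :* (w :* con 0ℚ) := con 0ℚ) refl (Ā⁻ y c) (w y))
        where
        sub : κ ∷ʳ b ⊆ κ
        sub p with ∈.∈-++⁻ κ p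
        ... | inj₁ q = q
        ... | inj₂ (here refl) = b∈
      go : (b∈? : Dec (b ∈ κ)) → ∑ℚ identity (λ y → Ā⁻ y c * (w y * ĝ (κ ∷ʳ b) (c ∷ʳ y))) ≡ (if does b∈? then 0ℚ else x b) * ĝ κ c
      go (yes b∈) = trans (∑-zero identity λ {y} y∈ → zero-term b∈ y y∈) (sym (ℚ.*-zeroˡ (ĝ κ c)))
      go (no b∉)  = trans
        (cong (λ l → ∑ℚ identity (term l)) (trans (cong (M ℕ.∸_) (length-∷ʳ κ b)) (sym (ℕ.pred[m∸n]≡m∸[1+n] M (length κ)))))
        (sym (u-relation (M ℕ.∸ length κ) b κ c b< b∉ κ< lc (ℕ.m∸n+n≡m (ℕ.<⇒≤ lκ)) r))

    range-lastn : ∀ d {c} → InRange c → InRange (lastn d c)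
    range-lastn d {c} r = range-drop (take (length c ℕ.∸ d) c) (subst InRange (sym (List.take++drop≡id (length c ℕ.∸ d) c)) r)

    𝒲-cong : ∀ k₀ ds {k} c {H H′} → Windows M k₀ k ds → length c ≡ k → InRange c →
             (∀ c′ → InRange c′ → k₀ ≤ length c′ → H c′ ≡ H′ c′) → 𝒲 w M ds c H ≡ 𝒲 w M ds c H′
    𝒲-cong k₀ []       c ok lc r e = e c r (ℕ.≤-trans ok (ℕ.≤-reflexive (sym lc)))
    𝒲-cong k₀ (d ∷ ds) c {H} {H′} (d≤ , d< , ok) lc r e = ∑-cong identity λ {y} y∈ → term y y∈
      where
      c₀ = lastn d c
      l₀ : length c₀ ≡ d
      l₀ = proj₂ (proj₂ (lastn-split d c (ℕ.≤-trans d≤ (ℕ.≤-reflexive (sym lc)))))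
      term : ∀ y → y ∈ identity → Ā⁻ y c₀ * (w y * 𝒲 w M ds (c₀ ∷ʳ y) H) ≡ Ā⁻ y c₀ * (w y * 𝒲 w M ds (c₀ ∷ʳ y) H′)
      term y y∈ with y ∈? c₀
      ... | yes p = trans (kill₀ (w y * 𝒲 w M ds (c₀ ∷ʳ y) H)) (sym (kill₀ (w y * 𝒲 w M ds (c₀ ∷ʳ y) H′)))
        where
        kill₀ : ∀ e → Ā⁻ y c₀ * e ≡ 0ℚ
        kill₀ e = trans (cong (_* e) (Ā⁻-∈ {y} {c₀} y∈ p)) (ℚ.*-zeroˡ e)
      ... | no ¬p = cong (λ e → Ā⁻ y c₀ * (w y * e))
        (𝒲-cong k₀ ds (c₀ ∷ʳ y) ok (trans (length-∷ʳ c₀ y) (cong suc l₀)) (range-snoc (range-lastn d r) y∈ ¬p) e)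

    𝒲-∑ : ∀ ds c {B : Set} (K : List B) (H : B → List ℕ → ℚ) → 𝒲 w M ds c (λ c′ → ∑ℚ K (λ b → H b c′)) ≡ ∑ℚ K (λ b → 𝒲 w M ds c (H b))
    𝒲-∑ []       c K H = refl
    𝒲-∑ (d ∷ ds) c K H = trans
      (∑-cong identity λ {y} _ → trans (cong (λ e → a y * (w y * e)) (𝒲-∑ ds (c₀ ∷ʳ y) K H))
        (trans (sym (ℚ.*-assoc (a y) (w y) _)) (trans (sym (∑-* K (a y * w y) (λ b → 𝒲 w M ds (c₀ ∷ʳ y) (H b))))
          (∑-cong K λ {b} _ → ℚ.*-assoc (a y) (w y) (𝒲 w M ds (c₀ ∷ʳ y) (H b))))))
      (∑-comm identity K (λ y b → a y * (w y * 𝒲 w M ds (c₀ ∷ʳ y) (H b))))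
      where
      c₀ = lastn d c
      a : ℕ → ℚ
      a y = Ā⁻ y c₀

    𝒲-* : ∀ ds c t (H : List ℕ → ℚ) → 𝒲 w M ds c (λ c′ → t * H c′) ≡ t * 𝒲 w M ds c H
    𝒲-* []       c t H = refl
    𝒲-* (d ∷ ds) c t H = trans
      (∑-cong identity λ {y} _ → trans (cong (λ e → Ā⁻ y c₀ * (w y * e)) (𝒲-* ds (c₀ ∷ʳ y) t H))
        (solve 4 (λ a w t e → a :* (w :* (t :* e)) := t :* (a :* (w :* e))) refl (Ā⁻ y c₀) (w y) t (𝒲 w M ds (c₀ ∷ʳ y) H)))
      (∑-* identity t (λ y → Ā⁻ y c₀ * (w y * 𝒲 w M ds (c₀ ∷ʳ y) H)))
      where c₀ = lastn d c

    -- Induction on the vertices: `ĝ-append` adds a vertex and `ĝ-window` forgets what is no longer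
    -- adjacent.
    intertwine : ∀ k₀ ds {k} c h → Windows M k₀ k ds → length c ≡ k → InRange c →
      𝒲 w M ds c (λ c′ → Σw k₀ (λ μ → ĝ μ (lastn k₀ c′) * h μ)) ≡ Σw (length c) (λ κ → ĝ κ c * 𝒱 x M ds κ (h ∘ lastn k₀))
    intertwine k₀ [] c h ok lc r = sym (ĝ-window k₀ c h (ℕ.≤-trans ok (ℕ.≤-reflexive (sym lc))) r)
    intertwine k₀ (d ∷ ds) {k} c h (d≤ , d< , ok) lc r = begin
      ∑ℚ identity (λ y → a y * (w y * 𝒲 w M ds (c₀ ∷ʳ y) H))
        ≡⟨ ∑-cong identity (λ {y} y∈ → term y y∈) ⟩
      ∑ℚ identity (λ y → Σw d (λ κ → Σc (λ b → V κ b * (a y * (w y * ĝ (κ ∷ʳ b) (c₀ ∷ʳ y))))))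
        ≡⟨ Σw-∑ d identity (λ κ y → Σc (λ b → V κ b * (a y * (w y * ĝ (κ ∷ʳ b) (c₀ ∷ʳ y))))) ⟨
      Σw d (λ κ → ∑ℚ identity (λ y → Σc (λ b → V κ b * (a y * (w y * ĝ (κ ∷ʳ b) (c₀ ∷ʳ y))))))
        ≡⟨ Σw-cong d (λ κ lκ κ< → summed κ lκ κ<) ⟩
      Σw d (λ κ → ĝ κ c₀ * Φ κ)
        ≡⟨ ĝ-window d c Φ d≤′ r ⟨
      Σw (length c) (λ κ → ĝ κ c * Φ (lastn d κ)) ∎
      where
      open ≡-Reasoning
      H : List ℕ → ℚ
      H c′ = Σw k₀ (λ μ → ĝ μ (lastn k₀ c′) * h μ)
      c₀ = lastn d c
      d≤′ : d ≤ length c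
      d≤′ = ℕ.≤-trans d≤ (ℕ.≤-reflexive (sym lc))
      l₀ : length c₀ ≡ d
      l₀ = proj₂ (proj₂ (lastn-split d c d≤′))
      r₀ : InRange c₀
      r₀ = range-lastn d r
      a : ℕ → ℚ
      a y = Ā⁻ y c₀
      V : List ℕ → ℕ → ℚ
      V κ b = 𝒱 x M ds (κ ∷ʳ b) (h ∘ lastn k₀)
      ξ : List ℕ → ℕ → ℚ
      ξ κ b = if does (b ∈? κ) then 0ℚ else x b
      Φ : List ℕ → ℚ
      Φ κ = Σc (λ b → ξ κ b * V κ b)
      term : ∀ y → y ∈ identity → a y * (w y * 𝒲 w M ds (c₀ ∷ʳ y) H) ≡
             Σw d (λ κ → Σc (λ b → V κ b * (a y * (w y * ĝ (κ ∷ʳ b) (c₀ ∷ʳ y)))))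
      term y y∈ with y ∈? c₀
      ... | yes p = trans (kill₀ (w y * 𝒲 w M ds (c₀ ∷ʳ y) H)) (sym (Σw-zero d λ κ _ _ → ∑-zero (upTo M) λ {b} _ →
            trans (cong (V κ b *_) (kill₀ (w y * ĝ (κ ∷ʳ b) (c₀ ∷ʳ y)))) (ℚ.*-zeroʳ (V κ b))))
        where
        kill₀ : ∀ e → a y * e ≡ 0ℚ
        kill₀ e = trans (cong (_* e) (Ā⁻-∈ {y} {c₀} y∈ p)) (ℚ.*-zeroˡ e)
      ... | no ¬p = begin
        a y * (w y * 𝒲 w M ds (c₀ ∷ʳ y) H)
          ≡⟨ cong (λ e → a y * (w y * e)) (intertwine k₀ ds (c₀ ∷ʳ y) h ok l₁ (range-snoc r₀ y∈ ¬p)) ⟩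
        a y * (w y * Σw (length (c₀ ∷ʳ y)) (λ κ → ĝ κ (c₀ ∷ʳ y) * 𝒱 x M ds κ (h ∘ lastn k₀)))
          ≡⟨ cong (λ l → a y * (w y * Σw l (λ κ → ĝ κ (c₀ ∷ʳ y) * 𝒱 x M ds κ (h ∘ lastn k₀)))) l₁ ⟩
        a y * (w y * Σw (suc d) (λ κ → ĝ κ (c₀ ∷ʳ y) * 𝒱 x M ds κ (h ∘ lastn k₀)))
          ≡⟨ cong (λ e → a y * (w y * e)) (Σw-snoc d (λ κ → ĝ κ (c₀ ∷ʳ y) * 𝒱 x M ds κ (h ∘ lastn k₀))) ⟩
        a y * (w y * Σw d (λ κ → Σc (λ b → ĝ (κ ∷ʳ b) (c₀ ∷ʳ y) * V κ b)))
          ≡⟨ ℚ.*-assoc (a y) (w y) _ ⟨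
        (a y * w y) * Σw d (λ κ → Σc (λ b → ĝ (κ ∷ʳ b) (c₀ ∷ʳ y) * V κ b))
          ≡⟨ Σw-* d (a y * w y) (λ κ → Σc (λ b → ĝ (κ ∷ʳ b) (c₀ ∷ʳ y) * V κ b)) ⟨
        Σw d (λ κ → (a y * w y) * Σc (λ b → ĝ (κ ∷ʳ b) (c₀ ∷ʳ y) * V κ b))
          ≡⟨ Σw-cong d (λ κ _ _ → trans (sym (∑-* (upTo M) (a y * w y) (λ b → ĝ (κ ∷ʳ b) (c₀ ∷ʳ y) * V κ b)))
               (∑-cong (upTo M) λ {b} _ → solve 4 (λ a w g v → (a :* w) :* (g :* v) := v :* (a :* (w :* g))) refl
                 (a y) (w y) (ĝ (κ ∷ʳ b) (c₀ ∷ʳ y)) (V κ b))) ⟩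
        Σw d (λ κ → Σc (λ b → V κ b * (a y * (w y * ĝ (κ ∷ʳ b) (c₀ ∷ʳ y))))) ∎
        where
        l₁ : length (c₀ ∷ʳ y) ≡ suc d
        l₁ = trans (length-∷ʳ c₀ y) (cong suc l₀)
      summed : ∀ κ → length κ ≡ d → All (_< M) κ →
               ∑ℚ identity (λ y → Σc (λ b → V κ b * (a y * (w y * ĝ (κ ∷ʳ b) (c₀ ∷ʳ y))))) ≡ ĝ κ c₀ * Φ κ
      summed κ lκ κ< = begin
        ∑ℚ identity (λ y → Σc (λ b → V κ b * (a y * (w y * ĝ (κ ∷ʳ b) (c₀ ∷ʳ y)))))
          ≡⟨ ∑-comm identity (upTo M) (λ y b → V κ b * (a y * (w y * ĝ (κ ∷ʳ b) (c₀ ∷ʳ y)))) ⟩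
        Σc (λ b → ∑ℚ identity (λ y → V κ b * (a y * (w y * ĝ (κ ∷ʳ b) (c₀ ∷ʳ y)))))
          ≡⟨ ∑-cong (upTo M) (λ {b} b∈ → trans (∑-* identity (V κ b) (λ y → a y * (w y * ĝ (κ ∷ʳ b) (c₀ ∷ʳ y))))
               (trans (cong (V κ b *_) (ĝ-append b κ c₀ (∈.∈-upTo⁻ b∈) κ< (trans l₀ (sym lκ)) (subst (_< M) (sym lκ) d<) r₀))
                 (solve 3 (λ v ξ g → v :* (ξ :* g) := g :* (ξ :* v)) refl (V κ b) (ξ κ b) (ĝ κ c₀)))) ⟩
        Σc (λ b → ĝ κ c₀ * (ξ κ b * V κ b))
          ≡⟨ ∑-* (upTo M) (ĝ κ c₀) (λ b → ξ κ b * V κ b) ⟩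
        ĝ κ c₀ * Φ κ ∎

    Σw-seqs : ∀ l f → Σw l f ≡ ∑ℚ (seqs (upTo M) l) f
    Σw-seqs zero    f = sym (ℚ.+-identityʳ (f []))
    Σw-seqs (suc l) f = trans (∑-cong (upTo M) λ {b} _ → Σw-seqs l (f ∘ (b ∷_))) (sym (∑-seqs-suc (upTo M) l f))

    non-unique : ∀ κ → ¬ Unique κ → ∃[ κ⁻ ] length κ⁻ < length κ × κ ⊆ κ⁻
    non-unique []      ¬u = contradiction [] ¬u
    non-unique (a ∷ κ) ¬u with a ∈? κ
    ... | yes a∈ = κ , ℕ.≤-refl , λ { (here refl) → a∈ ; (there p) → p }
    ... | no a∉ with non-unique κ (λ u → ¬u (All.tabulate (λ b∈ a≡b → a∉ (subst (_∈ κ) (sym a≡b) b∈)) ∷ u))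
    ...   | κ⁻ , lt , sub = a ∷ κ⁻ , s≤s lt , λ { (here refl) → here refl ; (there p) → there (sub p) }

    module _ (k : ℕ) (k≤M : k ≤ M) (ds : List ℕ) (ok : Windows M k k ds) where

      K : List (List ℕ)
      K = injWords M k

      K-ok : ∀ {κ} → κ ∈ K → Unique κ × length κ ≡ k × All (_< M) κ
      K-ok κ∈ with ∈.∈-filter⁻ unique? {xs = seqs (upTo M) k} κ∈
      ... | p , u with ∈-seqs⁻ k p
      ...   | l , κ∈′ = u , l , All.map ∈.∈-upTo⁻ κ∈′

      K-unique : Unique K
      K-unique = Unique.filter⁺ unique? (seqs-unique k (Unique.upTo⁺ M))

      -- Colours start at 0 and columns at 1. The shift lets the same injective words index the rows
      -- and the columns of all matrices.
      col : List ℕ → List ℕ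
      col = map suc

      col-range : ∀ {κ} → κ ∈ K → InRange (col κ)
      col-range κ∈ with K-ok κ∈
      ... | u , _ , κ< = Unique.map⁺ ℕ.suc-injective u
        , All.map⁺ (All.map (λ b< → ids-∈ 1 M (s≤s z≤n) (ℕ.≤-trans (s≤s b<) (ℕ.≤-reflexive (ℕ.+-comm 1 M)))) κ<)

      col-length : ∀ {κ} → κ ∈ K → length (col κ) ≡ k
      col-length {κ} κ∈ = trans (List.length-map suc κ) (proj₁ (proj₂ (K-ok κ∈)))

      range⇒K : ∀ {c} → InRange c → length c ≡ k → ∃[ κ ] κ ∈ K × col κ ≡ c
      range⇒K {c} (u , r) lc = map ℕ.pred c
        , ∈.∈-filter⁺ unique? (subst (λ l → map ℕ.pred c ∈ seqs (upTo M) l) (trans (List.length-map ℕ.pred c) lc)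
            (∈-seqs⁺ (map ℕ.pred c) (All.map⁺ (All.map (∈.∈-upTo⁺ ∘ pred<) r))))
            (Unique-map⁻ (subst Unique (sym eq) u))
        , eq
        where
        pred< : ∀ {a} → a ∈ identity → ℕ.pred a < M
        pred< {zero}  a∈ = contradiction a∈ 0∉identity
        pred< {suc a} a∈ = ℕ.s≤s⁻¹ (subst (suc a <_) (ℕ.+-comm M 1) (proj₂ (∈-ids 1 M a∈)))
        eq : col (map ℕ.pred c) ≡ c
        eq = go c r
          where
          go : ∀ c → All (_∈ identity) c → col (map ℕ.pred c) ≡ c
          go []          []       = refl
          go (zero ∷ c)  (p ∷ ps) = contradiction p 0∉identity
          go (suc a ∷ c) (p ∷ ps) = cong (suc a ∷_) (go c ps)
        Unique-map⁻ : ∀ {κ} → Unique (col κ) → Unique κ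
        Unique-map⁻ {[]}    _       = []
        Unique-map⁻ {a ∷ κ} (p ∷ u) = All.map (λ ne e → ne (cong suc e)) (All.map⁻ p) ∷ Unique-map⁻ u

      δ-expand : ∀ c → InRange c → length c ≡ k → (f : List ℕ → ℚ) → ∑ℚ K (λ κ → f (col κ) * δ′ (col κ) c) ≡ f c
      δ-expand c r lc f with range⇒K r lc
      ... | κ , κ∈ , refl = trans (∑-single K κ∈ K-unique λ {κ′} _ ne → trans
            (cong (f (col κ′) *_) (δ′-diff (λ e → ne (List.map-injective ℕ.suc-injective e)))) (ℚ.*-zeroʳ (f (col κ′))))
          (trans (cong (f (col κ) *_) (δ′-same (col κ))) (ℚ.*-identityʳ (f (col κ))))

      private
        N : ℕ
        N = length K
        word : Fin N → List ℕ
        word = lookup K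
        word∈ : ∀ i → word i ∈ K
        word∈ i = ∈.∈-lookup i
        lookup-injective : ∀ {B : Set} {L : List B} → Unique L → ∀ i j → lookup L i ≡ lookup L j → i ≡ j
        lookup-injective (b∉ ∷ u) zero    zero    e = refl
        lookup-injective (b∉ ∷ u) zero    (suc j) e = contradiction e (All.lookup b∉ (∈.∈-lookup j))
        lookup-injective (b∉ ∷ u) (suc i) zero    e = contradiction (sym e) (All.lookup b∉ (∈.∈-lookup i))
        lookup-injective (b∉ ∷ u) (suc i) (suc j) e = cong suc (lookup-injective u i j e)
        G P Q : Matrix {N}
        G i κ = ĝ (word κ) (col (word i))
        P i j = 𝒲 w M ds (col (word i)) (δ′ (col (word j)) ∘ lastn k)
        Q κ μ = 𝒱 x M ds (word κ) (δ′ (word μ) ∘ lastn k)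

        injective : Injective G
        injective a e κ₀ = independent (M ℕ.∸ k) k (ℕ.m∸n+n≡m k≤M) (allFin N) word a (Unique.allFin⁺ N)
          (λ {b} _ → proj₂ (K-ok (word∈ b))) (λ {b} {b′} → lookup-injective K-unique b b′) rel (∈.∈-allFin κ₀) (proj₁ (K-ok (word∈ κ₀)))
          where
          rel : ∀ c → InRange c → length c ≡ k → ∑ℚ (allFin N) (λ b → a b * g (M ℕ.∸ k) (word b) c) ≡ 0ℚ
          rel c r lc with range⇒K r lc
          ... | κ , κ∈ , refl = trans (∑-allFin (λ b → a b * g (M ℕ.∸ k) (word b) c)) (trans
            (sum-cong λ b → trans (ℚ.*-comm (a b) _) (cong (_* a b)
              (cong₂ (λ l κ′ → g (M ℕ.∸ l) (word b) (col κ′)) (sym (proj₁ (proj₂ (K-ok (word∈ b))))) (Any.lookup-index κ∈))))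
            (e (Any.index κ∈)))

        intertwined : ∀ i μ → (P ∙ G) i μ ≡ (G ∙ Q) i μ
        intertwined i μ = begin
          sum (λ j → 𝒲 w M ds c (δ′ (col (word j)) ∘ lastn k) * ĝ (word μ) (col (word j)))
            ≡⟨ ∑-lookup K (λ κ → 𝒲 w M ds c (δ′ (col κ) ∘ lastn k) * ĝ (word μ) (col κ)) ⟨
          ∑ℚ K (λ κ → 𝒲 w M ds c (δ′ (col κ) ∘ lastn k) * ĝ (word μ) (col κ))
            ≡⟨ ∑-cong K (λ {κ} _ → trans (ℚ.*-comm (𝒲 w M ds c (δ′ (col κ) ∘ lastn k)) (ĝ (word μ) (col κ)))
                 (sym (𝒲-* ds c (ĝ (word μ) (col κ)) (δ′ (col κ) ∘ lastn k)))) ⟩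
          ∑ℚ K (λ κ → 𝒲 w M ds c (λ c′ → ĝ (word μ) (col κ) * δ′ (col κ) (lastn k c′)))
            ≡⟨ 𝒲-∑ ds c K (λ κ c′ → ĝ (word μ) (col κ) * δ′ (col κ) (lastn k c′)) ⟨
          𝒲 w M ds c (λ c′ → ∑ℚ K (λ κ → ĝ (word μ) (col κ) * δ′ (col κ) (lastn k c′)))
            ≡⟨ 𝒲-cong k ds c ok (col-length (word∈ i)) (col-range (word∈ i)) (λ c′ r k≤ →
                 trans (δ-expand (lastn k c′) (range-lastn k r) (proj₂ (proj₂ (lastn-split k c′ k≤))) (ĝ (word μ)))
                       (sym (collapse (lastn k c′)))) ⟩
          𝒲 w M ds c (λ c′ → Σw k (λ κ → ĝ κ (lastn k c′) * δ′ (word μ) κ))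
            ≡⟨ intertwine k ds c (δ′ (word μ)) ok (col-length (word∈ i)) (col-range (word∈ i)) ⟩
          Σw (length c) (λ κ → ĝ κ c * 𝒱 x M ds κ (δ′ (word μ) ∘ lastn k))
            ≡⟨ cong (λ l → Σw l (λ κ → ĝ κ c * 𝒱 x M ds κ (δ′ (word μ) ∘ lastn k))) (col-length (word∈ i)) ⟩
          Σw k (λ κ → ĝ κ c * 𝒱 x M ds κ (δ′ (word μ) ∘ lastn k))
            ≡⟨ Σw-seqs k (λ κ → ĝ κ c * 𝒱 x M ds κ (δ′ (word μ) ∘ lastn k)) ⟩
          ∑ℚ (seqs (upTo M) k) (λ κ → ĝ κ c * 𝒱 x M ds κ (δ′ (word μ) ∘ lastn k))
            -- Words with a repeated letter contribute nothing because `ĝ` vanishes there, so the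
            -- sum shrinks to the index set of the matrices.
            ≡⟨ ∑-filter unique? (seqs (upTo M) k) (λ {κ} κ∈ ¬u → repeated κ κ∈ ¬u) ⟨
          ∑ℚ K (λ κ → ĝ κ c * 𝒱 x M ds κ (δ′ (word μ) ∘ lastn k))
            ≡⟨ ∑-lookup K (λ κ → ĝ κ c * 𝒱 x M ds κ (δ′ (word μ) ∘ lastn k)) ⟩
          sum (λ κ → ĝ (word κ) c * 𝒱 x M ds (word κ) (δ′ (word μ) ∘ lastn k)) ∎
          where
          open ≡-Reasoning
          c = col (word i)
          collapse : ∀ c′ → Σw k (λ κ → ĝ κ c′ * δ′ (word μ) κ) ≡ ĝ (word μ) c′
          collapse c′ with K-ok (word∈ μ)
          ... | _ , l , μ< = trans (cong (λ l → Σw l (λ κ → ĝ κ c′ * δ′ (word μ) κ)) (sym l)) (trans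
            (Σw-single (word μ) (λ κ → ĝ κ c′ * δ′ (word μ) κ) μ< λ κ _ _ ne →
              trans (cong (ĝ κ c′ *_) (δ′-diff (ne ∘ sym))) (ℚ.*-zeroʳ (ĝ κ c′)))
            (trans (cong (ĝ (word μ) c′ *_) (δ′-same (word μ))) (ℚ.*-identityʳ (ĝ (word μ) c′))))
          repeated : ∀ κ → κ ∈ seqs (upTo M) k → ¬ Unique κ → ĝ κ c * 𝒱 x M ds κ (δ′ (word μ) ∘ lastn k) ≡ 0ℚ
          repeated κ κ∈ ¬u with non-unique κ ¬u
          ... | κ⁻ , lt , sub = trans (cong (_* 𝒱 x M ds κ (δ′ (word μ) ∘ lastn k))
                (ĝ-missing κ κ⁻ c (subst (_≤ M) (sym (proj₁ (∈-seqs⁻ k κ∈))) k≤M) lt sub (col-range (word∈ i))))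
              (ℚ.*-zeroˡ (𝒱 x M ds κ (δ′ (word μ) ∘ lastn k)))

      trace-identity : ∑ℚ K (λ κ → 𝒲 w M ds (col κ) (δ′ (col κ) ∘ lastn k)) ≡ ∑ℚ K (λ κ → 𝒱 x M ds κ (δ′ κ ∘ lastn k))
      trace-identity = trans (∑-lookup K (λ κ → 𝒲 w M ds (col κ) (δ′ (col κ) ∘ lastn k)))
        (trans (trace-intertwined G injective P Q intertwined) (sym (∑-lookup K (λ κ → 𝒱 x M ds κ (δ′ κ ∘ lastn k)))))

-- Formal polynomials are determined by their values at good points.

module Evaluate where

  open import Defs
  open Rat using (-‿cancel)
  open Sums
  open import Data.Rational.Base using (_+_; _*_; _-_; -_)
  open import Data.Vec.Base using ([]; _∷_)
  open import Data.Vec.Relation.Unary.All using ([]; _∷_) renaming (All to VecAll)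

  open +-*-Solver using (solve; _:+_; _:*_; _:-_; :-_; _:=_; con)

  poly : ℕ → (ℕ → ℚ) → ℚ → ℚ
  poly zero    a x = a 0
  poly (suc d) a x = a 0 + x * poly d (a ∘ suc) x

  poly-cong : ∀ d {a b : ℕ → ℚ} x → (∀ i → a i ≡ b i) → poly d a x ≡ poly d b x
  poly-cong zero    x e = e 0
  poly-cong (suc d) x e = cong₂ (λ u v → u + x * v) (e 0) (poly-cong d x (e ∘ suc))

  poly-+ : ∀ d (a b : ℕ → ℚ) x → poly d (λ i → a i + b i) x ≡ poly d a x + poly d b x
  poly-+ zero    a b x = refl
  poly-+ (suc d) a b x = trans (cong (λ z → (a 0 + b 0) + x * z) (poly-+ d (a ∘ suc) (b ∘ suc) x))
    (solve 5 (λ a b x p q → (a :+ b) :+ x :* (p :+ q) := (a :+ x :* p) :+ (b :+ x :* q)) refl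
      (a 0) (b 0) x (poly d (a ∘ suc) x) (poly d (b ∘ suc) x))

  poly-* : ∀ d t (a : ℕ → ℚ) x → poly d (λ i → t * a i) x ≡ t * poly d a x
  poly-* zero    t a x = refl
  poly-* (suc d) t a x = trans (cong (λ z → t * a 0 + x * z) (poly-* d t (a ∘ suc) x))
    (solve 4 (λ t a x p → t :* a :+ x :* (t :* p) := t :* (a :+ x :* p)) refl t (a 0) x (poly d (a ∘ suc) x))

  poly-0 : ∀ d {a : ℕ → ℚ} x → (∀ i → a i ≡ 0ℚ) → poly d a x ≡ 0ℚ
  poly-0 zero    x e = e 0
  poly-0 (suc d) x e = trans (cong₂ (λ u v → u + x * v) (e 0) (poly-0 d x (e ∘ suc)))
    (solve 1 (λ x → con 0ℚ :+ x :* con 0ℚ := con 0ℚ) refl x)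

  poly-extend : ∀ d d′ (a : ℕ → ℚ) x → d ≤ d′ → (∀ i → d < i → a i ≡ 0ℚ) → poly d′ a x ≡ poly d a x
  poly-extend zero    zero     a x _        z = refl
  poly-extend zero    (suc d′) a x _        z = trans (cong (λ v → a 0 + x * v) (poly-0 d′ x (λ i → z (suc i) (s≤s z≤n))))
    (solve 2 (λ a x → a :+ x :* con 0ℚ := a) refl (a 0) x)
  poly-extend (suc d) (suc d′) a x (s≤s le) z = cong (λ v → a 0 + x * v) (poly-extend d d′ (a ∘ suc) x le (λ i p → z (suc i) (s≤s p)))

  ∑₊-0 : ∀ l {h : ℕ → ℕ → ℚ} → (∀ i j → i ℕ.+ j ≡ l → h i j ≡ 0ℚ) → ∑₊ l h ≡ 0ℚ
  ∑₊-0 zero    e = e 0 0 refl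
  ∑₊-0 (suc l) e = trans (cong₂ _+_ (e 0 (suc l) refl) (∑₊-0 l (λ i j p → e (suc i) j (cong suc p)))) (ℚ.+-identityˡ 0ℚ)

  poly-product : ∀ d d′ (a b : ℕ → ℚ) x → (∀ i → d < i → a i ≡ 0ℚ) → (∀ j → d′ < j → b j ≡ 0ℚ) →
                 poly (d ℕ.+ d′) (λ l → ∑₊ l (λ i j → a i * b j)) x ≡ poly d a x * poly d′ b x
  poly-product zero d′ a b x za zb = trans (poly-cong d′ x only) (poly-* d′ (a 0) b x)
    where
    only : ∀ l → ∑₊ l (λ i j → a i * b j) ≡ a 0 * b l
    only zero    = refl
    only (suc l) = trans (cong (λ z → a 0 * b (suc l) + z) (∑₊-0 l λ i j _ → trans (cong (_* b j) (za (suc i) (s≤s z≤n))) (ℚ.*-zeroˡ (b j))))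
      (ℚ.+-identityʳ (a 0 * b (suc l)))
  poly-product (suc d) d′ a b x za zb = begin
    a 0 * b 0 + x * poly (d ℕ.+ d′) (λ l → a 0 * b (suc l) + ∑₊ l (λ i j → a (suc i) * b j)) x
      ≡⟨ cong (λ z → a 0 * b 0 + x * z) (trans (poly-+ (d ℕ.+ d′) (λ l → a 0 * b (suc l)) (λ l → ∑₊ l (λ i j → a (suc i) * b j)) x)
           (cong₂ _+_ (poly-* (d ℕ.+ d′) (a 0) (b ∘ suc) x) (poly-product d d′ (a ∘ suc) b x (λ i p → za (suc i) (s≤s p)) zb))) ⟩
    a 0 * b 0 + x * (a 0 * B + A′ * poly d′ b x)
      ≡⟨ solve 6 (λ a b x B A P → a :* b :+ x :* (a :* B :+ A :* P) := a :* (b :+ x :* B) :+ x :* A :* P) refl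
           (a 0) (b 0) x B A′ (poly d′ b x) ⟩
    a 0 * poly (suc (d ℕ.+ d′)) b x + x * A′ * poly d′ b x
      ≡⟨ cong (λ z → a 0 * z + x * A′ * poly d′ b x) (poly-extend d′ (suc (d ℕ.+ d′)) b x (ℕ.m≤n⇒m≤1+n (ℕ.m≤n+m d′ d)) zb) ⟩
    a 0 * poly d′ b x + x * A′ * poly d′ b x
      ≡⟨ solve 4 (λ a x A P → a :* P :+ x :* A :* P := (a :+ x :* A) :* P) refl (a 0) x A′ (poly d′ b x) ⟩
    (a 0 + x * A′) * poly d′ b x ∎
    where
    open ≡-Reasoning
    B = poly (d ℕ.+ d′) (b ∘ suc) x
    A′ = poly d (a ∘ suc) x

  -- Divide by x - r at the root r = B + 1. The quotient vanishes for all x > r, so induction on the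
  -- degree applies with the bound r.
  poly-vanish : ∀ d (a : ℕ → ℚ) B → (∀ x → B ℚ.< x → poly d a x ≡ 0ℚ) → ∀ i → i ≤ d → a i ≡ 0ℚ
  poly-vanish zero a B e zero _ = e (B + 1ℚ) (B<B+1 B)
    where
    B<B+1 : ∀ B → B ℚ.< B + 1ℚ
    B<B+1 B = subst (ℚ._< B + 1ℚ) (ℚ.+-identityʳ B) (ℚ.+-monoʳ-< B (ℚ.positive⁻¹ 1ℚ))
  poly-vanish (suc d) a B e = all
    where
    r = B + 1ℚ
    B<r : B ℚ.< r
    B<r = subst (ℚ._< B + 1ℚ) (ℚ.+-identityʳ B) (ℚ.+-monoʳ-< B (ℚ.positive⁻¹ 1ℚ))
    quotient : ∀ d (a : ℕ → ℚ) → ℕ → ℚ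
    quotient zero    a i       = a 1
    quotient (suc d) a zero    = a 1 + r * quotient d (a ∘ suc) 0
    quotient (suc d) a (suc i) = quotient d (a ∘ suc) i
    quotient-0 : ∀ d (a : ℕ → ℚ) → quotient d a 0 ≡ poly d (a ∘ suc) r
    quotient-0 zero    a = refl
    quotient-0 (suc d) a = cong (λ z → a 1 + r * z) (quotient-0 d (a ∘ suc))
    division : ∀ d (a : ℕ → ℚ) x → poly (suc d) a x ≡ poly (suc d) a r + (x - r) * poly d (quotient d a) x
    division zero    a x = solve 4 (λ a b x r → a :+ x :* b := (a :+ r :* b) :+ (x :- r) :* b) refl (a 0) (a 1) x r
    division (suc d) a x = trans (cong (λ z → a 0 + x * z) (division d (a ∘ suc) x)) (trans
      (solve 5 (λ a x r p q → a :+ x :* (p :+ (x :- r) :* q) := (a :+ r :* p) :+ (x :- r) :* (p :+ x :* q)) refl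
        (a 0) x r (poly (suc d) (a ∘ suc) r) (poly d (quotient d (a ∘ suc)) x))
      (cong (λ z → (a 0 + r * poly (suc d) (a ∘ suc) r) + (x - r) * (z + x * poly d (quotient d (a ∘ suc)) x))
        (sym (cong (λ z → a 1 + r * z) (quotient-0 d (a ∘ suc))))))
    q≡0 : ∀ i → i ≤ d → quotient d a i ≡ 0ℚ
    q≡0 = poly-vanish d (quotient d a) r λ x r<x → ℚ-domain (x - r) (poly d (quotient d a) x)
      (λ z → ℚ.<⇒≢ r<x (sym (-‿cancel z)))
      (trans (sym (trans (cong (_+ (x - r) * poly d (quotient d a) x) (e r B<r)) (ℚ.+-identityˡ ((x - r) * poly d (quotient d a) x))))
             (trans (sym (division d a x)) (e x (ℚ.<-trans B<r r<x))))
    tails : ∀ d (a : ℕ → ℚ) → (∀ i → i ≤ d → quotient d a i ≡ 0ℚ) → ∀ i → i ≤ d → a (suc i) ≡ 0ℚ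
    tails zero    a z zero    _       = z 0 z≤n
    tails (suc d) a z zero    _       = trans (solve 2 (λ a r → a := a :+ r :* con 0ℚ) refl (a 1) r)
      (trans (cong (λ q → a 1 + r * q) (sym (z 1 (s≤s z≤n)))) (z 0 z≤n))
    tails (suc d) a z (suc i) (s≤s p) = tails d (a ∘ suc) (λ i p → z (suc i) (s≤s p)) i p
    all : ∀ i → i ≤ suc d → a i ≡ 0ℚ
    all zero    _       = trans (solve 2 (λ a r → a := a :+ r :* con 0ℚ) refl (a 0) r)
      (trans (cong (λ z → a 0 + r * z) (sym (zeros d (λ i p → tails d a q≡0 i p)))) (e r B<r))
      where
      zeros : ∀ d′ {b : ℕ → ℚ} → (∀ i → i ≤ d′ → b i ≡ 0ℚ) → poly d′ b r ≡ 0ℚ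
      zeros zero     z = z 0 z≤n
      zeros (suc d′) z = trans (cong₂ (λ u v → u + r * v) (z 0 z≤n) (zeros d′ (λ i p → z (suc i) (s≤s p))))
        (solve 1 (λ r → con 0ℚ :+ r :* con 0ℚ := con 0ℚ) refl r)
    all (suc i) (s≤s p) = tails d a q≡0 i p

  -- Exponents above d are cut off in each variable, so the result is meaningful under `Bounded d`,
  -- which likewise bounds the degree in every variable separately.
  eval : ∀ {m} → ℕ → (Vec ℕ m → ℚ) → Vec ℚ m → ℚ
  eval d f []       = f []
  eval d f (x ∷ xs) = poly d (λ i → eval d (f ∘ (i ∷_)) xs) x

  Bounded : ∀ {m} → ℕ → (Vec ℕ m → ℚ) → Set
  Bounded {zero}  d f = ⊤
  Bounded {suc m} d f = (∀ i → d < i → ∀ α → f (i ∷ α) ≡ 0ℚ) × (∀ i → Bounded d (f ∘ (i ∷_)))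

  eval-cong : ∀ {m} d {f g : Vec ℕ m → ℚ} x → (∀ α → f α ≡ g α) → eval d f x ≡ eval d g x
  eval-cong d []       e = e []
  eval-cong d (x ∷ xs) e = poly-cong d x λ i → eval-cong d xs (e ∘ (i ∷_))

  eval-+ : ∀ {m} d (f g : Vec ℕ m → ℚ) x → eval d (λ α → f α + g α) x ≡ eval d f x + eval d g x
  eval-+ d f g []       = refl
  eval-+ d f g (x ∷ xs) = trans (poly-cong d x λ i → eval-+ d (f ∘ (i ∷_)) (g ∘ (i ∷_)) xs)
    (poly-+ d (λ i → eval d (f ∘ (i ∷_)) xs) (λ i → eval d (g ∘ (i ∷_)) xs) x)

  eval-* : ∀ {m} d t (f : Vec ℕ m → ℚ) x → eval d (λ α → t * f α) x ≡ t * eval d f x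
  eval-* d t f []       = refl
  eval-* d t f (x ∷ xs) = trans (poly-cong d x λ i → eval-* d t (f ∘ (i ∷_)) xs) (poly-* d t (λ i → eval d (f ∘ (i ∷_)) xs) x)

  eval-0 : ∀ {m} d {f : Vec ℕ m → ℚ} x → (∀ α → f α ≡ 0ℚ) → eval d f x ≡ 0ℚ
  eval-0 d []       e = e []
  eval-0 d (x ∷ xs) e = poly-0 d x λ i → eval-0 d xs (e ∘ (i ∷_))

  eval-∑ : ∀ {m} {B : Set} d (K : List B) (f : B → Vec ℕ m → ℚ) x → eval d (λ α → ∑ℚ K (λ b → f b α)) x ≡ ∑ℚ K (λ b → eval d (f b) x)
  eval-∑ d []      f x = eval-0 d x (λ _ → refl)
  eval-∑ d (b ∷ K) f x = trans (eval-+ d (f b) (λ α → ∑ℚ K (λ b → f b α)) x) (cong (λ z → eval d (f b) x + z) (eval-∑ d K f x))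

  eval-∑₊ : ∀ {m} d l (h : ℕ → ℕ → Vec ℕ m → ℚ) x → eval d (λ α → ∑₊ l (λ i j → h i j α)) x ≡ ∑₊ l (λ i j → eval d (h i j) x)
  eval-∑₊ d zero    h x = refl
  eval-∑₊ d (suc l) h x = trans (eval-+ d (h 0 (suc l)) (λ α → ∑₊ l (λ i j → h (suc i) j α)) x)
    (cong (λ z → eval d (h 0 (suc l)) x + z) (eval-∑₊ d l (h ∘ suc) x))

  Bounded-≤ : ∀ {m} {d d′} (f : Vec ℕ m → ℚ) → d ≤ d′ → Bounded d f → Bounded d′ f
  Bounded-≤ {zero}  f le _       = tt
  Bounded-≤ {suc m} f le (z , b) = (λ i p → z i (ℕ.≤-trans (s≤s le) p)) , λ i → Bounded-≤ (f ∘ (i ∷_)) le (b i)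

  eval-extend : ∀ {m} d d′ (f : Vec ℕ m → ℚ) x → d ≤ d′ → Bounded d f → eval d′ f x ≡ eval d f x
  eval-extend d d′ f []       le _       = refl
  eval-extend d d′ f (x ∷ xs) le (z , b) = trans
    (poly-cong d′ x λ i → eval-extend d d′ (f ∘ (i ∷_)) xs le (b i))
    (poly-extend d d′ _ x le λ i p → eval-0 d xs (z i p))

  Bounded-zero : ∀ {m} d {f : Vec ℕ m → ℚ} → (∀ α → f α ≡ 0ℚ) → Bounded d f
  Bounded-zero {zero}  d e = tt
  Bounded-zero {suc m} d e = (λ i _ α → e (i ∷ α)) , λ i → Bounded-zero d (e ∘ (i ∷_))

  Bounded-+ : ∀ {m} d {f g : Vec ℕ m → ℚ} → Bounded d f → Bounded d g → Bounded d (λ α → f α + g α)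
  Bounded-+ {zero}  d _       _         = tt
  Bounded-+ {suc m} d (z , b) (z′ , b′) =
    (λ i p α → trans (cong₂ _+_ (z i p α) (z′ i p α)) (ℚ.+-identityˡ 0ℚ)) , λ i → Bounded-+ d (b i) (b′ i)

  Bounded-∑₊ : ∀ {m} d l {h : ℕ → ℕ → Vec ℕ m → ℚ} → (∀ i j → Bounded d (h i j)) → Bounded d (λ α → ∑₊ l (λ i j → h i j α))
  Bounded-∑₊ d zero    b = b 0 0
  Bounded-∑₊ d (suc l) b = Bounded-+ d (b 0 (suc l)) (Bounded-∑₊ d l (b ∘ suc))

  Bounded-convolve : ∀ {m} d d′ (f g : Vec ℕ m → ℚ) → Bounded d f → Bounded d′ g → Bounded (d ℕ.+ d′) (convolve f g)
  Bounded-convolve {zero}  d d′ f g _       _         = tt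
  Bounded-convolve {suc m} d d′ f g (z , b) (z′ , b′) =
    (λ l p α → ∑₊-0 l λ i j e → split i j α (large i j (subst (d ℕ.+ d′ <_) (sym e) p))) ,
    λ l → Bounded-∑₊ (d ℕ.+ d′) l λ i j → Bounded-convolve d d′ (f ∘ (i ∷_)) (g ∘ (j ∷_)) (b i) (b′ j)
    where
    large : ∀ i j → d ℕ.+ d′ < i ℕ.+ j → d < i ⊎ d′ < j
    large i j p with d ℕ.<? i
    ... | yes q = inj₁ q
    ... | no ¬q = inj₂ (ℕ.+-cancelˡ-< d d′ j (ℕ.<-≤-trans p (ℕ.+-monoˡ-≤ j (ℕ.≮⇒≥ ¬q))))
    split : ∀ i j α → d < i ⊎ d′ < j → convolve (f ∘ (i ∷_)) (g ∘ (j ∷_)) α ≡ 0ℚ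
    split i j α (inj₁ q) = convolve-zeroˡ (g ∘ (j ∷_)) (z i q) α
    split i j α (inj₂ q) = convolve-zeroʳ (f ∘ (i ∷_)) (z′ j q) α

  eval-convolve : ∀ {m} d d′ (f g : Vec ℕ m → ℚ) x → Bounded d f → Bounded d′ g →
                  eval (d ℕ.+ d′) (convolve f g) x ≡ eval d f x * eval d′ g x
  eval-convolve d d′ f g []       _       _         = refl
  eval-convolve d d′ f g (x ∷ xs) (z , b) (z′ , b′) = trans
    (poly-cong (d ℕ.+ d′) x λ l → trans
      (eval-∑₊ (d ℕ.+ d′) l (λ i j → convolve (f ∘ (i ∷_)) (g ∘ (j ∷_))) xs)
      (∑₊-cong l λ i j → eval-convolve d d′ (f ∘ (i ∷_)) (g ∘ (j ∷_)) xs (b i) (b′ j)))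
    (poly-product d d′ (λ i → eval d (f ∘ (i ∷_)) xs) (λ j → eval d′ (g ∘ (j ∷_)) xs) x
      (λ i p → eval-0 d xs (z i p)) (λ j p → eval-0 d′ xs (z′ j p)))

  -- f is a polynomial and F the function it defines.
  record _≙_ {m} (f : Vec ℕ m → ℚ) (F : Vec ℚ m → ℚ) : Set where
    field
      degree  : ℕ
      bounded : Bounded degree f
      value   : ∀ x → eval degree f x ≡ F x

  open _≙_ public

  ≙-+ : ∀ {m} {f g : Vec ℕ m → ℚ} {F G} → f ≙ F → g ≙ G → (λ α → f α + g α) ≙ (λ x → F x + G x)
  ≙-+ {f = f} {g} p q .degree = degree p ℕ.+ degree q
  ≙-+ {f = f} {g} p q .bounded = Bounded-+ _ (Bounded-≤ f (ℕ.m≤m+n (degree p) (degree q)) (bounded p))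
                                             (Bounded-≤ g (ℕ.m≤n+m (degree q) (degree p)) (bounded q))
  ≙-+ {f = f} {g} p q .value x = trans (eval-+ _ f g x) (cong₂ _+_
    (trans (eval-extend (degree p) _ f x (ℕ.m≤m+n (degree p) (degree q)) (bounded p)) (value p x))
    (trans (eval-extend (degree q) _ g x (ℕ.m≤n+m (degree q) (degree p)) (bounded q)) (value q x)))

  ≙-* : ∀ {m} {f g : Vec ℕ m → ℚ} {F G} → f ≙ F → g ≙ G → convolve f g ≙ (λ x → F x * G x)
  ≙-* {f = f} {g} p q .degree = degree p ℕ.+ degree q
  ≙-* {f = f} {g} p q .bounded = Bounded-convolve (degree p) (degree q) f g (bounded p) (bounded q)
  ≙-* {f = f} {g} p q .value x = trans (eval-convolve (degree p) (degree q) f g x (bounded p) (bounded q))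
    (cong₂ _*_ (value p x) (value q x))

  -- The strict decrease provides the distinct eigenvalues. Still, for a fixed good tail the first
  -- coordinate ranges over everything above a bound, which is what `poly-vanish` asks for.
  Good : ∀ {m} → Vec ℚ m → Set
  Good []       = ⊤
  Good (x ∷ xs) = VecAll (ℚ._< x) xs × 0ℚ ℚ.< x × Good xs

  upper : ∀ {m} (xs : Vec ℚ m) → ∃[ B ] 0ℚ ℚ.≤ B × (∀ x → B ℚ.< x → VecAll (ℚ._< x) xs)
  upper []       = 0ℚ , ℚ.≤-refl , λ _ _ → []
  upper (y ∷ ys) with upper ys
  ... | B , 0≤B , h with ℚ.≤-total B y
  ...   | inj₁ B≤y = y , ℚ.≤-trans 0≤B B≤y , λ x y<x → y<x ∷ h x (ℚ.≤-<-trans B≤y y<x)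
  ...   | inj₂ y≤B = B , 0≤B , λ x B<x → ℚ.≤-<-trans y≤B B<x ∷ h x B<x

  vanish : ∀ {m} d (f : Vec ℕ m → ℚ) → Bounded d f → (∀ x → Good x → eval d f x ≡ 0ℚ) → ∀ α → f α ≡ 0ℚ
  vanish d f b       e []      = e [] tt
  vanish d f (z , b) e (i ∷ α) with i ℕ.≤? d
  ... | no ¬p = z i (ℕ.≰⇒> ¬p) α
  ... | yes p = vanish d (f ∘ (i ∷_)) (b i) (λ xs good → coefficient xs good (upper xs)) α
    where
    coefficient : ∀ xs → Good xs → (∃[ B ] 0ℚ ℚ.≤ B × (∀ x → B ℚ.< x → VecAll (ℚ._< x) xs)) → eval d (f ∘ (i ∷_)) xs ≡ 0ℚ
    coefficient xs good (B , 0≤B , h) = poly-vanish d (λ i → eval d (f ∘ (i ∷_)) xs) B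
      (λ x B<x → e (x ∷ xs) (h x B<x , ℚ.≤-<-trans 0≤B B<x , good)) i p

  ≙-unique : ∀ {m} {f g : Vec ℕ m → ℚ} {F G} → f ≙ F → g ≙ G → (∀ x → Good x → F x ≡ G x) → ∀ α → f α ≡ g α
  ≙-unique {f = f} {g} {F} {G} p q e α = -‿cancel (trans (cong (λ z → f α + z) (solve 1 (λ b → :- b := (:- con 1ℚ) :* b) refl (g α))) (vanish D h bh eh α))
    where
    D = degree p ℕ.+ degree q
    h : Vec ℕ _ → ℚ
    h α = f α + (- 1ℚ) * g α
    Bounded-* : ∀ {m} d t {f : Vec ℕ m → ℚ} → Bounded d f → Bounded d (λ α → t * f α)
    Bounded-* {zero}  d t _       = tt
    Bounded-* {suc m} d t (z , b) = (λ i p α → trans (cong (t *_) (z i p α)) (ℚ.*-zeroʳ t)) , λ i → Bounded-* d t (b i)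
    bg = Bounded-≤ g (ℕ.m≤n+m (degree q) (degree p)) (bounded q)
    bh : Bounded D h
    bh = Bounded-+ D (Bounded-≤ f (ℕ.m≤m+n (degree p) (degree q)) (bounded p)) (Bounded-* D (- 1ℚ) bg)
    eh : ∀ x → Good x → eval D h x ≡ 0ℚ
    eh x good = trans (eval-+ D f (λ α → (- 1ℚ) * g α) x) (trans (cong₂ _+_
      (trans (eval-extend (degree p) D f x (ℕ.m≤m+n (degree p) (degree q)) (bounded p)) (trans (value p x) (e x good)))
      (trans (eval-* D (- 1ℚ) g x) (cong ((- 1ℚ) *_)
        (trans (eval-extend (degree q) D g x (ℕ.m≤n+m (degree q) (degree p)) (bounded q)) (value q x)))))
      (solve 1 (λ b → b :+ (:- con 1ℚ) :* b := con 0ℚ) refl (G x)))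

-- Values of chromatic series, elementary functions and fractions.

module Values where

  open import Defs
  open Rat
  open Sums
  open Evaluate
  open Elementary using (E)
  open import Data.Fin.Base using (zero; suc)
  open import Data.Rational.Base using (_+_; _*_)
  open import Data.Vec.Base using ([]; _∷_; tabulate; lookup)
  open import Data.Vec.Relation.Unary.All using ([]; _∷_) renaming (All to VecAll)

  open +-*-Solver using (solve; _:+_; _:*_; _:-_; :-_; _:=_; con)

  [_]ᵇ : Bool → ℚ
  [ b ]ᵇ = if b then 1ℚ else 0ℚ

  ≙-const : ∀ {m} q → coeff (const q) {m} ≙ λ _ → q
  ≙-const q .degree = 0
  ≙-const q .bounded = go
    where
    go : ∀ {m} → Bounded {m} 0 (coeff (const q))
    shift : ∀ {m} i → Bounded {m} 0 (coeff (const q) ∘ (i ∷_))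
    go {zero}  = tt
    go {suc m} = (λ { (suc i) _ α → refl }) , shift
    shift zero    = go
    shift (suc i) = Bounded-zero 0 (λ _ → refl)
  ≙-const q .value = go
    where
    go : ∀ {m} (x : Vec ℚ m) → eval 0 (coeff (const q)) x ≡ q
    go []       = refl
    go (x ∷ xs) = go xs

  e-0∷ : ∀ i {m} (α : Vec ℕ m) → coeff (e i) (0 ∷ α) ≡ coeff (e i) α
  e-0∷ i α = cong [_]ᵇ (does-⇔ (mk⇔ (λ { (_ ∷ p , s) → p , s }) (λ (p , s) → z≤n ∷ p , s)) (isElementary? i (0 ∷ α)) (isElementary? i α))

  e-1∷ : ∀ i {m} (α : Vec ℕ m) → coeff (e (suc i)) (1 ∷ α) ≡ coeff (e i) α
  e-1∷ i α = cong [_]ᵇ (does-⇔ (mk⇔ (λ { (_ ∷ p , s) → p , ℕ.suc-injective s }) (λ (p , s) → s≤s z≤n ∷ p , cong suc s))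
    (isElementary? (suc i) (1 ∷ α)) (isElementary? i α))

  e₀-1∷ : ∀ {m} (α : Vec ℕ m) → coeff (e 0) (1 ∷ α) ≡ 0ℚ
  e₀-1∷ α = cong [_]ᵇ (dec-false (isElementary? 0 (1 ∷ α)) λ { (_ , ()) })

  e-2∷ : ∀ i k {m} (α : Vec ℕ m) → 1 < k → coeff (e i) (k ∷ α) ≡ 0ℚ
  e-2∷ i k α 1<k = cong [_]ᵇ (dec-false (isElementary? i (k ∷ α)) λ { (p ∷ _ , _) → ℕ.<⇒≱ 1<k p })

  Bounded-cong : ∀ {m} d {f g : Vec ℕ m → ℚ} → (∀ α → f α ≡ g α) → Bounded d f → Bounded d g
  Bounded-cong {zero}  d e _       = tt
  Bounded-cong {suc m} d e (z , b) = (λ i p α → trans (sym (e (i ∷ α))) (z i p α)) , λ i → Bounded-cong d (e ∘ (i ∷_)) (b i)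

  ≙-e : ∀ {m} i → coeff (e i) {m} ≙ λ x → E (toList x) i
  ≙-e i .degree = 1
  ≙-e i .bounded = go i
    where
    go : ∀ {m} i → Bounded {m} 1 (coeff (e i))
    shift : ∀ {m} i k → Bounded {m} 1 (coeff (e i) ∘ (k ∷_))
    go {zero}  i = tt
    go {suc m} i = (λ k p α → e-2∷ i k α p) , shift i
    shift i       zero          = Bounded-cong 1 (λ α → sym (e-0∷ i α)) (go i)
    shift zero    (suc zero)    = Bounded-zero 1 e₀-1∷
    shift (suc i) (suc zero)    = Bounded-cong 1 (λ α → sym (e-1∷ i α)) (go i)
    shift i       (suc (suc k)) = Bounded-zero 1 (λ α → e-2∷ i (suc (suc k)) α (s≤s (s≤s z≤n)))
  ≙-e i .value = go i
    where
    go : ∀ {m} i (x : Vec ℚ m) → eval 1 (coeff (e i)) x ≡ E (toList x) i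
    go zero    []       = refl
    go (suc i) []       = refl
    go zero    (x ∷ xs) = trans (cong₂ (λ u v → u + x * v)
      (trans (eval-cong 1 xs (e-0∷ 0)) (go 0 xs)) (eval-0 1 xs e₀-1∷))
      (solve 1 (λ x → con 1ℚ :+ x :* con 0ℚ := con 1ℚ) refl x)
    go (suc i) (x ∷ xs) = cong₂ (λ u v → u + x * v)
      (trans (eval-cong 1 xs (e-0∷ (suc i))) (go (suc i) xs))
      (trans (eval-cong 1 xs (e-1∷ i)) (go i xs))

  powℚ : ℚ → ℕ → ℚ
  powℚ x zero    = 1ℚ
  powℚ x (suc n) = x * powℚ x n

  monomial : ∀ {m} → Vec ℕ m → Vec ℚ m → ℚ
  monomial []      []       = 1ℚ
  monomial (b ∷ β) (x ∷ xs) = powℚ x b * monomial β xs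

  indicator : ∀ {m} → Vec ℕ m → Vec ℕ m → ℚ
  indicator β α = [ does (Vec.≡-dec ℕ._≟_ β α) ]ᵇ

  indicator-∷ : ∀ {m} b i (β α : Vec ℕ m) → indicator (b ∷ β) (i ∷ α) ≡ [ does (b ℕ.≟ i) ]ᵇ * indicator β α
  indicator-∷ b i β α = if-∧ (does (b ℕ.≟ i)) (does (Vec.≡-dec ℕ._≟_ β α))
    where
    if-∧ : ∀ p q → [ p ∧ q ]ᵇ ≡ [ p ]ᵇ * [ q ]ᵇ
    if-∧ true  q = sym (ℚ.*-identityˡ [ q ]ᵇ)
    if-∧ false q = sym (ℚ.*-zeroˡ [ q ]ᵇ)

  indicator-bounded : ∀ {m} d (β : Vec ℕ m) → VecAll (_≤ d) β → Bounded d (indicator β)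
  indicator-bounded d []      []       = tt
  indicator-bounded d (b ∷ β) (b≤ ∷ p) =
    (λ i d<i α → trans (indicator-∷ b i β α) (trans (cong (λ z → [ z ]ᵇ * indicator β α)
      (dec-false (b ℕ.≟ i) λ { refl → ℕ.<⇒≱ d<i b≤ })) (ℚ.*-zeroˡ (indicator β α)))) ,
    λ i → Bounded-cong d (λ α → sym (indicator-∷ b i β α)) (scaled (does (b ℕ.≟ i)))
    where
    scaled : ∀ t → Bounded d (λ α → [ t ]ᵇ * indicator β α)
    scaled true  = Bounded-cong d (λ α → sym (ℚ.*-identityˡ (indicator β α))) (indicator-bounded d β p)
    scaled false = Bounded-zero d (λ α → ℚ.*-zeroˡ (indicator β α))

  eval-indicator : ∀ {m} d (β : Vec ℕ m) x → VecAll (_≤ d) β → eval d (indicator β) x ≡ monomial β x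
  eval-indicator d []      []       []       = refl
  eval-indicator d (b ∷ β) (x ∷ xs) (b≤ ∷ p) = trans
    (poly-cong d x λ i → trans (eval-cong d xs (indicator-∷ b i β)) (trans (eval-* d [ does (b ℕ.≟ i) ]ᵇ (indicator β) xs)
      (trans (cong ([ does (b ℕ.≟ i) ]ᵇ *_) (eval-indicator d β xs p)) (ℚ.*-comm [ does (b ℕ.≟ i) ]ᵇ (monomial β xs)))))
    (trans (poly-* d (monomial β xs) (λ i → [ does (b ℕ.≟ i) ]ᵇ) x)
      (trans (cong (monomial β xs *_) (pick d b b≤)) (ℚ.*-comm (monomial β xs) (powℚ x b))))
    where
    pick : ∀ d b → b ≤ d → poly d (λ i → [ does (b ℕ.≟ i) ]ᵇ) x ≡ powℚ x b
    pick zero    zero    _       = refl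
    pick (suc d) zero    _       = trans (cong (λ z → 1ℚ + x * z) (poly-0 d x (λ _ → refl)))
      (solve 1 (λ x → con 1ℚ :+ x :* con 0ℚ := con 1ℚ) refl x)
    pick (suc d) (suc b) (s≤s p) = trans (ℚ.+-identityˡ _) (cong (x *_) (pick d b p))

  atℚ : List ℚ → ℕ → ℚ
  atℚ []      _       = 0ℚ
  atℚ (x ∷ L) zero    = x
  atℚ (x ∷ L) (suc a) = atℚ L a

  ∏ᵥ : ∀ {n} → (ℕ → ℚ) → Vec ℕ n → ℚ
  ∏ᵥ f []      = 1ℚ
  ∏ᵥ f (a ∷ κ) = f a * ∏ᵥ f κ

  private
    bump : ℕ → (ℕ → ℕ) → ℕ → ℕ
    bump a h i = if does (i ℕ.≟ a) then suc (h i) else h i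

    monomial-bump : ∀ {m} a (h : ℕ → ℕ) (x : Vec ℚ m) → a < m →
      monomial (tabulate {n = m} (bump a h ∘ toℕ)) x ≡ atℚ (toList x) a * monomial (tabulate {n = m} (h ∘ toℕ)) x
    monomial-bump zero    h (x ∷ xs) _       = ℚ.*-assoc x (powℚ x (h 0)) (monomial (tabulate (h ∘ suc ∘ toℕ)) xs)
    monomial-bump (suc a) h (x ∷ xs) (s≤s p) = trans (cong (powℚ x (h 0) *_) (monomial-bump a (h ∘ suc) xs p))
      (solve 3 (λ p q r → p :* (q :* r) := q :* (p :* r)) refl (powℚ x (h 0)) (atℚ (toList xs) a) (monomial (tabulate (h ∘ suc ∘ toℕ)) xs))

    monomial-zero : ∀ {m} (x : Vec ℚ m) → monomial (tabulate {n = m} (λ _ → 0)) x ≡ 1ℚ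
    monomial-zero []       = refl
    monomial-zero (x ∷ xs) = trans (ℚ.*-identityˡ _) (monomial-zero xs)

  monomial-exponents : ∀ {m n} (κ : Vec ℕ n) (x : Vec ℚ m) → (∀ i → lookup κ i < m) →
                       monomial (exponents m κ) x ≡ ∏ᵥ (atℚ (toList x)) κ
  monomial-exponents     []      x _  = monomial-zero x
  monomial-exponents {m} (a ∷ κ) x κ< = trans
    (cong (λ β → monomial β x) (Vec.tabulate-cong {n = m} λ i → count-∷ (toℕ i)))
    (trans (monomial-bump a (λ i → Vec.count (i ℕ.≟_) κ) x (κ< zero))
           (cong (atℚ (toList x) a *_) (monomial-exponents κ x (κ< ∘ suc))))
    where
    count-∷ : ∀ i → Vec.count (i ℕ.≟_) (a ∷ κ) ≡ bump a (λ i → Vec.count (i ℕ.≟_) κ) i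
    count-∷ i with does (i ℕ.≟ a)
    ... | true  = refl
    ... | false = refl

  count-sum : ∀ {B : Set} {P : B → Set} (P? : Unary.Decidable P) (L : List B) →
              (+ length (filter P? L)) ℚ./ 1 ≡ ∑ℚ L (λ b → [ does (P? b) ]ᵇ)
  count-sum P? L = trans (sym (⟦⟧-def (+ length (filter P? L)))) (go L)
    where
    go : ∀ L → nat (length (filter P? L)) ≡ ∑ℚ L (λ b → [ does (P? b) ]ᵇ)
    go []      = ⟦⟧-0
    go (b ∷ L) with does (P? b)
    ... | true  = trans (nat-suc (length (filter P? L))) (cong (λ z → 1ℚ + z) (go L))
    ... | false = trans (go L) (sym (ℚ.+-identityˡ (∑ℚ L (λ b → [ does (P? b) ]ᵇ))))

  -- With m variables only the first m colours count, so the series becomes a finite sum over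
  -- colourings.
  chromaticValue : ∀ {n m} → Graph n → Vec ℚ m → ℚ
  chromaticValue {n} {m} Γ x = ∑ℚ (words (upTo m) n) (λ κ → [ does (proper? Γ κ) ]ᵇ * ∏ᵥ (atℚ (toList x)) κ)

  exponents-≤ : ∀ {m n} (κ : Vec ℕ n) → VecAll (_≤ n) (exponents m κ)
  exponents-≤ {m} {n} κ = tab {m} (λ i → Vec.count (toℕ i ℕ.≟_) κ) (λ i → Vec.count≤n (toℕ i ℕ.≟_) κ)
    where
    tab : ∀ {m} (h : Fin m → ℕ) → (∀ i → h i ≤ n) → VecAll (_≤ n) (tabulate h)
    tab {zero}  h e = []
    tab {suc m} h e = e zero ∷ tab (h ∘ suc) (e ∘ suc)

  ≙-chromatic : ∀ {n m} (Γ : Graph n) → coeff (chromatic Γ) {m} ≙ chromaticValue Γ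
  ≙-chromatic {n} {m} Γ .degree = n
  ≙-chromatic {n} {m} Γ .bounded = Bounded-cong n (λ α → sym (as-sum α)) (go (words (upTo m) n))
    where
    term : Vec ℕ n → Vec ℕ m → ℚ
    term κ α = [ does (hasMonomial? Γ α κ) ]ᵇ
    as-sum : ∀ α → coeff (chromatic Γ) α ≡ ∑ℚ (words (upTo m) n) (λ κ → term κ α)
    as-sum α = count-sum (hasMonomial? Γ α) (words (upTo m) n)
    one-term : ∀ κ → Bounded n (term κ)
    one-term κ = both (does (proper? Γ κ))
      where
      both : ∀ q → Bounded n (λ α → [ does (Vec.≡-dec ℕ._≟_ (exponents m κ) α) ∧ q ]ᵇ)
      both true  = Bounded-cong n (λ α → cong [_]ᵇ (sym (Bool.∧-identityʳ (does (Vec.≡-dec ℕ._≟_ (exponents m κ) α)))))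
        (indicator-bounded n (exponents m κ) (exponents-≤ {m} κ))
      both false = Bounded-zero n (λ α → cong [_]ᵇ (Bool.∧-zeroʳ (does (Vec.≡-dec ℕ._≟_ (exponents m κ) α))))
    go : ∀ K → Bounded n (λ α → ∑ℚ K (λ κ → term κ α))
    go []      = Bounded-zero n (λ _ → refl)
    go (κ ∷ K) = Bounded-+ n (one-term κ) (go K)
  ≙-chromatic {n} {m} Γ .value x = trans (eval-cong n x (λ α → count-sum (hasMonomial? Γ α) (words (upTo m) n)))
    (trans (eval-∑ n (words (upTo m) n) (λ κ α → [ does (hasMonomial? Γ α κ) ]ᵇ) x)
      (∑-cong (words (upTo m) n) λ {κ} κ∈ → one-value κ (All.lookup (words-∈ (upTo m) n (All.applyUpTo⁺₁ id m id)) κ∈)))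
    where
    one-value : ∀ κ → (∀ i → lookup κ i < m) →
                eval n (λ α → [ does (hasMonomial? Γ α κ) ]ᵇ) x ≡ [ does (proper? Γ κ) ]ᵇ * ∏ᵥ (atℚ (toList x)) κ
    one-value κ κ< = trans (eval-cong n x λ α → trans (if-∧ (does (Vec.≡-dec ℕ._≟_ (exponents m κ) α)) (does (proper? Γ κ)))
        (ℚ.*-comm (indicator (exponents m κ) α) [ does (proper? Γ κ) ]ᵇ))
      (trans (eval-* n [ does (proper? Γ κ) ]ᵇ (indicator (exponents m κ)) x)
        (cong ([ does (proper? Γ κ) ]ᵇ *_) (trans (eval-indicator n (exponents m κ) x (exponents-≤ {m} κ)) (monomial-exponents κ x κ<))))
      where
      if-∧ : ∀ p q → [ p ∧ q ]ᵇ ≡ [ p ]ᵇ * [ q ]ᵇ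
      if-∧ true  q = sym (ℚ.*-identityˡ [ q ]ᵇ)
      if-∧ false q = sym (ℚ.*-zeroˡ [ q ]ᵇ)

  -- The fraction p takes the value v x at every good point x.
  record HasValue (M : ℕ) (p : Fraction) (v : Vec ℚ M → ℚ) : Set where
    field
      P Q  : Vec ℚ M → ℚ
      num≙ : coeff (num p) {M} ≙ P
      den≙ : coeff (den p) {M} ≙ Q
      Q≢0  : ∀ x → Good x → Q x ≢ 0ℚ
      P≡vQ : ∀ x → Good x → P x ≡ v x * Q x

  open HasValue

  value-ι : ∀ {M f F} → coeff f {M} ≙ F → HasValue M (ι f) F
  value-ι {F = F} f≙ = record
    { P = F ; Q = λ _ → 1ℚ ; num≙ = f≙ ; den≙ = ≙-const 1ℚ ; Q≢0 = λ _ _ () ; P≡vQ = λ x _ → sym (ℚ.*-identityʳ (F x)) }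

  value-+ : ∀ {M p q u v} → HasValue M p u → HasValue M q v → HasValue M (p +ᶠ q) (λ x → u x + v x)
  value-+ {u = u} {v} a b = record
    { P = λ x → P a x * Q b x + P b x * Q a x
    ; Q = λ x → Q a x * Q b x
    ; num≙ = ≙-+ (≙-* (num≙ a) (den≙ b)) (≙-* (num≙ b) (den≙ a))
    ; den≙ = ≙-* (den≙ a) (den≙ b)
    ; Q≢0 = λ x g z → Q≢0 b x g (ℚ-domain (Q a x) (Q b x) (Q≢0 a x g) z)
    ; P≡vQ = λ x g → trans (cong₂ (λ s t → s * Q b x + t * Q a x) (P≡vQ a x g) (P≡vQ b x g))
        (solve 4 (λ u v q r → (u :* q) :* r :+ (v :* r) :* q := (u :+ v) :* (q :* r)) refl (u x) (v x) (Q a x) (Q b x))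
    }

  value-* : ∀ {M p q u v} → HasValue M p u → HasValue M q v → HasValue M (p *ᶠ q) (λ x → u x * v x)
  value-* {u = u} {v} a b = record
    { P = λ x → P a x * P b x
    ; Q = λ x → Q a x * Q b x
    ; num≙ = ≙-* (num≙ a) (num≙ b)
    ; den≙ = ≙-* (den≙ a) (den≙ b)
    ; Q≢0 = λ x g z → Q≢0 b x g (ℚ-domain (Q a x) (Q b x) (Q≢0 a x g) z)
    ; P≡vQ = λ x g → trans (cong₂ _*_ (P≡vQ a x g) (P≡vQ b x g))
        (solve 4 (λ u v q r → (u :* q) :* (v :* r) := (u :* v) :* (q :* r)) refl (u x) (v x) (Q a x) (Q b x))
    }

  value-∑ : ∀ {M} {B : Set} (K : List B) {f : B → Fraction} {v : B → Vec ℚ M → ℚ} →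
            (∀ {b} → b ∈ K → HasValue M (f b) (v b)) → HasValue M (∑ K f) (λ x → ∑ℚ K (λ b → v b x))
  value-∑ []      h = value-ι (≙-const 0ℚ)
  value-∑ (b ∷ K) h = value-+ (h (here refl)) (value-∑ K (h ∘ there))

  value-∏ : ∀ {M} {B : Set} (K : List B) {f : B → Fraction} {v : B → Vec ℚ M → ℚ} →
            (∀ {b} → b ∈ K → HasValue M (f b) (v b)) → HasValue M (∏ K f) (λ x → ∏ℚ K (λ b → v b x))
  value-∏ []      h = value-ι (≙-const 1ℚ)
  value-∏ (b ∷ K) h = value-* (h (here refl)) (value-∏ K (h ∘ there))

  -- Equality of fractions is cross-multiplied, hence an equality of polynomials, and these may be
  -- compared at good points.
  value-≃ : ∀ {M f F p v} → coeff f {M} ≙ F → HasValue M p v → (∀ x → Good x → F x ≡ v x) →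
            ∀ (α : Vec ℕ M) → coeff (num (ι f) *ₛ den p) α ≡ coeff (num p *ₛ den (ι f)) α
  value-≃ {F = F} {v = v} f≙ h e = ≙-unique (≙-* f≙ (den≙ h)) (≙-* (num≙ h) (≙-const 1ℚ)) λ x g → trans
    (cong (_* Q h x) (e x g)) (trans (sym (P≡vQ h x g)) (sym (ℚ.*-identityʳ (P h x))))

-- Adding and removing the largest entry of a tableau.

module Tableaux where

  open Lists
  open import Data.Nat.Base using (_+_)
  open import Data.Fin.Base using (suc)
  open import Data.List.Membership.DecPropositional ℤ._≟_ using (_∈?_)
  open import Data.List.Relation.Unary.Linked using ([]; _∷_)
  open import Data.List.Relation.Binary.Prefix.Heterogeneous using ([]; _∷_)

  private variable
    B : Set

  -- Rows are scanned from the bottom, so v joins the lowest row of length c - 1, the only one of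
  -- these that may grow. Failing that, a new top row is opened, which is right for c = 1 alone.
  insert : ℕ → ℤ → Tableau → Tableau
  insert c v []        = (v ∷ []) ∷ []
  insert c v (row ∷ T) with suc (length row) ℕ.≟ c
  ... | yes _ = (row ∷ʳ v) ∷ T
  ... | no  _ = row ∷ insert c v T

  entries-insert : ∀ c v T → entries (insert c v T) ↭ v ∷ entries T
  entries-insert c v []        = ↭.refl
  entries-insert c v (row ∷ T) with suc (length row) ℕ.≟ c
  ... | yes _ = ↭.trans (↭.↭-reflexive (List.++-assoc row (v ∷ []) (entries T))) (↭.shift v row (entries T))
  ... | no  _ = ↭.trans (↭.++⁺ˡ row (entries-insert c v T)) (↭.shift v row (entries T))

  prefix-refl : ∀ (xs : List B) → Prefix _≡_ xs xs
  prefix-refl []       = []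
  prefix-refl (x ∷ xs) = refl ∷ prefix-refl xs

  prefix-++ : ∀ (xs ys : List B) → Prefix _≡_ xs (xs ++ ys)
  prefix-++ []       ys = []
  prefix-++ (x ∷ xs) ys = refl ∷ prefix-++ xs ys

  prefix-trans : ∀ {xs ys zs : List B} → Prefix _≡_ xs ys → Prefix _≡_ ys zs → Prefix _≡_ xs zs
  prefix-trans []         _          = []
  prefix-trans (refl ∷ p) (refl ∷ q) = refl ∷ prefix-trans p q

  ⊑-refl : ∀ T → T ⊑ T
  ⊑-refl []        = []
  ⊑-refl (row ∷ T) = prefix-refl row ∷ ⊑-refl T

  ⊑-trans : ∀ {T T′ T″} → T ⊑ T′ → T′ ⊑ T″ → T ⊑ T″
  ⊑-trans []      _        = []
  ⊑-trans (p ∷ q) (p′ ∷ q′) = prefix-trans p p′ ∷ ⊑-trans q q′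

  ⊑-insert : ∀ c v T → T ⊑ insert c v T
  ⊑-insert c v []        = []
  ⊑-insert c v (row ∷ T) with suc (length row) ℕ.≟ c
  ... | yes _ = prefix-++ row (v ∷ []) ∷ ⊑-refl T
  ... | no  _ = prefix-refl row ∷ ⊑-insert c v T

  NonEmpty : Tableau → Set
  NonEmpty = All (λ row → 1 ≤ length row)

  Row : ℕ → Tableau → Set
  Row l = Any (λ row → length row ≡ l)

  Addable : ℕ → Tableau → Set
  Addable c T = c ≡ 1 ⊎ Any (λ row → suc (length row) ≡ c) T

  linked-∷ʳ : ∀ {row v} → Linked ℤ._<_ row → All (ℤ._< v) row → Linked ℤ._<_ (row ∷ʳ v)
  linked-∷ʳ []       []       = [-]
  linked-∷ʳ [-]      (p ∷ []) = p ∷ [-]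
  linked-∷ʳ (q ∷ ls) (_ ∷ ps) = q ∷ linked-∷ʳ ls ps

  linked-prefix : ∀ {row row′} → Prefix _≡_ row row′ → Linked ℤ._<_ row′ → Linked ℤ._<_ row
  linked-prefix []                  _        = []
  linked-prefix (refl ∷ [])         _        = [-]
  linked-prefix (refl ∷ refl ∷ p)   (q ∷ ls) = q ∷ linked-prefix (refl ∷ p) ls

  below-∷ʳ : ∀ {lower row v} → lower below row → All (ℤ._< v) lower → length lower ≢ length row → lower below (row ∷ʳ v)
  below-∷ʳ {[]}        []      _        ne = contradiction refl ne
  below-∷ʳ {a ∷ lower} []      (p ∷ _)  ne = p ∷ []
  below-∷ʳ             (q ∷ b) (_ ∷ ps) ne = q ∷ below-∷ʳ b ps (ne ∘ cong suc)

  below-extend : ∀ {lower row} zs → lower below row → (lower ++ zs) below row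
  below-extend zs []      = []
  below-extend zs (q ∷ b) = q ∷ below-extend zs b

  below-prefix : ∀ {lower row row′} → Prefix _≡_ row row′ → lower below row′ → lower below row
  below-prefix []         _       = []
  below-prefix (refl ∷ p) (q ∷ b) = q ∷ below-prefix p b

  below-length : ∀ {lower row} → lower below row → length row ≤ length lower
  below-length []      = z≤n
  below-length (_ ∷ b) = s≤s (below-length b)

  below-unsnoc : ∀ {lower row v} → (lower ∷ʳ v) below row → All (ℤ._≤ v) row → lower below row
  below-unsnoc {[]}        []       _        = []
  below-unsnoc {[]}        (q ∷ []) (p ∷ _)  = contradiction p (ℤ.<⇒≱ q)
  below-unsnoc {_ ∷ lower} []       _        = []
  below-unsnoc {_ ∷ lower} (q ∷ b)  (_ ∷ ps) = q ∷ below-unsnoc b ps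

  linked-extend : ∀ {row T} zs → Linked _below_ (row ∷ T) → Linked _below_ ((row ++ zs) ∷ T)
  linked-extend zs [-]     = [-]
  linked-extend zs (b ∷ l) = below-extend zs b ∷ l

  linked-tail : ∀ {row T} → Linked _below_ (row ∷ T) → Linked _below_ T
  linked-tail [-]     = []
  linked-tail (_ ∷ l) = l

  private
    addable-tail : ∀ {c row T} → c ≢ suc (length row) → Addable c (row ∷ T) → Addable c T
    addable-tail ne (inj₁ e)         = inj₁ e
    addable-tail ne (inj₂ (here e))  = contradiction (sym e) ne
    addable-tail ne (inj₂ (there a)) = inj₂ a

    linked-insert : ∀ {c v row T} → suc (length row) ≢ c → 1 ≤ length row → NonEmpty T → Linked _below_ (row ∷ T) →
                    All (ℤ._< v) (row ++ entries T) → Addable c T → Linked _below_ (row ∷ insert c v T)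
    linked-insert {row = a ∷ row} {[]} ne _ _ _ (a<v ∷ _) _ = (a<v ∷ []) ∷ [-]
    linked-insert {c} {v} {row} {r₂ ∷ T} ne _ (n ∷ ns) (b ∷ l) <v add with suc (length r₂) ℕ.≟ c
    ... | yes refl = below-∷ʳ b (All.++⁻ˡ row <v) (ne ∘ cong suc) ∷ linked-extend (v ∷ []) l
    ... | no ne₂   = b ∷ linked-insert ne₂ n ns l (All.++⁻ʳ row <v) (addable-tail (ne₂ ∘ sym) add)

    insert-nonempty : ∀ c v T → NonEmpty T → NonEmpty (insert c v T)
    insert-nonempty c v []        _        = s≤s z≤n ∷ []
    insert-nonempty c v (row ∷ T) (n ∷ ns) with suc (length row) ℕ.≟ c
    ... | yes _ = subst (1 ≤_) (sym (length-∷ʳ row v)) (s≤s z≤n) ∷ ns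
    ... | no  _ = n ∷ insert-nonempty c v T ns

    insert-rows : ∀ c v T → All (Linked ℤ._<_) T → All (ℤ._< v) (entries T) → All (Linked ℤ._<_) (insert c v T)
    insert-rows c v []        _        _  = [-] ∷ []
    insert-rows c v (row ∷ T) (l ∷ ls) <v with suc (length row) ℕ.≟ c
    ... | yes _ = linked-∷ʳ l (All.++⁻ˡ row <v) ∷ ls
    ... | no  _ = l ∷ insert-rows c v T ls (All.++⁻ʳ row <v)

  insert-tableau : ∀ {c v T} → IsTableau T → All (ℤ._< v) (entries T) → Addable c T → IsTableau (insert c v T)
  insert-tableau {c} {v} {T} (ns , ls , bs , u) <v add =
    insert-nonempty c v T ns , insert-rows c v T ls <v , belows T ns bs <v add ,
    unique-resp (↭.↭-sym (entries-insert c v T)) (All.map (λ x<v v≡x → ℤ.<-irrefl (sym v≡x) x<v) <v ∷ u)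
    where
    belows : ∀ T → NonEmpty T → Linked _below_ T → All (ℤ._< v) (entries T) → Addable c T → Linked _below_ (insert c v T)
    belows []        _        _ _  _   = [-]
    belows (row ∷ T) (n ∷ ns) l <v add with suc (length row) ℕ.≟ c
    ... | yes _ = linked-extend (v ∷ []) l
    ... | no ne = linked-insert ne n ns l <v (addable-tail (ne ∘ sym) add)

  insert-width : ∀ {N c v} T → 1 ≤ c → c ≤ N → All (λ row → length row ≤ N) T → All (λ row → length row ≤ N) (insert c v T)
  insert-width []        1≤c c≤N _        = ℕ.≤-trans 1≤c c≤N ∷ []
  insert-width {N} {c} {v} (row ∷ T) 1≤c c≤N (w ∷ ws) with suc (length row) ℕ.≟ c
  ... | yes e = subst (_≤ N) (sym (trans (length-∷ʳ row v) e)) c≤N ∷ ws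
  ... | no  _ = w ∷ insert-width T 1≤c c≤N ws

  row-insert : ∀ {c v} T → Addable c T → Row c (insert c v T)
  row-insert {.1} []   (inj₁ refl) = here refl
  row-insert {c} {v} (row ∷ T) add with suc (length row) ℕ.≟ c
  ... | yes e = here (trans (length-∷ʳ row v) e)
  ... | no ne = there (row-insert T (addable-tail (ne ∘ sym) add))

  row-keep : ∀ {c v l} T → suc l ≢ c → Row l T → Row l (insert c v T)
  row-keep {c} {v} (row ∷ T) ne r with suc (length row) ℕ.≟ c
  row-keep (row ∷ T) ne (here e)  | yes e′ = contradiction (trans (cong suc (sym e)) e′) ne
  row-keep (row ∷ T) ne (there r) | yes _  = there r
  row-keep (row ∷ T) ne (here e)  | no _   = here e
  row-keep (row ∷ T) ne (there r) | no _   = there (row-keep T ne r)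

  At : ℤ → ℕ → Tableau → Set
  At x c = Any (λ row → ∃[ pre ] ∃[ post ] row ≡ pre ++ x ∷ post × suc (length pre) ≡ c)

  At-⊑ : ∀ {x c T T′} → T ⊑ T′ → At x c T → At x c T′
  At-⊑ (p ∷ q) (here (pre , post , refl , refl)) = here (grow pre p)
    where
    grow : ∀ {x post row′} pre → Prefix _≡_ (pre ++ x ∷ post) row′ →
           ∃[ pre′ ] ∃[ post′ ] row′ ≡ pre′ ++ x ∷ post′ × suc (length pre′) ≡ suc (length pre)
    grow []        (refl ∷ p) = [] , _ , refl , refl
    grow (a ∷ pre) (refl ∷ p) with grow pre p
    ... | pre′ , post′ , refl , e = a ∷ pre′ , post′ , refl , cong suc e
  At-⊑ (p ∷ q) (there a) = there (At-⊑ q a)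

  At-insert : ∀ {c v} T → Addable c T → At v c (insert c v T)
  At-insert {.1} []    (inj₁ refl) = here ([] , [] , refl , refl)
  At-insert {c} {v} (row ∷ T) add with suc (length row) ℕ.≟ c
  ... | yes e = here (row , [] , refl , e)
  ... | no ne = there (At-insert T (addable-tail (ne ∘ sym) add))

  At⇒∈ : ∀ {x c T} → At x c T → x ∈ entries T
  At⇒∈ {T = row ∷ T} (here (pre , post , refl , _)) = ∈.∈-++⁺ˡ (∈.∈-++⁺ʳ pre (here refl))
  At⇒∈ {T = row ∷ T} (there a) = ∈.∈-++⁺ʳ row (At⇒∈ a)

  ∈⇒At : ∀ {x} T → x ∈ entries T → ∃[ c ] At x c T
  ∈⇒At (row ∷ T) x∈ with ∈.∈-++⁻ row x∈
  ... | inj₂ p = proj₁ (∈⇒At T p) , there (proj₂ (∈⇒At T p))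
  ... | inj₁ p with ∈.∈-∃++ p
  ...   | pre , post , e = suc (length pre) , here (pre , post , e , refl)

  private
    position : ℤ → List ℤ → Maybe ℕ
    position x row = Maybe.map (λ i → suc (toℕ i)) (findIndex (x ℤ.≟_) row)

    place : ∀ {n} → Fin n → ℕ
    place i = suc (toℕ i)

    next : ℕ → ℕ
    next = suc

    map-suc : ∀ {n} (i : Maybe (Fin n)) → Maybe.map place (Maybe.map Fin.suc i) ≡ Maybe.map next (Maybe.map place i)
    map-suc (just i) = refl
    map-suc nothing  = refl

    position-here : ∀ {x} row → position x (x ∷ row) ≡ just 1
    position-here {x} row rewrite dec-true (x ℤ.≟ x) refl = refl

    position-there : ∀ {x a} row → x ≢ a → position x (a ∷ row) ≡ Maybe.map next (position x row)
    position-there {x} {a} row x≢a rewrite dec-false (x ℤ.≟ a) x≢a = map-suc (findIndex (x ℤ.≟_) row)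

    position-∉ : ∀ {x} row → x ∉ row → position x row ≡ nothing
    position-∉ []        _  = refl
    position-∉ (a ∷ row) x∉ = trans (position-there row (x∉ ∘ here)) (cong (Maybe.map next) (position-∉ row (x∉ ∘ there)))

    position-∈ : ∀ {x} pre {post} → x ∉ pre → position x (pre ++ x ∷ post) ≡ just (suc (length pre))
    position-∈ {x} []    {post} _  = position-here {x} post
    position-∈ (a ∷ pre) {post} x∉ = trans (position-there (pre ++ _ ∷ post) (x∉ ∘ here)) (cong (Maybe.map next) (position-∈ pre (x∉ ∘ there)))

    column-just : ∀ {x row T c} → position x row ≡ just c → column (row ∷ T) x ≡ c
    column-just {x} {row} {T} e with position x row
    column-just refl | just _ = refl

    column-nothing : ∀ {x row T} → position x row ≡ nothing → column (row ∷ T) x ≡ column T x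
    column-nothing {x} {row} {T} e with position x row
    column-nothing refl | nothing = refl

  column-At : ∀ {x c T} → Unique (entries T) → At x c T → column T x ≡ c
  column-At {x} {T = row ∷ T} u (here (pre , post , refl , refl)) =
    column-just {x} {row} {T} (position-∈ pre λ x∈ → proj₂ (proj₂ (unique-++⁻ pre (proj₁ (unique-++⁻ (pre ++ x ∷ post) u)))) x∈ (here refl))
  column-At {x} {T = row ∷ T} u (there a) = trans
    (column-nothing {x} {row} {T} (position-∉ row λ x∈ → proj₂ (proj₂ (unique-++⁻ row u)) x∈ (At⇒∈ a)))
    (column-At (proj₁ (proj₂ (unique-++⁻ row u))) a)

  private
    prefix-unsnoc : ∀ {r₀ pre : List ℤ} {v} → Prefix _≡_ r₀ (pre ∷ʳ v) → v ∉ r₀ → Prefix _≡_ r₀ pre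
    prefix-unsnoc {pre = []}      []         _  = []
    prefix-unsnoc {pre = []}      (refl ∷ _) v∉ = contradiction (here refl) v∉
    prefix-unsnoc {pre = _ ∷ pre} []         _  = []
    prefix-unsnoc {pre = _ ∷ pre} (refl ∷ p) v∉ = refl ∷ prefix-unsnoc p (v∉ ∘ there)

    max-last : ∀ {v} pre {post} → Linked ℤ._<_ (pre ++ v ∷ post) → All (ℤ._≤ v) (pre ++ v ∷ post) → post ≡ []
    max-last []              {[]}    _       _           = refl
    max-last []              {_ ∷ _} (q ∷ _) (_ ∷ p ∷ _) = contradiction p (ℤ.<⇒≱ q)
    max-last (_ ∷ [])        (_ ∷ l) (_ ∷ ps) = max-last [] l ps
    max-last (_ ∷ a ∷ pre)   (_ ∷ l) (_ ∷ ps) = max-last (a ∷ pre) l ps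

    linked-⊑ : ∀ {row T T′} → T′ ⊑ T → Linked _below_ (row ∷ T) → Linked _below_ T′ → Linked _below_ (row ∷ T′)
    linked-⊑ []      _       _ = [-]
    linked-⊑ (p ∷ q) (b ∷ _) l = below-prefix p b ∷ l

    row-≤ : ∀ {row T c} → Linked _below_ (row ∷ T) → Row c T → c ≤ length row
    row-≤ (b ∷ l) (here refl) = below-length b
    row-≤ (b ∷ l) (there r)   = ℕ.≤-trans (row-≤ l r) (below-length b)

  record Uninsert (v : ℤ) (T : Tableau) : Set where
    field
      smaller  : Tableau
      col      : ℕ
      inserted : insert col v smaller ≡ T
      tableau  : IsTableau smaller
      addable  : Addable col smaller
      contains : ∀ {T₀} → NonEmpty T₀ → T₀ ⊑ T → v ∉ entries T₀ → T₀ ⊑ smaller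

  -- The largest entry ends its row and has nothing above it, so deleting it leaves a tableau. A
  -- tableau `T₀` without v survives the deletion.
  uninsert : ∀ {v} T → IsTableau T → v ∈ entries T → All (ℤ._≤ v) (entries T) → Uninsert v T
  uninsert {v} (row ∷ T) (n ∷ ns , l ∷ ls , bs , u) v∈ ≤v with v ∈? row
  ... | no v∉ = record
    { smaller  = row ∷ smaller
    ; col      = col
    ; inserted = skip
    ; tableau  = n ∷ proj₁ tableau , l ∷ proj₁ (proj₂ tableau) , linked-⊑ smaller⊑T bs (proj₁ (proj₂ (proj₂ tableau))) ,
        unique-tail (unique-resp (↭.trans (↭.++⁺ˡ row (↭.trans (↭.↭-reflexive (cong entries (sym inserted))) (entries-insert col v smaller)))
          (↭.shift v row (entries smaller))) u)
    ; addable  = lift addable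
    ; contains = λ { _ [] _ → [] ; {r₀ ∷ T₀} (_ ∷ ns₀) (p ∷ q) v∉₀ → p ∷ contains ns₀ q (v∉₀ ∘ ∈.∈-++⁺ʳ r₀) }
    }
    where
    v∈T : v ∈ entries T
    v∈T with ∈.∈-++⁻ row v∈
    ... | inj₁ p = contradiction p v∉
    ... | inj₂ p = p
    open Uninsert (uninsert T (ns , ls , linked-tail bs , proj₁ (proj₂ (unique-++⁻ row u))) v∈T (All.++⁻ʳ row ≤v))
    smaller⊑T : smaller ⊑ T
    smaller⊑T = subst (smaller ⊑_) inserted (⊑-insert col v smaller)
    -- The row that receives v has length `col` and lies above `row`. So `row` is at least that long
    -- and gets passed over.
    skip : insert col v (row ∷ smaller) ≡ row ∷ T
    skip with suc (length row) ℕ.≟ col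
    ... | yes e = contradiction (ℕ.≤-trans (ℕ.≤-reflexive e) (row-≤ bs (subst (Row col) inserted (row-insert smaller addable)))) ℕ.1+n≰n
    ... | no  _ = cong (row ∷_) inserted
    lift : Addable col smaller → Addable col (row ∷ smaller)
    lift (inj₁ e) = inj₁ e
    lift (inj₂ a) = inj₂ (there a)
  ... | yes p with ∈.∈-∃++ p
  ...   | pre , post , refl with max-last pre l (All.++⁻ˡ (pre ++ v ∷ post) ≤v)
  uninsert {v} (.(v ∷ []) ∷ T) (n ∷ ns , l ∷ ls , bs , u) v∈ ≤v | yes p | [] , .[] , refl | refl = record
    { smaller  = []
    ; col      = 1
    ; inserted = cong ((v ∷ []) ∷_) (sym (top ns bs (All.++⁻ʳ (v ∷ []) ≤v)))
    ; tableau  = [] , [] , [] , []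
    ; addable  = inj₁ refl
    ; contains = λ { _ [] _ → [] ; (() ∷ _) ([] ∷ _) _ ; _ ((refl ∷ _) ∷ _) v∉₀ → contradiction (here refl) v∉₀ }
    }
    where
    top : ∀ {T} → NonEmpty T → Linked _below_ ((v ∷ []) ∷ T) → All (ℤ._≤ v) (entries T) → T ≡ []
    top {[]}          _        _             _       = refl
    top {[] ∷ T}      (() ∷ _) _             _
    top {(a ∷ r) ∷ T} _        ((q ∷ _) ∷ _) (a≤ ∷ _) = contradiction a≤ (ℤ.<⇒≱ q)
  uninsert {v} (.((a ∷ pre) ++ v ∷ []) ∷ T) (n ∷ ns , l ∷ ls , bs , u) v∈ ≤v | yes p | a ∷ pre , .[] , refl | refl = record
    { smaller  = (a ∷ pre) ∷ T
    ; col      = suc (suc (length pre))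
    ; inserted = fits
    ; tableau  = s≤s z≤n ∷ ns , linked-prefix (prefix-++ (a ∷ pre) (v ∷ [])) l ∷ ls , shrink bs (All.++⁻ʳ ((a ∷ pre) ++ v ∷ []) ≤v) ,
        unique-tail (unique-resp (↭.trans (↭.↭-reflexive (List.++-assoc (a ∷ pre) (v ∷ []) (entries T))) (↭.shift v (a ∷ pre) (entries T))) u)
    ; addable  = inj₂ (here refl)
    ; contains = λ { _ [] _ → [] ; _ (q ∷ qs) v∉₀ → prefix-unsnoc q (v∉₀ ∘ ∈.∈-++⁺ˡ) ∷ qs }
    }
    where
    fits : insert (suc (suc (length pre))) v ((a ∷ pre) ∷ T) ≡ ((a ∷ pre) ++ v ∷ []) ∷ T
    fits with suc (length (a ∷ pre)) ℕ.≟ suc (suc (length pre))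
    ... | yes _ = refl
    ... | no ne = contradiction refl ne
    shrink : ∀ {T} → Linked _below_ (((a ∷ pre) ∷ʳ v) ∷ T) → All (ℤ._≤ v) (entries T) → Linked _below_ ((a ∷ pre) ∷ T)
    shrink         [-]     _  = [-]
    shrink {r ∷ T} (b ∷ l) ≤v = below-unsnoc b (All.++⁻ˡ r ≤v) ∷ l

  -- The tableaux obtained from T₀ by adding the entries R, listed in decreasing order.
  Spec : Tableau → List ℤ → Tableau → Set
  Spec T₀ R T = IsTableau T × T₀ ⊑ T × (∀ x → x ∈ entries T → x ∈ entries T₀ ⊎ x ∈ R) × (∀ x → x ∈ R → x ∈ entries T)

  Decreasing : Tableau → List ℤ → Set
  Decreasing T₀ []      = NonEmpty T₀ × Unique (entries T₀)
  Decreasing T₀ (v ∷ R) = All (ℤ._< v) (entries T₀) × All (ℤ._< v) R × Decreasing T₀ R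

  private
    prefix-length : ∀ {xs ys : List B} → Prefix _≡_ xs ys → length xs ≤ length ys
    prefix-length []      = z≤n
    prefix-length (_ ∷ p) = s≤s (prefix-length p)

    prefix-≡ : ∀ {xs ys : List B} → Prefix _≡_ xs ys → length ys ≤ length xs → xs ≡ ys
    prefix-≡ {ys = []}    []         _       = refl
    prefix-≡ {ys = _ ∷ _} (refl ∷ p) (s≤s q) = cong (_ ∷_) (prefix-≡ p q)

    ⊑-length : ∀ {T T′} → T ⊑ T′ → length (entries T) ≤ length (entries T′)
    ⊑-length []                                 = z≤n
    ⊑-length {row ∷ T} {row′ ∷ T′} (p ∷ q) = ℕ.≤-trans (ℕ.≤-reflexive (List.length-++ row))
      (ℕ.≤-trans (ℕ.+-mono-≤ (prefix-length p) (⊑-length q)) (ℕ.≤-reflexive (sym (List.length-++ row′))))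

    ⊑-≡ : ∀ {T T′} → NonEmpty T′ → T ⊑ T′ → length (entries T′) ≤ length (entries T) → T ≡ T′
    ⊑-≡ {T′ = []}      _        []      _  = refl
    ⊑-≡ {T′ = (_ ∷ _) ∷ _} (n ∷ _) []    ()
    ⊑-≡ {row ∷ T} {row′ ∷ T′} (n ∷ ns) (p ∷ q) le = cong₂ _∷_
      (prefix-≡ p (ℕ.+-cancelʳ-≤ (length (entries T)) (length row′) (length row)
        (ℕ.≤-trans (ℕ.+-monoʳ-≤ (length row′) (⊑-length q)) le′)))
      (⊑-≡ ns q (ℕ.+-cancelˡ-≤ (length row) (length (entries T′)) (length (entries T))
        (ℕ.≤-trans (ℕ.+-monoˡ-≤ (length (entries T′)) (prefix-length p)) le′)))
      where
      le′ : length row′ + length (entries T′) ≤ length row + length (entries T)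
      le′ = ℕ.≤-trans (ℕ.≤-reflexive (sym (List.length-++ row′))) (ℕ.≤-trans le (ℕ.≤-reflexive (List.length-++ row)))

  -- The largest new entry is removed from both tableaux; its column tells where it was, and
  -- induction settles the rest.
  spec-unique : ∀ {T₀} R {T T′} → Decreasing T₀ R → Spec T₀ R T → Spec T₀ R T′ →
                (∀ {v} → v ∈ R → column T v ≡ column T′ v) → T ≡ T′
  spec-unique {T₀} [] (ne , u) s s′ _ = trans (sym (base s)) (base s′)
    where
    base : ∀ {T} → Spec T₀ [] T → T₀ ≡ T
    base ((ns , _ , _ , uT) , sub , fromT , _) = ⊑-≡ ns sub (unique-⊆-length uT λ {x} x∈ → from x (fromT x x∈))
      where
      from : ∀ x → x ∈ entries T₀ ⊎ x ∈ [] → x ∈ entries T₀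
      from x (inj₁ p) = p
  spec-unique {T₀} (v ∷ R) {T} {T′} (T₀<v , R<v , dec) s s′ cols = trans (sym (inserted U)) (trans
    (cong₂ (λ c → insert c v) col≡ (spec-unique R dec (step s U) (step s′ U′) cols′)) (inserted U′))
    where
    open Uninsert
    max : ∀ {T} → Spec T₀ (v ∷ R) T → All (ℤ._≤ v) (entries T)
    max (_ , _ , fromT , _) = All.tabulate λ {x} x∈ → bound x (fromT x x∈)
      where
      bound : ∀ x → x ∈ entries T₀ ⊎ x ∈ v ∷ R → x ℤ.≤ v
      bound x (inj₁ p)           = ℤ.<⇒≤ (All.lookup T₀<v p)
      bound x (inj₂ (here refl)) = ℤ.≤-refl
      bound x (inj₂ (there p))   = ℤ.<⇒≤ (All.lookup R<v p)
    removal : ∀ {T} → Spec T₀ (v ∷ R) T → Uninsert v T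
    removal {T} s = uninsert T (proj₁ s) (proj₂ (proj₂ (proj₂ s)) v (here refl)) (max s)
    U = removal s
    U′ = removal s′
    v∉T₀ : v ∉ entries T₀
    v∉T₀ p = ℤ.<-irrefl refl (All.lookup T₀<v p)
    nonEmpty₀ : ∀ R → Decreasing T₀ R → NonEmpty T₀
    nonEmpty₀ []      (ne , _)    = ne
    nonEmpty₀ (_ ∷ R) (_ , _ , d) = nonEmpty₀ R d
    perm : ∀ {T} (W : Uninsert v T) → entries T ↭ v ∷ entries (smaller W)
    perm W = ↭.trans (↭.↭-reflexive (cong entries (sym (inserted W)))) (entries-insert (col W) v (smaller W))
    step : ∀ {T} → Spec T₀ (v ∷ R) T → (W : Uninsert v T) → Spec T₀ R (smaller W)
    step {T} (tab , sub , fromT , toT) W = tableau W , contains W (nonEmpty₀ R dec) sub v∉T₀ , from , to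
      where
      v∉ : v ∉ entries (smaller W)
      v∉ with unique-resp (perm W) (proj₂ (proj₂ (proj₂ tab)))
      ... | p ∷ _ = λ q → All.lookup p q refl
      from : ∀ x → x ∈ entries (smaller W) → x ∈ entries T₀ ⊎ x ∈ R
      from x x∈ with fromT x (↭.∈-resp-↭ (↭.↭-sym (perm W)) (there x∈))
      ... | inj₁ p           = inj₁ p
      ... | inj₂ (here refl) = contradiction x∈ v∉
      ... | inj₂ (there p)   = inj₂ p
      to : ∀ x → x ∈ R → x ∈ entries (smaller W)
      to x x∈ with ↭.∈-resp-↭ (perm W) (toT x (there x∈))
      ... | here refl = contradiction (All.lookup R<v x∈) (ℤ.<-irrefl refl)
      ... | there p   = p
    columnW : ∀ {T} → Spec T₀ (v ∷ R) T → (W : Uninsert v T) → column T v ≡ col W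
    columnW s W = column-At (proj₂ (proj₂ (proj₂ (proj₁ s)))) (subst (At v (col W)) (inserted W) (At-insert (smaller W) (addable W)))
    col≡ : col U ≡ col U′
    col≡ = trans (sym (columnW s U)) (trans (cols (here refl)) (columnW s′ U′))
    same : ∀ {T} → Spec T₀ (v ∷ R) T → (W : Uninsert v T) → ∀ {x} → x ∈ R → column (smaller W) x ≡ column T x
    same s W {x} x∈ with ∈⇒At (smaller W) (proj₂ (proj₂ (proj₂ (step s W))) x x∈)
    ... | c , a = trans (column-At (proj₂ (proj₂ (proj₂ (tableau W)))) a)
      (sym (column-At (proj₂ (proj₂ (proj₂ (proj₁ s)))) (subst (At x c) (inserted W) (At-⊑ (⊑-insert (col W) v (smaller W)) a))))
    cols′ : ∀ {x} → x ∈ R → column (smaller U) x ≡ column (smaller U′) x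
    cols′ x∈ = trans (same s U x∈) (trans (cols (there x∈)) (sym (same s′ U′ x∈)))

  spec-insert : ∀ {T₀ R T c v} → Spec T₀ R T → Addable c T → All (ℤ._< v) (entries T₀) → All (ℤ._< v) R → Spec T₀ (v ∷ R) (insert c v T)
  spec-insert {T₀} {R} {T} {c} {v} (tab , sub , fromT , toT) add T₀<v R<v =
    insert-tableau tab (All.tabulate λ {x} x∈ → bound x (fromT x x∈)) add , ⊑-trans sub (⊑-insert c v T) , from , to
    where
    bound : ∀ x → x ∈ entries T₀ ⊎ x ∈ R → x ℤ.< v
    bound x (inj₁ p) = All.lookup T₀<v p
    bound x (inj₂ p) = All.lookup R<v p
    perm = entries-insert c v T
    from : ∀ x → x ∈ entries (insert c v T) → x ∈ entries T₀ ⊎ x ∈ v ∷ R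
    from x x∈ with ↭.∈-resp-↭ perm x∈
    ... | here e  = inj₂ (here e)
    ... | there p with fromT x p
    ...   | inj₁ q = inj₁ q
    ...   | inj₂ q = inj₂ (there q)
    to : ∀ x → x ∈ v ∷ R → x ∈ entries (insert c v T)
    to x (here e)  = ↭.∈-resp-↭ (↭.↭-sym perm) (here e)
    to x (there p) = ↭.∈-resp-↭ (↭.↭-sym perm) (there (toT x p))

-- Weights of words, closed paths, and the bound on the columns.

module Words where

  open Coeff
  open Sums
  open Lists
  open Traces using (lastn; lastn-++; lastn-split; δ′; δ′-same; δ′-diff; Windows; 𝒱; 𝒲)
  open import Data.Rational.Base using (_+_; _*_)
  open import Data.List.Membership.DecPropositional ℕ._≟_ using (_∈?_)
  open import Data.Vec.Base using ([]; _∷_)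

  open +-*-Solver using (solve; _:+_; _:*_; _:-_; :-_; _:=_; con)

  private variable
    B C : Set

  ∑-↭ : ∀ {K K′ : List B} (f : B → ℚ) → K ↭ K′ → ∑ℚ K f ≡ ∑ℚ K′ f
  ∑-↭ f ↭.refl = refl
  ∑-↭ f (↭.prep a p) = cong (λ z → f a + z) (∑-↭ f p)
  ∑-↭ f (↭.swap {xs} {ys} a b p) = trans (cong (λ z → f a + (f b + z)) (∑-↭ f p))
    (solve 3 (λ a b c → a :+ (b :+ c) := b :+ (a :+ c)) refl (f a) (f b) (∑ℚ ys f))
  ∑-↭ f (↭.trans p q) = trans (∑-↭ f p) (∑-↭ f q)

  -- Surjectivity is asked only where g is nonzero: a word of weight 0 need not come from a tableau.
  ∑-bijection : ∀ (L : List B) (K : List C) (φ : B → C) (f : B → ℚ) (g : C → ℚ) → Unique L →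
    (∀ {b} → b ∈ L → φ b ∈ K) → (∀ {b b′} → b ∈ L → b′ ∈ L → φ b ≡ φ b′ → b ≡ b′) →
    (∀ {b} → b ∈ L → f b ≡ g (φ b)) →
    Unique K → (∀ {c} → c ∈ K → g c ≢ 0ℚ → ∃[ b ] b ∈ L × φ b ≡ c) → ∑ℚ L f ≡ ∑ℚ K g
  ∑-bijection [] K φ f g _ _ _ _ _ onto = sym (∑-zero K λ {c} c∈ →
    decidable-stable (g c ℚ.≟ 0ℚ) (λ ne → contradiction (proj₁ (proj₂ (onto c∈ ne))) λ ()))
  ∑-bijection {B} {C} (b ∷ L) K φ f g (b∉ ∷ uL) into inj eq uK onto = trans
    (cong₂ _+_ (eq (here refl)) (∑-bijection L (remove b∈) φ f g uL
      (λ {a} a∈ → ∈-remove b∈ (into (there a∈)) λ e → All.lookup b∉ a∈ (sym (inj (there a∈) (here refl) e)))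
      (λ p q → inj (there p) (there q)) (eq ∘ there) (proj₂ unique′) onto′))
    (sym (∑-↭ g (remove-↭ b∈)))
    where
    b∈ : φ b ∈ K
    b∈ = into (here refl)
    unique′ : All (φ b ≢_) (remove b∈) × Unique (remove b∈)
    unique′ with unique-resp (remove-↭ b∈) uK
    ... | p ∷ u = p , u
    onto′ : ∀ {c} → c ∈ remove b∈ → g c ≢ 0ℚ → ∃[ a ] a ∈ L × φ a ≡ c
    onto′ {c} c∈ ne with onto (↭.∈-resp-↭ (↭.↭-sym (remove-↭ b∈)) (there c∈)) ne
    ... | _ , here refl , refl = contradiction refl (All.lookup (proj₁ unique′) c∈)
    ... | a , there a∈ , e     = a , a∈ , e

  seqs-words : ∀ (L : List B) l → map toList (words L l) ≡ seqs L l
  seqs-words L zero    = refl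
  seqs-words L (suc l) = go L
    where
    go : ∀ bs → map toList (cartesianProductWith _∷_ bs (words L l)) ≡ concatMap (λ b → map (b ∷_) (seqs L l)) bs
    go []       = refl
    go (b ∷ bs) = trans (List.map-++ toList (map (b ∷_) (words L l)) _) (cong₂ _++_
      (trans (sym (List.map-∘ (words L l))) (trans (List.map-∘ (words L l)) (cong (map (b ∷_)) (seqs-words L l)))) (go bs))

  ∑-seqs-++ : ∀ (L : List B) l k f → ∑ℚ (seqs L (l ℕ.+ k)) f ≡ ∑ℚ (seqs L l) (λ u → ∑ℚ (seqs L k) (λ t → f (u ++ t)))
  ∑-seqs-++ L zero    k f = sym (ℚ.+-identityʳ (∑ℚ (seqs L k) f))
  ∑-seqs-++ L (suc l) k f = trans (∑-seqs-suc L (l ℕ.+ k) f) (trans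
    (∑-cong L λ {b} _ → ∑-seqs-++ L l k (f ∘ (b ∷_)))
    (sym (∑-seqs-suc L l (λ u → ∑ℚ (seqs L k) (λ t → f (u ++ t))))))

  -- Cutting a word in two and exchanging the parts permutes the words.
  ∑-rotate : ∀ (L : List B) l k f → ∑ℚ (seqs L (l ℕ.+ k)) f ≡ ∑ℚ (seqs L (k ℕ.+ l)) (λ v → f (drop k v ++ take k v))
  ∑-rotate {B} L l k f = trans (∑-seqs-++ L l k f) (trans (∑-comm (seqs L l) (seqs L k) (λ u t → f (u ++ t)))
    (trans (∑-cong (seqs L k) λ {t} t∈ → ∑-cong (seqs L l) λ {u} _ → cong f (sym (rotated t u (proj₁ (∈-seqs⁻ k t∈)))))
      (sym (∑-seqs-++ L k l (λ v → f (drop k v ++ take k v))))))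
    where
    cut : ∀ (t u : List B) → drop (length t) (t ++ u) ≡ u × take (length t) (t ++ u) ≡ t
    cut []      u = refl , refl
    cut (a ∷ t) u = proj₁ (cut t u) , cong (a ∷_) (proj₂ (cut t u))
    rotated : ∀ t u → length t ≡ k → drop k (t ++ u) ++ take k (t ++ u) ≡ u ++ t
    rotated t u refl = cong₂ _++_ (proj₁ (cut t u)) (proj₂ (cut t u))

  listsUpTo-seqs : ∀ m (L : List B) → listsUpTo m L ≡ concatMap (seqs L) (upTo (suc m))
  listsUpTo-seqs m L = List.concatMap-cong (seqs-words L) (upTo (suc m))

  ∈-listsUpTo : ∀ {m} {L : List B} ys → length ys ≤ m → All (_∈ L) ys → ys ∈ listsUpTo m L
  ∈-listsUpTo {m = m} {L} ys le p = subst (ys ∈_) (sym (listsUpTo-seqs m L))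
    (∈.∈-concatMap⁺ (seqs L) (Any.map (λ { refl → ∈-seqs⁺ ys p }) (∈.∈-upTo⁺ (s≤s le))))

  listsUpTo-unique : ∀ m {L : List B} → Unique L → Unique (listsUpTo m L)
  listsUpTo-unique m {L} uL = subst Unique (sym (listsUpTo-seqs m L)) (go (upTo (suc m)) (Unique.upTo⁺ (suc m)))
    where
    go : ∀ ls → Unique ls → Unique (concatMap (seqs L) ls)
    go []       _        = []
    go (l ∷ ls) (l∉ ∷ u) = Unique.++⁺ (seqs-unique l uL) (go ls u) λ (p , q) → disjoint p q
      where
      disjoint : ∀ {v} → v ∈ seqs L l → v ∉ concatMap (seqs L) ls
      disjoint p q with find (∈.∈-concatMap⁻ (seqs L) {xs = ls} q)
      ... | l′ , l′∈ , r = All.lookup l∉ l′∈ (trans (sym (proj₁ (∈-seqs⁻ l p))) (proj₁ (∈-seqs⁻ l′ r)))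

  -- The weight of appending the letters ys to the active list a; ω is the weight of one step.
  wt : (List ℕ → ℕ → ℚ) → List ℕ → List ℕ → List ℕ → ℚ
  wt ω (d ∷ ds) a (y ∷ ys) = ω (lastn d a) y * wt ω ds (lastn d a ∷ʳ y) ys
  wt ω _        a _        = 1ℚ

  final : List ℕ → List ℕ → List ℕ → List ℕ
  final (d ∷ ds) a (y ∷ ys) = final ds (lastn d a ∷ʳ y) ys
  final _        a _        = a

  paths : (List ℕ → ℕ → ℚ) → List ℕ → List ℕ → List ℕ → (List ℕ → ℚ) → ℚ
  paths ω L []       a H = H a
  paths ω L (d ∷ ds) a H = ∑ℚ L λ y → ω (lastn d a) y * paths ω L ds (lastn d a ∷ʳ y) H

  paths-words : ∀ ω L ds a H → paths ω L ds a H ≡ ∑ℚ (seqs L (length ds)) (λ ys → wt ω ds a ys * H (final ds a ys))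
  paths-words ω L []       a H = sym (trans (ℚ.+-identityʳ _) (ℚ.*-identityˡ (H a)))
  paths-words ω L (d ∷ ds) a H = trans
    (∑-cong L λ {y} _ → trans (cong (ω c y *_) (paths-words ω L ds (c ∷ʳ y) H))
      (trans (sym (∑-* (seqs L (length ds)) (ω c y) (λ ys → wt ω ds (c ∷ʳ y) ys * H (final ds (c ∷ʳ y) ys))))
        (∑-cong (seqs L (length ds)) λ {ys} _ → sym (ℚ.*-assoc (ω c y) (wt ω ds (c ∷ʳ y) ys) (H (final ds (c ∷ʳ y) ys))))))
    (sym (∑-seqs-suc L (length ds) (λ ys → wt ω (d ∷ ds) a ys * H (final (d ∷ ds) a ys))))
    where c = lastn d a

  ωV : (ℕ → ℚ) → List ℕ → ℕ → ℚ
  ωV x κ b = if does (b ∈? κ) then 0ℚ else x b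

  ωW : (ℕ → ℚ) → List ℕ → ℕ → ℚ
  ωW w c y = Ā (y ℕ.∸ 1) c * w y

  𝒱-paths : ∀ x M ds κ H → 𝒱 x M ds κ H ≡ paths (ωV x) (upTo M) ds κ H
  𝒱-paths x M []       κ H = refl
  𝒱-paths x M (d ∷ ds) κ H = ∑-cong (upTo M) λ {b} _ → cong (ωV x (lastn d κ) b *_) (𝒱-paths x M ds (lastn d κ ∷ʳ b) H)

  𝒲-paths : ∀ w M ds c H → 𝒲 w M ds c H ≡ paths (ωW w) (ids 1 M) ds c H
  𝒲-paths w M []       c H = refl
  𝒲-paths w M (d ∷ ds) c H = ∑-cong (ids 1 M) λ {y} _ → trans
    (sym (ℚ.*-assoc (Ā (y ℕ.∸ 1) (lastn d c)) (w y) (𝒲 w M ds (lastn d c ∷ʳ y) H)))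
    (cong (ωW w (lastn d c) y *_) (𝒲-paths w M ds (lastn d c ∷ʳ y) H))

  final-suffix : ∀ {M k₀ k} ds a ys → Windows M k₀ k ds → length a ≡ k → length ys ≡ length ds →
                 ∃[ p ] a ++ ys ≡ p ++ final ds a ys × k₀ ≤ length (final ds a ys)
  final-suffix [] a [] ok la _ = [] , List.++-identityʳ a , ℕ.≤-trans ok (ℕ.≤-reflexive (sym la))
  final-suffix (d ∷ ds) a (y ∷ ys) (d≤ , _ , ok) la ly with lastn-split d a (ℕ.≤-trans d≤ (ℕ.≤-reflexive (sym la)))
  ... | p , e , l with final-suffix ds (lastn d a ∷ʳ y) ys ok (trans (length-∷ʳ (lastn d a) y) (cong suc l)) (ℕ.suc-injective ly)
  ...   | p′ , e′ , le = p ++ p′ , trans (cong (_++ y ∷ ys) e) (trans (List.++-assoc p (lastn d a) (y ∷ ys))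
          (trans (cong (p ++_) (trans (sym (List.++-assoc (lastn d a) (y ∷ []) ys)) e′)) (sym (List.++-assoc p p′ _)))) , le

  lastn-suffix : ∀ k (p c : List B) → k ≤ length c → lastn k (p ++ c) ≡ lastn k c
  lastn-suffix k p c le with lastn-split k c le
  ... | q , e , l = trans (cong (λ z → lastn k (p ++ z)) e) (trans (cong (lastn k) (sym (List.++-assoc p q (lastn k c)))) (lastn-++ (p ++ q) l))

  lastn-final : ∀ {M k} ds a ys → Windows M k k ds → length a ≡ k → length ys ≡ length ds → k ≤ length ys →
                lastn k (final ds a ys) ≡ lastn k ys
  lastn-final {k = k} ds a ys ok la ly k≤ with final-suffix ds a ys ok la ly
  ... | p , e , le = trans (sym (lastn-suffix k p (final ds a ys) le)) (trans (cong (lastn k) (sym e)) (lastn-suffix k a ys k≤))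

  -- Closed paths, indexed by the word read; the starting list is read off its end.
  closedWeight : (List ℕ → ℕ → ℚ) → ℕ → List ℕ → List ℕ → ℚ
  closedWeight ω k ds ys = if does (unique? (lastn k ys)) then wt ω ds (lastn k ys) ys else 0ℚ

  -- For a given word the Kronecker symbol admits one starting list at most, the last k letters,
  -- provided that they are distinct.
  closed-words : ∀ ω L k ds (J : List (List ℕ)) → k ≤ length ds → Unique J →
    (∀ {j} → j ∈ J → Unique j) → (∀ {j} → Unique j → length j ≡ k → All (_∈ L) j → j ∈ J) →
    ∑ℚ J (λ j → ∑ℚ (seqs L (length ds)) (λ ys → wt ω ds j ys * δ′ j (lastn k ys))) ≡ ∑ℚ (seqs L (length ds)) (closedWeight ω k ds)
  closed-words ω L k ds J k≤ uJ J-unique J-all = trans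
    (∑-comm J (seqs L (length ds)) (λ j ys → wt ω ds j ys * δ′ j (lastn k ys)))
    (∑-cong (seqs L (length ds)) (λ {ys} ys∈ → collapse ys ys∈ (unique? (lastn k ys))))
    where
    off : ∀ {j} ys → j ≢ lastn k ys → wt ω ds j ys * δ′ j (lastn k ys) ≡ 0ℚ
    off {j} ys ne = trans (cong (wt ω ds j ys *_) (δ′-diff ne)) (ℚ.*-zeroʳ (wt ω ds j ys))
    collapse : ∀ ys → ys ∈ seqs L (length ds) → (u? : Dec (Unique (lastn k ys))) →
      ∑ℚ J (λ j → wt ω ds j ys * δ′ j (lastn k ys)) ≡ (if does u? then wt ω ds (lastn k ys) ys else 0ℚ)
    collapse ys ys∈ (no ¬u) = ∑-zero J λ {j} j∈ → off {j} ys λ { refl → ¬u (J-unique j∈) }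
    collapse ys ys∈ (yes u) = trans
      (∑-single J (J-all u (proj₂ (proj₂ (lastn-split k ys k≤′))) letters) uJ λ {j} _ ne → off {j} ys ne)
      (trans (cong (wt ω ds (lastn k ys) ys *_) (δ′-same (lastn k ys))) (ℚ.*-identityʳ (wt ω ds (lastn k ys) ys)))
      where
      ly = proj₁ (∈-seqs⁻ (length ds) ys∈)
      k≤′ : k ≤ length ys
      k≤′ = ℕ.≤-trans k≤ (ℕ.≤-reflexive (sym ly))
      letters : All (_∈ L) (lastn k ys)
      letters = All.drop⁺ (length ys ℕ.∸ k) (proj₂ (∈-seqs⁻ (length ds) ys∈))

  closed-paths : ∀ {M} ω L k ds (J : List (List ℕ)) → Windows M k k ds → k ≤ length ds → Unique J →
    (∀ {j} → j ∈ J → Unique j × length j ≡ k) → (∀ {j} → Unique j → length j ≡ k → All (_∈ L) j → j ∈ J) →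
    ∑ℚ J (λ j → paths ω L ds j (δ′ j ∘ lastn k)) ≡ ∑ℚ (seqs L (length ds)) (closedWeight ω k ds)
  closed-paths {M} ω L k ds J ok k≤ uJ J-ok J-all = trans
    (∑-cong J (λ {j} j∈ → trans (paths-words ω L ds j (δ′ j ∘ lastn k))
      (∑-cong (seqs L (length ds)) λ {ys} ys∈ → cong (λ c → wt ω ds j ys * δ′ j c)
        (lastn-final ds j ys ok (proj₂ (J-ok j∈)) (proj₁ (∈-seqs⁻ (length ds) ys∈))
          (ℕ.≤-trans k≤ (ℕ.≤-reflexive (sym (proj₁ (∈-seqs⁻ (length ds) ys∈)))))))))
    (closed-words ω L k ds J k≤ uJ (proj₁ ∘ J-ok) J-all)

  ∈-lastn : ∀ {a : B} k c → a ∈ lastn k c → a ∈ c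
  ∈-lastn {a = a} k c p = subst (a ∈_) (List.take++drop≡id (length c ℕ.∸ k) c) (∈.∈-++⁺ʳ (take (length c ℕ.∸ k) c) p)

  -- A nonzero weight for y requires y - 1 to be 0 or to lie in the active list, which consists of
  -- starting entries and letters already read.
  wt-predecessor : ∀ w ds a ys → length ys ≡ length ds → wt (ωW w) ds a ys ≢ 0ℚ →
                   ∀ {y} → y ∈ ys → y ℕ.∸ 1 ∈ 0 ∷ (a ++ ys)
  wt-predecessor w (d ∷ ds) a (y ∷ ys) ly ne (here refl) with (y ℕ.∸ 1) ∈? (0 ∷ lastn d a)
  ... | yes (here e)  = here e
  ... | yes (there p) = there (∈.∈-++⁺ˡ (∈-lastn d a p))
  ... | no ¬p = contradiction (trans (cong (λ z → (z * w y) * wt (ωW w) ds (lastn d a ∷ʳ y) ys) (Ā-∉ ¬p))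
      (solve 2 (λ w r → (con 0ℚ :* w) :* r := con 0ℚ) refl (w y) (wt (ωW w) ds (lastn d a ∷ʳ y) ys))) ne
  wt-predecessor w (d ∷ ds) a (y ∷ ys) ly ne {z} (there z∈)
    with wt-predecessor w ds (lastn d a ∷ʳ y) ys (ℕ.suc-injective ly)
           (λ e → ne (trans (cong (ωW w (lastn d a) y *_) e) (ℚ.*-zeroʳ (ωW w (lastn d a) y)))) z∈
  ... | here e  = here e
  ... | there p with ∈.∈-++⁻ (lastn d a ∷ʳ y) p
  ...   | inj₂ q = there (∈.∈-++⁺ʳ a (there q))
  ...   | inj₁ q with ∈.∈-++⁻ (lastn d a) q
  ...     | inj₁ r           = there (∈.∈-++⁺ˡ (∈-lastn d a r))
  ...     | inj₂ (here refl) = there (∈.∈-++⁺ʳ a (here refl))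

  -- On a closed path the starting entries are letters of the word too. Its set of letters is then
  -- closed under positive predecessors, so a letter y forces the y letters 1, ..., y into a word of
  -- the given length.
  closed-bounded : ∀ w k ds {ys} → length ys ≡ length ds → All (1 ≤_) ys → closedWeight (ωW w) k ds ys ≢ 0ℚ →
                   All (_≤ length ds) ys
  closed-bounded w k ds {ys} ly ys≥1 ne = All.tabulate bound
    where
    wt≢0 : wt (ωW w) ds (lastn k ys) ys ≢ 0ℚ
    wt≢0 = go (unique? (lastn k ys)) ne
      where
      go : (u? : Dec (Unique (lastn k ys))) → (if does u? then wt (ωW w) ds (lastn k ys) ys else 0ℚ) ≢ 0ℚ → wt (ωW w) ds (lastn k ys) ys ≢ 0ℚ
      go (yes _) ne = ne
      go (no _)  ne = contradiction refl ne
    below : ∀ {y} → y ∈ ys → y ℕ.∸ 1 ∈ 0 ∷ ys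
    below y∈ with wt-predecessor w ds (lastn k ys) ys ly wt≢0 y∈
    ... | here e = here e
    ... | there p with ∈.∈-++⁻ (lastn k ys) p
    ...   | inj₁ q = there (∈-lastn k ys q)
    ...   | inj₂ q = there q
    downward : ∀ d z → 1 ≤ z → d ℕ.+ z ∈ ys → z ∈ ys
    downward zero    z 1≤z p = p
    downward (suc d) z 1≤z p with below p
    ... | here e  = contradiction e (ℕ.m<n⇒n≢0 (ℕ.≤-trans 1≤z (ℕ.m≤n+m z d)))
    ... | there q = downward d z 1≤z q
    bound : ∀ {y} → y ∈ ys → y ≤ length ds
    bound {y} y∈ = subst (_≤ length ds) (length-ids 1 y) (ℕ.≤-trans
      (unique-⊆-length (ids-unique 1 y) (λ {z} z∈ → let (1≤z , z<) = ∈-ids 1 y z∈ in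
        downward (y ℕ.∸ z) z 1≤z (subst (_∈ ys) (sym (ℕ.m∸n+n≡m (ℕ.s≤s⁻¹ (subst (z <_) (ℕ.+-comm y 1) z<)))) y∈)))
      (ℕ.≤-reflexive ly))

  closed-truncate : ∀ w k ds {N M} → length ds ≤ N → N ≤ M →
    ∑ℚ (seqs (ids 1 N) (length ds)) (closedWeight (ωW w) k ds) ≡ ∑ℚ (seqs (ids 1 M) (length ds)) (closedWeight (ωW w) k ds)
  closed-truncate w k ds {N} {M} n≤N N≤M = ∑-bijection _ _ id (closedWeight (ωW w) k ds) (closedWeight (ωW w) k ds)
    (seqs-unique (length ds) (ids-unique 1 N)) widen (λ _ _ e → e) (λ _ → refl)
    (seqs-unique (length ds) (ids-unique 1 M)) onto
    where
    widen : ∀ {ys} → ys ∈ seqs (ids 1 N) (length ds) → ys ∈ seqs (ids 1 M) (length ds)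
    widen {ys} p with ∈-seqs⁻ (length ds) p
    ... | l , q = subst (λ n → ys ∈ seqs (ids 1 M) n) l (∈-seqs⁺ ys (All.map (λ y∈ → let (1≤y , y<) = ∈-ids 1 N y∈ in
      ids-∈ 1 M 1≤y (ℕ.≤-trans y< (ℕ.+-monoˡ-≤ 1 N≤M))) q))
    onto : ∀ {ys} → ys ∈ seqs (ids 1 M) (length ds) → closedWeight (ωW w) k ds ys ≢ 0ℚ → ∃[ ys′ ] ys′ ∈ seqs (ids 1 N) (length ds) × ys′ ≡ ys
    onto {ys} p ne with ∈-seqs⁻ (length ds) p
    ... | l , q = ys , subst (λ n → ys ∈ seqs (ids 1 N) n) l (∈-seqs⁺ ys (All.zipWith
        (λ (1≤y , y≤) → ids-∈ 1 N 1≤y (ℕ.≤-trans (s≤s (ℕ.≤-trans y≤ n≤N)) (ℕ.≤-reflexive (ℕ.+-comm 1 N))))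
        (ys≥1 , closed-bounded w k ds l ys≥1 ne))) , refl
      where
      ys≥1 : All (1 ≤_) ys
      ys≥1 = All.map (λ y∈ → proj₁ (∈-ids 1 M y∈)) q

-- Natural unit interval graphs: smaller neighbours form a window.

module Graphs where

  open import Defs
  open Lists
  open Traces using (lastn; lastn-split; Windows)
  open Words using (wt; lastn-suffix)
  open import Data.Fin.Base using (zero; suc)
  open import Data.Rational.Base using (_*_)
  open import Data.List.Base using (tabulate)

  private variable
    B : Set

  lastn-all : ∀ (c : List B) → lastn (length c) c ≡ c
  lastn-all c = cong (λ l → drop l c) (ℕ.n∸n≡0 (length c))

  filter-lastn : ∀ {P : B → Set} (P? : Unary.Decidable P) L → AllPairs (λ a b → P a → P b) L →
                 filter P? L ≡ lastn (length (filter P? L)) L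
  filter-lastn P? [] _ = refl
  filter-lastn P? (b ∷ L) (up ∷ ups) with P? b
  ... | yes p = trans (cong (b ∷_) (List.filter-all P? (All.map (λ f → f p) up)))
        (trans (sym (lastn-all (b ∷ L))) (cong (λ l → lastn (suc (length l)) (b ∷ L)) (sym (List.filter-all P? (All.map (λ f → f p) up)))))
  ... | no _  = trans (filter-lastn P? L ups) (sym (lastn-suffix (length (filter P? L)) (b ∷ []) L (List.length-filter P? L)))

  sorted-split : ∀ {R : B → B → Set} (xs : List B) {y ys} → AllPairs R (xs ++ y ∷ ys) →
                 All (λ x → R x y) xs × All (R y) ys × AllPairs R xs
  sorted-split []       (p ∷ _) = [] , p , []
  sorted-split (x ∷ xs) (p ∷ s) with sorted-split xs s
  ... | before , after , sorted with All.++⁻ʳ xs p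
  ...   | q ∷ _ = q ∷ before , after , All.++⁻ˡ xs p ∷ sorted

  allFin-sorted : ∀ m → AllPairs Fin._<_ (allFin m)
  allFin-sorted m = AllPairs.tabulate⁺-< id

  take-below : ∀ i {l m} (f : Fin l → Fin m) → (∀ v → toℕ (f v) ≡ i ℕ.+ toℕ v) → ∀ k → All (λ v → toℕ v < i ℕ.+ k) (take k (tabulate f))
  take-below i {zero}  f e zero    = []
  take-below i {zero}  f e (suc k) = []
  take-below i {suc l} f e zero    = []
  take-below i {suc l} f e (suc k) = ℕ.≤-trans (s≤s (ℕ.≤-reflexive (trans (e zero) (ℕ.+-identityʳ i)))) (ℕ.≤-trans (s≤s (ℕ.m≤m+n i k)) (ℕ.≤-reflexive (sym (ℕ.+-suc i k))))
    ∷ All.map (λ {v} lt → ℕ.≤-trans lt (ℕ.≤-reflexive (sym (ℕ.+-suc i k)))) (take-below (suc i) (f ∘ suc) (λ v → trans (e (suc v)) (ℕ.+-suc i (toℕ v))) k)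

  drop-above : ∀ i {l m} (f : Fin l → Fin m) → (∀ v → toℕ (f v) ≡ i ℕ.+ toℕ v) → ∀ k → All (λ v → i ℕ.+ k ≤ toℕ v) (drop k (tabulate f))
  drop-above i {l} f e zero = All.tabulate⁺ (λ v → ℕ.≤-trans (ℕ.≤-trans (ℕ.≤-reflexive (ℕ.+-identityʳ i)) (ℕ.m≤m+n i (toℕ v))) (ℕ.≤-reflexive (sym (e v))))
  drop-above i {zero}  f e (suc k) = []
  drop-above i {suc l} f e (suc k) = All.map (ℕ.≤-trans (ℕ.≤-reflexive (ℕ.+-suc i k)))
    (drop-above (suc i) (f ∘ suc) (λ v → trans (e (suc v)) (ℕ.+-suc i (toℕ v))) k)

  module Vertices (n k : ℕ) (G : Graph (n ℕ.+ k)) where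

    V : List (Fin (n ℕ.+ k))
    V = allFin (n ℕ.+ k)

    N : Fin (n ℕ.+ k) → List (Fin (n ℕ.+ k))
    N = smallerNeighbors n k G

    deg : Fin (n ℕ.+ k) → ℕ
    deg v = length (N v)

    low new : List (Fin (n ℕ.+ k))
    low = take k V
    new = drop k V

    ds : List ℕ
    ds = map deg new

    V-split : V ≡ low ++ new
    V-split = sym (List.take++drop≡id k V)

    low-< : All (λ v → toℕ v < k) low
    low-< = take-below 0 id (λ _ → refl) k

    new-≥ : All (λ v → k ≤ toℕ v) new
    new-≥ = drop-above 0 id (λ _ → refl) k

    newVertices-drop : newVertices n k G ≡ new
    newVertices-drop = trans (cong (filter k≤?) V-split) (trans (List.filter-++ k≤? low new)
      (cong₂ _++_ (List.filter-none k≤? (All.map ℕ.<⇒≱ low-<)) (List.filter-all k≤? new-≥)))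
      where
      k≤? : ∀ (v : Fin (n ℕ.+ k)) → Dec (k ≤ toℕ v)
      k≤? v = k ℕ.≤? toℕ v

    length-new : length new ≡ n
    length-new = trans (List.length-drop k V) (trans (cong (ℕ._∸ k) (List.length-tabulate id)) (ℕ.m+n∸n≡m n k))

    length-ds : length ds ≡ n
    length-ds = trans (List.length-map deg new) length-new

    length-low : length low ≡ k
    length-low = trans (List.length-take k V) (trans (cong (k ℕ.⊓_) (List.length-tabulate id)) (ℕ.m≤n⇒m⊓n≡m (ℕ.m≤n+m k n)))

    ∈-N⁺ : ∀ {u v} → u Fin.< v → Adj G u v → u ∈ N v
    ∈-N⁺ {u} {v} u<v a = ∈.∈-filter⁺ (λ u → (u Fin.<? v) ×-dec adj? G u v) (∈.∈-allFin u) (u<v , a)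

    ∈-N⁻ : ∀ {u v} → u ∈ N v → u Fin.< v × Adj G u v
    ∈-N⁻ {u} {v} p = proj₂ (∈.∈-filter⁻ (λ u → (u Fin.<? v) ×-dec adj? G u v) {xs = V} p)

    N-unique : ∀ v → Unique (N v)
    N-unique v = Unique.filter⁺ (λ u → (u Fin.<? v) ×-dec adj? G u v) (Unique.allFin⁺ (n ℕ.+ k))

    N-before : ∀ before {v vs} → V ≡ before ++ v ∷ vs → N v ≡ filter (λ u → (u Fin.<? v) ×-dec adj? G u v) before
    N-before before {v} {vs} e = trans (cong (filter nbr?) e) (trans (List.filter-++ nbr? before (v ∷ vs))
      (trans (cong (filter nbr? before ++_) (List.filter-none nbr? ((λ (v<v , _) → ℕ.<-irrefl refl v<v) ∷
        All.map (λ v<u (u<v , _) → ℕ.<-asym v<u u<v) (proj₁ (proj₂ (sorted-split before (subst (AllPairs Fin._<_) e (allFin-sorted (n ℕ.+ k)))))))))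
        (List.++-identityʳ (filter nbr? before))))
      where
      nbr? : ∀ u → Dec (u Fin.< v × Adj G u v)
      nbr? u = (u Fin.<? v) ×-dec adj? G u v

    before-∈ : ∀ before {v vs} → V ≡ before ++ v ∷ vs → ∀ {u} → u Fin.< v → u ∈ before
    before-∈ before {v} {vs} e {u} u<v with ∈.∈-++⁻ before (subst (u ∈_) e (∈.∈-allFin u))
    ... | inj₁ p           = p
    ... | inj₂ (here refl) = contradiction u<v (ℕ.<-irrefl refl)
    ... | inj₂ (there p)   = contradiction u<v (ℕ.<-asym
      (All.lookup (proj₁ (proj₂ (sorted-split before (subst (AllPairs Fin._<_) e (allFin-sorted (n ℕ.+ k)))))) p))

    new-or-low : ∀ v → v ∈ new ⊎ v ∈ low
    new-or-low v with ∈.∈-++⁻ low (subst (v ∈_) V-split (∈.∈-allFin v))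
    ... | inj₁ p = inj₂ p
    ... | inj₂ p = inj₁ p

    low-closed : ∀ {u v} → u Fin.< v → v ∈ low → u ∈ low
    low-closed {u} u<v v∈ with new-or-low u
    ... | inj₂ p = p
    ... | inj₁ p = contradiction (ℕ.<-trans u<v (All.lookup low-< v∈)) (ℕ.≤⇒≯ (All.lookup new-≥ p))

    -- Implies that h separates adjacent vertices, in the form in which the weights detect it. It is
    -- applied to colours as well as to columns.
    Free : (Fin (n ℕ.+ k) → ℕ) → Set
    Free h = Unique (map h low) × (∀ {v} → v ∈ new → h v ∉ map h (N v))

    free-separates : ∀ {h u v} → Free h → u Fin.< v → Adj G u v → h u ≢ h v
    free-separates {h} {u} {v} (u-low , free) u<v adj e with new-or-low v
    ... | inj₁ v∈ = free v∈ (subst (_∈ map h (N v)) e (∈.∈-map⁺ h (∈-N⁺ u<v adj)))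
    ... | inj₂ v∈ = unique-map h u-low (low-closed u<v v∈) v∈ (λ { refl → ℕ.<-irrefl refl u<v }) e

    module _ (unit : IsNaturalUnitInterval G) where

      -- If a < b < v and a is adjacent to v, then so is b; the smaller neighbours are therefore a
      -- final segment of the earlier vertices.
      N-lastn : ∀ before {v vs} → V ≡ before ++ v ∷ vs → N v ≡ lastn (deg v) before
      N-lastn before {v} {vs} e = trans (N-before before e) (trans
        (filter-lastn nbr? before (AllPairs.map (λ {a} {b} a<b → closed a<b) (AllPairs-before before e)))
        (cong (λ l → lastn (length l) before) (sym (N-before before e))))
        where
        nbr? : ∀ u → Dec (u Fin.< v × Adj G u v)
        nbr? u = (u Fin.<? v) ×-dec adj? G u v
        closed : ∀ {a b} → a Fin.< b × b Fin.< v → a Fin.< v × Adj G a v → b Fin.< v × Adj G b v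
        closed (a<b , b<v) (_ , adj) = b<v , proj₂ (unit a<b b<v adj)
        bounded : ∀ {L : List (Fin (n ℕ.+ k))} → AllPairs Fin._<_ L → All (Fin._< v) L → AllPairs (λ a b → a Fin.< b × b Fin.< v) L
        bounded []       []       = []
        bounded (p ∷ ps) (_ ∷ qs) = All.zip (p , qs) ∷ bounded ps qs
        AllPairs-before : ∀ before → V ≡ before ++ v ∷ vs → AllPairs (λ a b → a Fin.< b × b Fin.< v) before
        AllPairs-before before e with sorted-split before (subst (AllPairs Fin._<_) e (allFin-sorted (n ℕ.+ k)))
        ... | before<v , _ , sorted = bounded sorted before<v

      -- Invariant: the values at the earlier vertices are p, already forgotten, followed by the
      -- active list a.
      wt-vertices : ∀ ω (h : Fin (n ℕ.+ k) → ℕ) before vs {M ℓ} p a → V ≡ before ++ vs → map h before ≡ p ++ a →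
                    Windows M k ℓ (map deg vs) → length a ≡ ℓ →
                    wt ω (map deg vs) a (map h vs) ≡ ∏ℚ vs (λ v → ω (map h (N v)) (h v))
      wt-vertices ω h before []       p a e e′ ok la = refl
      wt-vertices ω h before (v ∷ vs) p a e e′ (d≤ , _ , ok) la = cong₂ _*_ (cong (λ σ → ω σ (h v)) (sym window))
        (wt-vertices ω h (before ∷ʳ v) vs (p ++ proj₁ split) (lastn (deg v) a ∷ʳ h v) (trans e (sym (List.++-assoc before (v ∷ []) vs)))
          (trans (List.map-++ h before (v ∷ [])) (trans (cong (_∷ʳ h v) (trans e′ (trans (cong (p ++_) (proj₁ (proj₂ split)))
            (sym (List.++-assoc p (proj₁ split) (lastn (deg v) a)))))) (List.++-assoc (p ++ proj₁ split) (lastn (deg v) a) (h v ∷ []))))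
          ok (trans (List.length-++ (lastn (deg v) a)) (trans (ℕ.+-comm (length (lastn (deg v) a)) 1) (cong suc (proj₂ (proj₂ split))))))
        where
        d≤a : deg v ≤ length a
        d≤a = ℕ.≤-trans d≤ (ℕ.≤-reflexive (sym la))
        split = lastn-split (deg v) a d≤a
        window : map h (N v) ≡ lastn (deg v) a
        window = trans (cong (map h) (N-lastn before e)) (trans (sym (List.drop-map (length before ℕ.∸ deg v) before))
          (trans (cong (λ l → drop (l ℕ.∸ deg v) (map h before)) (sym (List.length-map h before)))
          (trans (cong (lastn (deg v)) e′) (lastn-suffix (deg v) p a d≤a))))

      module _ (last-clique : IsClique G (λ v → n ≤ toℕ v)) {M} (n+k<M : n ℕ.+ k < M) where

        deg-before : ∀ before {v vs} → V ≡ before ++ v ∷ vs → deg v ≤ length before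
        deg-before before e = ℕ.≤-trans (ℕ.≤-reflexive (cong length (N-before before e))) (List.length-filter _ before)

        deg< : ∀ v → deg v < M
        deg< v = ℕ.≤-<-trans (ℕ.≤-trans (List.length-filter _ V) (ℕ.≤-reflexive (List.length-tabulate id))) n+k<M

        -- A smaller neighbour of the next vertex is u or a neighbour of u, so the degree grows by
        -- one at most. After the last vertex at least k entries remain, because the last k vertices
        -- form a clique.
        windows-after : ∀ before u vs → V ≡ before ++ u ∷ vs → Windows M k (suc (deg u)) (map deg vs)
        windows-after before u [] e = subst (_≤ suc (deg u)) length-top (unique-⊆-length top-unique cover)
          where
          top : List (Fin (n ℕ.+ k))
          top = drop n V
          length-top : length top ≡ k
          length-top = trans (List.length-drop n V) (trans (cong (ℕ._∸ n) (List.length-tabulate id)) (ℕ.m+n∸m≡n n k))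
          top-unique : Unique top
          top-unique = AllPairs.drop⁺ n (Unique.allFin⁺ (n ℕ.+ k))
          top-≥ : ∀ {w} → w ∈ top → n ≤ toℕ w
          top-≥ = All.lookup (drop-above 0 id (λ _ → refl) n)
          cover : ∀ {w} → w ∈ top → w ∈ u ∷ N u
          cover {w} w∈ with Fin.<-cmp w u
          ... | tri≈ _ refl _ = here refl
          ... | tri< w<u w≢u _ = there (∈-N⁺ w<u (last-clique (top-≥ w∈) (ℕ.≤-trans (top-≥ w∈) (ℕ.<⇒≤ w<u)) w≢u))
          ... | tri> _ w≢u u<w with ∈.∈-++⁻ before (subst (w ∈_) e (∈.∈-allFin w))
          ...   | inj₂ (here w≡u) = contradiction w≡u w≢u
          ...   | inj₁ p = contradiction u<w (ℕ.<-asym (All.lookup (proj₁ (sorted-split before (subst (AllPairs Fin._<_) e (allFin-sorted (n ℕ.+ k))))) p))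
        windows-after before u (v ∷ vs) e = deg-step , deg< v , windows-after (before ∷ʳ u) v vs e′
          where
          e′ : V ≡ (before ∷ʳ u) ++ v ∷ vs
          e′ = trans e (sym (List.++-assoc before (u ∷ []) (v ∷ vs)))
          cover : ∀ {w} → w ∈ N v → w ∈ u ∷ N u
          cover {w} w∈ with ∈-N⁻ w∈
          ... | w<v , adj with ∈.∈-++⁻ before (before-∈ (before ∷ʳ u) e′ w<v)
          ...   | inj₂ (here refl) = here refl
          ...   | inj₁ p = there (∈-N⁺ w<u (proj₁ (unit w<u u<v adj)))
            where
            w<u : w Fin.< u
            w<u = All.lookup (proj₁ (sorted-split before (subst (AllPairs Fin._<_) e (allFin-sorted (n ℕ.+ k))))) p
            u<v : u Fin.< v
            u<v with proj₁ (proj₂ (sorted-split before (subst (AllPairs Fin._<_) e (allFin-sorted (n ℕ.+ k)))))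
            ... | q ∷ _ = q
          deg-step : deg v ≤ suc (deg u)
          deg-step = unique-⊆-length (N-unique v) cover

        windows : Windows M k k ds
        windows = go new V-split
          where
          go : ∀ vs → V ≡ low ++ vs → Windows M k k (map deg vs)
          go []       e = ℕ.≤-refl
          go (v ∷ vs) e = ℕ.≤-trans (deg-before low e) (ℕ.≤-reflexive length-low) , deg< v , windows-after low v vs e

        wt-new : ∀ ω (h : Fin (n ℕ.+ k) → ℕ) → wt ω ds (map h low) (map h new) ≡ ∏ℚ new (λ v → ω (map h (N v)) (h v))
        wt-new ω h = wt-vertices ω h low new [] (map h low) V-split refl windows (trans (List.length-map h low) length-low)

-- Proper colourings of the identified graph as closed paths.

module Colorings where

  open import Defs
  open Sums
  open Lists
  open Traces using (lastn; lastn-++)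
  open Words
  open Values using ([_]ᵇ; ∏ᵥ; atℚ; chromaticValue)
  open Graphs
  open import Data.Fin.Base using (zero; suc)
  open import Data.Rational.Base using (_*_)
  open import Data.List.Base using (tabulate)
  open import Data.List.Membership.DecPropositional ℕ._≟_ using (_∈?_)
  open import Data.Vec.Base using ([]; _∷_; lookup)

  private variable
    B C : Set

  tabulate-++ : ∀ n {k} (f : Fin (n ℕ.+ k) → B) → tabulate f ≡ tabulate (f ∘ (_↑ˡ k)) ++ tabulate (f ∘ (n ↑ʳ_))
  tabulate-++ zero    f = refl
  tabulate-++ (suc n) f = cong (f zero ∷_) (tabulate-++ n (f ∘ suc))

  tabulate-toList : ∀ {n} (κ : Vec B n) → tabulate (lookup κ) ≡ toList κ
  tabulate-toList []      = refl
  tabulate-toList (a ∷ κ) = cong (a ∷_) (tabulate-toList κ)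

  tabulate-take : ∀ {n k} (κ : Vec B n) (k≤n : k ≤ n) → tabulate (λ r → lookup κ (inject≤ r k≤n)) ≡ take k (toList κ)
  tabulate-take {k = zero}  κ       _         = refl
  tabulate-take {k = suc k} (a ∷ κ) (s≤s k≤n) = cong (a ∷_) (tabulate-take κ k≤n)

  ∏ᵥ-toList : ∀ {n} f (κ : Vec ℕ n) → ∏ᵥ f κ ≡ ∏ℚ (toList κ) f
  ∏ᵥ-toList f []      = refl
  ∏ᵥ-toList f (a ∷ κ) = cong (f a *_) (∏ᵥ-toList f κ)

  module Coloring (n k : ℕ) (k≤n : k ≤ n) (G : Graph (n ℕ.+ k)) (Γ : Graph n)
    (unit : IsNaturalUnitInterval G) (first-clique : IsClique G (λ v → toℕ v < k)) (last-clique : IsClique G (λ v → n ≤ toℕ v))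
    (ident : IsIdentification k≤n G Γ) {M} (n+k<M : n ℕ.+ k < M) where

    open Vertices n k G

    private
      module _ (κ : Vec ℕ n) where

        h : Fin (n ℕ.+ k) → ℕ
        h v = lookup κ (identify k≤n v)

        l : List ℕ
        l = toList κ

        length-l : length l ≡ n
        length-l = Vec.length-toList κ

        k≤l : k ≤ length l
        k≤l = ℕ.≤-trans k≤n (ℕ.≤-reflexive (sym length-l))

        -- Vertex n + r carries the colour of r. This repetition is what makes the path of a
        -- colouring closed.
        map-V : map h V ≡ l ++ take k l
        map-V = trans (List.map-tabulate id h) (trans (tabulate-++ n h) (cong₂ _++_
          (trans (List.tabulate-cong λ i → cong (lookup κ ∘ Sum.[ id , (λ r → inject≤ r k≤n) ]) (Fin.splitAt-↑ˡ n i k)) (tabulate-toList κ))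
          (trans (List.tabulate-cong λ r → cong (lookup κ ∘ Sum.[ id , (λ r → inject≤ r k≤n) ]) (Fin.splitAt-↑ʳ n k r)) (tabulate-take κ k≤n))))

        take-++ : ∀ j (a b : List ℕ) → j ≤ length a → take j (a ++ b) ≡ take j a
        take-++ zero    a       b _       = refl
        take-++ (suc j) (x ∷ a) b (s≤s p) = cong (x ∷_) (take-++ j a b p)

        drop-++ : ∀ j (a b : List ℕ) → j ≤ length a → drop j (a ++ b) ≡ drop j a ++ b
        drop-++ zero    a       b _       = refl
        drop-++ (suc j) (x ∷ a) b (s≤s p) = drop-++ j a b p

        map-low : map h low ≡ take k l
        map-low = trans (sym (List.take-map k V)) (trans (cong (take k) map-V) (take-++ k l (take k l) k≤l))

        map-new : map h new ≡ drop k l ++ take k l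
        map-new = trans (sym (List.drop-map k V)) (trans (cong (drop k) map-V) (drop-++ k l (take k l) k≤l))

        lastn-new : lastn k (map h new) ≡ map h low
        lastn-new = trans (cong (lastn k) map-new) (trans (lastn-++ (drop k l) (trans (List.length-take k l) (ℕ.m≤n⇒m⊓n≡m k≤l))) (sym map-low))

        proper⇒free : Proper Γ κ → Free h
        proper⇒free proper = map-unique h low-unique (λ u∈ v∈ u≢v → edge (first-clique (All.lookup low-< u∈) (All.lookup low-< v∈) u≢v))
          , λ {v} v∈ p → avoid p
          where
          low-unique : Unique low
          low-unique = AllPairs.take⁺ k (Unique.allFin⁺ (n ℕ.+ k))
          edge : ∀ {u v} → Adj G u v → h u ≢ h v
          edge {u} {v} adj = proper (identify k≤n u) (identify k≤n v)
            (Equivalence.from (ident (identify k≤n u) (identify k≤n v)) (u , v , refl , refl , adj))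
          avoid : ∀ {v} → h v ∉ map h (N v)
          avoid p with ∈.∈-map⁻ h p
          ... | u , u∈ , e = edge (proj₂ (∈-N⁻ u∈)) (sym e)

        free⇒proper : Free h → Proper Γ κ
        free⇒proper free a b adj e with Equivalence.to (ident a b) adj
        ... | u , v , refl , refl , adj′ with Fin.<-cmp u v
        ...   | tri< u<v _ _ = free-separates {h} free u<v adj′ e
        ...   | tri≈ _ e′ _  = irreflexive G (subst (Adj G u) (sym e′) adj′)
        ...   | tri> _ _ v<u = free-separates {h} free v<u (symmetric G adj′) (sym e)

        module _ (x : ℕ → ℚ) where

          weight : ℚ
          weight = ∏ℚ new (λ v → ωV x (map h (N v)) (h v))

          weight≢0⇒free : weight ≢ 0ℚ → ∀ {v} → v ∈ new → h v ∉ map h (N v)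
          weight≢0⇒free ne {v} v∈ p = ne (∏-zero new (λ v → ωV x (map h (N v)) (h v)) v∈
            (cong (if_then 0ℚ else x (h v)) (dec-true (h v ∈? map h (N v)) p)))

          free-weight : Free h → weight ≡ ∏ᵥ x κ
          free-weight (_ , free) = trans
            (∏-cong new λ {v} v∈ → cong (if_then 0ℚ else x (h v)) (dec-false (h v ∈? map h (N v)) (free v∈)))
            (trans (sym (∏-map h new x)) (trans (cong (λ ys → ∏ℚ ys x) map-new)
              (trans (∏-↭ x (↭.++-comm (drop k l) (take k l))) (trans (cong (λ ys → ∏ℚ ys x) (List.take++drop≡id k l)) (sym (∏ᵥ-toList x κ))))))

          closed-weight : closedWeight (ωV x) k ds (map h new) ≡ (if does (unique? (map h low)) then weight else 0ℚ)
          closed-weight = trans (cong (λ a → if does (unique? a) then wt (ωV x) ds a (map h new) else 0ℚ) lastn-new)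
            (cong (λ r → if does (unique? (map h low)) then r else 0ℚ) (wt-new unit last-clique n+k<M (ωV x) h))

          -- The first k vertices form a clique, so their distinctness is part of properness, and
          -- the remaining edges are tested by the steps. Each vertex of Γ is represented once among
          -- k + 1, ..., n + k, hence each variable occurs once.
          coloring-weight : [ does (proper? Γ κ) ]ᵇ * ∏ᵥ x κ ≡ closedWeight (ωV x) k ds (drop k l ++ take k l)
          coloring-weight = trans (go (proper? Γ κ) (unique? (map h low))) (trans (sym closed-weight) (cong (closedWeight (ωV x) k ds) map-new))
            where
            go : (p? : Dec (Proper Γ κ)) (u? : Dec (Unique (map h low))) →
                 [ does p? ]ᵇ * ∏ᵥ x κ ≡ (if does u? then weight else 0ℚ)
            go (yes p) (yes u) = trans (ℚ.*-identityˡ (∏ᵥ x κ)) (sym (free-weight (proper⇒free p)))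
            go (yes p) (no ¬u) = contradiction (proj₁ (proper⇒free p)) ¬u
            go (no ¬p) (no _)  = ℚ.*-zeroˡ (∏ᵥ x κ)
            go (no ¬p) (yes u) = trans (ℚ.*-zeroˡ (∏ᵥ x κ)) (sym (decidable-stable (weight ℚ.≟ 0ℚ) λ ne →
              ¬p (free⇒proper (u , λ {v} → weight≢0⇒free ne {v}))))

    -- The path starts at vertex k + 1 and so reads the colouring with its first k letters moved to
    -- the end; `∑-rotate` undoes this.
    chromatic-words : ∀ {m} (xs : Vec ℚ m) →
      chromaticValue Γ xs ≡ ∑ℚ (seqs (upTo m) n) (closedWeight (ωV (atℚ (toList xs))) k ds)
    chromatic-words {m} xs = begin
      ∑ℚ (words (upTo m) n) (λ κ → [ does (proper? Γ κ) ]ᵇ * ∏ᵥ x κ)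
        ≡⟨ ∑-cong (words (upTo m) n) (λ {κ} _ → coloring-weight κ x) ⟩
      ∑ℚ (words (upTo m) n) (rotated ∘ toList)
        ≡⟨ ∑-map toList (words (upTo m) n) rotated ⟨
      ∑ℚ (map toList (words (upTo m) n)) rotated
        ≡⟨ cong (λ L → ∑ℚ L rotated) (seqs-words (upTo m) n) ⟩
      ∑ℚ (seqs (upTo m) n) rotated
        ≡⟨ cong (λ n → ∑ℚ (seqs (upTo m) n) rotated) (ℕ.m+[n∸m]≡n k≤n) ⟨
      ∑ℚ (seqs (upTo m) (k ℕ.+ (n ℕ.∸ k))) rotated
        ≡⟨ ∑-rotate (upTo m) (n ℕ.∸ k) k (closedWeight (ωV x) k ds) ⟨
      ∑ℚ (seqs (upTo m) (n ℕ.∸ k ℕ.+ k)) (closedWeight (ωV x) k ds)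
        ≡⟨ cong (λ n → ∑ℚ (seqs (upTo m) n) (closedWeight (ωV x) k ds)) (ℕ.m∸n+n≡m k≤n) ⟩
      ∑ℚ (seqs (upTo m) n) (closedWeight (ωV x) k ds) ∎
      where
      open ≡-Reasoning
      x = atℚ (toList xs)
      rotated : List ℕ → ℚ
      rotated v = closedWeight (ωV x) k ds (drop k v ++ take k v)

-- Building a tableau from a word of nonzero weight.

module Filling where

  open Coeff using (Ā; Ā-∉; Ā-suc-∈)
  open Traces using (lastn)
  open Words using (wt; ωW)
  open Tableaux
  open import Data.Rational.Base using (_*_)
  open import Data.List.Membership.DecPropositional ℕ._≟_ using (_∈?_)

  -- The row that ended in column c when c was appended to a has not been extended since.
  Open : ℕ → List ℕ → Set
  Open c []      = ⊥
  Open c (b ∷ a) = (b ≡ c × suc c ∉ a) ⊎ Open c a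

  Open-∈ : ∀ {c} a → Open c a → c ∈ a
  Open-∈ (b ∷ a) (inj₁ (e , _)) = here (sym e)
  Open-∈ (b ∷ a) (inj₂ o)       = there (Open-∈ a o)

  ∈-Open : ∀ {c} a → c ∈ a → suc c ∉ a → Open c a
  ∈-Open (b ∷ a) (here e)  c+1∉ = inj₁ (sym e , c+1∉ ∘ there)
  ∈-Open (b ∷ a) (there p) c+1∉ = inj₂ (∈-Open a p (c+1∉ ∘ there))

  Open-drop : ∀ {c} i a → Open c (drop i a) → Open c a
  Open-drop zero    a       o = o
  Open-drop (suc i) (b ∷ a) o = inj₂ (Open-drop i a o)

  Open-∷ʳ : ∀ {c y} a → Open c (a ∷ʳ y) → c ≡ y ⊎ (suc c ≢ y × Open c a)
  Open-∷ʳ []      (inj₁ (e , _)) = inj₁ (sym e)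
  Open-∷ʳ {c} {y} (b ∷ a) (inj₁ (e , c+1∉)) = inj₂ ((λ e′ → c+1∉ (subst (_∈ a ∷ʳ y) (sym e′) (last∈ a))) , inj₁ (e , c+1∉ ∘ init∈ a))
    where
    last∈ : ∀ a → y ∈ a ∷ʳ y
    last∈ []      = here refl
    last∈ (_ ∷ a) = there (last∈ a)
    init∈ : ∀ a → suc c ∈ a → suc c ∈ a ∷ʳ y
    init∈ (_ ∷ a) (here e)  = here e
    init∈ (_ ∷ a) (there p) = there (init∈ a p)
  Open-∷ʳ (b ∷ a) (inj₂ o) with Open-∷ʳ a o
  ... | inj₁ e        = inj₁ e
  ... | inj₂ (ne , o) = inj₂ (ne , inj₂ o)

  record Filled (T₀ : Tableau) (N : ℕ) (R vs : List ℤ) (ys : List ℕ) (T : Tableau) : Set where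
    field
      result  : Tableau
      spec    : Spec T₀ (vs ʳ++ R) result
      larger  : T ⊑ result
      width   : All (λ row → length row ≤ N) result
      columns : map (column result) vs ≡ ys

  -- Invariant: each open column of the active list is the length of some row of T. New labels
  -- arrive in increasing order, so every insertion adds the largest entry.
  fill : ∀ {T₀ N} w ds a ys vs R T → length ys ≡ length ds → length vs ≡ length ds → wt (ωW w) ds a ys ≢ 0ℚ →
         All (1 ≤_) ys → All (_≤ N) ys → (∀ c → Open c a → Row c T) →
         All (λ v → All (ℤ._< v) (entries T₀)) vs → All (λ v → All (ℤ._< v) R) vs → AllPairs ℤ._<_ vs →
         Spec T₀ R T → All (λ row → length row ≤ N) T → Filled T₀ N R vs ys T
  fill w [] a [] [] R T _ _ _ _ _ _ _ _ _ spec width = record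
    { result = T ; spec = spec ; larger = ⊑-refl T ; width = width ; columns = refl }
  fill {T₀} {N} w (d ∷ ds) a (suc s ∷ ys) (v ∷ vs) R T ly lv ne (1≤y ∷ ys≥1) (y≤N ∷ ys≤N) rows (T₀<v ∷ T₀<) (R<v ∷ R<) (v< ∷ asc) sp width = record
    { result  = F.result
    ; spec    = F.spec
    ; larger  = ⊑-trans (⊑-insert y v T) F.larger
    ; width   = F.width
    ; columns = cong₂ _∷_ (column-At (proj₂ (proj₂ (proj₂ (proj₁ F.spec)))) (At-⊑ F.larger (At-insert T addable))) F.columns
    }
    where
    y : ℕ
    y = suc s
    σ : List ℕ
    σ = lastn d a
    rest : ℚ
    rest = wt (ωW w) ds (σ ∷ʳ y) ys
    Ā≢0 : Ā s σ ≢ 0ℚ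
    Ā≢0 e = ne (trans (cong (λ z → (z * w y) * rest) e) (trans (cong (_* rest) (ℚ.*-zeroˡ (w y))) (ℚ.*-zeroˡ rest)))
    rest≢0 : rest ≢ 0ℚ
    rest≢0 e = ne (trans (cong (ωW w σ y *_) e) (ℚ.*-zeroʳ (ωW w σ y)))
    y∉σ : suc s ∉ σ
    y∉σ p = Ā≢0 (Ā-suc-∈ p)
    -- The nonzero weight puts s into 0 ∷ σ. If s is 0, a new row may be opened. Otherwise s + 1
    -- does not occur in σ, so s is open and a row of length s is available.
    addable : Addable y T
    addable with s ∈? (0 ∷ σ)
    ... | yes (here refl) = inj₁ refl
    ... | yes (there p)   = inj₂ (Any.map (cong suc) (rows s (Open-drop (length a ℕ.∸ d) a (∈-Open σ p y∉σ))))
    ... | no s∉           = contradiction (Ā-∉ s∉) Ā≢0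
    rows′ : ∀ c → Open c (σ ∷ʳ y) → Row c (insert y v T)
    rows′ c o with Open-∷ʳ σ o
    ... | inj₁ refl      = row-insert T addable
    ... | inj₂ (ne , o′) = row-keep T ne (rows c (Open-drop (length a ℕ.∸ d) a o′))
    module F = Filled (fill w ds (σ ∷ʳ y) ys vs (v ∷ R) (insert y v T) (ℕ.suc-injective ly) (ℕ.suc-injective lv) rest≢0 ys≥1 ys≤N rows′
      T₀< (All.zipWith (λ (v<u , R<u) → v<u ∷ R<u) (v< , R<)) asc (spec-insert sp addable T₀<v R<v) (insert-width T 1≤y y≤N width))

-- The sum over tableaux as a sum over words of columns.

module Fillings where

  open import Defs
  open Sums
  open Coeff using (Ā; A-Ā; Ā-suc-∈)
  open Lists
  open Traces using (lastn; lastn-++; δ′; δ′-same; δ′-diff)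
  open Words
  open Tableaux
  open Filling
  open Graphs
  open Colorings using (tabulate-++; tabulate-toList)
  open import Data.Rational.Base using (_*_)
  open import Data.List.Base using (tabulate)
  open import Data.List.Membership.DecPropositional ℤ._≟_ using () renaming (_∈?_ to _∈ℤ?_; _∉?_ to _∉ℤ?_)
  open import Data.Vec.Base using ([]; _∷_; lookup)

  private variable
    B C : Set

  take-tabulate : ∀ {n k} (f : ℕ → B) → k ≤ n → take k (tabulate {n = n} (f ∘ toℕ)) ≡ tabulate {n = k} (f ∘ toℕ)
  take-tabulate         f z≤n       = refl
  take-tabulate {B = B} f (s≤s k≤n) = cong (f 0 ∷_) (take-tabulate (f ∘ suc) k≤n)

  last⇒At : ∀ {x T l} → Any (λ row → length row ≡ l × last row ≡ just x) T → At x l T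
  last⇒At (there a) = there (last⇒At a)
  last⇒At {x} {row ∷ T} (here (refl , e)) with final-entry row e
    where
    final-entry : ∀ (row : List ℤ) → last row ≡ just x → ∃[ pre ] row ≡ pre ++ x ∷ [] × suc (length pre) ≡ length row
    final-entry (a ∷ [])      refl = [] , refl , refl
    final-entry (a ∷ b ∷ row) e with final-entry (b ∷ row) e
    ... | pre , e′ , l = a ∷ pre , cong (a ∷_) e′ , cong suc l
  ... | pre , e′ , l = here (pre , [] , e′ , l)

  At-bounds : ∀ {N x c T} → All (λ row → length row ≤ N) T → At x c T → 1 ≤ c × c ≤ N
  At-bounds (w ∷ ws) (there a) = At-bounds ws a
  At-bounds (w ∷ ws) (here (pre , post , refl , refl)) = s≤s z≤n , ℕ.≤-trans (ℕ.≤-trans (s≤s (ℕ.m≤m+n (length pre) (length post)))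
    (ℕ.≤-reflexive (trans (sym (ℕ.+-suc (length pre) (length post))) (sym (List.length-++ pre))))) w

  map-pointwise : ∀ {f g : B → C} {L b} → map f L ≡ map g L → b ∈ L → f b ≡ g b
  map-pointwise {L = b ∷ L} e (here refl) = proj₁ (List.∷-injective e)
  map-pointwise {L = b ∷ L} e (there p)   = map-pointwise (proj₂ (List.∷-injective e)) p

  decreasing-ʳ++ : ∀ {T₀} vs {R} → All (λ v → All (ℤ._< v) (entries T₀)) vs → All (λ v → All (ℤ._< v) R) vs → AllPairs ℤ._<_ vs →
                   Decreasing T₀ R → Decreasing T₀ (vs ʳ++ R)
  decreasing-ʳ++ []       _         _         _          dec = dec
  decreasing-ʳ++ (v ∷ vs) (p ∷ ps) (q ∷ qs) (v< ∷ asc) dec =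
    decreasing-ʳ++ vs ps (All.zipWith (λ (v<u , R<u) → v<u ∷ R<u) (v< , qs)) asc (p , q , dec)

  length-NonEmpty : ∀ {T} → NonEmpty T → length T ≤ length (entries T)
  length-NonEmpty []       = z≤n
  length-NonEmpty {row ∷ T} (n ∷ ns) = ℕ.≤-trans (ℕ.+-mono-≤ n (length-NonEmpty ns)) (ℕ.≤-reflexive (sym (List.length-++ row)))

  module TableauSum (n k N : ℕ) (k≤n : k ≤ n) (G : Graph (n ℕ.+ k))
    (unit : IsNaturalUnitInterval G) (last-clique : IsClique G (λ v → n ≤ toℕ v)) {M} (n+k<M : n ℕ.+ k < M) (w : ℕ → ℚ) where

    open Vertices n k G hiding (N)
    open Vertices n k G using () renaming (N to nbrs)

    labels : List ℤ
    labels = map label new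

    labels-new : map label (newVertices n k G) ≡ labels
    labels-new = cong (map label) newVertices-drop

    col : Tableau → Fin (n ℕ.+ k) → ℕ
    col T v = column T (label v)

    newColumns : Tableau → List ℕ
    newColumns T = map (col T) new

    summandValue : Tableau → ℚ
    summandValue T = if does (all? (unique? ∘ neighborColumns n k G T) (newVertices n k G))
      then ∏ℚ (newVertices n k G) (λ v → A (col T v) (neighborColumns n k G T v) * w (col T v)) else 0ℚ

    tuples-range : ∀ {j} → j ∈ tuples k N → Unique (toList j) × All (_∈ ids 1 N) (toList j)
    tuples-range {j} j∈ with ∈.∈-filter⁻ (unique? ∘ toList) {xs = words (map suc (upTo N)) k} j∈
    ... | j∈′ , u = u , All.map range (proj₂ (∈-seqs⁻ k (subst (toList j ∈_) (seqs-words (map suc (upTo N)) k) (∈.∈-map⁺ toList j∈′))))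
      where
      range : ∀ {c} → c ∈ map suc (upTo N) → c ∈ ids 1 N
      range c∈ with ∈.∈-map⁻ suc c∈
      ... | b , b∈ , refl = ids-∈ 1 N (s≤s z≤n) (ℕ.≤-trans (s≤s (∈.∈-upTo⁻ b∈)) (ℕ.≤-reflexive (ℕ.+-comm 1 N)))

    range-bounds : ∀ {c} → c ∈ ids 1 N → 1 ≤ c × c ≤ N
    range-bounds {c} c∈ with ∈-ids 1 N c∈
    ... | 1≤c , c< = 1≤c , ℕ.s≤s⁻¹ (subst (c <_) (ℕ.+-comm N 1) c<)

    bounds-range : ∀ {c} → 1 ≤ c → c ≤ N → c ∈ ids 1 N
    bounds-range 1≤c c≤N = ids-∈ 1 N 1≤c (ℕ.≤-trans (s≤s c≤N) (ℕ.≤-reflexive (ℕ.+-comm 1 N)))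

    map-last : ∀ T → lastn k (newColumns T) ≡ toList (lastColumns n k G T)
    map-last T = begin
      lastn k (newColumns T)
        ≡⟨ lastn-suffix k (map (col T) low) (newColumns T) (ℕ.≤-trans k≤n (ℕ.≤-reflexive (sym (trans (List.length-map (col T) new) length-new)))) ⟨
      lastn k (map (col T) low ++ newColumns T)
        ≡⟨ cong (lastn k) (trans (sym (List.map-++ (col T) low new)) (cong (map (col T)) (sym V-split))) ⟩
      lastn k (map (col T) V)
        ≡⟨ cong (lastn k) (trans (List.map-tabulate id (col T)) (tabulate-++ n (col T))) ⟩
      lastn k (tabulate (col T ∘ (_↑ˡ k)) ++ tabulate (col T ∘ (n ↑ʳ_)))
        ≡⟨ lastn-++ (tabulate (col T ∘ (_↑ˡ k))) (List.length-tabulate (col T ∘ (n ↑ʳ_))) ⟩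
      tabulate (col T ∘ (n ↑ʳ_))
        ≡⟨ List.tabulate-cong (λ r → Vec.lookup∘tabulate (col T ∘ (n ↑ʳ_)) r) ⟨
      tabulate (lookup (lastColumns n k G T))
        ≡⟨ tabulate-toList (lastColumns n k G T) ⟩
      toList (lastColumns n k G T) ∎
      where open ≡-Reasoning

    module _ (T₀ : Vec ℕ k → Tableau) {j : Vec ℕ k} (j∈ : j ∈ tuples k N) (initial : IsInitial j (T₀ j)) where

      private
        S : Tableau
        S = T₀ j

        R : List ℤ
        R = labels ʳ++ []

        R⁺ : ∀ {x} → x ∈ labels → x ∈ R
        R⁺ p = Any.reverse⁺ p

        R⁻ : ∀ {x} → x ∈ R → x ∈ labels
        R⁻ p = Any.reverse⁻ p

        S-below : All (λ v → All (ℤ._< v) (entries S)) labels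
        S-below = All.map⁺ (All.map (λ k≤v → All.map (below k≤v) (proj₂ (proj₂ (proj₂ initial)))) new-≥)
          where
          below : ∀ {v : Fin (n ℕ.+ k)} {x} → k ≤ toℕ v → x ℤ.≤ 0ℤ ⊎ (∃[ r ] x ≡ label {k} r) → x ℤ.< label v
          below k≤v (inj₁ x≤0)        = ℤ.≤-<-trans x≤0 (ℤ.+<+ (s≤s z≤n))
          below k≤v (inj₂ (r , refl)) = ℤ.+<+ (s≤s (ℕ.<-≤-trans (Fin.toℕ<n r) k≤v))

        ascending : AllPairs ℤ._<_ labels
        ascending = AllPairs.map⁺ (AllPairs.map (λ u<v → ℤ.+<+ (s≤s u<v)) (AllPairs.drop⁺ k (allFin-sorted (n ℕ.+ k))))

        decreasing : Decreasing S R
        decreasing = decreasing-ʳ++ labels S-below (All.universal (λ _ → []) labels) ascending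
          (proj₁ (proj₁ initial) , proj₂ (proj₂ (proj₂ (proj₁ initial))))

        label∉ : ∀ {x} → x ∈ labels → x ∉ entries S
        label∉ x∈ p = ℤ.<-irrefl refl (All.lookup (All.lookup S-below x∈) p)

        Admissible : Tableau → Set
        Admissible T = Spec S R T × All (λ row → length row ≤ N) T

        extends⇒admissible : ∀ {T} → Extends N S (map label (newVertices n k G)) T → Admissible T
        extends⇒admissible {T} (tab , sub , (⊆new , new⊆) , width) = (tab , sub , from , to) , width
          where
          from : ∀ x → x ∈ entries T → x ∈ entries S ⊎ x ∈ R
          from x x∈ with x ∈ℤ? entries S
          ... | yes p = inj₁ p
          ... | no ¬p = inj₂ (R⁺ (subst (x ∈_) labels-new (⊆new (∈.∈-filter⁺ (_∉ℤ? entries S) x∈ ¬p))))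
          to : ∀ x → x ∈ R → x ∈ entries T
          to x x∈ = proj₁ (∈.∈-filter⁻ (_∉ℤ? entries S) {xs = entries T} (new⊆ (subst (x ∈_) (sym labels-new) (R⁻ x∈))))

        admissible⇒extends : ∀ {T} → Admissible T → Extends N S (map label (newVertices n k G)) T
        admissible⇒extends {T} ((tab , sub , from , to) , width) = tab , sub , ((λ {x} → ⊆new {x}) , (λ {x} → new⊆ {x})) , width
          where
          ⊆new : ∀ {x} → x ∈ T ∖ S → x ∈ map label (newVertices n k G)
          ⊆new {x} x∈ with ∈.∈-filter⁻ (_∉ℤ? entries S) {xs = entries T} x∈
          ... | x∈T , x∉S with from x x∈T
          ...   | inj₁ p = contradiction p x∉S
          ...   | inj₂ p = subst (x ∈_) (sym labels-new) (R⁻ p)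
          new⊆ : ∀ {x} → x ∈ map label (newVertices n k G) → x ∈ T ∖ S
          new⊆ {x} x∈ = ∈.∈-filter⁺ (_∉ℤ? entries S) (to x (R⁺ x∈′)) (label∉ x∈′)
            where x∈′ = subst (x ∈_) labels-new x∈

        columns-unique : ∀ {T} → Admissible T → Unique (entries T)
        columns-unique ((tab , _) , _) = proj₂ (proj₂ (proj₂ tab))

        map-low : ∀ {T} → Admissible T → map (col T) low ≡ toList j
        map-low {T} adm = begin
          map (col T) (take k V)           ≡⟨ List.take-map k V ⟨
          take k (map (col T) V)           ≡⟨ cong (take k) (List.map-tabulate id (col T)) ⟩
          take k (tabulate (col T))        ≡⟨ take-tabulate (λ i → column T (+ suc i)) (ℕ.m≤n+m k n) ⟩
          tabulate {n = k} (λ r → column T (label r))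
            ≡⟨ List.tabulate-cong (λ r → column-At (columns-unique {T} adm)
                 (At-⊑ (proj₁ (proj₂ (proj₁ adm))) (last⇒At (proj₁ (proj₂ (proj₂ initial)) r)))) ⟩
          tabulate (lookup j)              ≡⟨ tabulate-toList j ⟩
          toList j ∎
          where open ≡-Reasoning

        new-range : ∀ {T} → Admissible T → ∀ {v} → v ∈ new → col T v ∈ ids 1 N
        new-range {T} adm@((_ , _ , _ , to) , width) {v} v∈ with ∈⇒At T (to (label v) (R⁺ (∈.∈-map⁺ label v∈)))
        ... | c , a = subst (_∈ ids 1 N) (sym (column-At (columns-unique {T} adm) a))
          (bounds-range (proj₁ (At-bounds width a)) (proj₂ (At-bounds width a)))

        all-range : ∀ {T} → Admissible T → ∀ v → col T v ∈ ids 1 N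
        all-range {T} adm v with new-or-low v
        ... | inj₁ p = new-range {T} adm p
        ... | inj₂ p = All.lookup (proj₂ (tuples-range j∈)) (subst (col T v ∈_) (map-low {T} adm) (∈.∈-map⁺ (col T) p))

        weight : Tableau → ℚ
        weight T = ∏ℚ new (λ v → ωW w (map (col T) (nbrs v)) (col T v))

        weight-wt : ∀ {T} → Admissible T → weight T ≡ wt (ωW w) ds (toList j) (newColumns T)
        weight-wt {T} adm = trans (sym (wt-new unit last-clique n+k<M (ωW w) (col T)))
          (cong (λ a → wt (ωW w) ds a (newColumns T)) (map-low {T} adm))

        factor-A : ∀ {T} → Admissible T → ∀ v → A (col T v) (map (col T) (nbrs v)) ≡ Ā (col T v ℕ.∸ 1) (map (col T) (nbrs v))
        factor-A {T} adm v = positive (col T v) (proj₁ (range-bounds (all-range {T} adm v)))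
          where
          σ : List ℕ
          σ = map (col T) (nbrs v)
          0∉ : 0 ∉ σ
          0∉ p with ∈.∈-map⁻ (col T) p
          ... | u , _ , e = ℕ.n≮n 0 (subst (1 ≤_) (sym e) (proj₁ (range-bounds (all-range {T} adm u))))
          positive : ∀ c → 1 ≤ c → A c σ ≡ Ā (c ℕ.∸ 1) σ
          positive (suc s) _ = A-Ā s 0∉

        weight≢0⇒free : ∀ {T} → Admissible T → weight T ≢ 0ℚ → Free (col T)
        weight≢0⇒free {T} adm ne = subst Unique (sym (map-low {T} adm)) (proj₁ (tuples-range j∈)) , λ {v} v∈ p →
          ne (∏-zero new (λ v → ωW w (map (col T) (nbrs v)) (col T v)) v∈ (vanish (col T v) (map (col T) (nbrs v))
            (proj₁ (range-bounds (all-range {T} adm v))) p))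
          where
          vanish : ∀ c σ → 1 ≤ c → c ∈ σ → ωW w σ c ≡ 0ℚ
          vanish (suc s) σ _ p = trans (cong (_* w (suc s)) (Ā-suc-∈ p)) (ℚ.*-zeroˡ (w (suc s)))

        free⇒unique : ∀ {h} → Free h → ∀ v → Unique (map h (nbrs v))
        free⇒unique {h} free v = map-unique h (N-unique v) distinct
          where
          distinct : ∀ {a b} → a ∈ nbrs v → b ∈ nbrs v → a ≢ b → h a ≢ h b
          distinct {a} {b} a∈ b∈ a≢b with Fin.<-cmp a b
          ... | tri< a<b _ _ = free-separates {h} free a<b (proj₁ (unit a<b (proj₁ (∈-N⁻ b∈)) (proj₂ (∈-N⁻ a∈))))
          ... | tri≈ _ e _   = contradiction e a≢b
          ... | tri> _ _ b<a = free-separates {h} free b<a (proj₁ (unit b<a (proj₁ (∈-N⁻ a∈)) (proj₂ (∈-N⁻ b∈)))) ∘ sym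

        -- Two smaller neighbours of a vertex are adjacent to each other, so a repetition among
        -- their columns violates `Free` and makes the weight 0. The convention for such tableaux is
        -- thus consistent with the product.
        summand-weight : ∀ {T} → Admissible T → summandValue T ≡ weight T
        summand-weight {T} adm = trans (cong (λ L → if does (all? (unique? ∘ neighborColumns n k G T) L)
            then ∏ℚ L (λ v → A (col T v) (neighborColumns n k G T v) * w (col T v)) else 0ℚ) newVertices-drop)
          (go (all? (unique? ∘ neighborColumns n k G T) new))
          where
          go : (u? : Dec (All (Unique ∘ neighborColumns n k G T) new)) →
               (if does u? then ∏ℚ new (λ v → A (col T v) (neighborColumns n k G T v) * w (col T v)) else 0ℚ) ≡ weight T
          go (yes _) = ∏-cong new λ {v} _ → cong (_* w (col T v)) (factor-A {T} adm v)
          go (no ¬u) = sym (decidable-stable (weight T ℚ.≟ 0ℚ) λ ne →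
            ¬u (All.universal (free⇒unique {col T} (weight≢0⇒free {T} adm ne)) new))

        support : List ℤ
        support = entries S ++ map label (newVertices n k G)

        support-unique : Unique support
        support-unique = Unique.++⁺ (proj₂ (proj₂ (proj₂ (proj₁ initial))))
          (subst Unique (sym labels-new) (AllPairs.map (λ { v<v refl → ℤ.<-irrefl refl v<v }) ascending))
          (λ {x} (p , q) → label∉ (subst (x ∈_) labels-new q) p)

        admissible-candidate : ∀ {T} → Admissible T → T ∈ extensions N S (map label (newVertices n k G))
        admissible-candidate {T} adm@((tab , _ , from , _) , width) = ∈.∈-filter⁺ (extends? N S (map label (newVertices n k G)))
          (∈-listsUpTo T (ℕ.≤-trans (length-NonEmpty (proj₁ tab)) (unique-⊆-length (columns-unique {T} adm) (λ {x} → supported {x})))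
            (All.tabulate λ {row} row∈ → ∈-listsUpTo row (All.lookup width row∈)
              (All.tabulate λ {x} x∈ → supported (∈.∈-concat⁺′ x∈ row∈))))
          (admissible⇒extends {T} adm)
          where
          supported : ∀ {x} → x ∈ entries T → x ∈ support
          supported {x} x∈ with from x x∈
          ... | inj₁ p = ∈.∈-++⁺ˡ p
          ... | inj₂ p = ∈.∈-++⁺ʳ (entries S) (subst (x ∈_) (sym labels-new) (R⁻ p))

        member : ∀ {T} → T ∈ tableauxFor n k G N T₀ j → Admissible T × lastColumns n k G T ≡ j
        member {T} T∈ with ∈.∈-filter⁻ (λ T → Vec.≡-dec ℕ._≟_ (lastColumns n k G T) j) {xs = extensions N S (map label (newVertices n k G))} T∈
        ... | T∈′ , e = extends⇒admissible {T} (proj₂ (∈.∈-filter⁻ (extends? N S (map label (newVertices n k G)))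
                {xs = listsUpTo (length support) (listsUpTo N support)} T∈′)) , e

        g : List ℕ → ℚ
        g ys = wt (ωW w) ds (toList j) ys * δ′ (toList j) (lastn k ys)

        value : ∀ {T} → T ∈ tableauxFor n k G N T₀ j → summandValue T ≡ g (newColumns T)
        value {T} T∈ = trans (summand-weight {T} adm) (trans (weight-wt {T} adm)
          (trans (sym (ℚ.*-identityʳ (wt (ωW w) ds (toList j) (newColumns T)))) (cong (wt (ωW w) ds (toList j) (newColumns T) *_) (sym one))))
          where
          adm = proj₁ (member {T} T∈)
          one : δ′ (toList j) (lastn k (newColumns T)) ≡ 1ℚ
          one = trans (cong (δ′ (toList j)) (trans (map-last T) (cong toList (proj₂ (member {T} T∈))))) (δ′-same (toList j))

        into : ∀ {T} → T ∈ tableauxFor n k G N T₀ j → newColumns T ∈ seqs (ids 1 N) n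
        into {T} T∈ = subst (λ l → newColumns T ∈ seqs (ids 1 N) l) (trans (List.length-map (col T) new) length-new)
          (∈-seqs⁺ (newColumns T) (All.map⁺ (All.tabulate λ v∈ → new-range {T} (proj₁ (member {T} T∈)) v∈)))

        -- The new entries are added in increasing order, so `spec-unique` recovers the tableau from
        -- their columns.
        injective : ∀ {T T′} → T ∈ tableauxFor n k G N T₀ j → T′ ∈ tableauxFor n k G N T₀ j → newColumns T ≡ newColumns T′ → T ≡ T′
        injective {T} {T′} T∈ T′∈ e = spec-unique R decreasing (proj₁ (proj₁ (member {T} T∈))) (proj₁ (proj₁ (member {T′} T′∈))) agree
          where
          agree : ∀ {x} → x ∈ R → column T x ≡ column T′ x
          agree x∈ with ∈.∈-map⁻ label (R⁻ x∈)
          ... | v , v∈ , refl = map-pointwise {f = col T} {g = col T′} e v∈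

        width₀ : All (λ row → length row ≤ N) S
        width₀ = All.map⁻ (All.tabulate λ {c} c∈ → proj₂ (range-bounds (All.lookup (proj₂ (tuples-range j∈))
          (↭.∈-resp-↭ (proj₁ (proj₂ initial)) c∈))))

        rows₀ : ∀ c → Open c (toList j) → Row c S
        rows₀ c o with ∈.∈-tabulate⁻ (subst (c ∈_) (sym (tabulate-toList j)) (Open-∈ (toList j) o))
        ... | r , refl = Any.map proj₁ (proj₁ (proj₂ (proj₂ initial)) r)

        -- A nonzero weight lets `fill` build the tableau, and the nonzero Kronecker symbol makes
        -- its last k columns equal to j.
        onto : ∀ {ys} → ys ∈ seqs (ids 1 N) n → g ys ≢ 0ℚ → ∃[ T ] T ∈ tableauxFor n k G N T₀ j × newColumns T ≡ ys
        onto {ys} ys∈ ne = result , ∈.∈-filter⁺ (λ T → Vec.≡-dec ℕ._≟_ (lastColumns n k G T) j) (admissible-candidate {result} (spec , width)) last≡ , cols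
          where
          ly : length ys ≡ n
          ly = proj₁ (∈-seqs⁻ n ys∈)
          range : All (_∈ ids 1 N) ys
          range = proj₂ (∈-seqs⁻ n ys∈)
          wt≢0 : wt (ωW w) ds (toList j) ys ≢ 0ℚ
          wt≢0 e = ne (trans (cong (_* δ′ (toList j) (lastn k ys)) e) (ℚ.*-zeroˡ (δ′ (toList j) (lastn k ys))))
          ends : toList j ≡ lastn k ys
          ends = decidable-stable (List.≡-dec ℕ._≟_ (toList j) (lastn k ys)) λ ≢ →
            ne (trans (cong (wt (ωW w) ds (toList j) ys *_) (δ′-diff ≢)) (ℚ.*-zeroʳ (wt (ωW w) ds (toList j) ys)))
          base : Spec S [] S
          base = proj₁ initial , ⊑-refl S , (λ _ → inj₁) , λ _ ()
          open Filled (fill w ds (toList j) ys labels [] S (trans ly (sym length-ds))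
            (trans (List.length-map label new) (sym (List.length-map deg new))) wt≢0
            (All.map (proj₁ ∘ range-bounds) range) (All.map (proj₂ ∘ range-bounds) range) rows₀
            S-below (All.universal (λ _ → []) labels) ascending base width₀)
          cols : newColumns result ≡ ys
          cols = trans (List.map-∘ new) columns
          last≡ : lastColumns n k G result ≡ j
          last≡ = toList-injective′ (lastColumns n k G result) j (trans (sym (map-last result)) (trans (cong (lastn k) cols) (sym ends)))
            where
            toList-injective′ : ∀ {l} (u v : Vec ℕ l) → toList u ≡ toList v → u ≡ v
            toList-injective′ []      []      _ = refl
            toList-injective′ (a ∷ u) (b ∷ v) e with List.∷-injective e
            ... | refl , e′ = cong (a ∷_) (toList-injective′ u v e′)

      summands : ∑ℚ (tableauxFor n k G N T₀ j) summandValue ≡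
                 ∑ℚ (seqs (ids 1 N) n) (λ ys → wt (ωW w) ds (toList j) ys * δ′ (toList j) (lastn k ys))
      summands = ∑-bijection (tableauxFor n k G N T₀ j) (seqs (ids 1 N) n) newColumns summandValue g
        (Unique.filter⁺ (λ T → Vec.≡-dec ℕ._≟_ (lastColumns n k G T) j) (Unique.filter⁺ (extends? N S (map label (newVertices n k G)))
          (listsUpTo-unique (length support) (listsUpTo-unique N support-unique))))
        (λ {T} → into {T}) (λ {T} {T′} → injective {T} {T′}) (λ {T} → value {T}) (seqs-unique n (ids-unique 1 N)) (λ {ys} → onto {ys})

      column-≤ : ∀ {T} → T ∈ tableauxFor n k G N T₀ j → ∀ v → col T v ≤ N
      column-≤ {T} T∈ v = proj₂ (range-bounds (all-range {T} (proj₁ (member {T} T∈)) v))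

    module _ (T₀ : Vec ℕ k → Tableau) (initial : ∀ j → j ∈ tuples k N → IsInitial j (T₀ j)) where

      tableaux-words : ∑ℚ (tuples k N) (λ j → ∑ℚ (tableauxFor n k G N T₀ j) summandValue) ≡
                       ∑ℚ (seqs (ids 1 N) n) (closedWeight (ωW w) k ds)
      tableaux-words = begin
        ∑ℚ (tuples k N) (λ j → ∑ℚ (tableauxFor n k G N T₀ j) summandValue)
          ≡⟨ ∑-cong (tuples k N) (λ {j} j∈ → summands T₀ j∈ (initial j j∈)) ⟩
        ∑ℚ (tuples k N) (λ j → ∑ℚ (seqs (ids 1 N) n) (λ ys → wt (ωW w) ds (toList j) ys * δ′ (toList j) (lastn k ys)))
          ≡⟨ cong (λ l → ∑ℚ (tuples k N) (λ j → ∑ℚ (seqs (ids 1 N) l) (λ ys → wt (ωW w) ds (toList j) ys * δ′ (toList j) (lastn k ys)))) length-ds ⟨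
        ∑ℚ (tuples k N) (f ∘ toList)
          ≡⟨ ∑-map toList (tuples k N) f ⟨
        ∑ℚ (map toList (tuples k N)) f
          ≡⟨ closed-words (ωW w) (ids 1 N) k ds (map toList (tuples k N)) (ℕ.≤-trans k≤n (ℕ.≤-reflexive (sym length-ds))) J-unique J-ok J-all ⟩
        ∑ℚ (seqs (ids 1 N) (length ds)) (closedWeight (ωW w) k ds)
          ≡⟨ cong (λ l → ∑ℚ (seqs (ids 1 N) l) (closedWeight (ωW w) k ds)) length-ds ⟩
        ∑ℚ (seqs (ids 1 N) n) (closedWeight (ωW w) k ds) ∎
        where
        open ≡-Reasoning
        f : List ℕ → ℚ
        f j = ∑ℚ (seqs (ids 1 N) (length ds)) (λ ys → wt (ωW w) ds j ys * δ′ j (lastn k ys))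
        upTo-unique : Unique (map suc (upTo N))
        upTo-unique = Unique.map⁺ ℕ.suc-injective (Unique.upTo⁺ N)
        J-unique : Unique (map toList (tuples k N))
        J-unique = subst Unique (filter-map unique? toList (words (map suc (upTo N)) k))
          (Unique.filter⁺ unique? (subst Unique (sym (seqs-words (map suc (upTo N)) k)) (seqs-unique k upTo-unique)))
        J-ok : ∀ {j} → j ∈ map toList (tuples k N) → Unique j
        J-ok j∈ with ∈.∈-map⁻ toList j∈
        ... | v , v∈ , refl = proj₁ (tuples-range v∈)
        J-all : ∀ {j} → Unique j → length j ≡ k → All (_∈ ids 1 N) j → j ∈ map toList (tuples k N)
        J-all {j} u l range = subst (j ∈_) (filter-map unique? toList (words (map suc (upTo N)) k))
          (∈.∈-filter⁺ unique? (subst (j ∈_) (sym (seqs-words (map suc (upTo N)) k))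
            (subst (λ l → j ∈ seqs (map suc (upTo N)) l) l (∈-seqs⁺ j (All.map range′ range)))) u)
          where
          range′ : ∀ {c} → c ∈ ids 1 N → c ∈ map suc (upTo N)
          range′ {zero}  c∈ = contradiction (proj₁ (range-bounds c∈)) λ ()
          range′ {suc c} c∈ = ∈.∈-map⁺ suc (∈.∈-upTo⁺ (proj₂ (range-bounds c∈)))

-- The numerical identity and the passage to series.

module Assembly where

  open import Defs
  open Rat using (inv; *-inv)
  open Sums
  open Elementary using (E; E≢0)
  open Evaluate using (Good)
  open Values
  open Lists
  open Traces
  open Words
  open Graphs
  open Colorings
  open Fillings
  open import Data.Rational.Base using (_*_)
  open import Data.Vec.Base using ([]; _∷_)
  open import Data.Vec.Relation.Unary.All using ([]; _∷_) renaming (All to VecAll)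

  open +-*-Solver using (solve; _:+_; _:*_; _:=_; con)

  map-atℚ : ∀ L → map (atℚ L) (upTo (length L)) ≡ L
  map-atℚ L = trans (List.map-applyUpTo id (atℚ L) (length L)) (go L)
    where
    go : ∀ L → List.applyUpTo (atℚ L) (length L) ≡ L
    go []      = refl
    go (x ∷ L) = cong (x ∷_) (go L)

  good-all : ∀ {m} (xs : Vec ℚ m) → Good xs → All (0ℚ ℚ.<_) (toList xs)
  good-all []       _           = []
  good-all (x ∷ xs) (_ , p , g) = p ∷ good-all xs g

  good-positive : ∀ {m} (xs : Vec ℚ m) → Good xs → ∀ {a} → a < m → 0ℚ ℚ.< atℚ (toList xs) a
  good-positive (x ∷ xs) (_ , p , g) {zero}  _       = p
  good-positive (x ∷ xs) (_ , p , g) {suc a} (s≤s q) = good-positive xs g q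

  good-decreasing : ∀ {m} (xs : Vec ℚ m) → Good xs → ∀ {a b} → a < b → b < m → atℚ (toList xs) b ℚ.< atℚ (toList xs) a
  good-decreasing (x ∷ xs) (q , _ , _) {zero}  {suc b} _         (s≤s b<) = first xs q b<
    where
    first : ∀ {m x} (xs : Vec ℚ m) → VecAll (ℚ._< x) xs → ∀ {b} → b < m → atℚ (toList xs) b ℚ.< x
    first (y ∷ xs) (p ∷ ps) {zero}  _        = p
    first (y ∷ xs) (p ∷ ps) {suc b} (s≤s b<) = first xs ps b<
  good-decreasing (x ∷ xs) (_ , _ , g) {suc a} {suc b} (s≤s a<b) (s≤s b<) = good-decreasing xs g a<b b<

  good-distinct : ∀ {m} (xs : Vec ℚ m) → Good xs → ∀ {a b} → a < m → b < m → a ≢ b → atℚ (toList xs) a ≢ atℚ (toList xs) b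
  good-distinct xs g {a} {b} a< b< a≢b e with ℕ.<-cmp a b
  ... | tri< a<b _ _ = ℚ.<-irrefl (sym e) (good-decreasing xs g a<b b<)
  ... | tri≈ _ a≡b _ = a≢b a≡b
  ... | tri> _ _ b<a = ℚ.<-irrefl e (good-decreasing xs g b<a a<)

  weightOf : List ℚ → ℕ → ℚ
  weightOf L y = E L y * inv (E L (y ℕ.∸ 1))

  -- The bound on c gives c ∸ 1 ≤ M, so e_{c-1} is positive at M positive numbers and the fraction
  -- has a value there.
  value-/e : ∀ {M} c → c ≤ suc M → HasValue M (e c / e (c ℕ.∸ 1) [ e-nonzero (c ℕ.∸ 1) ]) (λ xs → weightOf (toList xs) c)
  value-/e {M} c c≤ = record
    { P = λ xs → E (toList xs) c
    ; Q = λ xs → E (toList xs) (c ℕ.∸ 1)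
    ; num≙ = ≙-e c
    ; den≙ = ≙-e (c ℕ.∸ 1)
    ; Q≢0 = λ xs g → nonzero xs g
    ; P≡vQ = λ xs g → trans (trans (sym (ℚ.*-identityʳ (E (toList xs) c))) (cong (E (toList xs) c *_) (sym (*-inv (nonzero xs g)))))
        (solve 3 (λ p q i → p :* (q :* i) := (p :* i) :* q) refl (E (toList xs) c) (E (toList xs) (c ℕ.∸ 1)) (inv (E (toList xs) (c ℕ.∸ 1))))
    }
    where
    nonzero : ∀ xs → Good xs → E (toList xs) (c ℕ.∸ 1) ≢ 0ℚ
    nonzero xs g = E≢0 (toList xs) (c ℕ.∸ 1) (good-all xs g)
      (ℕ.≤-trans (ℕ.∸-monoˡ-≤ 1 c≤) (ℕ.≤-reflexive (sym (Vec.length-toList xs))))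

  module Main (n k N : ℕ) (k≤n : k ≤ n) (n≤N : n ≤ N) (G : Graph (n ℕ.+ k)) (Γ : Graph n)
    (unit : IsNaturalUnitInterval G) (first-clique : IsClique G (λ v → toℕ v < k)) (last-clique : IsClique G (λ v → n ≤ toℕ v))
    (ident : IsIdentification k≤n G Γ)
    (T₀ : Vec ℕ k → Tableau) (initial : ∀ j → j ∈ tuples k N → IsInitial j (T₀ j)) (m : ℕ) where

    open Vertices n k G using (ds; length-ds; windows)

    -- The two copies of N make M larger than n + k, so all windows fit; m leaves room for the
    -- variables of the monomial in question; the summand 2 is what the affine action on at least
    -- two letters needs.
    m′ M : ℕ
    m′ = N ℕ.+ N ℕ.+ m
    M = suc (suc m′)

    N≤M : N ≤ M
    N≤M = ℕ.≤-trans (ℕ.m≤m+n N N) (ℕ.≤-trans (ℕ.m≤m+n (N ℕ.+ N) m) (ℕ.≤-trans (ℕ.n≤1+n m′) (ℕ.n≤1+n (suc m′))))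

    n+k<M : n ℕ.+ k < M
    n+k<M = s≤s (ℕ.≤-trans (ℕ.+-mono-≤ n≤N (ℕ.≤-trans k≤n n≤N)) (ℕ.≤-trans (ℕ.m≤m+n (N ℕ.+ N) m) (ℕ.n≤1+n m′)))

    k≤M : k ≤ M
    k≤M = ℕ.≤-trans k≤n (ℕ.≤-trans n≤N N≤M)

    ok : Windows M k k ds
    ok = windows unit last-clique n+k<M

    k≤ds : k ≤ length ds
    k≤ds = ℕ.≤-trans k≤n (ℕ.≤-reflexive (sym length-ds))

    module Fill (xs : Vec ℚ M) = TableauSum n k N k≤n G unit last-clique n+k<M (weightOf (toList xs))

    numeric : ∀ (xs : Vec ℚ M) → Good xs →
              chromaticValue Γ xs ≡ ∑ℚ (tuples k N) (λ j → ∑ℚ (tableauxFor n k G N T₀ j) (Fill.summandValue xs))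
    numeric xs g = begin
      chromaticValue Γ xs
        ≡⟨ Coloring.chromatic-words n k k≤n G Γ unit first-clique last-clique ident n+k<M xs ⟩
      ∑ℚ (seqs (upTo M) n) (closedWeight (ωV x) k ds)
        ≡⟨ cong (λ l → ∑ℚ (seqs (upTo M) l) (closedWeight (ωV x) k ds)) length-ds ⟨
      ∑ℚ (seqs (upTo M) (length ds)) (closedWeight (ωV x) k ds)
        ≡⟨ closed-paths (ωV x) (upTo M) k ds K′ ok k≤ds TI.K-unique′ (λ κ∈ → let (u , l , _) = TI.K-ok′ κ∈ in u , l) colours ⟨
      ∑ℚ K′ (λ κ → paths (ωV x) (upTo M) ds κ (δ′ κ ∘ lastn k))
        ≡⟨ ∑-cong K′ (λ {κ} _ → 𝒱-paths x M ds κ (δ′ κ ∘ lastn k)) ⟨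
      ∑ℚ K′ (λ κ → 𝒱 x M ds κ (δ′ κ ∘ lastn k))
        ≡⟨ TI.trace-identity k k≤M ds ok ⟨
      ∑ℚ K′ (λ κ → 𝒲 wᴹ M ds (map suc κ) (δ′ (map suc κ) ∘ lastn k))
        ≡⟨ ∑-cong K′ (λ {κ} _ → 𝒲-paths wᴹ M ds (map suc κ) (δ′ (map suc κ) ∘ lastn k)) ⟩
      ∑ℚ K′ (f ∘ map suc)
        ≡⟨ ∑-map (map suc) K′ f ⟨
      ∑ℚ (map (map suc) K′) f
        ≡⟨ closed-paths (ωW wᴹ) (ids 1 M) k ds (map (map suc) K′) ok k≤ds
             (Unique.map⁺ (List.map-injective ℕ.suc-injective) TI.K-unique′) columns-ok columns ⟩
      ∑ℚ (seqs (ids 1 M) (length ds)) (closedWeight (ωW wᴹ) k ds)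
        -- Columns are cut down from M to N without loss, since columns beyond n have no weight and
        -- n ≤ N.
        ≡⟨ closed-truncate wᴹ k ds (ℕ.≤-trans (ℕ.≤-reflexive length-ds) n≤N) N≤M ⟨
      ∑ℚ (seqs (ids 1 N) (length ds)) (closedWeight (ωW wᴹ) k ds)
        ≡⟨ cong₂ (λ L l → ∑ℚ (seqs (ids 1 N) l) (closedWeight (ωW (weightOf L)) k ds)) same-variables length-ds ⟩
      ∑ℚ (seqs (ids 1 N) n) (closedWeight (ωW (weightOf (toList xs))) k ds)
        ≡⟨ Fill.tableaux-words xs T₀ initial ⟨
      ∑ℚ (tuples k N) (λ j → ∑ℚ (tableauxFor n k G N T₀ j) (Fill.summandValue xs)) ∎
      where
      open ≡-Reasoning
      x : ℕ → ℚ
      x = atℚ (toList xs)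
      module TI where
        open TraceIdentity m′ x (good-distinct xs g) (good-positive xs g) public
        K-unique′ = K-unique k k≤M ds ok
        K-ok′ : ∀ {κ} → κ ∈ injWords M k → Unique κ × length κ ≡ k × All (_< M) κ
        K-ok′ = K-ok k k≤M ds ok
      wᴹ : ℕ → ℚ
      wᴹ = weightOf (map x (upTo M))
      K′ : List (List ℕ)
      K′ = injWords M k
      f : List ℕ → ℚ
      f c = paths (ωW wᴹ) (ids 1 M) ds c (δ′ c ∘ lastn k)
      same-variables : map x (upTo M) ≡ toList xs
      same-variables = trans (cong (map x ∘ upTo) (sym (Vec.length-toList xs))) (map-atℚ (toList xs))
      colours : ∀ {κ} → Unique κ → length κ ≡ k → All (_∈ upTo M) κ → κ ∈ K′
      colours {κ} u refl κ< = ∈.∈-filter⁺ unique? (∈-seqs⁺ κ κ<) u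
      columns-ok : ∀ {c} → c ∈ map (map suc) K′ → Unique c × length c ≡ k
      columns-ok c∈ with ∈.∈-map⁻ (map suc) c∈
      ... | κ , κ∈ , refl = Unique.map⁺ ℕ.suc-injective (proj₁ (TI.K-ok′ κ∈)) , trans (List.length-map suc κ) (proj₁ (proj₂ (TI.K-ok′ κ∈)))
      columns : ∀ {c} → Unique c → length c ≡ k → All (_∈ ids 1 M) c → c ∈ map (map suc) K′
      columns u l r with TI.range⇒K k k≤M ds ok (u , r) l
      ... | κ , κ∈ , refl = ∈.∈-map⁺ (map suc) κ∈

    summand-value : ∀ {j} → j ∈ tuples k N → ∀ {T} → T ∈ tableauxFor n k G N T₀ j →
                    HasValue M (summand n k G T) (λ xs → Fill.summandValue xs T)
    summand-value {j} j∈ {T} T∈ = go (does (all? (unique? ∘ neighborColumns n k G T) (newVertices n k G)))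
      where
      col = column T ∘ label
      go : ∀ b → HasValue M (if b then ∏ (newVertices n k G) (factor n k G T) else ι 0ₛ)
        (λ xs → if b then ∏ℚ (newVertices n k G) (λ v → A (col v) (neighborColumns n k G T v) * weightOf (toList xs) (col v)) else 0ℚ)
      go false = value-ι (≙-const 0ℚ)
      go true  = value-∏ (newVertices n k G) λ {v} _ → value-* (value-ι (≙-const (A (col v) (neighborColumns n k G T v))))
        (value-/e (col v) (ℕ.≤-trans (TableauSum.column-≤ n k N k≤n G unit last-clique n+k<M (λ _ → 0ℚ) T₀ j∈ (initial j j∈) {T} T∈ v)
          (ℕ.≤-trans N≤M (ℕ.n≤1+n M))))

    sum-value : HasValue M (∑ (tuples k N) (λ j → ∑ (tableauxFor n k G N T₀ j) (summand n k G)))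
      (λ xs → ∑ℚ (tuples k N) (λ j → ∑ℚ (tableauxFor n k G N T₀ j) (Fill.summandValue xs)))
    sum-value = value-∑ (tuples k N) λ {j} j∈ → value-∑ (tableauxFor n k G N T₀ j) λ {T} T∈ → summand-value j∈ T∈

    -- Stability of series allows α to be padded with zeros to M variables, where the numerical
    -- identity at good points determines all coefficients.
    coefficients : ∀ (α : Vec ℕ m) →
      coeff (num (ι (chromatic Γ)) *ₛ den (∑ (tuples k N) (λ j → ∑ (tableauxFor n k G N T₀ j) (summand n k G)))) α ≡
      coeff (num (∑ (tuples k N) (λ j → ∑ (tableauxFor n k G N T₀ j) (summand n k G))) *ₛ den (ι (chromatic Γ))) α
    coefficients α = trans (sym (coeff-pad lhs d α)) (trans (value-≃ {f = chromatic Γ} {p = RHS} (≙-chromatic Γ) sum-value numeric (pad d α)) (coeff-pad rhs d α))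
      where
      d = suc (suc (N ℕ.+ N))
      RHS = ∑ (tuples k N) (λ j → ∑ (tableauxFor n k G N T₀ j) (summand n k G))
      lhs rhs : Series
      lhs = num (ι (chromatic Γ)) *ₛ den RHS
      rhs = num RHS *ₛ den (ι (chromatic Γ))

open import Defs
open import Data.Fin.Base using (toℕ)
open import Data.List.Membership.Propositional using (_∈_)
open import Data.Nat.Base using (ℕ; _+_; _≤_; _<_)
open import Data.Vec.Base using (Vec)

theorem1 : ∀ (n k N : ℕ) (k≤n : k ≤ n) → n ≤ N →
    (G : Graph (n + k)) (Γ : Graph n) →
    IsNaturalUnitInterval G →
    IsClique G (λ v → toℕ v < k) →
    IsClique G (λ v → n ≤ toℕ v) →
    IsIdentification k≤n G Γ →
    IsProperCircularArc Γ →
    (T₀ : Vec ℕ k → Tableau) →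
    (∀ j → j ∈ tuples k N → IsInitial j (T₀ j)) →
    ι (chromatic Γ) ≃ ∑ (tuples k N) (λ j → ∑ (tableauxFor n k G N T₀ j) (summand n k G))
theorem1 n k N k≤n n≤N G Γ unit first-clique last-clique ident _ T₀ initial {m} α =
  Assembly.Main.coefficients n k N k≤n n≤N G Γ unit first-clique last-clique ident T₀ initial m α
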